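{- Let $m,n\ge 2$ be integers and $R=[0,m-1]\times[0,n-1]$. There are bijections $\Phi_b:\ker BW\setminus\{0\}\to\mathcal{T}_b$ and $\Phi_w:\ker WB\setminus\{0\}\to\mathcal{T}_w$.
   Context: Let $G=R\cap(\mathbb{Z}\times\mathbb{Z})$ be the $m\times n$ rectangular graph, where $(x,y),(x',y')$ are adjacent iff $|x-x'|+|y-y'|=1$. A point $(x,y)$ is black if $x+y$ is even and white otherwise. Let $V_b$ (resp. $V_w$) be the $\mathbb{Z}/(2)$-vector space of functions on the black (resp. white) points of $G$. $BW:V_b\to V_w$ is the black-to-white adjacency map, $(BWu)(w)=\sum_{b \text{ black neighbor of } w}u(b) \pmod 2$, and $WB:V_w\to V_b$ is defined analogously. The tiles are the following closed polygons, where $a,b$ denote arbitrary positive integers; each tile may be translated and rotated by integer multiples of $\pi/2$. (T1) An axis-parallel square of side $2$. (T2) A square of side $\sqrt2$ with sides in the diagonal directions, e.g. with vertices $(0,0),(1,1),(0,2),(-1,1)$. (T3) The octagon with vertices $(0,0),(2,0),(2+a,a),(2+a,a+2),(2+a-b,a+b+2),(a-b,a+b+2),(-b,b+2),(-b,b)$. (T4) The hexagon with vertices $(0,0),(2,0),(2,2),(2-a,2+a),(-a,2+a),(-a,a)$. (T5) The trapezoid with vertices $(0,0),(2a+2,0),(a+2,a),(a,a)$, whose long base is called dashed. (T6) The right isosceles triangle with vertices $(0,0),(a,0),(0,a)$, whose two legs are called dashed. A tiling of $R$ is a covering of $R$ by finitely many such tiles with pairwise disjoint interiors such that every dashed side is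 contained in $\partial R$. In any tiling, all tile vertices are integral; the color of a tile is the common color of its vertices, except that for a triangle (T6) it is the color of its two vertices not at the right angle. $\mathcal{T}_b$ (resp. $\mathcal{T}_w$) is the set of tilings of $R$ all of whose tiles are black (resp. white). -}

module Defs where

open import Level using (0ℓ)
open import Data.Bool using (Bool; true; false; _xor_)
open import Data.Nat as ℕ using (ℕ; zero; suc; _%_; _<?_; _≤_)
open import Data.Fin using (Fin; toℕ; fromℕ<)
open import Data.Integer as ℤ using (ℤ; +_; -[1+_]; ∣_∣)
open import Data.Rational as ℚ using (ℚ; _/_; 0ℚ; 1ℚ)
open import Data.Product using (Σ; _×_; _,_; proj₁; proj₂; ∃-syntax)
open import Data.Sum using (_⊎_; inj₁; inj₂)
open import Data.Empty using (⊥)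
open import Data.List using (List; []; _∷_; map; length; lookup)
open import Data.List.Relation.Unary.All using (All)
open import Data.List.Relation.Unary.Any using (Any; here; there)
open import Data.List.Membership.Propositional using (_∈_)
open import Relation.Nullary using (¬_; yes; no)
open import Relation.Binary using (Setoid)
open import Relation.Binary.PropositionalEquality using (_≡_; refl; sym; trans)
open import Function using (_⇔_; mk⇔; Equivalence)

data Color : Set where
  black white : Color

colorℕ : ℕ → Color
colorℕ k with k % 2
... | zero  = black
... | suc _ = white

colorℤ : ℤ → ℤ → Color
colorℤ x y = colorℕ ∣ x ℤ.+ y ∣

data DecColor (c d : Color) : Set where
  same : c ≡ d → DecColor c d
  diff : ¬ (c ≡ d) → DecColor c d

decColor : (c d : Color) → DecColor c d
decColor black black = same refl
decColor white white = same refl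
decColor black white = diff (λ ())
decColor white black = diff (λ ())

GPt : ℕ → ℕ → Set
GPt m n = Fin m × Fin n

colorG : ∀ {m n} → GPt m n → Color
colorG (x , y) = colorℕ (toℕ x ℕ.+ toℕ y)

Pts : Color → ℕ → ℕ → Set
Pts c m n = Σ (GPt m n) (λ p → colorG p ≡ c)

-- V_c : Z/(2)-valued functions on the points of colour c (Z/(2) = Bool, + = xor)
V : Color → ℕ → ℕ → Set
V c m n = Pts c m n → Bool

opp : Color → Color
opp black = white
opp white = black

-- value of u at an integer point; 0 if the point is not a c-point of G
val : ∀ {c m n} → V c m n → ℤ → ℤ → Bool
val {c} {m} {n} u -[1+ _ ] _ = false
val {c} {m} {n} u (+ _) -[1+ _ ] = false
val {c} {m} {n} u (+ i) (+ j) with i <? m | j <? n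
... | no _ | _ = false
... | yes _ | no _ = false
... | yes i<m | yes j<n with decColor (colorG {m} {n} (fromℕ< i<m , fromℕ< j<n)) c
...   | same e = u ((fromℕ< i<m , fromℕ< j<n) , e)
...   | diff _ = false

-- adjacency map V_c → V_{opp c}:  (A u)(w) = Σ_{neighbours p of w} u(p)  (mod 2).
-- (Every neighbour of a point of colour opp c has colour c.)
adj : ∀ {c m n} → V c m n → V (opp c) m n
adj u ((x , y) , _) =
  let X = + toℕ x ; Y = + toℕ y in
  val u (X ℤ.- + 1) Y xor val u (X ℤ.+ + 1) Y xor
  val u X (Y ℤ.- + 1) xor val u X (Y ℤ.+ + 1)

BW : ∀ {m n} → V black m n → V white m n
BW = adj

WB : ∀ {m n} → V white m n → V black m n
WB = adj

KerNZ : Color → ℕ → ℕ → Set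
KerNZ c m n =
  Σ (V c m n) (λ u → (∀ w → adj u w ≡ false) × ¬ (∀ p → u p ≡ false))

KerSetoid : Color → ℕ → ℕ → Setoid 0ℓ 0ℓ
KerSetoid c m n = record
  { Carrier = KerNZ c m n
  ; _≈_ = λ u v → ∀ p → proj₁ u p ≡ proj₁ v p
  ; isEquivalence = record
    { refl = λ p → refl
    ; sym = λ e p → sym (e p)
    ; trans = λ e f p → trans (e p) (f p) } }

-- Tiles.  A tile is given by a shape (with positive integer parameters),
-- a rotation by k·π/2 (k : Fin 4) about the origin, and a translation by an
-- integer vector.  Vertices are listed counterclockwise.

Pt : Set
Pt = ℤ × ℤ

data Shape : Set where
  T1 : Shape
  T2 : Shape
  T3 : (a b : ℕ) → 1 ≤ a → 1 ≤ b → Shape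
  T4 : (a : ℕ) → 1 ≤ a → Shape
  T5 : (a : ℕ) → 1 ≤ a → Shape
  T6 : (a : ℕ) → 1 ≤ a → Shape

private
  infixr 5 _,,_
  _,,_ : ℤ → ℤ → Pt
  x ,, y = x , y

baseVertices : Shape → List Pt
baseVertices T1 = (+ 0 ,, + 0) ∷ (+ 2 ,, + 0) ∷ (+ 2 ,, + 2) ∷ (+ 0 ,, + 2) ∷ []
baseVertices T2 = (+ 0 ,, + 0) ∷ (+ 1 ,, + 1) ∷ (+ 0 ,, + 2) ∷ (ℤ.- + 1 ,, + 1) ∷ []
baseVertices (T3 a' b' _ _) =
  let a = + a' ; b = + b' ; two = + 2 in
  (+ 0 ,, + 0) ∷ (two ,, + 0) ∷ (two ℤ.+ a ,, a) ∷ (two ℤ.+ a ,, a ℤ.+ two) ∷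
  (two ℤ.+ a ℤ.- b ,, a ℤ.+ b ℤ.+ two) ∷ (a ℤ.- b ,, a ℤ.+ b ℤ.+ two) ∷
  (ℤ.- b ,, b ℤ.+ two) ∷ (ℤ.- b ,, b) ∷ []
baseVertices (T4 a' _) =
  let a = + a' ; two = + 2 in
  (+ 0 ,, + 0) ∷ (two ,, + 0) ∷ (two ,, two) ∷ (two ℤ.- a ,, two ℤ.+ a) ∷
  (ℤ.- a ,, two ℤ.+ a) ∷ (ℤ.- a ,, a) ∷ []
baseVertices (T5 a' _) =
  let a = + a' ; two = + 2 in
  (+ 0 ,, + 0) ∷ (two ℤ.* a ℤ.+ two ,, + 0) ∷ (a ℤ.+ two ,, a) ∷ (a ,, a) ∷ []
baseVertices (T6 a' _) =
  let a = + a' in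
  (+ 0 ,, + 0) ∷ (a ,, + 0) ∷ (+ 0 ,, a) ∷ []

baseDashed : Shape → List (Pt × Pt)
baseDashed (T5 a' _) = ((+ 0 ,, + 0) , (+ 2 ℤ.* + a' ℤ.+ + 2 ,, + 0)) ∷ []
baseDashed (T6 a' _) = ((+ 0 ,, + 0) , (+ a' ,, + 0)) ∷ ((+ 0 ,, + a') , (+ 0 ,, + 0)) ∷ []
baseDashed _ = []

baseColorVertex : Shape → Pt
baseColorVertex (T6 a' _) = (+ a' ,, + 0)
baseColorVertex _ = (+ 0 ,, + 0)

record Tile : Set where
  constructor tile
  field
    shape : Shape
    rot   : Fin 4
    shift : Pt

rot90 : Pt → Pt
rot90 (x , y) = (ℤ.- y , x)

rotateℕ : ℕ → Pt → Pt
rotateℕ zero p = p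
rotateℕ (suc k) p = rot90 (rotateℕ k p)

rotate : Fin 4 → Pt → Pt
rotate k = rotateℕ (toℕ k)

move : Tile → Pt → Pt
move (tile _ r (dx , dy)) p with rotate r p
... | (x , y) = (x ℤ.+ dx , y ℤ.+ dy)

vertices : Tile → List Pt
vertices t = map (move t) (baseVertices (Tile.shape t))

dashedSides : Tile → List (Pt × Pt)
dashedSides t = map (λ (p , q) → (move t p , move t q)) (baseDashed (Tile.shape t))

tileColor : Tile → Color
tileColor t with move t (baseColorVertex (Tile.shape t))
... | (x , y) = colorℤ x y

QPt : Set
QPt = ℚ × ℚ

toℚ : ℤ → ℚ
toℚ z = z / 1

cross : Pt → Pt → QPt → ℚ
cross (px , py) (qx , qy) (rx , ry) =
  (toℚ qx ℚ.- toℚ px) ℚ.* (ry ℚ.- toℚ py) ℚ.- (toℚ qy ℚ.- toℚ py) ℚ.* (rx ℚ.- toℚ px)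

edges : List Pt → List (Pt × Pt)
edges [] = []
edges (v ∷ vs) = go v (v ∷ vs)
  where
  go : Pt → List Pt → List (Pt × Pt)
  go first [] = []
  go first (p ∷ []) = (p , first) ∷ []
  go first (p ∷ q ∷ rest) = (p , q) ∷ go first (q ∷ rest)

-- the closed convex polygon with counterclockwise vertices vs, and its interior
InPoly : List Pt → QPt → Set
InPoly vs r = All (λ (p , q) → 0ℚ ℚ.≤ cross p q r) (edges vs)

InInterior : List Pt → QPt → Set
InInterior vs r = All (λ (p , q) → 0ℚ ℚ.< cross p q r) (edges vs)

_∈T_ : QPt → Tile → Set
r ∈T t = InPoly (vertices t) r

_∈T°_ : QPt → Tile → Set
r ∈T° t = InInterior (vertices t) r

InR : ℕ → ℕ → QPt → Set
InR m n (x , y) =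
  0ℚ ℚ.≤ x × x ℚ.≤ toℚ (+ m ℤ.- + 1) × 0ℚ ℚ.≤ y × y ℚ.≤ toℚ (+ n ℤ.- + 1)

In∂R : ℕ → ℕ → QPt → Set
In∂R m n (x , y) = InR m n (x , y) ×
  (x ≡ 0ℚ ⊎ x ≡ toℚ (+ m ℤ.- + 1) ⊎ y ≡ 0ℚ ⊎ y ≡ toℚ (+ n ℤ.- + 1))

SegmentIn∂R : ℕ → ℕ → Pt × Pt → Set
SegmentIn∂R m n ((px , py) , (qx , qy)) =
  ∀ (s : ℚ) → 0ℚ ℚ.≤ s → s ℚ.≤ 1ℚ →
  In∂R m n (toℚ px ℚ.+ s ℚ.* (toℚ qx ℚ.- toℚ px) , toℚ py ℚ.+ s ℚ.* (toℚ qy ℚ.- toℚ py))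

record IsTiling (m n : ℕ) (ts : List Tile) : Set where
  field
    inside   : ∀ (t : Tile) → t ∈ ts → ∀ r → r ∈T t → InR m n r
    covers   : ∀ r → InR m n r → Any (λ t → r ∈T t) ts
    disjoint : ∀ (i j : Fin (length ts)) → ¬ (i ≡ j) →
               ∀ r → r ∈T° lookup ts i → r ∈T° lookup ts j → ⊥
    dashed   : ∀ (t : Tile) → t ∈ ts → All (SegmentIn∂R m n) (dashedSides t)

Tilings : Color → ℕ → ℕ → Set
Tilings c m n = Σ (List Tile) (λ ts → IsTiling m n ts × All (λ t → tileColor t ≡ c) ts)

SameTile : Tile → Tile → Set
SameTile t t' = ∀ r → (r ∈T t → r ∈T t') × (r ∈T t' → r ∈T t)

Sub : List Tile → List Tile → Set
Sub ts ts' = All (λ t → Any (SameTile t) ts') ts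

private
  sameRefl : (t : Tile) → SameTile t t
  sameRefl t r = (λ x → x) , (λ x → x)

  sameTrans : {t u v : Tile} → SameTile t u → SameTile u v → SameTile t v
  sameTrans {t} {u} {v} e f r = (λ x → proj₁ (f r) (proj₁ (e r) x)) , (λ x → proj₂ (e r) (proj₂ (f r) x))

  anyRefl : ∀ {t ts} → t ∈ ts → Any (SameTile t) ts
  anyRefl {t} (here refl) = here (sameRefl t)
  anyRefl (there p) = there (anyRefl p)

  subRefl : ∀ ts → Sub ts ts
  subRefl ts = Data.List.Relation.Unary.All.tabulate anyRefl
    where import Data.List.Relation.Unary.All

  anyTrans : ∀ {t ts ts'} → Any (SameTile t) ts → Sub ts ts' → Any (SameTile t) ts'
  anyTrans {t} (here {x = u} e) (a All.∷ _) = Data.List.Relation.Unary.Any.map (λ {v} f → sameTrans {t} {u} {v} e f) a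
    where import Data.List.Relation.Unary.All as All
  anyTrans {t} (there p) (_ All.∷ as) = anyTrans {t} p as
    where import Data.List.Relation.Unary.All as All

  subTrans : ∀ {ts ts' ts''} → Sub ts ts' → Sub ts' ts'' → Sub ts ts''
  subTrans All.[] _ = All.[]
    where import Data.List.Relation.Unary.All as All
  subTrans (All._∷_ {x = t} a as) s = anyTrans {t} a s All.∷ subTrans as s
    where import Data.List.Relation.Unary.All as All

TilingSetoid : Color → ℕ → ℕ → Setoid 0ℓ 0ℓ
TilingSetoid c m n = record
  { Carrier = Tilings c m n
  ; _≈_ = λ T T' → Sub (proj₁ T) (proj₁ T') × Sub (proj₁ T') (proj₁ T)
  ; isEquivalence = record
    { refl = λ {T} → subRefl (proj₁ T) , subRefl (proj₁ T)
    ; sym = λ (a , b) → b , a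
    ; trans = λ (a , b) (c , d) → subTrans a c , subTrans d b } }

{-# OPTIONS --safe #-}
module Submission where

-- Give the points of colour c the coordinates (i , j) with i + j + e = x + 1 and
-- i - j = y + 1, where e is the parity of c.  The kernel equations say that
-- u (i , j) = h i xor h j for a function h on ℤ that is invariant under the maps
-- i ↦ - e - i, i ↦ i + m + 1 and i ↦ i + n + 1, which come from the reflections of
-- the plane in x = -1, x = m, y = -1 and y = n.  Call the maximal intervals on
-- which h is constant gaps.  Two gaps [a , b) and [c , d) of the same value form a
-- rectangle of pairs (i , j) with u = 0, the core of an octagon whose sides are
-- given by a, b, c, d; its intersection with R is a tile of type T1, T3 or T4, or
-- of type T5 or T6 if the octagon is symmetric about one or two of these lines.
-- What these octagons leave uncovered consists of the diamonds T2 around points of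
-- the opposite colour all of whose neighbours have u = 1.  Conversely, a tiling
-- determines u as the indicator of the points outside all cores.  The kernel
-- equation at a point of the opposite colour is checked by dividing the diamond
-- around it into four cells, each of which lies in a single tile.

-- Modulo 2 the kernel equation is the discrete wave equation with Y as time, and its solutions are
-- d'Alembert sums H (X + Y) xor H (X - Y), where X = x + 1 and Y = y + 1. At the points of one
-- colour the arguments X + Y and X - Y have a fixed parity, and h i is H (2 i + e). Gaps are finite
-- because u ≠ 0 makes h nonconstant and h is periodic. The obstacle is that the statement speaks of
-- rational points, of lists, and of tiles compared as point sets, whereas the argument is about the
-- integers a, b, c, d. Clearing denominators turns membership in a tile into inequalities that are
-- linear in monomials such as a Q, and the many case distinctions are left to a decision procedure.
-- Of a given tiling, covering and disjointness are used only at one sample point in each cell. A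
-- tile shows only the part of its octagon in R. That two equal tiles have the same core points in R
-- therefore needs an argument; it is delicate only at the corners of R, where a triangle and a
-- hexagon can both contain the cells around the corner.

open import Data.Nat as ℕ using (ℕ; zero; suc; _≤_)
open import Data.Product using (Σ; _×_; _,_; proj₁; proj₂)
open import Function.Bundles using (Bijection)
open import Data.Bool as Bool using (Bool; true; false; not; _xor_)
open import Data.Integer as ℤ using (ℤ; +_; -[1+_])
import Data.Integer.Properties as ℤₚ
import Data.Nat.Properties as ℕₚ
open import Data.Rational as ℚ using (ℚ; mkℚ; 0ℚ; 1ℚ; ½)
import Data.Rational.Properties as ℚₚ
open import Data.Rational.Unnormalised as ℚᵘ using (ℚᵘ; mkℚᵘ; *≡*; *≤*; *<*)
import Data.Rational.Unnormalised.Properties as ℚᵘₚ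
open import Data.Sum using (_⊎_; inj₁; inj₂)
open import Data.List using ([]; _∷_; List; map; upTo; cartesianProductWith; concatMap; deduplicate; tabulate; lookup; length)
open import Function using (_∘_)
open import Relation.Binary.PropositionalEquality
open import Data.Fin as Fin using (Fin; zero; suc; toℕ; fromℕ<)
open import Data.List.Relation.Unary.All as All using (All; []; _∷_)
import Data.Nat.DivMod as ℕD
open import Data.Empty using (⊥; ⊥-elim)
open import Data.Integer.DivMod using (_/ℕ_; _%ℕ_; a≡a%ℕn+[a/ℕn]*n; n%ℕd<d)
open import Relation.Nullary using (¬_; Dec; yes; no)
import Data.Bool.Properties as Boolₚ
import Data.Fin.Properties as Finₚ
open import Axiom.UniquenessOfIdentityProofs.WithK using (uip)
open import Data.List.Membership.Propositional using (_∈_; lose; find)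
open import Data.List.Relation.Unary.Any as Any using (Any; any?; here; there)
open import Relation.Nullary.Decidable using (⌊_⌋)
open import Data.List.Membership.Propositional.Properties using (∈-map⁺; ∈-upTo⁺; ∈-cartesianProductWith⁺; ∈-concatMap⁺; ∈-concatMap⁻; ∈-deduplicate⁺; ∈-deduplicate⁻; ∈-tabulate⁺; ∈-tabulate⁻; ∈-lookup)
open import Data.List.Relation.Unary.AllPairs using (AllPairs; []; _∷_)
import Data.List.Relation.Unary.AllPairs.Properties as AllPairsₚ
open import Data.List.Relation.Unary.Unique.Propositional using (Unique)
open import Data.List.Relation.Unary.Unique.DecPropositional.Properties using (deduplicate-!)
open import Relation.Binary using (Setoid)

-- A decision procedure for integer inequalities that are linear in monomials

module Omega where
  open import Data.Bool using (_∧_; if_then_else_; T)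
  open import Data.Nat.GCD using (gcd)
  open import Data.Integer using (∣_∣)
  open import Data.List using (_++_; foldr)
  open import Data.List.Relation.Unary.All.Properties using (++⁺)
  open import Data.Sum using ([_,_]′)
  open import Data.Unit using (⊤; tt)
  open import Relation.Nullary.Decidable using (_×-dec_; _⊎-dec_; _→-dec_; decidable-stable)
  open import Relation.Binary.Definitions using (tri<; tri≈; tri>)
  open import Data.Integer.Solver using (module +-*-Solver)

  infixl 6 _⊕_ _⊖_
  infixl 7 _⊗_
  infix  8 ⊝_
  infix  9 #_
  infix  4 _≼_ _≺_ _≐_
  infixr 3 _&_
  infixr 2 _∥_
  infixr 1 _⇛_

  data Expr : Set where
    atom : ℕ → Expr
    cst : ℤ → Expr
    _⊕_ _⊖_ _⊗_ : Expr → Expr → Expr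
    ⊝_ : Expr → Expr

  #_ : ℕ → Expr
  # n = cst (+ n)

  data Form : Set where
    _≼_ _≐_ : Expr → Expr → Form
    _&_ _∥_ _⇛_ : Form → Form → Form
    ⊥′ : Form

  _≺_ : Expr → Expr → Form
  a ≺ b = a ⊕ # 1 ≼ b

  Env : Set
  Env = List ℤ

  look : Env → ℕ → ℤ
  look []       _       = + 0
  look (x ∷ _)  zero    = x
  look (_ ∷ xs) (suc i) = look xs i

  eval : Env → Expr → ℤ
  eval ρ (atom i)  = look ρ i
  eval ρ (cst k)  = k
  eval ρ (a ⊕ b) = eval ρ a ℤ.+ eval ρ b
  eval ρ (a ⊖ b) = eval ρ a ℤ.- eval ρ b
  eval ρ (a ⊗ b) = eval ρ a ℤ.* eval ρ b
  eval ρ (⊝ a)   = ℤ.- eval ρ a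

  ⟦_⟧ : Form → Env → Set
  ⟦ a ≼ b ⟧ ρ = eval ρ a ℤ.≤ eval ρ b
  ⟦ a ≐ b ⟧ ρ = eval ρ a ≡ eval ρ b
  ⟦ F & G ⟧ ρ = ⟦ F ⟧ ρ × ⟦ G ⟧ ρ
  ⟦ F ∥ G ⟧ ρ = ⟦ F ⟧ ρ ⊎ ⟦ G ⟧ ρ
  ⟦ F ⇛ G ⟧ ρ = ⟦ F ⟧ ρ → ⟦ G ⟧ ρ
  ⟦ ⊥′ ⟧     ρ = ⊥

  dec : ∀ F ρ → Dec (⟦ F ⟧ ρ)
  dec (a ≼ b) ρ = eval ρ a ℤ.≤? eval ρ b
  dec (a ≐ b) ρ = eval ρ a ℤ.≟ eval ρ b
  dec (F & G) ρ = dec F ρ ×-dec dec G ρ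
  dec (F ∥ G) ρ = dec F ρ ⊎-dec dec G ρ
  dec (F ⇛ G) ρ = dec F ρ →-dec dec G ρ
  dec ⊥′       ρ = no λ ()

  -- Polynomials: sorted lists of monomials with coefficients; the constant
  -- term is the coefficient of the empty monomial.
  Mono : Set
  Mono = List ℕ

  Poly : Set
  Poly = List (Mono × ℤ)

  data Ord : Set where
    lt eq gt : Ord

  cmpℕ : ℕ → ℕ → Ord
  cmpℕ m n = if m ℕ.<ᵇ n then lt else if n ℕ.<ᵇ m then gt else eq

  pick : {A : Set} → Ord → A → A → A → A
  pick lt x _ _ = x
  pick eq _ x _ = x
  pick gt _ _ x = x

  cmp : Mono → Mono → Ord
  cmp []      []      = eq
  cmp []      (_ ∷ _) = lt
  cmp (_ ∷ _) []      = gt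
  cmp (x ∷ p) (y ∷ q) = pick (cmpℕ x y) lt (cmp p q) gt

  keep : Mono → ℤ → Poly → Poly
  keep m (+ 0) p = p
  keep m k     p = (m , k) ∷ p

  add : Poly → Poly → Poly
  add [] q = q
  add p [] = p
  add ((m , a) ∷ p) ((m′ , b) ∷ q) = pick (cmp m m′)
    ((m , a) ∷ add p ((m′ , b) ∷ q))
    (keep m (a ℤ.+ b) (add p q))
    ((m′ , b) ∷ add ((m , a) ∷ p) q)

  scale : ℤ → Poly → Poly
  scale (+ 1) p = p
  scale k p = map (λ (m , a) → m , k ℤ.* a) p

  insert : ℕ → Mono → Mono
  insert x []      = x ∷ []
  insert x (y ∷ m) = if y ℕ.<ᵇ x then y ∷ insert x m else x ∷ y ∷ m

  times : Mono → ℤ → Poly → Poly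
  times m a []            = []
  times m a ((m′ , b) ∷ p) = add ((foldr insert m′ m , a ℤ.* b) ∷ []) (times m a p)

  mul : Poly → Poly → Poly
  mul []            q = []
  mul ((m , a) ∷ p) q = add (times m a q) (mul p q)

  norm : Expr → Poly
  norm (atom i)  = (i ∷ [] , + 1) ∷ []
  norm (cst k)  = keep [] k []
  norm (a ⊕ b) = add (norm a) (norm b)
  norm (a ⊖ b) = add (norm a) (scale (-[1+ 0 ]) (norm b))
  norm (a ⊗ b) = mul (norm a) (norm b)
  norm (⊝ a)   = scale (-[1+ 0 ]) (norm a)

  module _ (ρ : Env) where

    evM : Mono → ℤ
    evM []      = + 1
    evM (x ∷ m) = look ρ x ℤ.* evM m

    evP : Poly → ℤ
    evP []            = + 0
    evP ((m , a) ∷ p) = a ℤ.* evM m ℤ.+ evP p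

    open +-*-Solver using (solve; con; _:+_; _:*_; :-_; _:-_; _:=_)

    <ᵇ-eq : ∀ m n → (m ℕ.<ᵇ n) ≡ false → (n ℕ.<ᵇ m) ≡ false → m ≡ n
    <ᵇ-eq zero zero _ _ = refl
    <ᵇ-eq (suc m) (suc n) p q = cong suc (<ᵇ-eq m n p q)

    cmpℕ-eq : ∀ m n → cmpℕ m n ≡ eq → m ≡ n
    cmpℕ-eq m n p with m ℕ.<ᵇ n in r | n ℕ.<ᵇ m in s
    ... | false | false = <ᵇ-eq m n r s

    cmp-eq : ∀ p q → cmp p q ≡ eq → p ≡ q
    cmp-eq [] [] _ = refl
    cmp-eq (x ∷ p) (y ∷ q) r with cmpℕ x y in s
    ... | eq = cong₂ _∷_ (cmpℕ-eq x y s) (cmp-eq p q r)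

    keep-ok : ∀ m k p → evP (keep m k p) ≡ k ℤ.* evM m ℤ.+ evP p
    keep-ok m (+ zero) p = solve 2 (λ x y → y := con (+ 0) :* x :+ y) refl (evM m) (evP p)
    keep-ok m (+ suc _) p = refl
    keep-ok m -[1+ _ ] p = refl

    add-ok : ∀ p q → evP (add p q) ≡ evP p ℤ.+ evP q
    add-ok [] q = sym (ℤₚ.+-identityˡ _)
    add-ok (x ∷ p) [] = sym (ℤₚ.+-identityʳ _)
    add-ok ((m , a) ∷ p) ((m′ , b) ∷ q) =
      by (cmp m m′) refl (add-ok p ((m′ , b) ∷ q)) (add-ok p q) (add-ok ((m , a) ∷ p) q)
      where
      by : ∀ o → cmp m m′ ≡ o →
           evP (add p ((m′ , b) ∷ q)) ≡ evP p ℤ.+ evP ((m′ , b) ∷ q) →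
           evP (add p q) ≡ evP p ℤ.+ evP q →
           evP (add ((m , a) ∷ p) q) ≡ evP ((m , a) ∷ p) ℤ.+ evP q →
           evP (pick o ((m , a) ∷ add p ((m′ , b) ∷ q)) (keep m (a ℤ.+ b) (add p q))
                       ((m′ , b) ∷ add ((m , a) ∷ p) q))
           ≡ evP ((m , a) ∷ p) ℤ.+ evP ((m′ , b) ∷ q)
      by lt _ ih _ _ = trans (cong (ℤ._+_ (a ℤ.* evM m)) ih) (sym (ℤₚ.+-assoc (a ℤ.* evM m) (evP p) _))
      by eq r _ ih _ with refl ← cmp-eq m m′ r = trans (keep-ok m (a ℤ.+ b) (add p q))
        (trans (cong (ℤ._+_ ((a ℤ.+ b) ℤ.* evM m)) ih)
          (solve 5 (λ a b x p q → (a :+ b) :* x :+ (p :+ q) := (a :* x :+ p) :+ (b :* x :+ q)) refl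
            a b (evM m) (evP p) (evP q)))
      by gt _ _ _ ih = trans (cong (ℤ._+_ (b ℤ.* evM m′)) ih)
        (solve 3 (λ u v w → u :+ (v :+ w) := v :+ (u :+ w)) refl
          (b ℤ.* evM m′) (a ℤ.* evM m ℤ.+ evP p) (evP q))

    scale-map-ok : ∀ k p → evP (map (λ (m , a) → m , k ℤ.* a) p) ≡ k ℤ.* evP p
    scale-map-ok k [] = sym (ℤₚ.*-zeroʳ k)
    scale-map-ok k ((m , a) ∷ p) rewrite scale-map-ok k p =
      solve 4 (λ k a x p → k :* a :* x :+ k :* p := k :* (a :* x :+ p)) refl k a (evM m) (evP p)

    scale-ok : ∀ k p → evP (scale k p) ≡ k ℤ.* evP p
    scale-ok (+ 1) p = sym (ℤₚ.*-identityˡ _)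
    scale-ok (+ 0) p = scale-map-ok (+ 0) p
    scale-ok (+ (suc (suc n))) p = scale-map-ok (+ (suc (suc n))) p
    scale-ok -[1+ n ] p = scale-map-ok -[1+ n ] p

    insert-ok : ∀ x m → evM (insert x m) ≡ look ρ x ℤ.* evM m
    insert-ok x [] = refl
    insert-ok x (y ∷ m) with y ℕ.<ᵇ x
    ... | false = refl
    ... | true rewrite insert-ok x m =
      solve 3 (λ x y m → y :* (x :* m) := x :* (y :* m)) refl (look ρ x) (look ρ y) (evM m)

    insert*-ok : ∀ m m′ → evM (foldr insert m′ m) ≡ evM m ℤ.* evM m′
    insert*-ok [] m′ = sym (ℤₚ.*-identityˡ _)
    insert*-ok (x ∷ m) m′ rewrite insert-ok x (foldr insert m′ m) | insert*-ok m m′ =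
      sym (ℤₚ.*-assoc (look ρ x) (evM m) (evM m′))

    times-ok : ∀ m a p → evP (times m a p) ≡ a ℤ.* evM m ℤ.* evP p
    times-ok m a [] = sym (ℤₚ.*-zeroʳ (a ℤ.* evM m))
    times-ok m a ((m′ , b) ∷ p)
      rewrite add-ok ((foldr insert m′ m , a ℤ.* b) ∷ []) (times m a p)
            | insert*-ok m m′ | times-ok m a p =
      solve 5 (λ a b x y p → a :* b :* (x :* y) :+ con (+ 0) :+ a :* x :* p
                           := a :* x :* (b :* y :+ p)) refl a b (evM m) (evM m′) (evP p)

    mul-ok : ∀ p q → evP (mul p q) ≡ evP p ℤ.* evP q
    mul-ok [] q = sym (ℤₚ.*-zeroˡ (evP q))
    mul-ok ((m , a) ∷ p) q rewrite add-ok (times m a q) (mul p q) | times-ok m a q | mul-ok p q =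
      sym (ℤₚ.*-distribʳ-+ (evP q) (a ℤ.* evM m) (evP p))

    norm-ok : ∀ a → evP (norm a) ≡ eval ρ a
    norm-ok (atom i) = solve 1 (λ x → con (+ 1) :* (x :* con (+ 1)) :+ con (+ 0) := x) refl (look ρ i)
    norm-ok (cst k) rewrite keep-ok [] k [] =
      solve 1 (λ k → k :* con (+ 1) :+ con (+ 0) := k) refl k
    norm-ok (a ⊕ b) rewrite add-ok (norm a) (norm b) = cong₂ ℤ._+_ (norm-ok a) (norm-ok b)
    norm-ok (a ⊖ b)
      rewrite add-ok (norm a) (scale (-[1+ 0 ]) (norm b)) | scale-map-ok (-[1+ 0 ]) (norm b)
            | norm-ok a | norm-ok b = cong (ℤ._+_ (eval ρ a)) (ℤₚ.-1*i≡-i _)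
    norm-ok (a ⊗ b) rewrite mul-ok (norm a) (norm b) = cong₂ ℤ._*_ (norm-ok a) (norm-ok b)
    norm-ok (⊝ a) rewrite scale-map-ok (-[1+ 0 ]) (norm a) | norm-ok a = ℤₚ.-1*i≡-i _

  -- A row p stands for the inequality 0 ≤ p.  Dividing it by the greatest common
  -- divisor of the non-constant coefficients and rounding the constant down is
  -- what makes the procedure see integrality.
  content : Poly → ℕ
  content []                = 0
  content (([] , _) ∷ p)    = content p
  content ((_ ∷ _ , a) ∷ p) = gcd ∣ a ∣ (content p)

  divide : ∀ d → .{{ℕ.NonZero d}} → Poly → Poly
  divide d []            = []
  divide d ((m , a) ∷ p) = keep m (a /ℕ d) (divide d p)

  isZero : ℕ → Bool
  isZero zero    = true
  isZero (suc _) = false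

  exact : ∀ d → .{{ℕ.NonZero d}} → Poly → Bool
  exact d []            = true
  exact d ((m , a) ∷ p) = isZero (a %ℕ d) ∧ exact d p

  tail-exact : ∀ d → .{{ℕ.NonZero d}} → Poly → Bool
  tail-exact d (([] , a) ∷ p) = exact d p
  tail-exact d p              = exact d p

  tightenBy : ℕ → Poly → Poly
  tightenBy (suc (suc d)) p = if tail-exact (2 ℕ.+ d) p then divide (2 ℕ.+ d) p else p
  tightenBy _             p = p

  tighten : Poly → Poly
  tighten p = tightenBy (content p) p

  -- The search may stop at the first larger monomial because polynomials are sorted.
  coef : Mono → Poly → ℤ
  coef m [] = + 0
  coef m ((m′ , a) ∷ p) = pick (cmp m m′) (+ 0) a (coef m p)

  contradictory : Poly → Bool
  contradictory (([] , -[1+ _ ]) ∷ []) = true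
  contradictory _                      = false

  -- the number of positive and of negative occurrences of each monomial
  Tally : Set
  Tally = List (Mono × ℕ × ℕ)

  count : Mono → ℤ → Tally → Tally
  count m a [] with a
  ... | + _      = (m , 1 , 0) ∷ []
  ... | -[1+ _ ] = (m , 0 , 1) ∷ []
  count m a ((m′ , x , y) ∷ t) with a
  ... | + _      = pick (cmp m m′) ((m , 1 , 0) ∷ (m′ , x , y) ∷ t) ((m , suc x , y) ∷ t) ((m′ , x , y) ∷ count m a t)
  ... | -[1+ _ ] = pick (cmp m m′) ((m , 0 , 1) ∷ (m′ , x , y) ∷ t) ((m , x , suc y) ∷ t) ((m′ , x , y) ∷ count m a t)

  tallyRow : Poly → Tally → Tally
  tallyRow []                t = t
  tallyRow (([] , _) ∷ p)    t = tallyRow p t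
  tallyRow ((x ∷ m , a) ∷ p) t = tallyRow p (count (x ∷ m) a t)

  -- Eliminating a monomial with x positive and y negative occurrences creates x y rows, so the
  -- smallest product is preferred.
  cheapest : Tally → Mono × ℕ
  cheapest []               = [] , 0
  cheapest ((m , x , y) ∷ []) = m , x ℕ.* y
  cheapest ((m , x , y) ∷ t@(_ ∷ _)) with cheapest t
  ... | m′ , c = if x ℕ.* y ℕ.<ᵇ c then (m , x ℕ.* y) else (m′ , c)

  combine : Mono → Poly → Poly → Poly
  combine m p q = tighten (add (scale (+ ∣ coef m q ∣) p) (scale (+ ∣ coef m p ∣) q))

  splitRows : Mono → List Poly → List Poly × List Poly × List Poly
  splitRows m [] = [] , [] , []
  splitRows m (p ∷ ps) with coef m p | splitRows m ps
  ... | + 0      | z , a , b = p ∷ z , a , b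
  ... | + suc _  | z , a , b = z , p ∷ a , b
  ... | -[1+ _ ] | z , a , b = z , a , p ∷ b

  pairs : Mono → List Poly → List Poly → List Poly
  pairs m []       qs = []
  pairs m (p ∷ ps) qs = map (combine m p) qs ++ pairs m ps qs

  sameTail : Poly → Poly → Bool
  sameTail [] [] = true
  sameTail ((m , a) ∷ p) ((m′ , b) ∷ q) = pick (cmp m m′) false (same a b ∧ sameTail p q) false
    where
    same : ℤ → ℤ → Bool
    same (+ x) (+ y) = x ℕ.≡ᵇ y
    same -[1+ x ] -[1+ y ] = x ℕ.≡ᵇ y
    same _ _ = false
  sameTail _ _ = false

  split : Poly → ℤ × Poly
  split (([] , a) ∷ p) = a , p
  split p              = + 0 , p

  _≤ᵇ_ : ℤ → ℤ → Bool
  a ≤ᵇ b = a ℤ.≤ᵇ b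

  -- Of two rows that differ only in the constant term, the one with the smaller constant implies
  -- the other.
  include : Poly → List Poly → List Poly
  include p [] = p ∷ []
  include p (q ∷ qs) =
    if sameTail (proj₂ (split p)) (proj₂ (split q))
    then (if proj₁ (split p) ≤ᵇ proj₁ (split q) then p ∷ qs else q ∷ qs)
    else q ∷ include p qs

  includeNontrivial : Poly → List Poly → List Poly
  includeNontrivial []                 qs = qs
  includeNontrivial (([] , + _) ∷ []) qs = qs
  includeNontrivial p                  qs = include p qs

  any : (Poly → Bool) → List Poly → Bool
  any f []       = false
  any f (p ∷ ps) = if f p then true else any f ps

  fourierMotzkin : ℕ → List Poly → Bool
  fourierMotzkin zero    ps = any contradictory ps
  fourierMotzkin (suc n) ps =
    if any contradictory ps then true else step (proj₁ (cheapest (foldr tallyRow [] ps)))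
    where
    step : Mono → Bool
    step [] = false
    step m@(_ ∷ _) with splitRows m ps
    ... | z , a , b = fourierMotzkin n (foldr includeNontrivial z (pairs m a b))

  -- A monomial with coefficient 1 or -1 is an integer combination of the other ones, so
  -- substituting for it loses no integrality. The empty monomial signals that there is none.
  unit : Poly → Mono × ℤ
  unit [] = [] , + 0
  unit (([] , _) ∷ p) = unit p
  unit ((m , + 1) ∷ p) = m , + 1
  unit ((m , -[1+ 0 ]) ∷ p) = m , -[1+ 0 ]
  unit (_ ∷ p) = unit p

  reduceBy : Mono → ℤ → Poly → Poly → Poly
  reduceBy m k e p with coef m p
  ... | + 0 = p
  ... | c   = add p (scale (ℤ.- (c ℤ.* k)) e)

  infeasible : ℕ → List Poly → List Poly → Bool
  infeasible n       []       ps = fourierMotzkin 40 (foldr includeNontrivial [] (map tighten ps))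
  infeasible zero    (e ∷ es) ps = false
  infeasible (suc n) (e ∷ es) ps with unit e
  -- No coefficient is 1 or -1, so e = 0 is replaced by 0 ≤ e and 0 ≤ - e.
  ... | [] , k = infeasible n es (e ∷ scale -[1+ 0 ] e ∷ ps)
  ... | m@(_ ∷ _) , k = infeasible n (map (reduceBy m k e) es) (map (reduceBy m k e) ps)

  record State : Set where
    constructor _∣_
    field
      equations inequalities : List Poly

  close : State → Bool
  close (es ∣ ps) = infeasible 40 es ps

  -- Refutes a signed formula.  The negated conclusion of an implication comes
  -- first, and a case distinction is made only if the state is still feasible.
  refute : Bool → Form → (State → Bool) → State → Bool
  refute true  (a ≼ b) k (es ∣ ps) = k (es ∣ (norm (b ⊖ a) ∷ ps))
  refute false (a ≼ b) k (es ∣ ps) = k (es ∣ (norm (a ⊖ b ⊖ # 1) ∷ ps))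
  refute true  (a ≐ b) k (es ∣ ps) = k ((norm (b ⊖ a) ∷ es) ∣ ps)
  refute false (a ≐ b) k (es ∣ ps) = k (es ∣ (norm (a ⊖ b ⊖ # 1) ∷ ps)) ∧ k (es ∣ (norm (b ⊖ a ⊖ # 1) ∷ ps))
  refute true  (F & G) k = refute true F (refute true G k)
  refute false (F & G) k s = refute false F k s ∧ refute false G k s
  refute true  (F ∥ G) k s = if close s then true else refute true F k s ∧ refute true G k s
  refute false (F ∥ G) k = refute false F (refute false G k)
  refute true  (F ⇛ G) k s = refute false F k s ∧ refute true G k s
  refute false (F ⇛ G) k = refute false G (refute true F k)
  refute true  ⊥′ k s = true
  refute false ⊥′ k s = k s

  valid : Form → Bool
  valid F = refute false F close ([] ∣ [])

  module _ (ρ : Env) where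

    private
      Nonneg : Poly → Set
      Nonneg p = + 0 ℤ.≤ evP ρ p

      Null : Poly → Set
      Null p = evP ρ p ≡ + 0

    open +-*-Solver using (solve; con; _:+_; _:*_; :-_; _:-_; _:=_)

    ∧-true : ∀ {a b} → a ∧ b ≡ true → a ≡ true × b ≡ true
    ∧-true {true} {true} _ = refl , refl

    exact-ok : ∀ d .{{_ : ℕ.NonZero d}} p → exact d p ≡ true → evP ρ p ≡ + d ℤ.* evP ρ (divide d p)
    exact-ok d [] _ = sym (ℤₚ.*-zeroʳ (+ d))
    exact-ok d ((m , a) ∷ p) h with a %ℕ d in r | a≡a%ℕn+[a/ℕn]*n a d
    ... | zero | e rewrite keep-ok ρ m (a /ℕ d) (divide d p) | exact-ok d p h =
      trans (cong (λ a → a ℤ.* evM ρ m ℤ.+ + d ℤ.* evP ρ (divide d p)) e)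
        (solve 4 (λ q d x p → (con (+ 0) :+ q :* d) :* x :+ d :* p := d :* (q :* x :+ p)) refl
          (a /ℕ d) (+ d) (evM ρ m) (evP ρ (divide d p)))

    tail-exact-ok : ∀ d .{{_ : ℕ.NonZero d}} p → tail-exact d p ≡ true →
      Σ ℕ λ r → r ℕ.< d × evP ρ p ≡ + r ℤ.+ + d ℤ.* evP ρ (divide d p)
    tail-exact-ok d@(suc _) [] h = 0 , ℕ.s≤s ℕ.z≤n , trans (exact-ok d [] h) (sym (ℤₚ.+-identityˡ _))
    tail-exact-ok d@(suc _) p@((_ ∷ _ , _) ∷ _) h = 0 , ℕ.s≤s ℕ.z≤n , trans (exact-ok d p h) (sym (ℤₚ.+-identityˡ _))
    tail-exact-ok d (([] , a) ∷ p) h = a %ℕ d , n%ℕd<d a d , (begin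
      a ℤ.* + 1 ℤ.+ evP ρ p
        ≡⟨ cong₂ (λ a p → a ℤ.* + 1 ℤ.+ p) (a≡a%ℕn+[a/ℕn]*n a d) (exact-ok d p h) ⟩
      (+ (a %ℕ d) ℤ.+ (a /ℕ d) ℤ.* + d) ℤ.* + 1 ℤ.+ + d ℤ.* evP ρ (divide d p)
        ≡⟨ solve 4 (λ r q d p → (r :+ q :* d) :* con (+ 1) :+ d :* p := r :+ d :* (q :* con (+ 1) :+ p)) refl
             (+ (a %ℕ d)) (a /ℕ d) (+ d) (evP ρ (divide d p)) ⟩
      + (a %ℕ d) ℤ.+ + d ℤ.* ((a /ℕ d) ℤ.* + 1 ℤ.+ evP ρ (divide d p))
        ≡⟨ cong (λ z → + (a %ℕ d) ℤ.+ + d ℤ.* z) (sym (keep-ok ρ [] (a /ℕ d) (divide d p))) ⟩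
      _ ∎)
      where open ≡-Reasoning

    -- This justifies rounding the constant term: for z ≤ -1 the sum r + d z would be at most r - d,
    -- which is negative.
    floor : ∀ d r z → r ℕ.< d → + 0 ℤ.≤ + r ℤ.+ + d ℤ.* z → + 0 ℤ.≤ z
    floor d r (+ n) _ _ = ℤ.+≤+ ℕ.z≤n
    floor d@(suc d′) r -[1+ n ] r<d h = ⊥-elim (ℤₚ.<⇒≱ (begin-strict
      + r ℤ.+ + d ℤ.* -[1+ n ]       <⟨ ℤₚ.+-monoˡ-< (+ d ℤ.* -[1+ n ]) (ℤ.+<+ r<d) ⟩
      + d ℤ.+ + d ℤ.* -[1+ n ]       ≡⟨ solve 2 (λ d n → d :+ d :* (:- (con (+ 1) :+ n)) := :- (d :* n)) refl (+ d) (+ n) ⟩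
      ℤ.- (+ d ℤ.* + n)              ≡⟨ cong ℤ.-_ (sym (ℤₚ.pos-* d n)) ⟩
      ℤ.- (+ (d ℕ.* n))              ≤⟨ ℤₚ.neg-mono-≤ (ℤ.+≤+ ℕ.z≤n) ⟩
      + 0                            ∎) h)
      where open ℤₚ.≤-Reasoning

    tightenBy-ok : ∀ d p → Nonneg p → Nonneg (tightenBy d p)
    tightenBy-ok zero p h = h
    tightenBy-ok (suc zero) p h = h
    tightenBy-ok (suc (suc d)) p h with tail-exact (2 ℕ.+ d) p in r
    ... | false = h
    ... | true with tail-exact-ok (2 ℕ.+ d) p r
    ...   | k , k<d , e = floor (2 ℕ.+ d) k _ k<d (subst (+ 0 ℤ.≤_) e h)

    tighten-ok : ∀ p → Nonneg p → Nonneg (tighten p)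
    tighten-ok p = tightenBy-ok (content p) p

    scale⁺ : ∀ k p → Nonneg p → Nonneg (scale (+ k) p)
    scale⁺ k p h = subst₂ ℤ._≤_ (ℤₚ.*-zeroʳ (+ k)) (sym (scale-ok ρ (+ k) p)) (ℤₚ.*-monoˡ-≤-nonNeg (+ k) h)

    add⁺ : ∀ p q → Nonneg p → Nonneg q → Nonneg (add p q)
    add⁺ p q h g = subst (+ 0 ℤ.≤_) (sym (add-ok ρ p q)) (ℤₚ.+-mono-≤ h g)

    -- Any nonnegative combination of valid rows is valid; the two factors are chosen such that `m`
    -- cancels.
    combine-ok : ∀ m p q → Nonneg p → Nonneg q → Nonneg (combine m p q)
    combine-ok m p q h g = tighten-ok (add (scale (+ ∣ coef m q ∣) p) (scale (+ ∣ coef m p ∣) q))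
      (add⁺ (scale (+ ∣ coef m q ∣) p) (scale (+ ∣ coef m p ∣) q) (scale⁺ ∣ coef m q ∣ p h) (scale⁺ ∣ coef m p ∣ q g))

    contradictory-ok : ∀ p → contradictory p ≡ true → Nonneg p → ⊥
    contradictory-ok (([] , -[1+ n ]) ∷ []) _ h
      with () ← subst (+ 0 ℤ.≤_) (trans (ℤₚ.+-identityʳ _) (ℤₚ.*-identityʳ -[1+ n ])) h

    splitRows-ok : ∀ m ps → All Nonneg ps → let (z , a , b) = splitRows m ps in
      All Nonneg z × All Nonneg a × All Nonneg b
    splitRows-ok m [] [] = [] , [] , []
    splitRows-ok m (p ∷ ps) (h ∷ hs) with coef m p | splitRows m ps | splitRows-ok m ps hs
    ... | + 0      | z , a , b | hz , ha , hb = h ∷ hz , ha , hb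
    ... | + suc _  | z , a , b | hz , ha , hb = hz , h ∷ ha , hb
    ... | -[1+ _ ] | z , a , b | hz , ha , hb = hz , ha , h ∷ hb

    row-ok : ∀ m p qs → Nonneg p → All Nonneg qs → All Nonneg (map (combine m p) qs)
    row-ok m p []       h []       = []
    row-ok m p (q ∷ qs) h (g ∷ gs) = combine-ok m p q h g ∷ row-ok m p qs h gs

    pairs-ok : ∀ m ps qs → All Nonneg ps → All Nonneg qs → All Nonneg (pairs m ps qs)
    pairs-ok m [] qs [] gs = []
    pairs-ok m (p ∷ ps) qs (h ∷ hs) gs = ++⁺ (row-ok m p qs h gs) (pairs-ok m ps qs hs gs)

    include-ok : ∀ p qs → Nonneg p → All Nonneg qs → All Nonneg (include p qs)
    include-ok p [] h [] = h ∷ []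
    include-ok p (q ∷ qs) h (g ∷ gs) with sameTail (proj₂ (split p)) (proj₂ (split q))
    ... | false = g ∷ include-ok p qs h gs
    ... | true with proj₁ (split p) ≤ᵇ proj₁ (split q)
    ...   | true  = h ∷ gs
    ...   | false = g ∷ gs

    includeNontrivial-ok : ∀ p qs → Nonneg p → All Nonneg qs → All Nonneg (includeNontrivial p qs)
    includeNontrivial-ok [] qs h gs = gs
    includeNontrivial-ok (([] , + _) ∷ []) qs h gs = gs
    includeNontrivial-ok p@(([] , + _) ∷ _ ∷ _) qs h gs = include-ok p qs h gs
    includeNontrivial-ok p@(([] , -[1+ _ ]) ∷ _) qs h gs = include-ok p qs h gs
    includeNontrivial-ok p@((_ ∷ _ , _) ∷ _) qs h gs = include-ok p qs h gs

    includeAll-ok : ∀ ps qs → All Nonneg ps → All Nonneg qs → All Nonneg (foldr includeNontrivial qs ps)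
    includeAll-ok [] qs [] gs = gs
    includeAll-ok (p ∷ ps) qs (h ∷ hs) gs = includeNontrivial-ok p _ h (includeAll-ok ps qs hs gs)

    any-ok : ∀ ps → any contradictory ps ≡ true → All Nonneg ps → ⊥
    any-ok (p ∷ ps) e (h ∷ hs) with contradictory p in r
    ... | true  = contradictory-ok p r h
    ... | false = any-ok ps e hs

    fourierMotzkin-ok : ∀ n ps → fourierMotzkin n ps ≡ true → All Nonneg ps → ⊥
    fourierMotzkin-ok zero ps e hs = any-ok ps e hs
    fourierMotzkin-ok (suc n) ps e hs with any contradictory ps in r
    ... | true = any-ok ps r hs
    ... | false with proj₁ (cheapest (foldr tallyRow [] ps))
    ...   | m@(_ ∷ _) with splitRows m ps | splitRows-ok m ps hs
    ...     | z , a , b | hz , ha , hb =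
      fourierMotzkin-ok n _ e (includeAll-ok (pairs m a b) z (pairs-ok m a b ha hb) hz)

    add-scale : ∀ k e p → Null e → evP ρ (add p (scale k e)) ≡ evP ρ p
    add-scale k e p h rewrite add-ok ρ p (scale k e) | scale-ok ρ k e | h | ℤₚ.*-zeroʳ k = ℤₚ.+-identityʳ _

    reduceBy-ok : ∀ m k e p → Null e → evP ρ (reduceBy m k e p) ≡ evP ρ p
    reduceBy-ok m k e p h with coef m p
    ... | + 0      = refl
    ... | + suc c  = add-scale (ℤ.- (+ suc c ℤ.* k)) e p h
    ... | -[1+ c ] = add-scale (ℤ.- (-[1+ c ] ℤ.* k)) e p h

    mapAll : ∀ {P : Poly → Set} f → (∀ p → P p → P (f p)) → ∀ ps → All P ps → All P (map f ps)
    mapAll f g [] [] = []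
    mapAll f g (p ∷ ps) (h ∷ hs) = g p h ∷ mapAll f g ps hs

    infeasible-ok : ∀ n es ps → infeasible n es ps ≡ true → All Null es → All Nonneg ps → ⊥
    infeasible-ok n [] ps e [] hs = fourierMotzkin-ok 40 _ (lemma n e)
      (includeAll-ok _ [] (mapAll tighten tighten-ok ps hs) [])
      where
      lemma : ∀ n → infeasible n [] ps ≡ true → fourierMotzkin 40 (foldr includeNontrivial [] (map tighten ps)) ≡ true
      lemma zero e = e
      lemma (suc n) e = e
    infeasible-ok (suc n) (e ∷ es) ps r (g ∷ gs) hs with unit e
    ... | [] , k = infeasible-ok n es _ r gs
      (ℤₚ.≤-reflexive (sym g) ∷
       ℤₚ.≤-reflexive (sym (trans (scale-ok ρ -[1+ 0 ] e) (cong (-[1+ 0 ] ℤ.*_) g))) ∷ hs)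
    ... | m@(_ ∷ _) , k = infeasible-ok n _ _ r
      (mapAll (reduceBy m k e) (λ p → trans (reduceBy-ok m k e p g)) es gs)
      (mapAll (reduceBy m k e) (λ p → subst (+ 0 ℤ.≤_) (sym (reduceBy-ok m k e p g))) ps hs)

    Holds : State → Set
    Holds (es ∣ ps) = All Null es × All Nonneg ps

    Signed : Bool → Form → Set
    Signed true  F = ⟦ F ⟧ ρ
    Signed false F = ¬ ⟦ F ⟧ ρ

    nonneg : ∀ a b → eval ρ a ℤ.≤ eval ρ b → Nonneg (norm (b ⊖ a))
    nonneg a b h = subst (+ 0 ℤ.≤_) (sym (norm-ok ρ (b ⊖ a))) (ℤₚ.i≤j⇒0≤j-i h)

    strict : ∀ a b → eval ρ b ℤ.< eval ρ a → Nonneg (norm (a ⊖ b ⊖ # 1))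
    strict a b h = subst (+ 0 ℤ.≤_) (sym (norm-ok ρ (a ⊖ b ⊖ # 1)))
      (subst (+ 0 ℤ.≤_) (solve 2 (λ a b → a :- (con (+ 1) :+ b) := a :- b :- con (+ 1)) refl (eval ρ a) (eval ρ b))
        (ℤₚ.i≤j⇒0≤j-i (ℤₚ.i<j⇒suc[i]≤j h)))

    null : ∀ a b → eval ρ a ≡ eval ρ b → Null (norm (b ⊖ a))
    null a b h = trans (norm-ok ρ (b ⊖ a)) (ℤₚ.i≡j⇒i-j≡0 (sym h))

    close-ok : ∀ s → close s ≡ true → Holds s → ⊥
    close-ok (es ∣ ps) e (g , h) = infeasible-ok 40 es ps e g h

    -- All formulas are decidable, so negated conjunctions and implications can be split as in
    -- classical logic.
    refute-ok : ∀ b F k s → (∀ s → k s ≡ true → Holds s → ⊥) → refute b F k s ≡ true → Holds s → Signed b F → ⊥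
    refute-ok true (a ≼ b) k (es ∣ ps) hk e (g , h) x = hk _ e (g , nonneg a b x ∷ h)
    refute-ok false (a ≼ b) k (es ∣ ps) hk e (g , h) x = hk _ e (g , strict a b (ℤₚ.≰⇒> x) ∷ h)
    refute-ok true (a ≐ b) k (es ∣ ps) hk e (g , h) x = hk _ e (null a b x ∷ g , h)
    refute-ok false (a ≐ b) k (es ∣ ps) hk e (g , h) x with ∧-true e
    ... | e₁ , e₂ with ℤₚ.<-cmp (eval ρ a) (eval ρ b)
    ...   | tri< l _ _ = hk _ e₂ (g , strict b a l ∷ h)
    ...   | tri≈ _ l _ = x l
    ...   | tri> _ _ l = hk _ e₁ (g , strict a b l ∷ h)
    refute-ok true (F & G) k s hk e h (x , y) =
      refute-ok true F _ s (λ s e h → refute-ok true G k s hk e h y) e h x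
    refute-ok false (F & G) k s hk e h x with dec F ρ | ∧-true {refute false F k s} e
    ... | no ¬f | e₁ , _  = refute-ok false F k s hk e₁ h ¬f
    ... | yes f | _  , e₂ = refute-ok false G k s hk e₂ h (λ g → x (f , g))
    refute-ok true (F ∥ G) k s hk e h x with close s in r
    ... | true = close-ok s r h
    ... | false with ∧-true {refute true F k s} e
    ...   | e₁ , e₂ = [ refute-ok true F k s hk e₁ h , refute-ok true G k s hk e₂ h ]′ x
    refute-ok false (F ∥ G) k s hk e h x =
      refute-ok false F _ s (λ s e h → refute-ok false G k s hk e h (x ∘ inj₂)) e h (x ∘ inj₁)
    refute-ok true (F ⇛ G) k s hk e h x with dec F ρ | ∧-true {refute false F k s} e
    ... | no ¬f | e₁ , _  = refute-ok false F k s hk e₁ h ¬f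
    ... | yes f | _  , e₂ = refute-ok true G k s hk e₂ h (x f)
    refute-ok false (F ⇛ G) k s hk e h x with dec F ρ
    ... | no ¬f = x (λ f → ⊥-elim (¬f f))
    ... | yes f = refute-ok false G _ s (λ s e h → refute-ok true F k s hk e h f) e h (λ g → x (λ _ → g))
    refute-ok false ⊥′ k s hk e h x = hk s e h

    valid-ok : ∀ F → T (valid F) → ⟦ F ⟧ ρ
    valid-ok F v = decidable-stable (dec F ρ) (λ x →
      refute-ok false F close ([] ∣ []) close-ok (T⇒≡ v) ([] , []) x)
      where
      T⇒≡ : ∀ {b} → T b → b ≡ true
      T⇒≡ {true} _ = refl

  Fun : ℕ → Set
  Fun zero    = Form
  Fun (suc n) = Expr → Fun n

  apply : ∀ n → ℕ → Fun n → Form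
  apply zero    i F = F
  apply (suc n) i f = apply n (suc i) (f (atom i))

  Forall : ℕ → (Env → Set) → Set
  Forall zero    P = P []
  Forall (suc n) P = (x : ℤ) → Forall n (λ ρ → P (x ∷ ρ))

  forall⁺ : ∀ n {P : Env → Set} → (∀ ρ → P ρ) → Forall n P
  forall⁺ zero    p = p []
  forall⁺ (suc n) p = λ x → forall⁺ n (λ ρ → p (x ∷ ρ))

  -- Proof by reflection: the implicit argument has the unit type as soon as `valid` evaluates to
  -- `true`.
  omega : ∀ n (f : Fun n) {_ : T (valid (apply n 0 f))} → Forall n ⟦ apply n 0 f ⟧
  omega n f {v} = forall⁺ n (λ ρ → valid-ok ρ (apply n 0 f) v)

  -- The conclusion of multiplying every comparison in a positive formula by a
  -- nonnegative quantity.
  scaled : Expr → Form → Form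
  scaled q (a ≼ b) = a ⊗ q ≼ b ⊗ q
  scaled q (a ≐ b) = a ⊗ q ≐ b ⊗ q
  scaled q (F & G) = scaled q F & scaled q G
  scaled q (F ∥ G) = scaled q F ∥ scaled q G
  scaled q (F ⇛ G) = ⊥′ ⇛ ⊥′
  scaled q ⊥′      = ⊥′

  scaled-ok : ∀ {ρ} q → + 0 ℤ.≤ eval ρ q → ∀ F → ⟦ F ⟧ ρ → ⟦ scaled q F ⟧ ρ
  scaled-ok {ρ} q h (a ≼ b) x = ℤₚ.*-monoʳ-≤-nonNeg (eval ρ q) {{ℤ.nonNegative h}} x
  scaled-ok {ρ} q h (a ≐ b) x = cong (ℤ._* eval ρ q) x
  scaled-ok q h (F & G) (x , y) = scaled-ok q h F x , scaled-ok q h G y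
  scaled-ok q h (F ∥ G) = [ inj₁ ∘ scaled-ok q h F , inj₂ ∘ scaled-ok q h G ]′
  scaled-ok q h (F ⇛ G) x ()
  scaled-ok q h ⊥′ ()

open import Defs
open Omega using (Expr; cst; _⊕_; _⊖_; _⊗_; ⊝_; #_; Form; _≼_; _≐_; _≺_; _&_; _∥_; _⇛_; ⊥′; eval; ⟦_⟧; Forall; apply; omega; scaled; scaled-ok; dec)

-- Rational points

fromℚᵘ-+ : ∀ p q → ℚ.fromℚᵘ (p ℚᵘ.+ q) ≡ ℚ.fromℚᵘ p ℚ.+ ℚ.fromℚᵘ q
fromℚᵘ-+ p q = ℚₚ.toℚᵘ-injective (ℚᵘₚ.≃-trans (ℚₚ.toℚᵘ-fromℚᵘ (p ℚᵘ.+ q))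
  (ℚᵘₚ.≃-sym (ℚᵘₚ.≃-trans (ℚₚ.toℚᵘ-homo-+ (ℚ.fromℚᵘ p) (ℚ.fromℚᵘ q))
    (ℚᵘₚ.+-cong (ℚₚ.toℚᵘ-fromℚᵘ p) (ℚₚ.toℚᵘ-fromℚᵘ q)))))

fromℚᵘ-* : ∀ p q → ℚ.fromℚᵘ (p ℚᵘ.* q) ≡ ℚ.fromℚᵘ p ℚ.* ℚ.fromℚᵘ q
fromℚᵘ-* p q = ℚₚ.toℚᵘ-injective (ℚᵘₚ.≃-trans (ℚₚ.toℚᵘ-fromℚᵘ (p ℚᵘ.* q))
  (ℚᵘₚ.≃-sym (ℚᵘₚ.≃-trans (ℚₚ.toℚᵘ-homo-* (ℚ.fromℚᵘ p) (ℚ.fromℚᵘ q))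
    (ℚᵘₚ.*-cong (ℚₚ.toℚᵘ-fromℚᵘ p) (ℚₚ.toℚᵘ-fromℚᵘ q)))))

fromℚᵘ-neg : ∀ p → ℚ.fromℚᵘ (ℚᵘ.- p) ≡ ℚ.- ℚ.fromℚᵘ p
fromℚᵘ-neg p = ℚₚ.toℚᵘ-injective (ℚᵘₚ.≃-trans (ℚₚ.toℚᵘ-fromℚᵘ (ℚᵘ.- p))
  (ℚᵘₚ.≃-sym (ℚᵘₚ.≃-trans (ℚₚ.toℚᵘ-homo‿- (ℚ.fromℚᵘ p))
    (ℚᵘₚ.-‿cong (ℚₚ.toℚᵘ-fromℚᵘ p)))))

toℚ-+ : ∀ a b → toℚ (a ℤ.+ b) ≡ toℚ a ℚ.+ toℚ b
toℚ-+ a b = trans (ℚₚ.fromℚᵘ-cong {mkℚᵘ (a ℤ.+ b) 0} {mkℚᵘ a 0 ℚᵘ.+ mkℚᵘ b 0}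
  (*≡* (omega 2 (λ a b → (a ⊕ b) ⊗ # 1 ≐ (a ⊗ # 1 ⊕ b ⊗ # 1) ⊗ # 1) a b))) (fromℚᵘ-+ (mkℚᵘ a 0) (mkℚᵘ b 0))

toℚ-* : ∀ a b → toℚ (a ℤ.* b) ≡ toℚ a ℚ.* toℚ b
toℚ-* a b = fromℚᵘ-* (mkℚᵘ a 0) (mkℚᵘ b 0)

toℚ-neg : ∀ a → toℚ (ℤ.- a) ≡ ℚ.- toℚ a
toℚ-neg a = fromℚᵘ-neg (mkℚᵘ a 0)

toℚ-sub : ∀ a b → toℚ (a ℤ.- b) ≡ toℚ a ℚ.- toℚ b
toℚ-sub a b = trans (toℚ-+ a (ℤ.- b)) (cong (toℚ a ℚ.+_) (toℚ-neg b))

toℚ-mono-≤ : ∀ {a b} → a ℤ.≤ b → toℚ a ℚ.≤ toℚ b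
toℚ-mono-≤ {a} {b} h = ℚₚ.toℚᵘ-cancel-≤ (ℚᵘₚ.≤-respˡ-≃ (ℚᵘₚ.≃-sym (ℚₚ.toℚᵘ-fromℚᵘ (mkℚᵘ a 0)))
  (ℚᵘₚ.≤-respʳ-≃ (ℚᵘₚ.≃-sym (ℚₚ.toℚᵘ-fromℚᵘ (mkℚᵘ b 0)))
    (*≤* (subst₂ ℤ._≤_ (sym (ℤₚ.*-identityʳ a)) (sym (ℤₚ.*-identityʳ b)) h))))

toℚ-mono-< : ∀ {a b} → a ℤ.< b → toℚ a ℚ.< toℚ b
toℚ-mono-< {a} {b} h = ℚₚ.toℚᵘ-cancel-< (ℚᵘₚ.<-respˡ-≃ (ℚᵘₚ.≃-sym (ℚₚ.toℚᵘ-fromℚᵘ (mkℚᵘ a 0)))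
  (ℚᵘₚ.<-respʳ-≃ (ℚᵘₚ.≃-sym (ℚₚ.toℚᵘ-fromℚᵘ (mkℚᵘ b 0)))
    (*<* (subst₂ ℤ._<_ (sym (ℤₚ.*-identityʳ a)) (sym (ℤₚ.*-identityʳ b)) h))))

toℚ-cancel-≤ : ∀ {a b} → toℚ a ℚ.≤ toℚ b → a ℤ.≤ b
toℚ-cancel-≤ h = ℤₚ.≮⇒≥ (λ b<a → ℚₚ.<-irrefl refl (ℚₚ.<-≤-trans (toℚ-mono-< b<a) h))

toℚ-cancel-< : ∀ {a b} → toℚ a ℚ.< toℚ b → a ℤ.< b
toℚ-cancel-< h = ℤₚ.≰⇒> (λ b≤a → ℚₚ.<-irrefl refl (ℚₚ.<-≤-trans h (toℚ-mono-≤ b≤a)))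

toℚ-pos : ∀ {q} → + 0 ℤ.< q → ℚ.Positive (toℚ q)
toℚ-pos h = ℚ.positive (toℚ-mono-< h)

-- x = a / q
record Frac (q : ℤ) (x : ℚ) (a : ℤ) : Set where
  constructor frac
  field eqn : toℚ q ℚ.* x ≡ toℚ a

frac-toℚ : ∀ q k → Frac q (toℚ k) (k ℤ.* q)
frac-toℚ q k = frac (trans (sym (toℚ-* q k)) (cong toℚ (ℤₚ.*-comm q k)))

frac-+ : ∀ {q x y a b} → Frac q x a → Frac q y b → Frac q (x ℚ.+ y) (a ℤ.+ b)
frac-+ {q} {x} {y} {a} {b} (frac f) (frac g) =
  frac (trans (ℚₚ.*-distribˡ-+ (toℚ q) x y) (trans (cong₂ ℚ._+_ f g) (sym (toℚ-+ a b))))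

frac-neg : ∀ {q x a} → Frac q x a → Frac q (ℚ.- x) (ℤ.- a)
frac-neg {q} {x} {a} (frac f) =
  frac (trans (sym (ℚₚ.neg-distribʳ-* (toℚ q) x)) (trans (cong ℚ.-_ f) (sym (toℚ-neg a))))

frac-sub : ∀ {q x y a b} → Frac q x a → Frac q y b → Frac q (x ℚ.- y) (a ℤ.- b)
frac-sub f g = frac-+ f (frac-neg g)

frac-* : ∀ {q x y a} k → x ≡ toℚ k → Frac q y a → Frac q (x ℚ.* y) (k ℤ.* a)
frac-* {q} {_} {y} {a} k refl (frac f) = frac (begin
  toℚ q ℚ.* (toℚ k ℚ.* y)   ≡⟨ sym (ℚₚ.*-assoc (toℚ q) (toℚ k) y) ⟩
  toℚ q ℚ.* toℚ k ℚ.* y     ≡⟨ cong (ℚ._* y) (ℚₚ.*-comm (toℚ q) (toℚ k)) ⟩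
  toℚ k ℚ.* toℚ q ℚ.* y     ≡⟨ ℚₚ.*-assoc (toℚ k) (toℚ q) y ⟩
  toℚ k ℚ.* (toℚ q ℚ.* y)   ≡⟨ cong (toℚ k ℚ.*_) f ⟩
  toℚ k ℚ.* toℚ a           ≡⟨ sym (toℚ-* k a) ⟩
  toℚ (k ℤ.* a)             ∎)
  where open ≡-Reasoning

module _ {q : ℤ} (q>0 : + 0 ℤ.< q) {x y a b} (f : Frac q x a) (g : Frac q y b) where
  private instance
    q⁺ : ℚ.Positive (toℚ q)
    q⁺ = toℚ-pos q>0
    q⁰ : ℚ.NonNegative (toℚ q)
    q⁰ = ℚₚ.pos⇒nonNeg (toℚ q)

  frac-≤ : x ℚ.≤ y → a ℤ.≤ b
  frac-≤ h = toℚ-cancel-≤ (subst₂ ℚ._≤_ (Frac.eqn f) (Frac.eqn g) (ℚₚ.*-monoˡ-≤-nonNeg (toℚ q) h))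

  frac-≤⁻ : a ℤ.≤ b → x ℚ.≤ y
  frac-≤⁻ h = ℚₚ.*-cancelˡ-≤-pos (toℚ q) (subst₂ ℚ._≤_ (sym (Frac.eqn f)) (sym (Frac.eqn g)) (toℚ-mono-≤ h))

  frac-< : x ℚ.< y → a ℤ.< b
  frac-< h = toℚ-cancel-< (subst₂ ℚ._<_ (Frac.eqn f) (Frac.eqn g) (ℚₚ.*-monoʳ-<-pos (toℚ q) h))

  frac-<⁻ : a ℤ.< b → x ℚ.< y
  frac-<⁻ h = ℚₚ.*-cancelˡ-<-nonNeg (toℚ q) (subst₂ ℚ._<_ (sym (Frac.eqn f)) (sym (Frac.eqn g)) (toℚ-mono-< h))

frac-≡ : ∀ {q x y a b} → + 0 ℤ.< q → Frac q x a → Frac q y b → x ≡ y → a ≡ b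
frac-≡ q>0 f g refl = ℤₚ.≤-antisym (frac-≤ q>0 f g ℚₚ.≤-refl) (frac-≤ q>0 g f ℚₚ.≤-refl)

frac-0 : ∀ q → Frac q 0ℚ (+ 0)
frac-0 q = frac (ℚₚ.*-zeroʳ (toℚ q))

frac-weaken : ∀ {q x a} k → Frac q x a → Frac (k ℤ.* q) x (k ℤ.* a)
frac-weaken {q} {x} {a} k (frac f) = frac (trans (cong (ℚ._* x) (toℚ-* k q))
  (trans (ℚₚ.*-assoc (toℚ k) (toℚ q) x) (trans (cong (toℚ k ℚ.*_) f) (sym (toℚ-* k a)))))

frac-div : ∀ a d → Frac (+ suc d) (ℚ.fromℚᵘ (mkℚᵘ a d)) a
frac-div a d = frac (trans (sym (fromℚᵘ-* (mkℚᵘ (+ suc d) 0) (mkℚᵘ a d)))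
  (ℚₚ.fromℚᵘ-cong {mkℚᵘ (+ suc d) 0 ℚᵘ.* mkℚᵘ a d} {mkℚᵘ a 0} (*≡* (begin
    + suc d ℤ.* a ℤ.* + 1      ≡⟨ omega 2 (λ d a → d ⊗ a ⊗ # 1 ≐ a ⊗ d) (+ suc d) a ⟩
    a ℤ.* + suc d              ≡⟨ cong (λ z → a ℤ.* + suc z) (sym (ℕₚ.+-identityʳ d)) ⟩
    a ℤ.* + (1 ℕ.* suc d)      ∎))))
  where open ≡-Reasoning

frac-self : ∀ x → Frac (ℚ.↧ x) x (ℚ.↥ x)
frac-self x@(mkℚ n d _) = subst (λ y → Frac (+ suc d) y n) (ℚₚ.fromℚᵘ-toℚᵘ x) (frac-div n d)

-- The coordinates are shifted by one: (X/Q , Y/Q) is the point r + (1 , 1).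
record Rep (r : QPt) (X Y Q : ℤ) : Set where
  constructor rep
  field
    pos : + 0 ℤ.< Q
    fx  : Frac Q (proj₁ r) (X ℤ.- Q)
    fy  : Frac Q (proj₂ r) (Y ℤ.- Q)

-- The product of the two denominators serves as common denominator; adding it to a numerator shifts
-- the coordinate by one.
represent : ∀ r → Σ ℤ λ X → Σ ℤ λ Y → Σ ℤ λ Q → Rep r X Y Q
represent (x , y) = ℚ.↧ y ℤ.* ℚ.↥ x ℤ.+ q , ℚ.↧ x ℤ.* ℚ.↥ y ℤ.+ q , q , rep (pos x y)
  (subst₂ (λ q → Frac q x) (ℤₚ.*-comm (ℚ.↧ y) (ℚ.↧ x)) (cancel _ q) (frac-weaken (ℚ.↧ y) (frac-self x)))
  (subst (Frac q y) (cancel _ q) (frac-weaken (ℚ.↧ x) (frac-self y)))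
  where
  q : ℤ
  q = ℚ.↧ x ℤ.* ℚ.↧ y
  cancel : ∀ a q → a ≡ (a ℤ.+ q) ℤ.- q
  cancel = omega 2 (λ a q → a ≐ (a ⊕ q) ⊖ q)
  pos : ∀ x y → + 0 ℤ.< ℚ.↧ x ℤ.* ℚ.↧ y
  pos (mkℚ _ _ _) (mkℚ _ _ _) = ℤ.+<+ (ℕ.s≤s ℕ.z≤n)

point : ∀ X Y d → Σ QPt λ r → Rep r X Y (+ suc d)
point X Y d = (ℚ.fromℚᵘ (mkℚᵘ (X ℤ.- + suc d) d) , ℚ.fromℚᵘ (mkℚᵘ (Y ℤ.- + suc d) d)) ,
  rep (ℤ.+<+ (ℕ.s≤s ℕ.z≤n)) (frac-div _ d) (frac-div _ d)

-- In shifted coordinates R is given by 1 ≤ X / Q ≤ m and 1 ≤ Y / Q ≤ n. Here and in the later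
-- formulas `θ` is 0 for a closed region and 1 for its interior.
rectF : (m n X Y Q θ : Expr) → Form
rectF m n X Y Q θ = Q ⊕ θ ≼ X & X ⊕ θ ≼ m ⊗ Q & Q ⊕ θ ≼ Y & Y ⊕ θ ≼ n ⊗ Q

InRect : (m n X Y Q θ : ℤ) → Set
InRect m n X Y Q θ = ⟦ rectF (cst m) (cst n) (cst X) (cst Y) (cst Q) (cst θ) ⟧ []

module _ {m n : ℕ} {r : QPt} {X Y Q : ℤ} (R : Rep r X Y Q) where
  open Rep R

  InR⇒ : InR m n r → InRect (+ m) (+ n) X Y Q (+ 0)
  InR⇒ (a , b , c , d) = omega 5 (λ m n X Y Q → # 0 ≼ X ⊖ Q ⇛ X ⊖ Q ≼ (m ⊖ # 1) ⊗ Q ⇛ # 0 ≼ Y ⊖ Q ⇛ Y ⊖ Q ≼ (n ⊖ # 1) ⊗ Q ⇛ rectF m n X Y Q (# 0))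
    (+ m) (+ n) X Y Q (frac-≤ pos (frac-0 Q) fx a) (frac-≤ pos fx (frac-toℚ Q (+ m ℤ.- + 1)) b)
      (frac-≤ pos (frac-0 Q) fy c) (frac-≤ pos fy (frac-toℚ Q (+ n ℤ.- + 1)) d)

  InR⇐ : InRect (+ m) (+ n) X Y Q (+ 0) → InR m n r
  InR⇐ h with omega 5 (λ m n X Y Q → rectF m n X Y Q (# 0) ⇛ # 0 ≼ X ⊖ Q & X ⊖ Q ≼ (m ⊖ # 1) ⊗ Q & # 0 ≼ Y ⊖ Q & Y ⊖ Q ≼ (n ⊖ # 1) ⊗ Q)
                (+ m) (+ n) X Y Q h
  ... | a , b , c , d = frac-≤⁻ pos (frac-0 Q) fx a , frac-≤⁻ pos fx (frac-toℚ Q (+ m ℤ.- + 1)) b ,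
                        frac-≤⁻ pos (frac-0 Q) fy c , frac-≤⁻ pos fy (frac-toℚ Q (+ n ℤ.- + 1)) d

crossℤ : Pt → Pt → ℤ → ℤ → ℤ → ℤ
crossℤ (px , py) (qx , qy) X Y Q =
  (qx ℤ.- px) ℤ.* (Y ℤ.- Q ℤ.- py ℤ.* Q) ℤ.- (qy ℤ.- py) ℤ.* (X ℤ.- Q ℤ.- px ℤ.* Q)

frac-cross : ∀ p q {r X Y Q} → Rep r X Y Q → Frac Q (cross p q r) (crossℤ p q X Y Q)
frac-cross (px , py) (qx , qy) {rx , ry} {Q = Q} (rep _ fx fy) = frac-sub
  (frac-* (qx ℤ.- px) (sym (toℚ-sub qx px)) (frac-sub fy (frac-toℚ Q py)))
  (frac-* (qy ℤ.- py) (sym (toℚ-sub qy py)) (frac-sub fx (frac-toℚ Q px)))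

-- Closed polygons and their interiors are treated together:
-- for integers, 0 < z means 1 ≤ z.
Nonneg : Bool → ℚ → Set
Nonneg false x = 0ℚ ℚ.≤ x
Nonneg true  x = 0ℚ ℚ.< x

slack : Bool → ℤ
slack false = + 0
slack true  = + 1

slackF : Expr → Form
slackF θ = # 0 ≼ θ & θ ≼ # 1

slack-ok : ∀ b → + 0 ℤ.≤ slack b × slack b ℤ.≤ + 1
slack-ok false = ℤ.+≤+ ℕ.z≤n , ℤ.+≤+ ℕ.z≤n
slack-ok true  = ℤ.+≤+ ℕ.z≤n , ℤ.+≤+ (ℕ.s≤s ℕ.z≤n)

module _ (p q : Pt) {r X Y Q} (R : Rep r X Y Q) where
  cross⇒ : ∀ b → Nonneg b (cross p q r) → slack b ℤ.≤ crossℤ p q X Y Q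
  cross⇒ false h = frac-≤ (Rep.pos R) (frac-0 Q) (frac-cross p q R) h
  cross⇒ true  h = ℤₚ.i<j⇒suc[i]≤j (frac-< (Rep.pos R) (frac-0 Q) (frac-cross p q R) h)

  cross⇐ : ∀ b → slack b ℤ.≤ crossℤ p q X Y Q → Nonneg b (cross p q r)
  cross⇐ false h = frac-≤⁻ (Rep.pos R) (frac-0 Q) (frac-cross p q R) h
  cross⇐ true  h = frac-<⁻ (Rep.pos R) (frac-0 Q) (frac-cross p q R) (ℤₚ.suc[i]≤j⇒i<j h)

-- Tiles

pattern r0 = zero
pattern r1 = suc zero
pattern r2 = suc (suc zero)
pattern r3 = suc (suc (suc zero))

In : Bool → Tile → QPt → Set
In b t r = All (λ (p , q) → Nonneg b (cross p q r)) (edges (vertices t))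

-- The tile frame: (X , Y) pulled back by the translation and the rotation.
pullXF pullYF : Fin 4 → (dx dy X Y Q : Expr) → Expr
pullXF r0 dx dy X Y Q = X ⊖ (dx ⊕ # 1) ⊗ Q
pullXF r1 dx dy X Y Q = Y ⊖ (dy ⊕ # 1) ⊗ Q
pullXF r2 dx dy X Y Q = ⊝ (X ⊖ (dx ⊕ # 1) ⊗ Q)
pullXF r3 dx dy X Y Q = ⊝ (Y ⊖ (dy ⊕ # 1) ⊗ Q)
pullYF r0 dx dy X Y Q = Y ⊖ (dy ⊕ # 1) ⊗ Q
pullYF r1 dx dy X Y Q = ⊝ (X ⊖ (dx ⊕ # 1) ⊗ Q)
pullYF r2 dx dy X Y Q = ⊝ (Y ⊖ (dy ⊕ # 1) ⊗ Q)
pullYF r3 dx dy X Y Q = X ⊖ (dx ⊕ # 1) ⊗ Q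

pullX pullY : Fin 4 → (dx dy X Y Q : ℤ) → ℤ
pullX k dx dy X Y Q = eval [] (pullXF k (cst dx) (cst dy) (cst X) (cst Y) (cst Q))
pullY k dx dy X Y Q = eval [] (pullYF k (cst dx) (cst dy) (cst X) (cst Y) (cst Q))

crossF : (px py qx qy X Y Q : Expr) → Expr
crossF px py qx qy X Y Q = (qx ⊖ px) ⊗ (Y ⊖ py ⊗ Q) ⊖ (qy ⊖ py) ⊗ (X ⊖ px ⊗ Q)

cross₀ : Pt → Pt → (X Y Q : ℤ) → ℤ
cross₀ (px , py) (qx , qy) X Y Q =
  eval [] (crossF (cst px) (cst py) (cst qx) (cst qy) (cst X) (cst Y) (cst Q))

-- The cross product is invariant under rotations and translations, so the sides of a moved tile can
-- be tested in the frame of its shape.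
cross-move : ∀ s k dx dy p q X Y Q →
  crossℤ (move (tile s k (dx , dy)) p) (move (tile s k (dx , dy)) q) X Y Q
  ≡ cross₀ p q (pullX k dx dy X Y Q) (pullY k dx dy X Y Q) Q
cross-move s r0 dx dy (px , py) (qx , qy) X Y Q = omega 9 (λ dx dy px py qx qy X Y Q →
  ((qx ⊕ dx) ⊖ (px ⊕ dx)) ⊗ (Y ⊖ Q ⊖ (py ⊕ dy) ⊗ Q) ⊖ ((qy ⊕ dy) ⊖ (py ⊕ dy)) ⊗ (X ⊖ Q ⊖ (px ⊕ dx) ⊗ Q)
  ≐ crossF px py qx qy (pullXF r0 dx dy X Y Q) (pullYF r0 dx dy X Y Q) Q) dx dy px py qx qy X Y Q
cross-move s r1 dx dy (px , py) (qx , qy) X Y Q = omega 9 (λ dx dy px py qx qy X Y Q →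
  ((⊝ qy ⊕ dx) ⊖ (⊝ py ⊕ dx)) ⊗ (Y ⊖ Q ⊖ (px ⊕ dy) ⊗ Q) ⊖ ((qx ⊕ dy) ⊖ (px ⊕ dy)) ⊗ (X ⊖ Q ⊖ (⊝ py ⊕ dx) ⊗ Q)
  ≐ crossF px py qx qy (pullXF r1 dx dy X Y Q) (pullYF r1 dx dy X Y Q) Q) dx dy px py qx qy X Y Q
cross-move s r2 dx dy (px , py) (qx , qy) X Y Q = omega 9 (λ dx dy px py qx qy X Y Q →
  ((⊝ qx ⊕ dx) ⊖ (⊝ px ⊕ dx)) ⊗ (Y ⊖ Q ⊖ (⊝ py ⊕ dy) ⊗ Q) ⊖ ((⊝ qy ⊕ dy) ⊖ (⊝ py ⊕ dy)) ⊗ (X ⊖ Q ⊖ (⊝ px ⊕ dx) ⊗ Q)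
  ≐ crossF px py qx qy (pullXF r2 dx dy X Y Q) (pullYF r2 dx dy X Y Q) Q) dx dy px py qx qy X Y Q
cross-move s r3 dx dy (px , py) (qx , qy) X Y Q = omega 9 (λ dx dy px py qx qy X Y Q →
  ((⊝ (⊝ qy) ⊕ dx) ⊖ (⊝ (⊝ py) ⊕ dx)) ⊗ (Y ⊖ Q ⊖ (⊝ px ⊕ dy) ⊗ Q) ⊖ ((⊝ qx ⊕ dy) ⊖ (⊝ px ⊕ dy)) ⊗ (X ⊖ Q ⊖ (⊝ (⊝ py) ⊕ dx) ⊗ Q)
  ≐ crossF px py qx qy (pullXF r3 dx dy X Y Q) (pullYF r3 dx dy X Y Q) Q) dx dy px py qx qy X Y Q

Iff : Set → Set → Set
Iff A B = (A → B) × (B → A)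

-- The cross product with a side is `l` times a linear form of slope 0, ±1 or ∞, where `l` comes
-- from the length of the side. A positive factor affects neither the weak nor the strict
-- inequality.
mul-slack : ∀ b l z → 1 ℕ.≤ l → Iff (slack b ℤ.≤ + l ℤ.* z) (slack b ℤ.≤ z)
mul-slack false l@(suc _) z _ =
  (λ h → ℤₚ.*-cancelˡ-≤-pos (+ 0) z (+ l) (subst (ℤ._≤ + l ℤ.* z) (sym (ℤₚ.*-zeroʳ (+ l))) h)) ,
  (λ h → subst (ℤ._≤ + l ℤ.* z) (ℤₚ.*-zeroʳ (+ l)) (ℤₚ.*-monoˡ-≤-nonNeg (+ l) h))
mul-slack true l@(suc _) z _ =
  (λ h → ℤₚ.i<j⇒suc[i]≤j (ℤₚ.*-cancelˡ-<-nonNeg (+ l) (subst (ℤ._< + l ℤ.* z) (sym (ℤₚ.*-zeroʳ (+ l))) (ℤₚ.suc[i]≤j⇒i<j h)))) ,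
  (λ h → ℤₚ.i<j⇒suc[i]≤j (subst (ℤ._< + l ℤ.* z) (ℤₚ.*-zeroʳ (+ l)) (ℤₚ.*-monoˡ-<-pos (+ l) (ℤₚ.suc[i]≤j⇒i<j h))))

module Frame (s : Shape) (k : Fin 4) (dx dy : ℤ) {r X Y Q} (R : Rep r X Y Q) (b : Bool) where

  t : Tile
  t = tile s k (dx , dy)

  U W : ℤ
  U = pullX k dx dy X Y Q
  W = pullY k dx dy X Y Q

  side : ∀ p q l → 1 ℕ.≤ l → ∀ z → cross₀ p q U W Q ≡ + l ℤ.* z →
         Iff (Nonneg b (cross (move t p) (move t q) r)) (slack b ℤ.≤ z)
  side p q l 1≤l z e =
    (λ h → proj₁ (mul-slack b l z 1≤l) (subst (slack b ℤ.≤_) eqn (cross⇒ (move t p) (move t q) R b h))) ,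
    (λ h → cross⇐ (move t p) (move t q) R b (subst (slack b ℤ.≤_) (sym eqn) (proj₂ (mul-slack b l z 1≤l) h)))
    where
    eqn : crossℤ (move t p) (move t q) X Y Q ≡ + l ℤ.* z
    eqn = trans (cross-move s k dx dy p q X Y Q) e

-- One inequality for each side of T3, with the length factor removed. For a = 0, or a = b = 0, the
-- octagon degenerates to T4 or T1, so one formula serves three shapes.
baseOctF : (a b X Y Q θ : Expr) → Form
baseOctF a b X Y Q θ = θ ≼ Y & θ ≼ # 2 ⊗ Q ⊖ X ⊕ Y & θ ≼ (# 2 ⊕ a) ⊗ Q ⊖ X & θ ≼ (# 2 ⊗ a ⊕ # 4) ⊗ Q ⊖ X ⊖ Y &
  θ ≼ (a ⊕ b ⊕ # 2) ⊗ Q ⊖ Y & θ ≼ (# 2 ⊗ b ⊕ # 2) ⊗ Q ⊕ X ⊖ Y & θ ≼ X ⊕ b ⊗ Q & θ ≼ X ⊕ Y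

baseDiaF : (X Y Q θ : Expr) → Form
baseDiaF X Y Q θ = θ ≼ Y ⊖ X & θ ≼ # 2 ⊗ Q ⊖ X ⊖ Y & θ ≼ # 2 ⊗ Q ⊕ X ⊖ Y & θ ≼ X ⊕ Y

baseTrapF : (a X Y Q θ : Expr) → Form
baseTrapF a X Y Q θ = θ ≼ Y & θ ≼ (# 2 ⊗ a ⊕ # 2) ⊗ Q ⊖ X ⊖ Y & θ ≼ a ⊗ Q ⊖ Y & θ ≼ X ⊖ Y

baseTriF : (a X Y Q θ : Expr) → Form
baseTriF a X Y Q θ = θ ≼ Y & θ ≼ a ⊗ Q ⊖ X ⊖ Y & θ ≼ X

baseF : Shape → (X Y Q θ : Expr) → Form
baseF T1 = baseOctF (# 0) (# 0)
baseF T2 = baseDiaF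
baseF (T3 a b _ _) = baseOctF (# a) (# b)
baseF (T4 a _) = baseOctF (# 0) (# a)
baseF (T5 a _) = baseTrapF (# a)
baseF (T6 a _) = baseTriF (# a)

Base : Shape → (X Y Q θ : ℤ) → Set
Base s X Y Q θ = ⟦ baseF s (cst X) (cst Y) (cst Q) (cst θ) ⟧ []

1≤1 : 1 ℕ.≤ 1
1≤1 = ℕ.s≤s ℕ.z≤n

1≤2 : 1 ℕ.≤ 2
1≤2 = ℕ.s≤s ℕ.z≤n

in-base : ∀ s k dx dy {r X Y Q} → Rep r X Y Q → ∀ b →
  Iff (In b (tile s k (dx , dy)) r) (Base s (pullX k dx dy X Y Q) (pullY k dx dy X Y Q) Q (slack b))
in-base s@T1 k dx dy {Q = Q} R b =
  -- The four diagonal inequalities of the degenerate octagon are sums of two axis-parallel ones,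
  -- because θ ≤ 2 θ.
  (λ { (h₁ ∷ h₂ ∷ h₃ ∷ h₄ ∷ []) → omega 4 (λ U W Q θ → slackF θ ⇛ # 0 ≼ Q ⇛
         θ ≼ W ⇛ θ ≼ # 2 ⊗ Q ⊖ U ⇛ θ ≼ # 2 ⊗ Q ⊖ W ⇛ θ ≼ U ⇛ baseOctF (# 0) (# 0) U W Q θ)
         U W Q (slack b) (slack-ok b) (ℤₚ.<⇒≤ (Rep.pos R)) (proj₁ s₁ h₁) (proj₁ s₂ h₂) (proj₁ s₃ h₃) (proj₁ s₄ h₄) }) ,
  (λ h → let (g₁ , g₂ , g₃ , g₄) = omega 4 (λ U W Q θ → baseOctF (# 0) (# 0) U W Q θ ⇛
                 θ ≼ W & θ ≼ # 2 ⊗ Q ⊖ U & θ ≼ # 2 ⊗ Q ⊖ W & θ ≼ U) U W Q (slack b) h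
         in proj₂ s₁ g₁ ∷ proj₂ s₂ g₂ ∷ proj₂ s₃ g₃ ∷ proj₂ s₄ g₄ ∷ [])
  where
  open Frame s k dx dy R b
  s₁ = side (+ 0 , + 0) (+ 2 , + 0) 2 1≤2 W
    (omega 3 (λ U W Q → crossF (# 0) (# 0) (# 2) (# 0) U W Q ≐ # 2 ⊗ W) U W Q)
  s₂ = side (+ 2 , + 0) (+ 2 , + 2) 2 1≤2 (+ 2 ℤ.* Q ℤ.- U)
    (omega 3 (λ U W Q → crossF (# 2) (# 0) (# 2) (# 2) U W Q ≐ # 2 ⊗ (# 2 ⊗ Q ⊖ U)) U W Q)
  s₃ = side (+ 2 , + 2) (+ 0 , + 2) 2 1≤2 (+ 2 ℤ.* Q ℤ.- W)
    (omega 3 (λ U W Q → crossF (# 2) (# 2) (# 0) (# 2) U W Q ≐ # 2 ⊗ (# 2 ⊗ Q ⊖ W)) U W Q)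
  s₄ = side (+ 0 , + 2) (+ 0 , + 0) 2 1≤2 U
    (omega 3 (λ U W Q → crossF (# 0) (# 2) (# 0) (# 0) U W Q ≐ # 2 ⊗ U) U W Q)
in-base s@T2 k dx dy {Q = Q} R b =
  (λ { (h₁ ∷ h₂ ∷ h₃ ∷ h₄ ∷ []) → proj₁ s₁ h₁ , proj₁ s₂ h₂ , proj₁ s₃ h₃ , proj₁ s₄ h₄ }) ,
  (λ { (h₁ , h₂ , h₃ , h₄) → proj₂ s₁ h₁ ∷ proj₂ s₂ h₂ ∷ proj₂ s₃ h₃ ∷ proj₂ s₄ h₄ ∷ [] })
  where
  open Frame s k dx dy R b
  s₁ = side (+ 0 , + 0) (+ 1 , + 1) 1 1≤1 (W ℤ.- U)
    (omega 3 (λ U W Q → crossF (# 0) (# 0) (# 1) (# 1) U W Q ≐ # 1 ⊗ (W ⊖ U)) U W Q)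
  s₂ = side (+ 1 , + 1) (+ 0 , + 2) 1 1≤1 (+ 2 ℤ.* Q ℤ.- U ℤ.- W)
    (omega 3 (λ U W Q → crossF (# 1) (# 1) (# 0) (# 2) U W Q ≐ # 1 ⊗ (# 2 ⊗ Q ⊖ U ⊖ W)) U W Q)
  s₃ = side (+ 0 , + 2) (ℤ.- + 1 , + 1) 1 1≤1 (+ 2 ℤ.* Q ℤ.+ U ℤ.- W)
    (omega 3 (λ U W Q → crossF (# 0) (# 2) (⊝ # 1) (# 1) U W Q ≐ # 1 ⊗ (# 2 ⊗ Q ⊕ U ⊖ W)) U W Q)
  s₄ = side (ℤ.- + 1 , + 1) (+ 0 , + 0) 1 1≤1 (U ℤ.+ W)
    (omega 3 (λ U W Q → crossF (⊝ # 1) (# 1) (# 0) (# 0) U W Q ≐ # 1 ⊗ (U ⊕ W)) U W Q)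
in-base s@(T3 a b a≥1 b≥1) k dx dy {Q = Q} R c =
  (λ { (h₁ ∷ h₂ ∷ h₃ ∷ h₄ ∷ h₅ ∷ h₆ ∷ h₇ ∷ h₈ ∷ []) → proj₁ s₁ h₁ , proj₁ s₂ h₂ , proj₁ s₃ h₃ , proj₁ s₄ h₄ ,
         proj₁ s₅ h₅ , proj₁ s₆ h₆ , proj₁ s₇ h₇ , proj₁ s₈ h₈ }) ,
  (λ { (h₁ , h₂ , h₃ , h₄ , h₅ , h₆ , h₇ , h₈) → proj₂ s₁ h₁ ∷ proj₂ s₂ h₂ ∷ proj₂ s₃ h₃ ∷ proj₂ s₄ h₄ ∷
         proj₂ s₅ h₅ ∷ proj₂ s₆ h₆ ∷ proj₂ s₇ h₇ ∷ proj₂ s₈ h₈ ∷ [] })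
  where
  open Frame s k dx dy R c
  A B : ℤ
  A = + a
  B = + b
  s₁ = side (+ 0 , + 0) (+ 2 , + 0) 2 1≤2 W
    (omega 3 (λ U W Q → crossF (# 0) (# 0) (# 2) (# 0) U W Q ≐ # 2 ⊗ W) U W Q)
  s₂ = side (+ 2 , + 0) (+ 2 ℤ.+ A , A) a a≥1 (+ 2 ℤ.* Q ℤ.- U ℤ.+ W)
    (omega 4 (λ U W Q A → crossF (# 2) (# 0) (# 2 ⊕ A) A U W Q ≐ A ⊗ (# 2 ⊗ Q ⊖ U ⊕ W)) U W Q A)
  s₃ = side (+ 2 ℤ.+ A , A) (+ 2 ℤ.+ A , A ℤ.+ + 2) 2 1≤2 ((+ 2 ℤ.+ A) ℤ.* Q ℤ.- U)
    (omega 4 (λ U W Q A → crossF (# 2 ⊕ A) A (# 2 ⊕ A) (A ⊕ # 2) U W Q ≐ # 2 ⊗ ((# 2 ⊕ A) ⊗ Q ⊖ U)) U W Q A)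
  s₄ = side (+ 2 ℤ.+ A , A ℤ.+ + 2) (+ 2 ℤ.+ A ℤ.- B , A ℤ.+ B ℤ.+ + 2) b b≥1 ((+ 2 ℤ.* A ℤ.+ + 4) ℤ.* Q ℤ.- U ℤ.- W)
    (omega 5 (λ U W Q A B → crossF (# 2 ⊕ A) (A ⊕ # 2) (# 2 ⊕ A ⊖ B) (A ⊕ B ⊕ # 2) U W Q
      ≐ B ⊗ ((# 2 ⊗ A ⊕ # 4) ⊗ Q ⊖ U ⊖ W)) U W Q A B)
  s₅ = side (+ 2 ℤ.+ A ℤ.- B , A ℤ.+ B ℤ.+ + 2) (A ℤ.- B , A ℤ.+ B ℤ.+ + 2) 2 1≤2 ((A ℤ.+ B ℤ.+ + 2) ℤ.* Q ℤ.- W)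
    (omega 5 (λ U W Q A B → crossF (# 2 ⊕ A ⊖ B) (A ⊕ B ⊕ # 2) (A ⊖ B) (A ⊕ B ⊕ # 2) U W Q
      ≐ # 2 ⊗ ((A ⊕ B ⊕ # 2) ⊗ Q ⊖ W)) U W Q A B)
  s₆ = side (A ℤ.- B , A ℤ.+ B ℤ.+ + 2) (ℤ.- B , B ℤ.+ + 2) a a≥1 ((+ 2 ℤ.* B ℤ.+ + 2) ℤ.* Q ℤ.+ U ℤ.- W)
    (omega 5 (λ U W Q A B → crossF (A ⊖ B) (A ⊕ B ⊕ # 2) (⊝ B) (B ⊕ # 2) U W Q
      ≐ A ⊗ ((# 2 ⊗ B ⊕ # 2) ⊗ Q ⊕ U ⊖ W)) U W Q A B)
  s₇ = side (ℤ.- B , B ℤ.+ + 2) (ℤ.- B , B) 2 1≤2 (U ℤ.+ B ℤ.* Q)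
    (omega 4 (λ U W Q B → crossF (⊝ B) (B ⊕ # 2) (⊝ B) B U W Q ≐ # 2 ⊗ (U ⊕ B ⊗ Q)) U W Q B)
  s₈ = side (ℤ.- B , B) (+ 0 , + 0) b b≥1 (U ℤ.+ W)
    (omega 4 (λ U W Q B → crossF (⊝ B) B (# 0) (# 0) U W Q ≐ B ⊗ (U ⊕ W)) U W Q B)
in-base s@(T4 a a≥1) k dx dy {Q = Q} R b =
  (λ { (h₁ ∷ h₂ ∷ h₃ ∷ h₄ ∷ h₅ ∷ h₆ ∷ []) → omega 5 (λ U W Q A θ → slackF θ ⇛ # 0 ≼ Q ⇛
         θ ≼ W ⇛ θ ≼ # 2 ⊗ Q ⊖ U ⇛ θ ≼ # 4 ⊗ Q ⊖ U ⊖ W ⇛ θ ≼ (A ⊕ # 2) ⊗ Q ⊖ W ⇛ θ ≼ U ⊕ A ⊗ Q ⇛ θ ≼ U ⊕ W ⇛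
         baseOctF (# 0) A U W Q θ)
         U W Q A (slack b) (slack-ok b) (ℤₚ.<⇒≤ (Rep.pos R)) (proj₁ s₁ h₁) (proj₁ s₂ h₂) (proj₁ s₃ h₃) (proj₁ s₄ h₄) (proj₁ s₅ h₅) (proj₁ s₆ h₆) }) ,
  (λ h → let (g₁ , g₂ , g₃ , g₄ , g₅ , g₆) = omega 5 (λ U W Q A θ → baseOctF (# 0) A U W Q θ ⇛
                 θ ≼ W & θ ≼ # 2 ⊗ Q ⊖ U & θ ≼ # 4 ⊗ Q ⊖ U ⊖ W & θ ≼ (A ⊕ # 2) ⊗ Q ⊖ W & θ ≼ U ⊕ A ⊗ Q & θ ≼ U ⊕ W) U W Q A (slack b) h
         in proj₂ s₁ g₁ ∷ proj₂ s₂ g₂ ∷ proj₂ s₃ g₃ ∷ proj₂ s₄ g₄ ∷ proj₂ s₅ g₅ ∷ proj₂ s₆ g₆ ∷ [])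
  where
  open Frame s k dx dy R b
  A : ℤ
  A = + a
  s₁ = side (+ 0 , + 0) (+ 2 , + 0) 2 1≤2 W
    (omega 3 (λ U W Q → crossF (# 0) (# 0) (# 2) (# 0) U W Q ≐ # 2 ⊗ W) U W Q)
  s₂ = side (+ 2 , + 0) (+ 2 , + 2) 2 1≤2 (+ 2 ℤ.* Q ℤ.- U)
    (omega 3 (λ U W Q → crossF (# 2) (# 0) (# 2) (# 2) U W Q ≐ # 2 ⊗ (# 2 ⊗ Q ⊖ U)) U W Q)
  s₃ = side (+ 2 , + 2) (+ 2 ℤ.- A , + 2 ℤ.+ A) a a≥1 (+ 4 ℤ.* Q ℤ.- U ℤ.- W)
    (omega 4 (λ U W Q A → crossF (# 2) (# 2) (# 2 ⊖ A) (# 2 ⊕ A) U W Q ≐ A ⊗ (# 4 ⊗ Q ⊖ U ⊖ W)) U W Q A)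
  s₄ = side (+ 2 ℤ.- A , + 2 ℤ.+ A) (ℤ.- A , + 2 ℤ.+ A) 2 1≤2 ((A ℤ.+ + 2) ℤ.* Q ℤ.- W)
    (omega 4 (λ U W Q A → crossF (# 2 ⊖ A) (# 2 ⊕ A) (⊝ A) (# 2 ⊕ A) U W Q ≐ # 2 ⊗ ((A ⊕ # 2) ⊗ Q ⊖ W)) U W Q A)
  s₅ = side (ℤ.- A , + 2 ℤ.+ A) (ℤ.- A , A) 2 1≤2 (U ℤ.+ A ℤ.* Q)
    (omega 4 (λ U W Q A → crossF (⊝ A) (# 2 ⊕ A) (⊝ A) A U W Q ≐ # 2 ⊗ (U ⊕ A ⊗ Q)) U W Q A)
  s₆ = side (ℤ.- A , A) (+ 0 , + 0) a a≥1 (U ℤ.+ W)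
    (omega 4 (λ U W Q A → crossF (⊝ A) A (# 0) (# 0) U W Q ≐ A ⊗ (U ⊕ W)) U W Q A)
in-base s@(T5 a a≥1) k dx dy {Q = Q} R b =
  (λ { (h₁ ∷ h₂ ∷ h₃ ∷ h₄ ∷ []) → proj₁ s₁ h₁ , proj₁ s₂ h₂ , proj₁ s₃ h₃ , proj₁ s₄ h₄ }) ,
  (λ { (h₁ , h₂ , h₃ , h₄) → proj₂ s₁ h₁ ∷ proj₂ s₂ h₂ ∷ proj₂ s₃ h₃ ∷ proj₂ s₄ h₄ ∷ [] })
  where
  open Frame s k dx dy R b
  A : ℤ
  A = + a
  s₁ = side (+ 0 , + 0) (+ 2 ℤ.* A ℤ.+ + 2 , + 0) (2 ℕ.* a ℕ.+ 2) (ℕₚ.≤-trans 1≤2 (ℕₚ.m≤n+m 2 (2 ℕ.* a))) W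
    (trans (omega 4 (λ U W Q A → crossF (# 0) (# 0) (# 2 ⊗ A ⊕ # 2) (# 0) U W Q ≐ (# 2 ⊗ A ⊕ # 2) ⊗ W) U W Q A)
           (cong (λ z → (z ℤ.+ + 2) ℤ.* W) (sym (ℤₚ.pos-* 2 a))))
  s₂ = side (+ 2 ℤ.* A ℤ.+ + 2 , + 0) (A ℤ.+ + 2 , A) a a≥1 ((+ 2 ℤ.* A ℤ.+ + 2) ℤ.* Q ℤ.- U ℤ.- W)
    (omega 4 (λ U W Q A → crossF (# 2 ⊗ A ⊕ # 2) (# 0) (A ⊕ # 2) A U W Q ≐ A ⊗ ((# 2 ⊗ A ⊕ # 2) ⊗ Q ⊖ U ⊖ W)) U W Q A)
  s₃ = side (A ℤ.+ + 2 , A) (A , A) 2 1≤2 (A ℤ.* Q ℤ.- W)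
    (omega 4 (λ U W Q A → crossF (A ⊕ # 2) A A A U W Q ≐ # 2 ⊗ (A ⊗ Q ⊖ W)) U W Q A)
  s₄ = side (A , A) (+ 0 , + 0) a a≥1 (U ℤ.- W)
    (omega 4 (λ U W Q A → crossF A A (# 0) (# 0) U W Q ≐ A ⊗ (U ⊖ W)) U W Q A)
in-base s@(T6 a a≥1) k dx dy {Q = Q} R b =
  (λ { (h₁ ∷ h₂ ∷ h₃ ∷ []) → proj₁ s₁ h₁ , proj₁ s₂ h₂ , proj₁ s₃ h₃ }) ,
  (λ { (h₁ , h₂ , h₃) → proj₂ s₁ h₁ ∷ proj₂ s₂ h₂ ∷ proj₂ s₃ h₃ ∷ [] })
  where
  open Frame s k dx dy R b
  A : ℤ
  A = + a
  s₁ = side (+ 0 , + 0) (A , + 0) a a≥1 W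
    (omega 4 (λ U W Q A → crossF (# 0) (# 0) A (# 0) U W Q ≐ A ⊗ W) U W Q A)
  s₂ = side (A , + 0) (+ 0 , A) a a≥1 (A ℤ.* Q ℤ.- U ℤ.- W)
    (omega 4 (λ U W Q A → crossF A (# 0) (# 0) A U W Q ≐ A ⊗ (A ⊗ Q ⊖ U ⊖ W)) U W Q A)
  s₃ = side (+ 0 , A) (+ 0 , + 0) a a≥1 U
    (omega 4 (λ U W Q A → crossF (# 0) A (# 0) (# 0) U W Q ≐ A ⊗ U) U W Q A)

-- Pieces

-- oct a b c d is the part in the rectangle of the octagon with core
-- [a , b) × [c , d), and dia k l is the diamond around the point of the opposite
-- colour with X = k + l - 1 + e and Y = k - l.
data Piece : Set where
  oct : (a b c d : ℤ) → Piece
  dia : (k l : ℤ) → Piece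

-- The Minkowski sum of the convex hull of the core with the square [-1 , 1] × [-1 , 1]: compared
-- with the core, X + Y and X - Y are widened by 2 at both ends, and X and Y by 1.
octF : (a b c d e X Y Q θ : Expr) → Form
octF a b c d e X Y Q θ =
  (# 2 ⊗ a ⊖ # 2 ⊕ e) ⊗ Q ⊕ θ ≼ X ⊕ Y & X ⊕ Y ⊕ θ ≼ (# 2 ⊗ b ⊕ e) ⊗ Q &
  (# 2 ⊗ c ⊖ # 2 ⊕ e) ⊗ Q ⊕ θ ≼ X ⊖ Y & X ⊖ Y ⊕ θ ≼ (# 2 ⊗ d ⊕ e) ⊗ Q &
  (a ⊕ c ⊖ # 1 ⊕ e) ⊗ Q ⊕ θ ≼ X & X ⊕ θ ≼ (b ⊕ d ⊖ # 1 ⊕ e) ⊗ Q &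
  (a ⊖ d) ⊗ Q ⊕ θ ≼ Y & Y ⊕ θ ≼ (b ⊖ c) ⊗ Q

octRF : (a b c d e m n X Y Q θ : Expr) → Form
octRF a b c d e m n X Y Q θ = octF a b c d e X Y Q θ & rectF m n X Y Q θ

diaF : (k l e X Y Q θ : Expr) → Form
diaF k l e X Y Q θ =
  (# 2 ⊗ k ⊖ # 2 ⊕ e) ⊗ Q ⊕ θ ≼ X ⊕ Y & X ⊕ Y ⊕ θ ≼ (# 2 ⊗ k ⊕ e) ⊗ Q &
  (# 2 ⊗ l ⊖ # 2 ⊕ e) ⊗ Q ⊕ θ ≼ X ⊖ Y & X ⊖ Y ⊕ θ ≼ (# 2 ⊗ l ⊕ e) ⊗ Q

-- L, R, B and T stand for the lines X = 0, X = m + 1, Y = 0 and Y = n + 1.  An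
-- octagon may be symmetric about such a line; otherwise it stays clear of it.
symL clrL symR clrR symB clrB symT clrT : (a b c d e m n : Expr) → Form
symL a b c d e m n = a ⊕ # 2 ≼ b & a ⊕ d ≐ # 1 ⊖ e & b ⊕ c ≐ # 1 ⊖ e
clrL a b c d e m n = # 2 ≼ a ⊕ c ⊕ e
symR a b c d e m n = a ⊕ # 2 ≼ b & a ⊕ d ≐ m ⊕ # 2 ⊖ e & b ⊕ c ≐ m ⊕ # 2 ⊖ e
clrR a b c d e m n = b ⊕ d ⊕ e ≼ m ⊕ # 1
symB a b c d e m n = a ⊕ # 2 ≼ b & a ≐ c & b ≐ d
clrB a b c d e m n = # 1 ≼ a ⊖ d
symT a b c d e m n = a ⊕ # 2 ≼ b & a ≐ c ⊕ n ⊕ # 1 & b ≐ d ⊕ n ⊕ # 1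
clrT a b c d e m n = b ⊖ c ≼ n

validOctF : (a b c d e m n : Expr) → Form
validOctF a b c d e m n = a ≺ b & c ≺ d &
  (symL a b c d e m n ∥ clrL a b c d e m n) & (symR a b c d e m n ∥ clrR a b c d e m n) &
  (symB a b c d e m n ∥ clrB a b c d e m n) & (symT a b c d e m n ∥ clrT a b c d e m n)

-- The centre keeps distance at least 1 from the sides of R, so the whole diamond is in R.
validDiaF : (k l e m n : Expr) → Form
validDiaF k l e m n = # 3 ≼ k ⊕ l ⊕ e & k ⊕ l ⊕ e ≼ m & # 2 ≼ k ⊖ l & k ⊖ l ⊕ # 1 ≼ n

-- The position of a tile with shape parameters A and B, in terms of its piece.
octCondF : Fin 4 → (a b c d e m n A B dx dy : Expr) → Form
octCondF k a b c d e m n A B dx dy =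
  pos k & clrL a b c d e m n & clrR a b c d e m n & clrB a b c d e m n & clrT a b c d e m n
  where
  pos : Fin 4 → Form
  pos r0 = dx ⊕ # 3 ≐ a ⊕ d ⊕ e & dy ⊕ # 1 ≐ a ⊖ d & b ≐ a ⊕ A ⊕ # 1 & d ≐ c ⊕ B ⊕ # 1
  pos r1 = dx ⊕ # 2 ≐ b ⊕ d ⊕ e & dy ⊕ # 2 ≐ b ⊖ d & b ≐ a ⊕ B ⊕ # 1 & d ≐ c ⊕ A ⊕ # 1
  pos r2 = dx ⊕ # 1 ≐ b ⊕ c ⊕ e & dy ⊕ # 1 ≐ b ⊖ c & b ≐ a ⊕ A ⊕ # 1 & d ≐ c ⊕ B ⊕ # 1
  pos r3 = dx ⊕ # 2 ≐ a ⊕ c ⊕ e & dy ≐ a ⊖ c & b ≐ a ⊕ B ⊕ # 1 & d ≐ c ⊕ A ⊕ # 1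

diaCondF : Fin 4 → (k l e m n dx dy : Expr) → Form
diaCondF r k l e m n dx dy = pos r & validDiaF k l e m n
  where
  pos : Fin 4 → Form
  pos r0 = dx ⊕ # 2 ≐ k ⊕ l ⊕ e & dy ⊕ # 2 ≐ k ⊖ l
  pos r1 = dx ⊕ # 1 ≐ k ⊕ l ⊕ e & dy ⊕ # 1 ≐ k ⊖ l
  pos r2 = dx ⊕ # 2 ≐ k ⊕ l ⊕ e & dy ≐ k ⊖ l
  pos r3 = dx ⊕ # 3 ≐ k ⊕ l ⊕ e & dy ⊕ # 1 ≐ k ⊖ l

trapCondF : Fin 4 → (a b c d e m n A dx dy : Expr) → Form
trapCondF r0 a b c d e m n A dx dy = dy ≐ # 0 & dx ⊕ # 2 ≐ # 2 ⊗ c ⊕ e & b ≐ a ⊕ A ⊕ # 1 & a ≐ c & b ≐ d &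
  clrL a b c d e m n & clrR a b c d e m n & clrT a b c d e m n
trapCondF r1 a b c d e m n A dx dy = dx ⊕ # 1 ≐ m & dy ⊕ # 1 ≐ a ⊖ d & b ≐ a ⊕ A ⊕ # 1 &
  a ⊕ d ≐ m ⊕ # 2 ⊖ e & b ⊕ c ≐ m ⊕ # 2 ⊖ e &
  clrL a b c d e m n & clrB a b c d e m n & clrT a b c d e m n
trapCondF r2 a b c d e m n A dx dy = dy ⊕ # 1 ≐ n & dx ⊕ # 2 ≐ b ⊕ d ⊕ e & b ≐ a ⊕ A ⊕ # 1 &
  a ≐ c ⊕ n ⊕ # 1 & b ≐ d ⊕ n ⊕ # 1 &
  clrL a b c d e m n & clrR a b c d e m n & clrB a b c d e m n
trapCondF r3 a b c d e m n A dx dy = dx ≐ # 0 & dy ⊕ # 1 ≐ b ⊖ c & b ≐ a ⊕ A ⊕ # 1 &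
  a ⊕ d ≐ # 1 ⊖ e & b ⊕ c ≐ # 1 ⊖ e &
  clrR a b c d e m n & clrB a b c d e m n & clrT a b c d e m n

triCondF : Fin 4 → (a b c d e m n A dx dy : Expr) → Form
triCondF r0 a b c d e m n A dx dy = dx ≐ # 0 & dy ≐ # 0 & # 2 ⊗ b ⊕ e ≐ A ⊕ # 2 &
  a ⊕ d ≐ # 1 ⊖ e & b ⊕ c ≐ # 1 ⊖ e & a ≐ c & b ≐ d & clrR a b c d e m n & clrT a b c d e m n
triCondF r1 a b c d e m n A dx dy = dx ⊕ # 1 ≐ m & dy ≐ # 0 & m ⊕ # 1 ≐ # 2 ⊗ c ⊕ e ⊕ A &
  a ⊕ d ≐ m ⊕ # 2 ⊖ e & b ⊕ c ≐ m ⊕ # 2 ⊖ e & a ≐ c & b ≐ d & clrL a b c d e m n & clrT a b c d e m n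
triCondF r2 a b c d e m n A dx dy = dx ⊕ # 1 ≐ m & dy ⊕ # 1 ≐ n & m ⊕ n ⊕ # 2 ≐ # 2 ⊗ a ⊕ e ⊕ A &
  a ⊕ d ≐ m ⊕ # 2 ⊖ e & b ⊕ c ≐ m ⊕ # 2 ⊖ e & a ≐ c ⊕ n ⊕ # 1 & b ≐ d ⊕ n ⊕ # 1 &
  clrL a b c d e m n & clrB a b c d e m n
triCondF r3 a b c d e m n A dx dy = dx ≐ # 0 & dy ⊕ # 1 ≐ n & A ⊕ # 1 ⊖ n ≐ # 2 ⊗ d ⊕ e &
  a ⊕ d ≐ # 1 ⊖ e & b ⊕ c ≐ # 1 ⊖ e & a ≐ c ⊕ n ⊕ # 1 & b ≐ d ⊕ n ⊕ # 1 &
  clrR a b c d e m n & clrB a b c d e m n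

-- The conditions on the position do not involve Q. Multiplied by Q, they become linear relations
-- among the monomials a Q, b Q, ... that occur in the inequalities of the tile.
octCaseF : Fin 4 → (a b c d e m n A B dx dy X Y Q θ : Expr) → Form
octCaseF k a b c d e m n A B dx dy X Y Q θ = slackF θ ⇛ # 0 ≼ Q ⇛ scaled Q (octCondF k a b c d e m n A B dx dy) ⇛
  (baseOctF A B (pullXF k dx dy X Y Q) (pullYF k dx dy X Y Q) Q θ ⇛ octRF a b c d e m n X Y Q θ) &
  (octRF a b c d e m n X Y Q θ ⇛ baseOctF A B (pullXF k dx dy X Y Q) (pullYF k dx dy X Y Q) Q θ)

trapCaseF : Fin 4 → (a b c d e m n A dx dy X Y Q θ : Expr) → Form
trapCaseF k a b c d e m n A dx dy X Y Q θ = slackF θ ⇛ # 0 ≼ Q ⇛ scaled Q (trapCondF k a b c d e m n A dx dy) ⇛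
  (baseTrapF A (pullXF k dx dy X Y Q) (pullYF k dx dy X Y Q) Q θ ⇛ octRF a b c d e m n X Y Q θ) &
  (octRF a b c d e m n X Y Q θ ⇛ baseTrapF A (pullXF k dx dy X Y Q) (pullYF k dx dy X Y Q) Q θ)

triCaseF : Fin 4 → (a b c d e m n A dx dy X Y Q θ : Expr) → Form
triCaseF k a b c d e m n A dx dy X Y Q θ = slackF θ ⇛ # 0 ≼ Q ⇛ scaled Q (triCondF k a b c d e m n A dx dy) ⇛
  (baseTriF A (pullXF k dx dy X Y Q) (pullYF k dx dy X Y Q) Q θ ⇛ octRF a b c d e m n X Y Q θ) &
  (octRF a b c d e m n X Y Q θ ⇛ baseTriF A (pullXF k dx dy X Y Q) (pullYF k dx dy X Y Q) Q θ)

diaCaseF : Fin 4 → (k l e m n dx dy X Y Q θ : Expr) → Form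
diaCaseF r k l e m n dx dy X Y Q θ = slackF θ ⇛ # 0 ≼ Q ⇛ scaled Q (diaCondF r k l e m n dx dy) ⇛
  (baseDiaF (pullXF r dx dy X Y Q) (pullYF r dx dy X Y Q) Q θ ⇛ diaF k l e X Y Q θ) &
  (diaF k l e X Y Q θ ⇛ baseDiaF (pullXF r dx dy X Y Q) (pullYF r dx dy X Y Q) Q θ)

octCase : ∀ k → Forall 15 ⟦ apply 15 0 (octCaseF k) ⟧
octCase r0 = omega 15 (octCaseF r0)
octCase r1 = omega 15 (octCaseF r1)
octCase r2 = omega 15 (octCaseF r2)
octCase r3 = omega 15 (octCaseF r3)

trapCase : ∀ k → Forall 14 ⟦ apply 14 0 (trapCaseF k) ⟧
trapCase r0 = omega 14 (trapCaseF r0)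
trapCase r1 = omega 14 (trapCaseF r1)
trapCase r2 = omega 14 (trapCaseF r2)
trapCase r3 = omega 14 (trapCaseF r3)

triCase : ∀ k → Forall 14 ⟦ apply 14 0 (triCaseF k) ⟧
triCase r0 = omega 14 (triCaseF r0)
triCase r1 = omega 14 (triCaseF r1)
triCase r2 = omega 14 (triCaseF r2)
triCase r3 = omega 14 (triCaseF r3)

diaCase : ∀ k → Forall 11 ⟦ apply 11 0 (diaCaseF k) ⟧
diaCase r0 = omega 11 (diaCaseF r0)
diaCase r1 = omega 11 (diaCaseF r1)
diaCase r2 = omega 11 (diaCaseF r2)
diaCase r3 = omega 11 (diaCaseF r3)

octDescribe : ∀ k a b c d e m n A B dx dy X Y Q θ → ⟦ slackF (cst θ) ⟧ [] → + 0 ℤ.≤ Q →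
  ⟦ octCondF k (cst a) (cst b) (cst c) (cst d) (cst e) (cst m) (cst n) (cst A) (cst B) (cst dx) (cst dy) ⟧ [] →
  Iff (⟦ baseOctF (cst A) (cst B) (cst (pullX k dx dy X Y Q)) (cst (pullY k dx dy X Y Q)) (cst Q) (cst θ) ⟧ [])
      (⟦ octRF (cst a) (cst b) (cst c) (cst d) (cst e) (cst m) (cst n) (cst X) (cst Y) (cst Q) (cst θ) ⟧ [])
octDescribe r0 a b c d e m n A B dx dy X Y Q θ s q h = octCase r0 a b c d e m n A B dx dy X Y Q θ s q (scaled-ok {[]} (cst Q) q (octCondF r0 (cst a) (cst b) (cst c) (cst d) (cst e) (cst m) (cst n) (cst A) (cst B) (cst dx) (cst dy)) h)
octDescribe r1 a b c d e m n A B dx dy X Y Q θ s q h = octCase r1 a b c d e m n A B dx dy X Y Q θ s q (scaled-ok {[]} (cst Q) q (octCondF r1 (cst a) (cst b) (cst c) (cst d) (cst e) (cst m) (cst n) (cst A) (cst B) (cst dx) (cst dy)) h)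
octDescribe r2 a b c d e m n A B dx dy X Y Q θ s q h = octCase r2 a b c d e m n A B dx dy X Y Q θ s q (scaled-ok {[]} (cst Q) q (octCondF r2 (cst a) (cst b) (cst c) (cst d) (cst e) (cst m) (cst n) (cst A) (cst B) (cst dx) (cst dy)) h)
octDescribe r3 a b c d e m n A B dx dy X Y Q θ s q h = octCase r3 a b c d e m n A B dx dy X Y Q θ s q (scaled-ok {[]} (cst Q) q (octCondF r3 (cst a) (cst b) (cst c) (cst d) (cst e) (cst m) (cst n) (cst A) (cst B) (cst dx) (cst dy)) h)

trapDescribe : ∀ k a b c d e m n A dx dy X Y Q θ → ⟦ slackF (cst θ) ⟧ [] → + 0 ℤ.≤ Q →
  ⟦ trapCondF k (cst a) (cst b) (cst c) (cst d) (cst e) (cst m) (cst n) (cst A) (cst dx) (cst dy) ⟧ [] →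
  Iff (⟦ baseTrapF (cst A) (cst (pullX k dx dy X Y Q)) (cst (pullY k dx dy X Y Q)) (cst Q) (cst θ) ⟧ [])
      (⟦ octRF (cst a) (cst b) (cst c) (cst d) (cst e) (cst m) (cst n) (cst X) (cst Y) (cst Q) (cst θ) ⟧ [])
trapDescribe r0 a b c d e m n A dx dy X Y Q θ s q h = trapCase r0 a b c d e m n A dx dy X Y Q θ s q (scaled-ok {[]} (cst Q) q (trapCondF r0 (cst a) (cst b) (cst c) (cst d) (cst e) (cst m) (cst n) (cst A) (cst dx) (cst dy)) h)
trapDescribe r1 a b c d e m n A dx dy X Y Q θ s q h = trapCase r1 a b c d e m n A dx dy X Y Q θ s q (scaled-ok {[]} (cst Q) q (trapCondF r1 (cst a) (cst b) (cst c) (cst d) (cst e) (cst m) (cst n) (cst A) (cst dx) (cst dy)) h)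
trapDescribe r2 a b c d e m n A dx dy X Y Q θ s q h = trapCase r2 a b c d e m n A dx dy X Y Q θ s q (scaled-ok {[]} (cst Q) q (trapCondF r2 (cst a) (cst b) (cst c) (cst d) (cst e) (cst m) (cst n) (cst A) (cst dx) (cst dy)) h)
trapDescribe r3 a b c d e m n A dx dy X Y Q θ s q h = trapCase r3 a b c d e m n A dx dy X Y Q θ s q (scaled-ok {[]} (cst Q) q (trapCondF r3 (cst a) (cst b) (cst c) (cst d) (cst e) (cst m) (cst n) (cst A) (cst dx) (cst dy)) h)

triDescribe : ∀ k a b c d e m n A dx dy X Y Q θ → ⟦ slackF (cst θ) ⟧ [] → + 0 ℤ.≤ Q →
  ⟦ triCondF k (cst a) (cst b) (cst c) (cst d) (cst e) (cst m) (cst n) (cst A) (cst dx) (cst dy) ⟧ [] →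
  Iff (⟦ baseTriF (cst A) (cst (pullX k dx dy X Y Q)) (cst (pullY k dx dy X Y Q)) (cst Q) (cst θ) ⟧ [])
      (⟦ octRF (cst a) (cst b) (cst c) (cst d) (cst e) (cst m) (cst n) (cst X) (cst Y) (cst Q) (cst θ) ⟧ [])
triDescribe r0 a b c d e m n A dx dy X Y Q θ s q h = triCase r0 a b c d e m n A dx dy X Y Q θ s q (scaled-ok {[]} (cst Q) q (triCondF r0 (cst a) (cst b) (cst c) (cst d) (cst e) (cst m) (cst n) (cst A) (cst dx) (cst dy)) h)
triDescribe r1 a b c d e m n A dx dy X Y Q θ s q h = triCase r1 a b c d e m n A dx dy X Y Q θ s q (scaled-ok {[]} (cst Q) q (triCondF r1 (cst a) (cst b) (cst c) (cst d) (cst e) (cst m) (cst n) (cst A) (cst dx) (cst dy)) h)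
triDescribe r2 a b c d e m n A dx dy X Y Q θ s q h = triCase r2 a b c d e m n A dx dy X Y Q θ s q (scaled-ok {[]} (cst Q) q (triCondF r2 (cst a) (cst b) (cst c) (cst d) (cst e) (cst m) (cst n) (cst A) (cst dx) (cst dy)) h)
triDescribe r3 a b c d e m n A dx dy X Y Q θ s q h = triCase r3 a b c d e m n A dx dy X Y Q θ s q (scaled-ok {[]} (cst Q) q (triCondF r3 (cst a) (cst b) (cst c) (cst d) (cst e) (cst m) (cst n) (cst A) (cst dx) (cst dy)) h)

diaDescribe : ∀ r k l e m n dx dy X Y Q θ → ⟦ slackF (cst θ) ⟧ [] → + 0 ℤ.≤ Q →
  ⟦ diaCondF r (cst k) (cst l) (cst e) (cst m) (cst n) (cst dx) (cst dy) ⟧ [] →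
  Iff (⟦ baseDiaF  (cst (pullX r dx dy X Y Q)) (cst (pullY r dx dy X Y Q)) (cst Q) (cst θ) ⟧ [])
      (⟦ diaF (cst k) (cst l) (cst e) (cst X) (cst Y) (cst Q) (cst θ) ⟧ [])
diaDescribe r0 k l e m n dx dy X Y Q θ s q h = diaCase r0 k l e m n dx dy X Y Q θ s q (scaled-ok {[]} (cst Q) q (diaCondF r0 (cst k) (cst l) (cst e) (cst m) (cst n) (cst dx) (cst dy)) h)
diaDescribe r1 k l e m n dx dy X Y Q θ s q h = diaCase r1 k l e m n dx dy X Y Q θ s q (scaled-ok {[]} (cst Q) q (diaCondF r1 (cst k) (cst l) (cst e) (cst m) (cst n) (cst dx) (cst dy)) h)
diaDescribe r2 k l e m n dx dy X Y Q θ s q h = diaCase r2 k l e m n dx dy X Y Q θ s q (scaled-ok {[]} (cst Q) q (diaCondF r2 (cst k) (cst l) (cst e) (cst m) (cst n) (cst dx) (cst dy)) h)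
diaDescribe r3 k l e m n dx dy X Y Q θ s q h = diaCase r3 k l e m n dx dy X Y Q θ s q (scaled-ok {[]} (cst Q) q (diaCondF r3 (cst k) (cst l) (cst e) (cst m) (cst n) (cst dx) (cst dy)) h)

InPiece : (e m n : ℤ) → Piece → (X Y Q θ : ℤ) → Set
InPiece e m n (oct a b c d) X Y Q θ =
  ⟦ octRF (cst a) (cst b) (cst c) (cst d) (cst e) (cst m) (cst n) (cst X) (cst Y) (cst Q) (cst θ) ⟧ []
InPiece e m n (dia k l) X Y Q θ = ⟦ diaF (cst k) (cst l) (cst e) (cst X) (cst Y) (cst Q) (cst θ) ⟧ []

Valid : (e m n : ℤ) → Piece → Set
Valid e m n (oct a b c d) = ⟦ validOctF (cst a) (cst b) (cst c) (cst d) (cst e) (cst m) (cst n) ⟧ []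
Valid e m n (dia k l) = ⟦ validDiaF (cst k) (cst l) (cst e) (cst m) (cst n) ⟧ []

Placed : (e m n : ℤ) → Shape → Fin 4 → (dx dy : ℤ) → Piece → Set
Placed e m n T1 k dx dy (oct a b c d) = ⟦ octCondF k (cst a) (cst b) (cst c) (cst d) (cst e) (cst m) (cst n) (# 0) (# 0) (cst dx) (cst dy) ⟧ []
Placed e m n T2 r dx dy (dia k l) = ⟦ diaCondF r (cst k) (cst l) (cst e) (cst m) (cst n) (cst dx) (cst dy) ⟧ []
Placed e m n (T3 A B _ _) k dx dy (oct a b c d) = ⟦ octCondF k (cst a) (cst b) (cst c) (cst d) (cst e) (cst m) (cst n) (# A) (# B) (cst dx) (cst dy) ⟧ []
Placed e m n (T4 A _) k dx dy (oct a b c d) = ⟦ octCondF k (cst a) (cst b) (cst c) (cst d) (cst e) (cst m) (cst n) (# 0) (# A) (cst dx) (cst dy) ⟧ []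
Placed e m n (T5 A _) k dx dy (oct a b c d) = ⟦ trapCondF k (cst a) (cst b) (cst c) (cst d) (cst e) (cst m) (cst n) (# A) (cst dx) (cst dy) ⟧ []
Placed e m n (T6 A _) k dx dy (oct a b c d) = ⟦ triCondF k (cst a) (cst b) (cst c) (cst d) (cst e) (cst m) (cst n) (# A) (cst dx) (cst dy) ⟧ []
Placed e m n _ _ _ _ _ = ⊥

describe : ∀ e m n s k dx dy P → Placed e m n s k dx dy P → ∀ {r X Y Q} → Rep r X Y Q → ∀ θ →
  Iff (In θ (tile s k (dx , dy)) r) (InPiece e m n P X Y Q (slack θ))
describe e m n s k dx dy P h {r} {X} {Y} {Q} R θ = proj₁ (go s P h) ∘ proj₁ ib , proj₂ ib ∘ proj₂ (go s P h)
  where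
  ib = in-base s k dx dy R θ
  σ = slack-ok θ
  q = ℤₚ.<⇒≤ (Rep.pos R)
  go : ∀ s P → Placed e m n s k dx dy P →
    Iff (Base s (pullX k dx dy X Y Q) (pullY k dx dy X Y Q) Q (slack θ)) (InPiece e m n P X Y Q (slack θ))
  go T1 (oct a b c d) h = octDescribe k a b c d e m n (+ 0) (+ 0) dx dy X Y Q (slack θ) σ q h
  go T2 (dia i j) h = diaDescribe k i j e m n dx dy X Y Q (slack θ) σ q h
  go (T3 A B _ _) (oct a b c d) h = octDescribe k a b c d e m n (+ A) (+ B) dx dy X Y Q (slack θ) σ q h
  go (T4 A _) (oct a b c d) h = octDescribe k a b c d e m n (+ 0) (+ A) dx dy X Y Q (slack θ) σ q h
  go (T5 A _) (oct a b c d) h = trapDescribe k a b c d e m n (+ A) dx dy X Y Q (slack θ) σ q h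
  go (T6 A _) (oct a b c d) h = triDescribe k a b c d e m n (+ A) dx dy X Y Q (slack θ) σ q h

-- Colours of tiles as parities

eps : Color → ℤ
eps black = + 0
eps white = + 1

color-index : ∀ z c → colorℕ ℤ.∣ z ∣ ≡ c → Σ ℤ λ k → z ≡ + 2 ℤ.* k ℤ.+ eps c
color-index z c h with ∣∣-index z
  where
  ℕ-index : ∀ k → Σ ℤ λ h → + k ≡ + 2 ℤ.* h ℤ.+ eps (colorℕ k)
  ℕ-index k with k ℕ.% 2 | k ℕ./ 2 | ℕD.m≡m%n+[m/n]*n k 2 | ℕD.m%n<n k 2
  ... | zero | h | e | _ = + h , trans (cong +_ e) (trans (ℤₚ.pos-* h 2) (omega 1 (λ h → h ⊗ # 2 ≐ # 2 ⊗ h ⊕ # 0) (+ h)))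
  ... | suc zero | h | e | _ = + h , trans (cong +_ e) (trans (cong (λ z → + 1 ℤ.+ z) (ℤₚ.pos-* h 2)) (omega 1 (λ h → # 1 ⊕ h ⊗ # 2 ≐ # 2 ⊗ h ⊕ # 1) (+ h)))
  ... | suc (suc _) | _ | _ | ℕ.s≤s (ℕ.s≤s ())
  ∣∣-index : ∀ z → Σ ℤ λ h → z ≡ + 2 ℤ.* h ℤ.+ eps (colorℕ ℤ.∣ z ∣)
  ∣∣-index (+ k) = ℕ-index k
  ∣∣-index -[1+ k ] with ℕ-index (suc k)
  ... | h , e = ℤ.- h ℤ.- ε , trans (cong ℤ.-_ e) (omega 2 (λ h ε → ⊝ (# 2 ⊗ h ⊕ ε) ≐ # 2 ⊗ (⊝ h ⊖ ε) ⊕ ε) h ε)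
    where
    ε : ℤ
    ε = eps (colorℕ (suc k))
... | k , e rewrite h = k , e

index-color : ∀ z c k → z ≡ + 2 ℤ.* k ℤ.+ eps c → colorℕ ℤ.∣ z ∣ ≡ c
index-color z c k e with colorℕ ℤ.∣ z ∣ in r
... | d with color-index z d r
...   | k′ , e′ = agree c d k k′ (trans (sym e) e′)
  where
  agree : ∀ c d k k′ → + 2 ℤ.* k ℤ.+ eps c ≡ + 2 ℤ.* k′ ℤ.+ eps d → d ≡ c
  agree black black _ _ _ = refl
  agree white white _ _ _ = refl
  agree black white k k′ h = ⊥-elim (omega 2 (λ k k′ → # 2 ⊗ k ⊕ # 0 ≐ # 2 ⊗ k′ ⊕ # 1 ⇛ ⊥′) k k′ h)
  agree white black k k′ h = ⊥-elim (omega 2 (λ k k′ → # 2 ⊗ k ⊕ # 1 ≐ # 2 ⊗ k′ ⊕ # 0 ⇛ ⊥′) k k′ h)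

colorSumF : Fin 4 → (v dx dy : Expr) → Expr
colorSumF r0 v dx dy = dx ⊕ dy ⊕ v
colorSumF r1 v dx dy = dx ⊕ dy ⊕ v
colorSumF r2 v dx dy = dx ⊕ dy ⊖ v
colorSumF r3 v dx dy = dx ⊕ dy ⊖ v

colorOffset : Shape → ℤ
colorOffset (T6 a _) = + a
colorOffset _        = + 0

colorSum : Shape → Fin 4 → ℤ → ℤ → ℤ
colorSum s k dx dy = eval [] (colorSumF k (cst (colorOffset s)) (cst dx) (cst dy))

tileColor-sum : ∀ s k dx dy → tileColor (tile s k (dx , dy)) ≡ colorℕ ℤ.∣ colorSum s k dx dy ∣
tileColor-sum s k dx dy = trans (vertex s) (cong (λ z → colorℕ ℤ.∣ z ∣) (sum k (colorOffset s)))
  where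
  moved : ℤ → Pt
  moved v = move (tile s k (dx , dy)) (v , + 0)
  vertex : ∀ s → tileColor (tile s k (dx , dy)) ≡ colorℤ (proj₁ (moved (colorOffset s))) (proj₂ (moved (colorOffset s)))
  vertex T1 = refl
  vertex T2 = refl
  vertex (T3 _ _ _ _) = refl
  vertex (T4 _ _) = refl
  vertex (T5 _ _) = refl
  vertex (T6 _ _) = refl
  sum : ∀ k v → proj₁ (move (tile s k (dx , dy)) (v , + 0)) ℤ.+ proj₂ (move (tile s k (dx , dy)) (v , + 0))
        ≡ eval [] (colorSumF k (cst v) (cst dx) (cst dy))
  sum r0 v = omega 3 (λ v dx dy → (v ⊕ dx) ⊕ (# 0 ⊕ dy) ≐ colorSumF r0 v dx dy) v dx dy
  sum r1 v = omega 3 (λ v dx dy → (# 0 ⊕ dx) ⊕ (v ⊕ dy) ≐ colorSumF r1 v dx dy) v dx dy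
  sum r2 v = omega 3 (λ v dx dy → (⊝ v ⊕ dx) ⊕ (# 0 ⊕ dy) ≐ colorSumF r2 v dx dy) v dx dy
  sum r3 v = omega 3 (λ v dx dy → (# 0 ⊕ dx) ⊕ (⊝ v ⊕ dy) ≐ colorSumF r3 v dx dy) v dx dy

-- The piece of a given tile

pushXF pushYF : Fin 4 → (dx dy u w : Expr) → Expr
pushXF r0 dx dy u w = dx ⊕ # 1 ⊕ u
pushXF r1 dx dy u w = dx ⊕ # 1 ⊖ w
pushXF r2 dx dy u w = dx ⊕ # 1 ⊖ u
pushXF r3 dx dy u w = dx ⊕ # 1 ⊕ w
pushYF r0 dx dy u w = dy ⊕ # 1 ⊕ w
pushYF r1 dx dy u w = dy ⊕ # 1 ⊕ u
pushYF r2 dx dy u w = dy ⊕ # 1 ⊖ w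
pushYF r3 dx dy u w = dy ⊕ # 1 ⊖ u

pushX pushY : Fin 4 → (dx dy u w : ℤ) → ℤ
pushX k dx dy u w = eval [] (pushXF k (cst dx) (cst dy) (cst u) (cst w))
pushY k dx dy u w = eval [] (pushYF k (cst dx) (cst dy) (cst u) (cst w))

pull-push : ∀ k dx dy u w →
  pullX k dx dy (pushX k dx dy u w) (pushY k dx dy u w) (+ 1) ≡ u ×
  pullY k dx dy (pushX k dx dy u w) (pushY k dx dy u w) (+ 1) ≡ w
pull-push r0 = omega 4 (λ dx dy u w → pullXF r0 dx dy (pushXF r0 dx dy u w) (pushYF r0 dx dy u w) (# 1) ≐ u
                                    & pullYF r0 dx dy (pushXF r0 dx dy u w) (pushYF r0 dx dy u w) (# 1) ≐ w)
pull-push r1 = omega 4 (λ dx dy u w → pullXF r1 dx dy (pushXF r1 dx dy u w) (pushYF r1 dx dy u w) (# 1) ≐ u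
                                    & pullYF r1 dx dy (pushXF r1 dx dy u w) (pushYF r1 dx dy u w) (# 1) ≐ w)
pull-push r2 = omega 4 (λ dx dy u w → pullXF r2 dx dy (pushXF r2 dx dy u w) (pushYF r2 dx dy u w) (# 1) ≐ u
                                    & pullYF r2 dx dy (pushXF r2 dx dy u w) (pushYF r2 dx dy u w) (# 1) ≐ w)
pull-push r3 = omega 4 (λ dx dy u w → pullXF r3 dx dy (pushXF r3 dx dy u w) (pushYF r3 dx dy u w) (# 1) ≐ u
                                    & pullYF r3 dx dy (pushXF r3 dx dy u w) (pushYF r3 dx dy u w) (# 1) ≐ w)

frac-half : ∀ k → Frac (+ 2) (½ ℚ.* toℚ k) k
frac-half k = frac (trans (sym (ℚₚ.*-assoc (toℚ (+ 2)) ½ (toℚ k))) (ℚₚ.*-identityˡ (toℚ k)))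

-- The midpoint of a dashed side suffices: both ends are in R, so a midpoint on a line bounding R
-- forces both ends onto this line.
midpoint : ∀ m n px py qx qy → SegmentIn∂R m n ((px , py) , (qx , qy)) →
  px ℤ.+ qx ≡ + 0 ⊎ px ℤ.+ qx ≡ + 2 ℤ.* (+ m ℤ.- + 1) ⊎ py ℤ.+ qy ≡ + 0 ⊎ py ℤ.+ qy ≡ + 2 ℤ.* (+ n ℤ.- + 1)
midpoint m n px py qx qy seg with proj₂ (seg ½ 0≤½ ½≤1)
  where
  0≤½ : 0ℚ ℚ.≤ ½
  0≤½ = ℚ.*≤* (ℤ.+≤+ ℕ.z≤n)
  ½≤1 : ½ ℚ.≤ 1ℚ
  ½≤1 = ℚ.*≤* (ℤ.+≤+ (ℕ.s≤s ℕ.z≤n))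
... | side = go side
  where
  mid : ∀ p q → Frac (+ 2) (toℚ p ℚ.+ ½ ℚ.* (toℚ q ℚ.- toℚ p)) (p ℤ.+ q)
  mid p q = subst₂ (Frac (+ 2)) (cong (λ z → toℚ p ℚ.+ ½ ℚ.* z) (toℚ-sub q p))
    (omega 2 (λ p q → p ⊗ # 2 ⊕ (q ⊖ p) ≐ p ⊕ q) p q) (frac-+ (frac-toℚ (+ 2) p) (frac-half (q ℤ.- p)))
  2>0 : + 0 ℤ.< + 2
  2>0 = ℤ.+<+ (ℕ.s≤s ℕ.z≤n)
  go : _ → _
  go (inj₁ h) = inj₁ (frac-≡ 2>0 (mid px qx) (frac-0 (+ 2)) h)
  go (inj₂ (inj₁ h)) = inj₂ (inj₁ (trans (frac-≡ 2>0 (mid px qx) (frac-toℚ (+ 2) (+ m ℤ.- + 1)) h) (ℤₚ.*-comm (+ m ℤ.- + 1) (+ 2))))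
  go (inj₂ (inj₂ (inj₁ h))) = inj₂ (inj₂ (inj₁ (frac-≡ 2>0 (mid py qy) (frac-0 (+ 2)) h)))
  go (inj₂ (inj₂ (inj₂ h))) = inj₂ (inj₂ (inj₂ (trans (frac-≡ 2>0 (mid py qy) (frac-toℚ (+ 2) (+ n ℤ.- + 1)) h) (ℤₚ.*-comm (+ n ℤ.- + 1) (+ 2)))))

midF : (m n px py qx qy : Expr) → Form
midF m n px py qx qy = px ⊕ qx ≐ # 0 ∥ px ⊕ qx ≐ # 2 ⊗ (m ⊖ # 1) ∥ py ⊕ qy ≐ # 0 ∥ py ⊕ qy ≐ # 2 ⊗ (n ⊖ # 1)

cornerF : Fin 4 → (m n dx dy u w : Expr) → Form
cornerF k m n dx dy u w = rectF m n (pushXF k dx dy u w) (pushYF k dx dy u w) (# 1) (# 0)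

module Inside (m n : ℕ) (s : Shape) (k : Fin 4) (dx dy : ℤ)
  (inside : ∀ r → r ∈T tile s k (dx , dy) → InR m n r) where

  corner : ∀ u w → Base s u w (+ 1) (+ 0) →
    InRect (+ m) (+ n) (pushX k dx dy u w) (pushY k dx dy u w) (+ 1) (+ 0)
  corner u w h with point (pushX k dx dy u w) (pushY k dx dy u w) 0
  ... | r , R = InR⇒ {m} {n} R (inside r (proj₂ (in-base s k dx dy R false)
    (subst₂ (λ u w → Base s u w (+ 1) (+ 0)) (sym (proj₁ (pull-push k dx dy u w))) (sym (proj₂ (pull-push k dx dy u w))) h)))

-- The four corners are chosen one on each axis-parallel side, so together they bound the octagon in
-- all directions. The colour enters through i, half of the coordinate sum, without which a, b, c, d
-- would not be integers.
octLocateF : Fin 4 → (e m n A B dx dy i : Expr) → Form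
octLocateF k e m n A B dx dy i =
  # 0 ≼ A ⇛ # 0 ≼ B ⇛ colorSumF k (# 0) dx dy ≐ # 2 ⊗ i ⊕ e ⇛
  cornerF k m n dx dy (# 0) (# 0) ⇛ cornerF k m n dx dy (# 2 ⊕ A) A ⇛
  cornerF k m n dx dy (A ⊖ B) (A ⊕ B ⊕ # 2) ⇛ cornerF k m n dx dy (⊝ B) B ⇛ goal k
  where
  put : (a b c d : Expr) → Form
  put a b c d = octCondF k a b c d e m n A B dx dy & validOctF a b c d e m n
  goal : Fin 4 → Form
  goal r0 = put (i ⊕ # 2) (i ⊕ # 2 ⊕ A ⊕ # 1) (i ⊕ # 1 ⊖ dy ⊖ B ⊖ # 1) (i ⊕ # 1 ⊖ dy)
  goal r1 = put (i ⊕ # 2 ⊖ B ⊖ # 1) (i ⊕ # 2) (i ⊖ dy ⊖ A ⊖ # 1) (i ⊖ dy)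
  goal r2 = put (i ⊕ # 1 ⊖ A ⊖ # 1) (i ⊕ # 1) (i ⊖ dy) (i ⊖ dy ⊕ B ⊕ # 1)
  goal r3 = put (i ⊕ # 1) (i ⊕ # 1 ⊕ B ⊕ # 1) (i ⊕ # 1 ⊖ dy) (i ⊕ # 1 ⊖ dy ⊕ A ⊕ # 1)

OctAt : Fin 4 → (e m n A B dx dy : ℤ) → Set
OctAt k e m n A B dx dy = Σ ℤ λ a → Σ ℤ λ b → Σ ℤ λ c → Σ ℤ λ d →
  ⟦ octCondF k (cst a) (cst b) (cst c) (cst d) (cst e) (cst m) (cst n) (cst A) (cst B) (cst dx) (cst dy) ⟧ [] ×
  Valid e m n (oct a b c d)

Corner : Fin 4 → (m n dx dy u w : ℤ) → Set
Corner k m n dx dy u w = InRect m n (pushX k dx dy u w) (pushY k dx dy u w) (+ 1) (+ 0)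

octLocate : ∀ k (e m n A B dx dy i : ℤ) → + 0 ℤ.≤ A → + 0 ℤ.≤ B →
  eval [] (colorSumF k (# 0) (cst dx) (cst dy)) ≡ + 2 ℤ.* i ℤ.+ e →
  Corner k m n dx dy (+ 0) (+ 0) → Corner k m n dx dy (+ 2 ℤ.+ A) A →
  Corner k m n dx dy (A ℤ.- B) (A ℤ.+ B ℤ.+ + 2) → Corner k m n dx dy (ℤ.- B) B →
  OctAt k e m n A B dx dy
octLocate r0 e m n A B dx dy i p q h₀ h₁ h₂ h₃ h₄ =
    (i ℤ.+ + 2) , (i ℤ.+ + 2 ℤ.+ A ℤ.+ + 1) , (i ℤ.+ + 1 ℤ.- dy ℤ.- B ℤ.- + 1) , (i ℤ.+ + 1 ℤ.- dy) ,
    omega 8 (octLocateF r0) e m n A B dx dy i p q h₀ h₁ h₂ h₃ h₄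
octLocate r1 e m n A B dx dy i p q h₀ h₁ h₂ h₃ h₄ =
    (i ℤ.+ + 2 ℤ.- B ℤ.- + 1) , (i ℤ.+ + 2) , (i ℤ.- dy ℤ.- A ℤ.- + 1) , (i ℤ.- dy) ,
    omega 8 (octLocateF r1) e m n A B dx dy i p q h₀ h₁ h₂ h₃ h₄
octLocate r2 e m n A B dx dy i p q h₀ h₁ h₂ h₃ h₄ =
    (i ℤ.+ + 1 ℤ.- A ℤ.- + 1) , (i ℤ.+ + 1) , (i ℤ.- dy) , (i ℤ.- dy ℤ.+ B ℤ.+ + 1) ,
    omega 8 (octLocateF r2) e m n A B dx dy i p q h₀ h₁ h₂ h₃ h₄
octLocate r3 e m n A B dx dy i p q h₀ h₁ h₂ h₃ h₄ =
    (i ℤ.+ + 1) , (i ℤ.+ + 1 ℤ.+ B ℤ.+ + 1) , (i ℤ.+ + 1 ℤ.- dy) , (i ℤ.+ + 1 ℤ.- dy ℤ.+ A ℤ.+ + 1) ,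
    omega 8 (octLocateF r3) e m n A B dx dy i p q h₀ h₁ h₂ h₃ h₄

diaLocateF : Fin 4 → (e m n dx dy i : Expr) → Form
diaLocateF r e m n dx dy i =
  colorSumF r (# 0) dx dy ≐ # 2 ⊗ i ⊕ e ⇛
  cornerF r m n dx dy (# 0) (# 0) ⇛ cornerF r m n dx dy (# 1) (# 1) ⇛
  cornerF r m n dx dy (# 0) (# 2) ⇛ cornerF r m n dx dy (⊝ # 1) (# 1) ⇛ goal r
  where
  put : (k l : Expr) → Form
  put k l = diaCondF r k l e m n dx dy & validDiaF k l e m n
  goal : Fin 4 → Form
  goal r0 = put (i ⊕ # 2) (i ⊖ dy)
  goal r1 = put (i ⊕ # 1) (i ⊖ dy)
  goal r2 = put (i ⊕ # 1) (i ⊕ # 1 ⊖ dy)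
  goal r3 = put (i ⊕ # 2) (i ⊕ # 1 ⊖ dy)

DiaAt : Fin 4 → (e m n dx dy : ℤ) → Set
DiaAt r e m n dx dy = Σ ℤ λ k → Σ ℤ λ l →
  ⟦ diaCondF r (cst k) (cst l) (cst e) (cst m) (cst n) (cst dx) (cst dy) ⟧ [] × Valid e m n (dia k l)

diaLocate : ∀ r (e m n dx dy i : ℤ) →
  eval [] (colorSumF r (# 0) (cst dx) (cst dy)) ≡ + 2 ℤ.* i ℤ.+ e →
  Corner r m n dx dy (+ 0) (+ 0) → Corner r m n dx dy (+ 1) (+ 1) →
  Corner r m n dx dy (+ 0) (+ 2) → Corner r m n dx dy (ℤ.- + 1) (+ 1) →
  DiaAt r e m n dx dy
diaLocate r0 e m n dx dy i h₀ h₁ h₂ h₃ h₄ =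
    (i ℤ.+ + 2) , (i ℤ.- dy) ,
    omega 6 (diaLocateF r0) e m n dx dy i h₀ h₁ h₂ h₃ h₄
diaLocate r1 e m n dx dy i h₀ h₁ h₂ h₃ h₄ =
    (i ℤ.+ + 1) , (i ℤ.- dy) ,
    omega 6 (diaLocateF r1) e m n dx dy i h₀ h₁ h₂ h₃ h₄
diaLocate r2 e m n dx dy i h₀ h₁ h₂ h₃ h₄ =
    (i ℤ.+ + 1) , (i ℤ.+ + 1 ℤ.- dy) ,
    omega 6 (diaLocateF r2) e m n dx dy i h₀ h₁ h₂ h₃ h₄
diaLocate r3 e m n dx dy i h₀ h₁ h₂ h₃ h₄ =
    (i ℤ.+ + 2) , (i ℤ.+ + 1 ℤ.- dy) ,
    omega 6 (diaLocateF r3) e m n dx dy i h₀ h₁ h₂ h₃ h₄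

-- The motion in unshifted coordinates, written in the form to which `move` computes, so that the
-- formulas match the dashed sides definitionally.
movedXF movedYF : Fin 4 → (dx dy u w : Expr) → Expr
movedXF r0 dx dy u w = u ⊕ dx
movedXF r1 dx dy u w = ⊝ w ⊕ dx
movedXF r2 dx dy u w = ⊝ u ⊕ dx
movedXF r3 dx dy u w = ⊝ (⊝ w) ⊕ dx
movedYF r0 dx dy u w = w ⊕ dy
movedYF r1 dx dy u w = u ⊕ dy
movedYF r2 dx dy u w = ⊝ w ⊕ dy
movedYF r3 dx dy u w = ⊝ u ⊕ dy

sideF : Fin 4 → (m n dx dy u w u′ w′ : Expr) → Form
sideF k m n dx dy u w u′ w′ = midF m n (movedXF k dx dy u w) (movedYF k dx dy u w) (movedXF k dx dy u′ w′) (movedYF k dx dy u′ w′)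

Mid : (m n : ℤ) → Pt → Pt → Set
Mid m n (px , py) (qx , qy) = ⟦ midF (cst m) (cst n) (cst px) (cst py) (cst qx) (cst qy) ⟧ []

-- The base has positive length, so its midpoint cannot be on a line bounding R that is
-- perpendicular to it. Of the two parallel lines, the corner (A , A) excludes the one that would
-- put the tile outside R.
trapLocateF : Fin 4 → (e m n A dx dy i : Expr) → Form
trapLocateF k e m n A dx dy i =
  # 1 ≼ A ⇛ colorSumF k (# 0) dx dy ≐ # 2 ⊗ i ⊕ e ⇛
  cornerF k m n dx dy (# 0) (# 0) ⇛ cornerF k m n dx dy (# 2 ⊗ A ⊕ # 2) (# 0) ⇛ cornerF k m n dx dy A A ⇛
  sideF k m n dx dy (# 0) (# 0) (# 2 ⊗ A ⊕ # 2) (# 0) ⇛ goal k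
  where
  put : (a b c d : Expr) → Form
  put a b c d = trapCondF k a b c d e m n A dx dy & validOctF a b c d e m n
  goal : Fin 4 → Form
  goal r0 = put (i ⊕ # 1) (i ⊕ # 1 ⊕ A ⊕ # 1) (i ⊕ # 1) (i ⊕ # 1 ⊕ A ⊕ # 1)
  goal r1 = put (i ⊕ # 2) (i ⊕ # 2 ⊕ A ⊕ # 1) (m ⊕ # 2 ⊖ e ⊖ (i ⊕ # 2 ⊕ A ⊕ # 1)) (m ⊕ # 2 ⊖ e ⊖ (i ⊕ # 2))
  goal r2 = put (i ⊕ # 2 ⊖ A ⊖ # 1) (i ⊕ # 2) (i ⊕ # 2 ⊖ A ⊖ # 1 ⊖ n ⊖ # 1) (i ⊕ # 2 ⊖ n ⊖ # 1)
  goal r3 = put (i ⊖ A) (i ⊕ # 1) (⊝ e ⊖ i) (# 1 ⊖ e ⊖ i ⊕ A)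

TrapAt : Fin 4 → (e m n A dx dy : ℤ) → Set
TrapAt k e m n A dx dy = Σ ℤ λ a → Σ ℤ λ b → Σ ℤ λ c → Σ ℤ λ d →
  ⟦ trapCondF k (cst a) (cst b) (cst c) (cst d) (cst e) (cst m) (cst n) (cst A) (cst dx) (cst dy) ⟧ [] ×
  Valid e m n (oct a b c d)

module _ (s : Shape) where
  trapLocate : ∀ k (e m n A dx dy i : ℤ) → + 1 ℤ.≤ A →
    eval [] (colorSumF k (# 0) (cst dx) (cst dy)) ≡ + 2 ℤ.* i ℤ.+ e →
    Corner k m n dx dy (+ 0) (+ 0) → Corner k m n dx dy (+ 2 ℤ.* A ℤ.+ + 2) (+ 0) → Corner k m n dx dy A A →
    Mid m n (move (tile s k (dx , dy)) (+ 0 , + 0)) (move (tile s k (dx , dy)) (+ 2 ℤ.* A ℤ.+ + 2 , + 0)) →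
    TrapAt k e m n A dx dy
  trapLocate r0 e m n A dx dy i p h₀ h₁ h₂ h₃ h₄ =
    (i ℤ.+ + 1) , (i ℤ.+ + 1 ℤ.+ A ℤ.+ + 1) , (i ℤ.+ + 1) , (i ℤ.+ + 1 ℤ.+ A ℤ.+ + 1) ,
    omega 7 (trapLocateF r0) e m n A dx dy i p h₀ h₁ h₂ h₃ h₄
  trapLocate r1 e m n A dx dy i p h₀ h₁ h₂ h₃ h₄ =
    (i ℤ.+ + 2) , (i ℤ.+ + 2 ℤ.+ A ℤ.+ + 1) , (m ℤ.+ + 2 ℤ.- e ℤ.- (i ℤ.+ + 2 ℤ.+ A ℤ.+ + 1)) , (m ℤ.+ + 2 ℤ.- e ℤ.- (i ℤ.+ + 2)) ,
    omega 7 (trapLocateF r1) e m n A dx dy i p h₀ h₁ h₂ h₃ h₄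
  trapLocate r2 e m n A dx dy i p h₀ h₁ h₂ h₃ h₄ =
    (i ℤ.+ + 2 ℤ.- A ℤ.- + 1) , (i ℤ.+ + 2) , (i ℤ.+ + 2 ℤ.- A ℤ.- + 1 ℤ.- n ℤ.- + 1) , (i ℤ.+ + 2 ℤ.- n ℤ.- + 1) ,
    omega 7 (trapLocateF r2) e m n A dx dy i p h₀ h₁ h₂ h₃ h₄
  trapLocate r3 e m n A dx dy i p h₀ h₁ h₂ h₃ h₄ =
    (i ℤ.- A) , (i ℤ.+ + 1) , (ℤ.- e ℤ.- i) , (+ 1 ℤ.- e ℤ.- i ℤ.+ A) ,
    omega 7 (trapLocateF r3) e m n A dx dy i p h₀ h₁ h₂ h₃ h₄

triLocateF : Fin 4 → (e m n A dx dy i : Expr) → Form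
triLocateF k e m n A dx dy i =
  # 1 ≼ A ⇛ colorSumF k A dx dy ≐ # 2 ⊗ i ⊕ e ⇛
  cornerF k m n dx dy (# 0) (# 0) ⇛ cornerF k m n dx dy A (# 0) ⇛ cornerF k m n dx dy (# 0) A ⇛
  sideF k m n dx dy (# 0) (# 0) A (# 0) ⇛ sideF k m n dx dy (# 0) A (# 0) (# 0) ⇛ goal k
  where
  put : (a b c d : Expr) → Form
  put a b c d = triCondF k a b c d e m n A dx dy & validOctF a b c d e m n
  goal : Fin 4 → Form
  goal r0 = put (⊝ e ⊖ i) (i ⊕ # 1) (⊝ e ⊖ i) (i ⊕ # 1)
  goal r1 = put (i ⊕ # 1 ⊖ A) (m ⊕ # 1 ⊖ e ⊖ i ⊕ A) (i ⊕ # 1 ⊖ A) (m ⊕ # 1 ⊖ e ⊖ i ⊕ A)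
  goal r2 = put (i ⊕ # 2) (m ⊖ e ⊖ i ⊕ n ⊕ # 1) (i ⊕ # 1 ⊖ n) (m ⊖ e ⊖ i)
  goal r3 = put (# 1 ⊕ i) (n ⊕ # 1 ⊖ i ⊖ e) (i ⊖ n) (⊝ i ⊖ e)

TriAt : Fin 4 → (e m n A dx dy : ℤ) → Set
TriAt k e m n A dx dy = Σ ℤ λ a → Σ ℤ λ b → Σ ℤ λ c → Σ ℤ λ d →
  ⟦ triCondF k (cst a) (cst b) (cst c) (cst d) (cst e) (cst m) (cst n) (cst A) (cst dx) (cst dy) ⟧ [] ×
  Valid e m n (oct a b c d)

module _ (s : Shape) where
  triLocate : ∀ k (e m n A dx dy i : ℤ) → + 1 ℤ.≤ A →
    eval [] (colorSumF k (cst A) (cst dx) (cst dy)) ≡ + 2 ℤ.* i ℤ.+ e →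
    Corner k m n dx dy (+ 0) (+ 0) → Corner k m n dx dy A (+ 0) → Corner k m n dx dy (+ 0) A →
    Mid m n (move (tile s k (dx , dy)) (+ 0 , + 0)) (move (tile s k (dx , dy)) (A , + 0)) →
    Mid m n (move (tile s k (dx , dy)) (+ 0 , A)) (move (tile s k (dx , dy)) (+ 0 , + 0)) →
    TriAt k e m n A dx dy
  triLocate r0 e m n A dx dy i p h₀ h₁ h₂ h₃ h₄ h₅ =
    (ℤ.- e ℤ.- i) , (i ℤ.+ + 1) , (ℤ.- e ℤ.- i) , (i ℤ.+ + 1) ,
    omega 7 (triLocateF r0) e m n A dx dy i p h₀ h₁ h₂ h₃ h₄ h₅
  triLocate r1 e m n A dx dy i p h₀ h₁ h₂ h₃ h₄ h₅ =
    (i ℤ.+ + 1 ℤ.- A) , (m ℤ.+ + 1 ℤ.- e ℤ.- i ℤ.+ A) , (i ℤ.+ + 1 ℤ.- A) , (m ℤ.+ + 1 ℤ.- e ℤ.- i ℤ.+ A) ,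
    omega 7 (triLocateF r1) e m n A dx dy i p h₀ h₁ h₂ h₃ h₄ h₅
  triLocate r2 e m n A dx dy i p h₀ h₁ h₂ h₃ h₄ h₅ =
    (i ℤ.+ + 2) , (m ℤ.- e ℤ.- i ℤ.+ n ℤ.+ + 1) , (i ℤ.+ + 1 ℤ.- n) , (m ℤ.- e ℤ.- i) ,
    omega 7 (triLocateF r2) e m n A dx dy i p h₀ h₁ h₂ h₃ h₄ h₅
  triLocate r3 e m n A dx dy i p h₀ h₁ h₂ h₃ h₄ h₅ =
    (+ 1 ℤ.+ i) , (n ℤ.+ + 1 ℤ.- i ℤ.- e) , (i ℤ.- n) , (ℤ.- i ℤ.- e) ,
    omega 7 (triLocateF r3) e m n A dx dy i p h₀ h₁ h₂ h₃ h₄ h₅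

analyze : ∀ c m n s k dx dy → let t = tile s k (dx , dy) in
  tileColor t ≡ c → (∀ r → r ∈T t → InR m n r) → All (SegmentIn∂R m n) (dashedSides t) →
  Σ Piece λ P → Placed (eps c) (+ m) (+ n) s k dx dy P × Valid (eps c) (+ m) (+ n) P
analyze c m n s k dx dy color inside dashed with color-index _ c (trans (sym (tileColor-sum s k dx dy)) color)
... | i , sum = go s sum dashed (Inside.corner m n s k dx dy inside)
  where
  e = eps c
  pos : ∀ {a} → 1 ℕ.≤ a → + 1 ℤ.≤ + a
  pos = ℤ.+≤+
  nat : ∀ {a} → + 0 ℤ.≤ + a
  nat = ℤ.+≤+ ℕ.z≤n
  t = tile s k (dx , dy)
  segment : ∀ p q → SegmentIn∂R m n (move t p , move t q) → Mid (+ m) (+ n) (move t p) (move t q)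
  segment p q = midpoint m n (proj₁ (move t p)) (proj₂ (move t p)) (proj₁ (move t q)) (proj₂ (move t q))
  go : ∀ s → colorSum s k dx dy ≡ + 2 ℤ.* i ℤ.+ e → All (SegmentIn∂R m n) (dashedSides (tile s k (dx , dy))) →
    (∀ u w → Base s u w (+ 1) (+ 0) → Corner k (+ m) (+ n) dx dy u w) →
    Σ Piece λ P → Placed e (+ m) (+ n) s k dx dy P × Valid e (+ m) (+ n) P
  go T1 sum _ corner with octLocate k e (+ m) (+ n) (+ 0) (+ 0) dx dy i nat nat sum
       (corner (+ 0) (+ 0) (omega 2 (λ A B → # 0 ≼ A ⇛ # 0 ≼ B ⇛ baseOctF A B (# 0) (# 0) (# 1) (# 0)) (+ 0) (+ 0) nat nat))
       (corner (+ 2) (+ 0) (omega 2 (λ A B → # 0 ≼ A ⇛ # 0 ≼ B ⇛ baseOctF A B (# 2) (# 0) (# 1) (# 0)) (+ 0) (+ 0) nat nat))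
       (corner (+ 0) (+ 2) (omega 2 (λ A B → # 0 ≼ A ⇛ # 0 ≼ B ⇛ baseOctF A B (# 0) (# 2) (# 1) (# 0)) (+ 0) (+ 0) nat nat))
       (corner (+ 0) (+ 0) (omega 2 (λ A B → # 0 ≼ A ⇛ # 0 ≼ B ⇛ baseOctF A B (# 0) (# 0) (# 1) (# 0)) (+ 0) (+ 0) nat nat))
  ... | a , b , c , d , h = oct a b c d , h
  go T2 sum _ corner with diaLocate k e (+ m) (+ n) dx dy i sum
       (corner _ _ (omega 0 (baseDiaF (# 0) (# 0) (# 1) (# 0)))) (corner _ _ (omega 0 (baseDiaF (# 1) (# 1) (# 1) (# 0))))
       (corner _ _ (omega 0 (baseDiaF (# 0) (# 2) (# 1) (# 0)))) (corner _ _ (omega 0 (baseDiaF (⊝ # 1) (# 1) (# 1) (# 0))))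
  ... | k , l , h = dia k l , h
  go (T3 a b _ _) sum _ corner with octLocate k e (+ m) (+ n) (+ a) (+ b) dx dy i nat nat sum
       (corner _ _ (omega 2 (λ A B → # 0 ≼ A ⇛ # 0 ≼ B ⇛ baseOctF A B (# 0) (# 0) (# 1) (# 0)) (+ a) (+ b) nat nat))
       (corner _ _ (omega 2 (λ A B → # 0 ≼ A ⇛ # 0 ≼ B ⇛ baseOctF A B (# 2 ⊕ A) (A) (# 1) (# 0)) (+ a) (+ b) nat nat))
       (corner _ _ (omega 2 (λ A B → # 0 ≼ A ⇛ # 0 ≼ B ⇛ baseOctF A B (A ⊖ B) (A ⊕ B ⊕ # 2) (# 1) (# 0)) (+ a) (+ b) nat nat))
       (corner _ _ (omega 2 (λ A B → # 0 ≼ A ⇛ # 0 ≼ B ⇛ baseOctF A B (⊝ B) (B) (# 1) (# 0)) (+ a) (+ b) nat nat))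
  ... | a , b , c , d , h = oct a b c d , h
  go (T4 b _) sum _ corner with octLocate k e (+ m) (+ n) (+ 0) (+ b) dx dy i nat nat sum
       (corner _ _ (omega 2 (λ A B → # 0 ≼ A ⇛ # 0 ≼ B ⇛ baseOctF A B (# 0) (# 0) (# 1) (# 0)) (+ 0) (+ b) nat nat))
       (corner _ _ (omega 2 (λ A B → # 0 ≼ A ⇛ # 0 ≼ B ⇛ baseOctF A B (# 2 ⊕ A) (A) (# 1) (# 0)) (+ 0) (+ b) nat nat))
       (corner _ _ (omega 2 (λ A B → # 0 ≼ A ⇛ # 0 ≼ B ⇛ baseOctF A B (A ⊖ B) (A ⊕ B ⊕ # 2) (# 1) (# 0)) (+ 0) (+ b) nat nat))
       (corner _ _ (omega 2 (λ A B → # 0 ≼ A ⇛ # 0 ≼ B ⇛ baseOctF A B (⊝ B) (B) (# 1) (# 0)) (+ 0) (+ b) nat nat))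
  ... | a , b , c , d , h = oct a b c d , h
  go (T5 a a≥1) sum (d₁ ∷ []) corner with trapLocate (T5 a a≥1) k e (+ m) (+ n) (+ a) dx dy i (pos a≥1) sum
       (corner _ _ (omega 1 (λ A → # 1 ≼ A ⇛ baseTrapF A (# 0) (# 0) (# 1) (# 0)) (+ a) (pos a≥1)))
       (corner _ _ (omega 1 (λ A → # 1 ≼ A ⇛ baseTrapF A (# 2 ⊗ A ⊕ # 2) (# 0) (# 1) (# 0)) (+ a) (pos a≥1)))
       (corner _ _ (omega 1 (λ A → # 1 ≼ A ⇛ baseTrapF A A A (# 1) (# 0)) (+ a) (pos a≥1)))
       (segment (+ 0 , + 0) (+ 2 ℤ.* + a ℤ.+ + 2 , + 0) d₁)
  ... | a , b , c , d , h = oct a b c d , h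
  go (T6 a a≥1) sum (d₁ ∷ d₂ ∷ []) corner with triLocate (T6 a a≥1) k e (+ m) (+ n) (+ a) dx dy i (pos a≥1) sum
       (corner _ _ (omega 1 (λ A → # 1 ≼ A ⇛ baseTriF A (# 0) (# 0) (# 1) (# 0)) (+ a) (pos a≥1)))
       (corner _ _ (omega 1 (λ A → # 1 ≼ A ⇛ baseTriF A A (# 0) (# 1) (# 0)) (+ a) (pos a≥1)))
       (corner _ _ (omega 1 (λ A → # 1 ≼ A ⇛ baseTriF A (# 0) A (# 1) (# 0)) (+ a) (pos a≥1)))
       (segment (+ 0 , + 0) (+ a , + 0) d₁) (segment (+ 0 , + a) (+ 0 , + 0) d₂)
  ... | a , b , c , d , h = oct a b c d , h

-- Dashed sides of a tile with a known piece

edgeF : (m n px py qx qy : Expr) → Form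
edgeF m n px py qx qy =
  # 0 ≼ px & px ≼ m ⊖ # 1 & # 0 ≼ py & py ≼ n ⊖ # 1 & # 0 ≼ qx & qx ≼ m ⊖ # 1 & # 0 ≼ qy & qy ≼ n ⊖ # 1 &
  (px ≐ # 0 & qx ≐ # 0 ∥ px ≐ m ⊖ # 1 & qx ≐ m ⊖ # 1 ∥ py ≐ # 0 & qy ≐ # 0 ∥ py ≐ n ⊖ # 1 & qy ≐ n ⊖ # 1)

Edge : (m n : ℤ) → Pt → Pt → Set
Edge m n (px , py) (qx , qy) = ⟦ edgeF (cst m) (cst n) (cst px) (cst py) (cst qx) (cst qy) ⟧ []

edge-segment : ∀ m n p q → Edge (+ m) (+ n) p q → SegmentIn∂R m n (p , q)
edge-segment m n (px , py) (qx , qy) (x₁ , x₂ , y₁ , y₂ , x₃ , x₄ , y₃ , y₄ , onSide) s s≥0 s≤1 =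
  (frac-≤⁻ q>0 (frac-0 q) fx (proj₁ bx) , frac-≤⁻ q>0 fx (frac-toℚ q (+ m ℤ.- + 1)) (proj₂ bx) ,
   frac-≤⁻ q>0 (frac-0 q) fy (proj₁ by) , frac-≤⁻ q>0 fy (frac-toℚ q (+ n ℤ.- + 1)) (proj₂ by)) , side onSide
  where
  q σ : ℤ
  q = ℚ.↧ s
  σ = ℚ.↥ s
  q>0 : + 0 ℤ.< q
  q>0 = positive s
    where
    positive : ∀ s → + 0 ℤ.< ℚ.↧ s
    positive (ℚ.mkℚ _ _ _) = ℤ.+<+ (ℕ.s≤s ℕ.z≤n)
  σ≥0 : + 0 ℤ.≤ σ
  σ≥0 = frac-≤ q>0 (frac-0 q) (frac-self s) s≥0
  σ≤q : σ ℤ.≤ q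
  σ≤q = subst (σ ℤ.≤_) (ℤₚ.*-identityˡ q) (frac-≤ q>0 (frac-self s) (frac-toℚ q (+ 1)) s≤1)
  along : ∀ p r → Frac q (toℚ p ℚ.+ s ℚ.* (toℚ r ℚ.- toℚ p)) (p ℤ.* q ℤ.+ (r ℤ.- p) ℤ.* σ)
  along p r = frac-+ (frac-toℚ q p)
    (subst (λ x → Frac q x ((r ℤ.- p) ℤ.* σ)) (ℚₚ.*-comm (toℚ r ℚ.- toℚ p) s) (frac-* (r ℤ.- p) (sym (toℚ-sub r p)) (frac-self s)))
  fx = along px qx
  fy = along py qy
  between : ∀ p r k → + 0 ℤ.≤ p → p ℤ.≤ k → + 0 ℤ.≤ r → r ℤ.≤ k →
    + 0 ℤ.≤ p ℤ.* q ℤ.+ (r ℤ.- p) ℤ.* σ × p ℤ.* q ℤ.+ (r ℤ.- p) ℤ.* σ ℤ.≤ k ℤ.* q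
  -- The coordinate is p (q - σ) + r σ. Scaling the bounds on p by q - σ ≥ 0 and those on r by σ ≥ 0
  -- makes the claim linear.
  between p r k p≥0 p≤k r≥0 r≤k = omega 5 (λ p r k q σ →
    (scaled (q ⊖ σ) (# 0 ≼ p & p ≼ k) & scaled σ (# 0 ≼ r & r ≼ k)) ⇛
    # 0 ≼ p ⊗ q ⊕ (r ⊖ p) ⊗ σ & p ⊗ q ⊕ (r ⊖ p) ⊗ σ ≼ k ⊗ q) p r k q σ
    (scaled-ok {[]} (cst q ⊖ cst σ) (ℤₚ.i≤j⇒0≤j-i σ≤q) (# 0 ≼ cst p & cst p ≼ cst k) (p≥0 , p≤k) ,
     scaled-ok {[]} (cst σ) σ≥0 (# 0 ≼ cst r & cst r ≼ cst k) (r≥0 , r≤k))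
  bx = between px qx (+ m ℤ.- + 1) x₁ x₂ x₃ x₄
  by = between py qy (+ n ℤ.- + 1) y₁ y₂ y₃ y₄
  fixed : ∀ p r k {y} → Frac q y (k ℤ.* q) → p ≡ k → r ≡ k → toℚ p ℚ.+ s ℚ.* (toℚ r ℚ.- toℚ p) ≡ y
  fixed p r k f refl refl = ℚₚ.≤-antisym (frac-≤⁻ q>0 (along k k) f (ℤₚ.≤-reflexive e)) (frac-≤⁻ q>0 f (along k k) (ℤₚ.≤-reflexive (sym e)))
    where
    e : k ℤ.* q ℤ.+ (k ℤ.- k) ℤ.* σ ≡ k ℤ.* q
    e = omega 3 (λ k q σ → k ⊗ q ⊕ (k ⊖ k) ⊗ σ ≐ k ⊗ q) k q σ
  side : _ → _
  side (inj₁ (e , f)) = inj₁ (fixed px qx (+ 0) (frac-0 q) e f)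
  side (inj₂ (inj₁ (e , f))) = inj₂ (inj₁ (fixed px qx (+ m ℤ.- + 1) (frac-toℚ q (+ m ℤ.- + 1)) e f))
  side (inj₂ (inj₂ (inj₁ (e , f)))) = inj₂ (inj₂ (inj₁ (fixed py qy (+ 0) (frac-0 q) e f)))
  side (inj₂ (inj₂ (inj₂ (e , f)))) = inj₂ (inj₂ (inj₂ (fixed py qy (+ n ℤ.- + 1) (frac-toℚ q (+ n ℤ.- + 1)) e f)))

trapEdgeF : Fin 4 → (a b c d e m n A dx dy : Expr) → Form
trapEdgeF k a b c d e m n A dx dy = # 1 ≼ A ⇛ trapCondF k a b c d e m n A dx dy ⇛
  edgeF m n (movedXF k dx dy (# 0) (# 0)) (movedYF k dx dy (# 0) (# 0))
            (movedXF k dx dy (# 2 ⊗ A ⊕ # 2) (# 0)) (movedYF k dx dy (# 2 ⊗ A ⊕ # 2) (# 0))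

triEdgeF : Fin 4 → (a b c d e m n A dx dy : Expr) → Form
triEdgeF k a b c d e m n A dx dy = # 1 ≼ A ⇛ triCondF k a b c d e m n A dx dy ⇛
  edgeF m n (movedXF k dx dy (# 0) (# 0)) (movedYF k dx dy (# 0) (# 0))
            (movedXF k dx dy A (# 0)) (movedYF k dx dy A (# 0)) &
  edgeF m n (movedXF k dx dy (# 0) A) (movedYF k dx dy (# 0) A)
            (movedXF k dx dy (# 0) (# 0)) (movedYF k dx dy (# 0) (# 0))

placed-dashed : ∀ e m n s k dx dy P → Placed e (+ m) (+ n) s k dx dy P →
  All (SegmentIn∂R m n) (dashedSides (tile s k (dx , dy)))
placed-dashed e m n T1 k dx dy P h = []
placed-dashed e m n T2 k dx dy P h = []
placed-dashed e m n (T3 _ _ _ _) k dx dy P h = []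
placed-dashed e m n (T4 _ _) k dx dy P h = []
placed-dashed e m n s@(T5 A A≥1) k dx dy (oct a b c d) h = edge-segment m n (move t (+ 0 , + 0)) (move t (+ 2 ℤ.* + A ℤ.+ + 2 , + 0)) (edge k h) ∷ []
  where
  t = tile s k (dx , dy)
  edge : ∀ k → Placed e (+ m) (+ n) s k dx dy (oct a b c d) → let t = tile s k (dx , dy) in
    Edge (+ m) (+ n) (move t (+ 0 , + 0)) (move t (+ 2 ℤ.* + A ℤ.+ + 2 , + 0))
  edge r0 h = omega 10 (trapEdgeF r0) a b c d e (+ m) (+ n) (+ A) dx dy (ℤ.+≤+ A≥1) h
  edge r1 h = omega 10 (trapEdgeF r1) a b c d e (+ m) (+ n) (+ A) dx dy (ℤ.+≤+ A≥1) h
  edge r2 h = omega 10 (trapEdgeF r2) a b c d e (+ m) (+ n) (+ A) dx dy (ℤ.+≤+ A≥1) h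
  edge r3 h = omega 10 (trapEdgeF r3) a b c d e (+ m) (+ n) (+ A) dx dy (ℤ.+≤+ A≥1) h
placed-dashed e m n s@(T6 A A≥1) k dx dy (oct a b c d) h with edges₂ k h
  where
  edges₂ : ∀ k → Placed e (+ m) (+ n) s k dx dy (oct a b c d) → let t = tile s k (dx , dy) in
    Edge (+ m) (+ n) (move t (+ 0 , + 0)) (move t (+ A , + 0)) × Edge (+ m) (+ n) (move t (+ 0 , + A)) (move t (+ 0 , + 0))
  edges₂ r0 h = omega 10 (triEdgeF r0) a b c d e (+ m) (+ n) (+ A) dx dy (ℤ.+≤+ A≥1) h
  edges₂ r1 h = omega 10 (triEdgeF r1) a b c d e (+ m) (+ n) (+ A) dx dy (ℤ.+≤+ A≥1) h
  edges₂ r2 h = omega 10 (triEdgeF r2) a b c d e (+ m) (+ n) (+ A) dx dy (ℤ.+≤+ A≥1) h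
  edges₂ r3 h = omega 10 (triEdgeF r3) a b c d e (+ m) (+ n) (+ A) dx dy (ℤ.+≤+ A≥1) h
... | h₁ , h₂ = edge-segment m n (move t (+ 0 , + 0)) (move t (+ A , + 0)) h₁ ∷ edge-segment m n (move t (+ 0 , + A)) (move t (+ 0 , + 0)) h₂ ∷ []
  where
  t = tile s k (dx , dy)

-- The tile of a given piece

record Realization (c : Color) (m n : ℤ) (P : Piece) : Set where
  constructor realize
  field
    shape  : Shape
    rot    : Fin 4
    dx dy  : ℤ
    placed : Placed (eps c) m n shape rot dx dy P
    index  : Σ ℤ λ i → colorSum shape rot dx dy ≡ + 2 ℤ.* i ℤ.+ eps c

natural : ∀ z → + 0 ℤ.≤ z → Σ ℕ λ k → z ≡ + k
natural (+ k) _ = k , refl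

module _ (c : Color) (m n : ℤ) (m≥1 : + 1 ℤ.≤ m) (n≥1 : + 1 ℤ.≤ n) (a b c′ d : ℤ) where
  private
    e = eps c
    at : (f : (a b c d e m n : Expr) → Form) → Set
    at f = ⟦ f (cst a) (cst b) (cst c′) (cst d) (cst e) (cst m) (cst n) ⟧ []

  inner : a ℤ.+ + 1 ℤ.≤ b → c′ ℤ.+ + 1 ℤ.≤ d → at clrL → at clrR → at clrB → at clrT → Realization c m n (oct a b c′ d)
  inner h₁ h₂ l r bt t with natural (b ℤ.- a ℤ.- + 1) (omega 2 (λ a b → a ⊕ # 1 ≼ b ⇛ # 0 ≼ b ⊖ a ⊖ # 1) a b h₁)
                          | natural (d ℤ.- c′ ℤ.- + 1) (omega 2 (λ a b → a ⊕ # 1 ≼ b ⇛ # 0 ≼ b ⊖ a ⊖ # 1) c′ d h₂)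
  ... | zero , p | zero , q = realize T1 r0 (a ℤ.+ d ℤ.+ e ℤ.- + 3) (a ℤ.- d ℤ.- + 1)
    (omega 7 (λ a b c d e m n → b ⊖ a ⊖ # 1 ≐ # 0 ⇛ d ⊖ c ⊖ # 1 ≐ # 0 ⇛ clrL a b c d e m n ⇛ clrR a b c d e m n ⇛ clrB a b c d e m n ⇛ clrT a b c d e m n ⇛
      octCondF r0 a b c d e m n (# 0) (# 0) (a ⊕ d ⊕ e ⊖ # 3) (a ⊖ d ⊖ # 1)) a b c′ d e m n p q l r bt t)
    (a ℤ.- + 2 , omega 3 (λ a d e → colorSumF r0 (# 0) (a ⊕ d ⊕ e ⊖ # 3) (a ⊖ d ⊖ # 1) ≐ # 2 ⊗ (a ⊖ # 2) ⊕ e) a d e)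
  ... | zero , p | B@(suc _) , q = realize (T4 B (ℕ.s≤s ℕ.z≤n)) r0 (a ℤ.+ d ℤ.+ e ℤ.- + 3) (a ℤ.- d ℤ.- + 1)
    (omega 8 (λ a b c d e m n B → b ⊖ a ⊖ # 1 ≐ # 0 ⇛ d ⊖ c ⊖ # 1 ≐ B ⇛ clrL a b c d e m n ⇛ clrR a b c d e m n ⇛ clrB a b c d e m n ⇛ clrT a b c d e m n ⇛
      octCondF r0 a b c d e m n (# 0) B (a ⊕ d ⊕ e ⊖ # 3) (a ⊖ d ⊖ # 1)) a b c′ d e m n (+ B) p q l r bt t)
    (a ℤ.- + 2 , omega 3 (λ a d e → colorSumF r0 (# 0) (a ⊕ d ⊕ e ⊖ # 3) (a ⊖ d ⊖ # 1) ≐ # 2 ⊗ (a ⊖ # 2) ⊕ e) a d e)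
  -- T4 is an octagon whose first parameter is 0, so a long first gap needs a quarter turn, which
  -- exchanges the two parameters.
  ... | A@(suc _) , p | zero , q = realize (T4 A (ℕ.s≤s ℕ.z≤n)) r1 (b ℤ.+ d ℤ.+ e ℤ.- + 2) (b ℤ.- d ℤ.- + 2)
    (omega 8 (λ a b c d e m n A → b ⊖ a ⊖ # 1 ≐ A ⇛ d ⊖ c ⊖ # 1 ≐ # 0 ⇛ clrL a b c d e m n ⇛ clrR a b c d e m n ⇛ clrB a b c d e m n ⇛ clrT a b c d e m n ⇛
      octCondF r1 a b c d e m n (# 0) A (b ⊕ d ⊕ e ⊖ # 2) (b ⊖ d ⊖ # 2)) a b c′ d e m n (+ A) p q l r bt t)
    (b ℤ.- + 2 , omega 3 (λ b d e → colorSumF r1 (# 0) (b ⊕ d ⊕ e ⊖ # 2) (b ⊖ d ⊖ # 2) ≐ # 2 ⊗ (b ⊖ # 2) ⊕ e) b d e)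
  ... | A@(suc _) , p | B@(suc _) , q = realize (T3 A B (ℕ.s≤s ℕ.z≤n) (ℕ.s≤s ℕ.z≤n)) r0 (a ℤ.+ d ℤ.+ e ℤ.- + 3) (a ℤ.- d ℤ.- + 1)
    (omega 9 (λ a b c d e m n A B → b ⊖ a ⊖ # 1 ≐ A ⇛ d ⊖ c ⊖ # 1 ≐ B ⇛ clrL a b c d e m n ⇛ clrR a b c d e m n ⇛ clrB a b c d e m n ⇛ clrT a b c d e m n ⇛
      octCondF r0 a b c d e m n A B (a ⊕ d ⊕ e ⊖ # 3) (a ⊖ d ⊖ # 1)) a b c′ d e m n (+ A) (+ B) p q l r bt t)
    (a ℤ.- + 2 , omega 3 (λ a d e → colorSumF r0 (# 0) (a ⊕ d ⊕ e ⊖ # 3) (a ⊖ d ⊖ # 1) ≐ # 2 ⊗ (a ⊖ # 2) ⊕ e) a d e)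

  trapezoid : ∀ k dx dy i →
    (∀ A → b ℤ.- a ℤ.- + 1 ≡ A → ⟦ trapCondF k (cst a) (cst b) (cst c′) (cst d) (cst e) (cst m) (cst n) (cst A) (cst dx) (cst dy) ⟧ []) →
    eval [] (colorSumF k (# 0) (cst dx) (cst dy)) ≡ + 2 ℤ.* i ℤ.+ e → a ℤ.+ + 2 ℤ.≤ b → Realization c m n (oct a b c′ d)
  trapezoid k dx dy i cond sum h with natural (b ℤ.- a ℤ.- + 1) (omega 2 (λ a b → a ⊕ # 2 ≼ b ⇛ # 0 ≼ b ⊖ a ⊖ # 1) a b h)
  ... | A , p = realize (T5 A (ℤₚ.drop‿+≤+ (subst (+ 1 ℤ.≤_) p (omega 2 (λ a b → a ⊕ # 2 ≼ b ⇛ # 1 ≼ b ⊖ a ⊖ # 1) a b h)))) k dx dy (cond (+ A) p) (i , sum)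

  triangle : ∀ k dx dy i A → + 1 ℤ.≤ A →
    ⟦ triCondF k (cst a) (cst b) (cst c′) (cst d) (cst e) (cst m) (cst n) (cst A) (cst dx) (cst dy) ⟧ [] →
    eval [] (colorSumF k (cst A) (cst dx) (cst dy)) ≡ + 2 ℤ.* i ℤ.+ e → Realization c m n (oct a b c′ d)
  triangle k dx dy i (+ A) (ℤ.+≤+ A≥1) cond sum = realize (T6 A A≥1) k dx dy cond (i , sum)

  -- Opposite lines cannot both be axes of symmetry, since that would force m = -1 or n = -1. The
  -- other nine combinations give one shape in each possible orientation.
  build-oct : Valid e m n (oct a b c′ d) → Realization c m n (oct a b c′ d)
  build-oct (h₁ , h₂ , inj₁ l , inj₁ r , _) = ⊥-elim (omega 7 (λ a b c d e m n → # 1 ≼ m ⇛ symL a b c d e m n ⇛ symR a b c d e m n ⇛ ⊥′) a b c′ d e m n m≥1 l r)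
  build-oct (h₁ , h₂ , _ , _ , inj₁ bt , inj₁ t) = ⊥-elim (omega 7 (λ a b c d e m n → # 1 ≼ n ⇛ symB a b c d e m n ⇛ symT a b c d e m n ⇛ ⊥′) a b c′ d e m n n≥1 bt t)
  build-oct (h₁ , h₂ , inj₂ l , inj₂ r , inj₂ bt , inj₂ t) = inner h₁ h₂ l r bt t
  build-oct (h₁ , h₂ , inj₁ l , inj₂ r , inj₂ bt , inj₂ t) = trapezoid r3 (+ 0) (b ℤ.- c′ ℤ.- + 1) (b ℤ.- + 1)
    (λ A p → omega 8 (λ a b c d e m n A → symL a b c d e m n ⇛ clrR a b c d e m n ⇛ clrB a b c d e m n ⇛ clrT a b c d e m n ⇛ b ⊖ a ⊖ # 1 ≐ A ⇛
      trapCondF r3 a b c d e m n A (# 0) (b ⊖ c ⊖ # 1)) a b c′ d e m n A l r bt t p)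
    (omega 7 (λ a b c d e m n → symL a b c d e m n ⇛ colorSumF r3 (# 0) (# 0) (b ⊖ c ⊖ # 1) ≐ # 2 ⊗ (b ⊖ # 1) ⊕ e) a b c′ d e m n l) (proj₁ l)
  build-oct (h₁ , h₂ , inj₂ l , inj₁ r , inj₂ bt , inj₂ t) = trapezoid r1 (m ℤ.- + 1) (a ℤ.- d ℤ.- + 1) (a ℤ.- + 2)
    (λ A p → omega 8 (λ a b c d e m n A → clrL a b c d e m n ⇛ symR a b c d e m n ⇛ clrB a b c d e m n ⇛ clrT a b c d e m n ⇛ b ⊖ a ⊖ # 1 ≐ A ⇛
      trapCondF r1 a b c d e m n A (m ⊖ # 1) (a ⊖ d ⊖ # 1)) a b c′ d e m n A l r bt t p)
    (omega 7 (λ a b c d e m n → symR a b c d e m n ⇛ colorSumF r1 (# 0) (m ⊖ # 1) (a ⊖ d ⊖ # 1) ≐ # 2 ⊗ (a ⊖ # 2) ⊕ e) a b c′ d e m n r) (proj₁ r)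
  build-oct (h₁ , h₂ , inj₂ l , inj₂ r , inj₁ bt , inj₂ t) = trapezoid r0 (+ 2 ℤ.* c′ ℤ.+ e ℤ.- + 2) (+ 0) (c′ ℤ.- + 1)
    (λ A p → omega 8 (λ a b c d e m n A → clrL a b c d e m n ⇛ clrR a b c d e m n ⇛ symB a b c d e m n ⇛ clrT a b c d e m n ⇛ b ⊖ a ⊖ # 1 ≐ A ⇛
      trapCondF r0 a b c d e m n A (# 2 ⊗ c ⊕ e ⊖ # 2) (# 0)) a b c′ d e m n A l r bt t p)
    (omega 2 (λ c e → colorSumF r0 (# 0) (# 2 ⊗ c ⊕ e ⊖ # 2) (# 0) ≐ # 2 ⊗ (c ⊖ # 1) ⊕ e) c′ e) (proj₁ bt)
  build-oct (h₁ , h₂ , inj₂ l , inj₂ r , inj₂ bt , inj₁ t) = trapezoid r2 (b ℤ.+ d ℤ.+ e ℤ.- + 2) (n ℤ.- + 1) (b ℤ.- + 2)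
    (λ A p → omega 8 (λ a b c d e m n A → clrL a b c d e m n ⇛ clrR a b c d e m n ⇛ clrB a b c d e m n ⇛ symT a b c d e m n ⇛ b ⊖ a ⊖ # 1 ≐ A ⇛
      trapCondF r2 a b c d e m n A (b ⊕ d ⊕ e ⊖ # 2) (n ⊖ # 1)) a b c′ d e m n A l r bt t p)
    (omega 7 (λ a b c d e m n → symT a b c d e m n ⇛ colorSumF r2 (# 0) (b ⊕ d ⊕ e ⊖ # 2) (n ⊖ # 1) ≐ # 2 ⊗ (b ⊖ # 2) ⊕ e) a b c′ d e m n t) (proj₁ t)
  -- The hypotenuse is on X + Y = 2 b + e and the right angle at X = Y = 1, hence the leg 2 b + e -
  -- 2. The other three triangles are computed in the same way.
  build-oct (h₁ , h₂ , inj₁ l , inj₂ r , inj₁ bt , inj₂ t) = triangle r0 (+ 0) (+ 0) (b ℤ.- + 1) (+ 2 ℤ.* b ℤ.+ e ℤ.- + 2)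
    (omega 7 (λ a b c d e m n → symL a b c d e m n ⇛ symB a b c d e m n ⇛ # 1 ≼ # 2 ⊗ b ⊕ e ⊖ # 2) a b c′ d e m n l bt)
    (omega 7 (λ a b c d e m n → symL a b c d e m n ⇛ symB a b c d e m n ⇛ clrR a b c d e m n ⇛ clrT a b c d e m n ⇛
      triCondF r0 a b c d e m n (# 2 ⊗ b ⊕ e ⊖ # 2) (# 0) (# 0)) a b c′ d e m n l bt r t)
    (omega 2 (λ b e → colorSumF r0 (# 2 ⊗ b ⊕ e ⊖ # 2) (# 0) (# 0) ≐ # 2 ⊗ (b ⊖ # 1) ⊕ e) b e)
  build-oct (h₁ , h₂ , inj₂ l , inj₁ r , inj₁ bt , inj₂ t) = triangle r1 (m ℤ.- + 1) (+ 0) (m ℤ.- c′ ℤ.- e) (m ℤ.+ + 1 ℤ.- + 2 ℤ.* c′ ℤ.- e)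
    (omega 7 (λ a b c d e m n → symR a b c d e m n ⇛ symB a b c d e m n ⇛ # 1 ≼ m ⊕ # 1 ⊖ # 2 ⊗ c ⊖ e) a b c′ d e m n r bt)
    (omega 7 (λ a b c d e m n → symR a b c d e m n ⇛ symB a b c d e m n ⇛ clrL a b c d e m n ⇛ clrT a b c d e m n ⇛
      triCondF r1 a b c d e m n (m ⊕ # 1 ⊖ # 2 ⊗ c ⊖ e) (m ⊖ # 1) (# 0)) a b c′ d e m n r bt l t)
    (omega 3 (λ c e m → colorSumF r1 (m ⊕ # 1 ⊖ # 2 ⊗ c ⊖ e) (m ⊖ # 1) (# 0) ≐ # 2 ⊗ (m ⊖ c ⊖ e) ⊕ e) c′ e m)
  build-oct (h₁ , h₂ , inj₂ l , inj₁ r , inj₂ bt , inj₁ t) = triangle r2 (m ℤ.- + 1) (n ℤ.- + 1) (a ℤ.- + 2) (m ℤ.+ n ℤ.+ + 2 ℤ.- + 2 ℤ.* a ℤ.- e)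
    (omega 7 (λ a b c d e m n → symR a b c d e m n ⇛ symT a b c d e m n ⇛ # 1 ≼ m ⊕ n ⊕ # 2 ⊖ # 2 ⊗ a ⊖ e) a b c′ d e m n r t)
    (omega 7 (λ a b c d e m n → symR a b c d e m n ⇛ symT a b c d e m n ⇛ clrL a b c d e m n ⇛ clrB a b c d e m n ⇛
      triCondF r2 a b c d e m n (m ⊕ n ⊕ # 2 ⊖ # 2 ⊗ a ⊖ e) (m ⊖ # 1) (n ⊖ # 1)) a b c′ d e m n r t l bt)
    (omega 4 (λ a e m n → colorSumF r2 (m ⊕ n ⊕ # 2 ⊖ # 2 ⊗ a ⊖ e) (m ⊖ # 1) (n ⊖ # 1) ≐ # 2 ⊗ (a ⊖ # 2) ⊕ e) a e m n)
  build-oct (h₁ , h₂ , inj₁ l , inj₂ r , inj₂ bt , inj₁ t) = triangle r3 (+ 0) (n ℤ.- + 1) (ℤ.- d ℤ.- e) (+ 2 ℤ.* d ℤ.+ e ℤ.+ n ℤ.- + 1)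
    (omega 7 (λ a b c d e m n → symL a b c d e m n ⇛ symT a b c d e m n ⇛ # 1 ≼ # 2 ⊗ d ⊕ e ⊕ n ⊖ # 1) a b c′ d e m n l t)
    (omega 7 (λ a b c d e m n → symL a b c d e m n ⇛ symT a b c d e m n ⇛ clrR a b c d e m n ⇛ clrB a b c d e m n ⇛
      triCondF r3 a b c d e m n (# 2 ⊗ d ⊕ e ⊕ n ⊖ # 1) (# 0) (n ⊖ # 1)) a b c′ d e m n l t r bt)
    (omega 3 (λ d e n → colorSumF r3 (# 2 ⊗ d ⊕ e ⊕ n ⊖ # 1) (# 0) (n ⊖ # 1) ≐ # 2 ⊗ (⊝ d ⊖ e) ⊕ e) d e n)

build : ∀ c m n → + 1 ℤ.≤ m → + 1 ℤ.≤ n → ∀ P → Valid (eps c) m n P → Realization c m n P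
build c m n m≥1 n≥1 (oct a b c′ d) h = build-oct c m n m≥1 n≥1 a b c′ d h
build c m n _ _ (dia k l) h = realize T2 r0 (k ℤ.+ l ℤ.+ e ℤ.- + 2) (k ℤ.- l ℤ.- + 2)
  (omega 5 (λ k l e m n → validDiaF k l e m n ⇛ diaCondF r0 k l e m n (k ⊕ l ⊕ e ⊖ # 2) (k ⊖ l ⊖ # 2)) k l e m n h)
  (k ℤ.- + 2 , omega 3 (λ k l e → colorSumF r0 (# 0) (k ⊕ l ⊕ e ⊖ # 2) (k ⊖ l ⊖ # 2) ≐ # 2 ⊗ (k ⊖ # 2) ⊕ e) k l e)
  where
  e = eps c

-- Cells

bitF : Expr → Form
bitF p = p ≐ # 0 ∥ p ≐ # 1

-- A cell is a quarter of the diamond around a point of the opposite colour,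
-- the point with coordinates X = k + l - 1 + e and Y = k - l: its eastern half
-- if p = 1, its western half if p = 0, and its northern half if q = 1.
record Cell : Set where
  constructor cell
  field k l p q : ℤ

-- The unit square in the quadrant (p , q) of the centre lies in R.
boxF : (k l p q e m n : Expr) → Form
boxF k l p q e m n = # 1 ≼ k ⊕ l ⊖ # 2 ⊕ e ⊕ p & k ⊕ l ⊖ # 1 ⊕ e ⊕ p ≼ m & # 1 ≼ k ⊖ l ⊖ # 1 ⊕ q & k ⊖ l ⊕ q ≼ n

cellRectF : (k l p q e m n : Expr) → Form
cellRectF k l p q e m n = boxF k l p q e m n & bitF p & bitF q

-- Every side of an octagon runs along sides of cells, so a cell is either inside an octagon or
-- shares no interior point with it. One inequality for each side decides which.
cellOctF : (a b c d k l p q : Expr) → Form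
cellOctF a b c d k l p q = a ≼ k & k ≼ b & c ≼ l & l ≼ d & a ⊕ c ⊕ # 1 ≼ k ⊕ l ⊕ p & k ⊕ l ⊕ p ≼ b ⊕ d &
  a ⊖ d ≼ k ⊖ l ⊖ # 1 ⊕ q & k ⊖ l ⊕ q ≼ b ⊖ c

cellDiaF : (k′ l′ k l : Expr) → Form
cellDiaF k′ l′ k l = k ≐ k′ & l ≐ l′

triangleF : (k l p q e X Y Q : Expr) → Form
triangleF k l p q e X Y Q =
  (k ⊕ l ⊖ # 2 ⊕ e ⊕ p) ⊗ Q ≼ X & X ≼ (k ⊕ l ⊖ # 1 ⊕ e ⊕ p) ⊗ Q &
  (k ⊖ l ⊖ # 1 ⊕ q) ⊗ Q ≼ Y & Y ≼ (k ⊖ l ⊕ q) ⊗ Q &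
  (# 2 ⊗ k ⊖ # 2 ⊕ e) ⊗ Q ≼ X ⊕ Y & X ⊕ Y ≼ (# 2 ⊗ k ⊕ e) ⊗ Q &
  (# 2 ⊗ l ⊖ # 2 ⊕ e) ⊗ Q ≼ X ⊖ Y & X ⊖ Y ≼ (# 2 ⊗ l ⊕ e) ⊗ Q

CellIn : Piece → Cell → Set
CellIn (oct a b c d) (cell k l p q) = ⟦ cellOctF (cst a) (cst b) (cst c) (cst d) (cst k) (cst l) (cst p) (cst q) ⟧ []
CellIn (dia k′ l′) (cell k l p q) = ⟦ cellDiaF (cst k′) (cst l′) (cst k) (cst l) ⟧ []

CellR : (e m n : ℤ) → Cell → Set
CellR e m n (cell k l p q) = ⟦ cellRectF (cst k) (cst l) (cst p) (cst q) (cst e) (cst m) (cst n) ⟧ []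

Triangle : ℤ → Cell → (X Y Q : ℤ) → Set
Triangle e (cell k l p q) X Y Q = ⟦ triangleF (cst k) (cst l) (cst p) (cst q) (cst e) (cst X) (cst Y) (cst Q) ⟧ []

-- An interior point of the cell, with denominator 4.
sampleXF sampleYF : (k l p q e : Expr) → Expr
sampleXF k l p q e = # 4 ⊗ (k ⊕ l ⊖ # 1 ⊕ e) ⊖ # 1 ⊕ # 2 ⊗ p
sampleYF k l p q e = # 4 ⊗ (k ⊖ l) ⊖ # 1 ⊕ # 2 ⊗ q

sampleX sampleY : ℤ → Cell → ℤ
sampleX e (cell k l p q) = eval [] (sampleXF (cst k) (cst l) (cst p) (cst q) (cst e))
sampleY e (cell k l p q) = eval [] (sampleYF (cst k) (cst l) (cst p) (cst q) (cst e))

sample-in : ∀ e m n P z → CellR e m n z → CellIn P z → InPiece e m n P (sampleX e z) (sampleY e z) (+ 4) (+ 1)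
sample-in e m n (oct a b c d) (cell k l p q) r h = omega 11 (λ a b c d k l p q e m n → cellRectF k l p q e m n ⇛ cellOctF a b c d k l p q ⇛
  octRF a b c d e m n (sampleXF k l p q e) (sampleYF k l p q e) (# 4) (# 1)) a b c d k l p q e m n r h
sample-in e m n (dia k′ l′) (cell k l p q) r h = omega 9 (λ k′ l′ k l p q e m n → cellRectF k l p q e m n ⇛ cellDiaF k′ l′ k l ⇛
  diaF k′ l′ e (sampleXF k l p q e) (sampleYF k l p q e) (# 4) (# 1)) k′ l′ k l p q e m n r h

-- The sample point is on none of the lines that can bound a piece, so even the closed piece
-- contains it only together with the whole cell.
sample-out : ∀ e m n P z → CellR e m n z → InPiece e m n P (sampleX e z) (sampleY e z) (+ 4) (+ 0) → CellIn P z
sample-out e m n (oct a b c d) (cell k l p q) r h = omega 11 (λ a b c d k l p q e m n → cellRectF k l p q e m n ⇛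
  octRF a b c d e m n (sampleXF k l p q e) (sampleYF k l p q e) (# 4) (# 0) ⇛ cellOctF a b c d k l p q) a b c d k l p q e m n r h
sample-out e m n (dia k′ l′) (cell k l p q) r h = omega 9 (λ k′ l′ k l p q e m n → cellRectF k l p q e m n ⇛
  diaF k′ l′ e (sampleXF k l p q e) (sampleYF k l p q e) (# 4) (# 0) ⇛ cellDiaF k′ l′ k l) k′ l′ k l p q e m n r h

sample-rect : ∀ e m n z → CellR e m n z → InRect m n (sampleX e z) (sampleY e z) (+ 4) (+ 0)
sample-rect e m n (cell k l p q) r = omega 7 (λ k l p q e m n → cellRectF k l p q e m n ⇛
  rectF m n (sampleXF k l p q e) (sampleYF k l p q e) (# 4) (# 0)) k l p q e m n r

triangle-in : ∀ e m n P z X Y Q → + 0 ℤ.≤ Q → CellR e m n z → CellIn P z → Triangle e z X Y Q → InPiece e m n P X Y Q (+ 0)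
triangle-in e m n (oct a b c d) (cell k l p q) X Y Q Q≥0 r@(r′ , _) h t = omega 14 (λ a b c d k l p q e m n X Y Q →
  scaled Q (cellOctF a b c d k l p q) ⇛
  scaled Q (# 1 ≼ k ⊕ l ⊖ # 2 ⊕ e ⊕ p & k ⊕ l ⊖ # 1 ⊕ e ⊕ p ≼ m & # 1 ≼ k ⊖ l ⊖ # 1 ⊕ q & k ⊖ l ⊕ q ≼ n) ⇛
  triangleF k l p q e X Y Q ⇛ octRF a b c d e m n X Y Q (# 0)) a b c d k l p q e m n X Y Q
  (scaled-ok {[]} (cst Q) Q≥0 (cellOctF (cst a) (cst b) (cst c) (cst d) (cst k) (cst l) (cst p) (cst q)) h)
  (scaled-ok {[]} (cst Q) Q≥0 (# 1 ≼ cst k ⊕ cst l ⊖ # 2 ⊕ cst e ⊕ cst p & cst k ⊕ cst l ⊖ # 1 ⊕ cst e ⊕ cst p ≼ cst m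
    & # 1 ≼ cst k ⊖ cst l ⊖ # 1 ⊕ cst q & cst k ⊖ cst l ⊕ cst q ≼ cst n) r′) t
triangle-in e m n (dia _ _) (cell k l p q) X Y Q Q≥0 r (refl , refl) (_ , _ , _ , _ , t) = omega 6 (λ k l e X Y Q →
  ((# 2 ⊗ k ⊖ # 2 ⊕ e) ⊗ Q ≼ X ⊕ Y & X ⊕ Y ≼ (# 2 ⊗ k ⊕ e) ⊗ Q &
  (# 2 ⊗ l ⊖ # 2 ⊕ e) ⊗ Q ≼ X ⊖ Y & X ⊖ Y ≼ (# 2 ⊗ l ⊕ e) ⊗ Q) ⇛ diaF k l e X Y Q (# 0)) k l e X Y Q t

unitF : (m X Q x : Expr) → Form
unitF m X Q x = # 1 ≼ x & x ⊕ # 1 ≼ m & x ⊗ Q ≼ X & X ≼ (x ⊕ # 1) ⊗ Q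

unit-interval : ∀ m X Q → + 2 ℤ.≤ m → + 0 ℤ.< Q → Q ℤ.≤ X → X ℤ.≤ m ℤ.* Q →
  Σ ℤ λ x → ⟦ unitF (cst m) (cst X) (cst Q) (cst x) ⟧ []
unit-interval m X (+ zero) m≥2 (ℤ.+<+ ()) lo hi
unit-interval m X Q@(+ suc d) m≥2 _ lo hi with X /ℕ suc d | X %ℕ suc d | a≡a%ℕn+[a/ℕn]*n X (suc d) | n%ℕd<d X (suc d)
... | x | r | e | r<d = go (m ℤ.≤? x)
  where
  r≥0 : + 0 ℤ.≤ + r
  r≥0 = ℤ.+≤+ ℕ.z≤n
  r<Q : + r ℤ.+ + 1 ℤ.≤ Q
  r<Q = subst (ℤ._≤ Q) (ℤₚ.+-comm (+ 1) (+ r)) (ℤ.+≤+ r<d)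
  x≥1 : + 1 ℤ.≤ x
  x≥1 = ℤₚ.i<j⇒suc[i]≤j {+ 0} (ℤₚ.≰⇒> λ x≤0 → omega 4 (λ X Q x r → Q ≼ X ⇛ X ≐ r ⊕ x ⊗ Q ⇛ r ⊕ # 1 ≼ Q ⇛ x ⊗ Q ≼ # 0 ⊗ Q ⇛ ⊥′)
    X Q x (+ r) lo e r<Q (ℤₚ.*-monoʳ-≤-nonNeg Q x≤0))
  go : Dec (m ℤ.≤ x) → Σ ℤ λ x → ⟦ unitF (cst m) (cst X) (cst Q) (cst x) ⟧ []
  go (no m≰x) = x , omega 5 (λ m X Q x r → X ≐ r ⊕ x ⊗ Q ⇛ # 0 ≼ r ⇛ r ⊕ # 1 ≼ Q ⇛ # 1 ≼ x ⇛ (m ≼ x ⇛ ⊥′) ⇛ unitF m X Q x)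
    m X Q x (+ r) e r≥0 r<Q x≥1 m≰x
  -- At the right end X = m Q the quotient is m, and the last interval in R starts at m - 1.
  go (yes m≤x) = m ℤ.- + 1 , omega 5 (λ m X Q x r → X ≐ r ⊕ x ⊗ Q ⇛ # 0 ≼ r ⇛ r ⊕ # 1 ≼ Q ⇛ m ⊗ Q ≼ x ⊗ Q ⇛ # 2 ≼ m ⇛ X ≼ m ⊗ Q ⇛
      unitF m X Q (m ⊖ # 1))
    m X Q x (+ r) e r≥0 r<Q (ℤₚ.*-monoʳ-≤-nonNeg Q m≤x) m≥2 hi

halve : ∀ z → Σ ℤ λ h → z ≡ + 2 ℤ.* h ⊎ z ≡ + 2 ℤ.* h ℤ.+ + 1
halve z with z /ℕ 2 | z %ℕ 2 | a≡a%ℕn+[a/ℕn]*n z 2 | n%ℕd<d z 2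
... | h | zero | e | _ = h , inj₁ (trans e (omega 1 (λ h → # 0 ⊕ h ⊗ # 2 ≐ # 2 ⊗ h) h))
... | h | suc zero | e | _ = h , inj₂ (trans e (omega 1 (λ h → # 1 ⊕ h ⊗ # 2 ≐ # 2 ⊗ h ⊕ # 1) h))
... | h | suc (suc _) | _ | ℕ.s≤s (ℕ.s≤s ())

locate : ∀ e m n X Y Q → + 2 ℤ.≤ m → + 2 ℤ.≤ n → + 0 ℤ.< Q → InRect m n X Y Q (+ 0) →
  Σ Cell λ z → CellR e m n z × Triangle e z X Y Q
locate e m n X Y Q m≥2 n≥2 Q>0 r
  with omega 5 (λ m n X Y Q → rectF m n X Y Q (# 0) ⇛ Q ≼ X & X ≼ m ⊗ Q & Q ≼ Y & Y ≼ n ⊗ Q) m n X Y Q r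
... | x₁ , x₂ , y₁ , y₂ with unit-interval m X Q m≥2 Q>0 x₁ x₂ | unit-interval n Y Q n≥2 Q>0 y₁ y₂
-- The parity tells which diagonal of the unit square at (x , y) joins its two points of colour c;
-- the two halves on either side of that diagonal are cells.
... | x , hx | y , hy with halve (x ℤ.+ y ℤ.+ + 1 ℤ.- e)
... | h , inj₁ even = go ((X ℤ.+ Y) ℤ.≤? (x ℤ.+ y ℤ.+ + 1) ℤ.* Q)
  where
  q : + 0 ℤ.≤ Q
  q = ℤₚ.<⇒≤ Q>0
  evenQ = scaled-ok {[]} (cst Q) q (cst x ⊕ cst y ⊕ # 1 ⊖ cst e ≐ # 2 ⊗ cst h) even
  go : Dec _ → _
  go (yes s) = cell h (h ℤ.- y) (+ 1) (+ 1) ,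
    omega 9 (λ m n X Y Q x y e h → unitF m X Q x ⇛ unitF n Y Q y ⇛ x ⊕ y ⊕ # 1 ⊖ e ≐ # 2 ⊗ h ⇛ scaled Q (x ⊕ y ⊕ # 1 ⊖ e ≐ # 2 ⊗ h) ⇛
      X ⊕ Y ≼ (x ⊕ y ⊕ # 1) ⊗ Q ⇛ cellRectF h (h ⊖ y) (# 1) (# 1) e m n & triangleF h (h ⊖ y) (# 1) (# 1) e X Y Q)
      m n X Y Q x y e h hx hy even evenQ s
  go (no s) = cell (h ℤ.+ + 1) (h ℤ.- y) (+ 0) (+ 0) ,
    omega 9 (λ m n X Y Q x y e h → unitF m X Q x ⇛ unitF n Y Q y ⇛ x ⊕ y ⊕ # 1 ⊖ e ≐ # 2 ⊗ h ⇛ scaled Q (x ⊕ y ⊕ # 1 ⊖ e ≐ # 2 ⊗ h) ⇛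
      (X ⊕ Y ≼ (x ⊕ y ⊕ # 1) ⊗ Q ⇛ ⊥′) ⇛ cellRectF (h ⊕ # 1) (h ⊖ y) (# 0) (# 0) e m n & triangleF (h ⊕ # 1) (h ⊖ y) (# 0) (# 0) e X Y Q)
      m n X Y Q x y e h hx hy even evenQ s
... | h , inj₂ odd = go ((x ℤ.- y) ℤ.* Q ℤ.≤? X ℤ.- Y)
  where
  q : + 0 ℤ.≤ Q
  q = ℤₚ.<⇒≤ Q>0
  oddQ = scaled-ok {[]} (cst Q) q (cst x ⊕ cst y ⊕ # 1 ⊖ cst e ≐ # 2 ⊗ cst h ⊕ # 1) odd
  go : Dec _ → _
  go (yes s) = cell (h ℤ.+ + 1) (h ℤ.+ + 1 ℤ.- y) (+ 0) (+ 1) ,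
    omega 9 (λ m n X Y Q x y e h → unitF m X Q x ⇛ unitF n Y Q y ⇛ x ⊕ y ⊕ # 1 ⊖ e ≐ # 2 ⊗ h ⊕ # 1 ⇛ scaled Q (x ⊕ y ⊕ # 1 ⊖ e ≐ # 2 ⊗ h ⊕ # 1) ⇛
      (x ⊖ y) ⊗ Q ≼ X ⊖ Y ⇛ cellRectF (h ⊕ # 1) (h ⊕ # 1 ⊖ y) (# 0) (# 1) e m n & triangleF (h ⊕ # 1) (h ⊕ # 1 ⊖ y) (# 0) (# 1) e X Y Q)
      m n X Y Q x y e h hx hy odd oddQ s
  go (no s) = cell (h ℤ.+ + 1) (h ℤ.- y) (+ 1) (+ 0) ,
    omega 9 (λ m n X Y Q x y e h → unitF m X Q x ⇛ unitF n Y Q y ⇛ x ⊕ y ⊕ # 1 ⊖ e ≐ # 2 ⊗ h ⊕ # 1 ⇛ scaled Q (x ⊕ y ⊕ # 1 ⊖ e ≐ # 2 ⊗ h ⊕ # 1) ⇛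
      ((x ⊖ y) ⊗ Q ≼ X ⊖ Y ⇛ ⊥′) ⇛ cellRectF (h ⊕ # 1) (h ⊖ y) (# 1) (# 0) e m n & triangleF (h ⊕ # 1) (h ⊖ y) (# 1) (# 0) e X Y Q)
      m n X Y Q x y e h hx hy odd oddQ s

-- Waves and gaps

clash : ∀ {x : Bool} v → x ≡ v → x ≡ not v → ⊥
clash true refl ()
clash false refl ()

-- A wave gives the solution u (i , j) = h i xor h j at X = i + j + e, Y = i - j;
-- its symmetries are the reflections of the plane in the sides X = 0, X = m + 1,
-- Y = 0 and Y = n + 1.
record IsWave (e m n : ℤ) (h : ℤ → Bool) : Set where
  field
    reflect : ∀ i → h (ℤ.- e ℤ.- i) ≡ h i
    shiftX  : ∀ i → h (i ℤ.+ (m ℤ.+ + 1)) ≡ h i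
    shiftY  : ∀ i → h (i ℤ.+ (n ℤ.+ + 1)) ≡ h i

record Gap (h : ℤ → Bool) (a b : ℤ) (v : Bool) : Set where
  constructor gap
  field
    nonempty : a ℤ.+ + 1 ℤ.≤ b
    before   : h (a ℤ.- + 1) ≡ not v
    after    : h b ≡ not v
    between  : ∀ k → a ℤ.≤ k → k ℤ.+ + 1 ℤ.≤ b → h k ≡ v

-- The pieces that belong to the solution with wave h. The cell in R selects one among the mirror
-- images of an octagon. The bounds for a diamond only say that its centre is in R; `valid` sharpens
-- them.
Good : (e m n : ℤ) (h : ℤ → Bool) → Piece → Set
Good e m n h P@(oct a b c d) = Σ Bool λ v → Gap h a b v × Gap h c d v × Σ Cell λ z → CellR e m n z × CellIn P z
Good e m n h (dia k l) = Σ Bool λ v → (h (k ℤ.- + 1) ≡ v × h k ≡ v × h (l ℤ.- + 1) ≡ not v × h l ≡ not v) ×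
  ⟦ # 2 ≼ cst k ⊕ cst l ⊕ cst e & cst k ⊕ cst l ⊕ cst e ≼ cst m ⊕ # 1 & # 1 ≼ cst k ⊖ cst l & cst k ⊖ cst l ≼ cst n ⟧ []

-- The known value at b + t bounds the search.
first : ∀ (h : ℤ → Bool) v i t b → i ℤ.+ + 1 ℤ.≤ b → (∀ k → i ℤ.≤ k → k ℤ.+ + 1 ℤ.≤ b → h k ≡ v) →
  h (b ℤ.+ + t) ≡ not v →
  Σ ℤ λ b → i ℤ.+ + 1 ℤ.≤ b × h b ≡ not v × (∀ k → i ℤ.≤ k → k ℤ.+ + 1 ℤ.≤ b → h k ≡ v)
first h v i t b i<b run end with h b in r
... | w with w Bool.≟ v
first h v i t b i<b run end | w | no w≢v = b , i<b , trans r (Boolₚ.¬-not w≢v) , run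
first h v i zero b i<b run end | w | yes refl =
  ⊥-elim (clash w r (trans (cong h (sym (ℤₚ.+-identityʳ b))) end))
first h v i (suc t) b i<b run end | w | yes refl = first h v i t (b ℤ.+ + 1)
  (omega 2 (λ i b → i ⊕ # 1 ≼ b ⇛ i ⊕ # 1 ≼ b ⊕ # 1) i b i<b) run′
  (trans (cong h (omega 2 (λ b t → (b ⊕ # 1) ⊕ t ≐ b ⊕ (# 1 ⊕ t)) b (+ t))) end)
  where
  run′ : ∀ k → i ℤ.≤ k → k ℤ.+ + 1 ℤ.≤ b ℤ.+ + 1 → h k ≡ w
  run′ k i≤k k≤b with k ℤ.≟ b
  ... | yes refl = r
  ... | no k≢b = run k i≤k (omega 2 (λ k b → (k ≐ b ⇛ ⊥′) ⇛ k ⊕ # 1 ≼ b ⊕ # 1 ⇛ k ⊕ # 1 ≼ b) k b k≢b k≤b)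

module _ {e m n : ℤ} {h : ℤ → Bool} (m≥1 : + 1 ℤ.≤ m) (n≥1 : + 1 ℤ.≤ n) (W : IsWave e m n h) where
  open IsWave W

  shiftX-multiple : ∀ t i → h (i ℤ.+ (m ℤ.+ + 1) ℤ.* + t) ≡ h i
  shiftX-multiple zero i = cong h (omega 2 (λ i m → i ⊕ (m ⊕ # 1) ⊗ # 0 ≐ i) i m)
  shiftX-multiple (suc t) i = trans (cong h (omega 3 (λ i m t → i ⊕ (m ⊕ # 1) ⊗ (# 1 ⊕ t) ≐ i ⊕ (m ⊕ # 1) ⊗ t ⊕ (m ⊕ # 1)) i m (+ t)))
    (trans (shiftX (i ℤ.+ (m ℤ.+ + 1) ℤ.* + t)) (shiftX-multiple t i))

  reflectX : ∀ i → h (m ℤ.+ + 1 ℤ.- e ℤ.- i) ≡ h i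
  reflectX i = trans (cong h (omega 3 (λ i e m → m ⊕ # 1 ⊖ e ⊖ i ≐ ⊝ e ⊖ i ⊕ (m ⊕ # 1)) i e m))
    (trans (shiftX (ℤ.- e ℤ.- i)) (reflect i))

  gap-reflect : ∀ {a b v} → Gap h a b v → Gap h (+ 1 ℤ.- e ℤ.- b) (+ 1 ℤ.- e ℤ.- a) v
  gap-reflect {a} {b} {v} (gap a<b l r run) = gap
    (omega 3 (λ a b e → a ⊕ # 1 ≼ b ⇛ # 1 ⊖ e ⊖ b ⊕ # 1 ≼ # 1 ⊖ e ⊖ a) a b e a<b)
    (trans (cong h (omega 2 (λ b e → # 1 ⊖ e ⊖ b ⊖ # 1 ≐ ⊝ e ⊖ b) b e)) (trans (reflect b) r))
    (trans (cong h (omega 2 (λ a e → # 1 ⊖ e ⊖ a ≐ ⊝ e ⊖ (a ⊖ # 1)) a e)) (trans (reflect (a ℤ.- + 1)) l))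
    (λ k p q → trans (sym (reflect k)) (run (ℤ.- e ℤ.- k)
      (omega 3 (λ a k e → k ⊕ # 1 ≼ # 1 ⊖ e ⊖ a ⇛ a ≼ ⊝ e ⊖ k) a k e q)
      (omega 3 (λ b k e → # 1 ⊖ e ⊖ b ≼ k ⇛ ⊝ e ⊖ k ⊕ # 1 ≼ b) b k e p)))

  gap-shift : ∀ t → (∀ i → h (i ℤ.+ t) ≡ h i) → ∀ {a b v} → Gap h a b v → Gap h (a ℤ.+ t) (b ℤ.+ t) v
  gap-shift t s {a} {b} (gap a<b l r run) = gap
    (omega 3 (λ a b t → a ⊕ # 1 ≼ b ⇛ a ⊕ t ⊕ # 1 ≼ b ⊕ t) a b t a<b)
    (trans (cong h (omega 2 (λ a t → a ⊕ t ⊖ # 1 ≐ a ⊖ # 1 ⊕ t) a t)) (trans (s (a ℤ.- + 1)) l))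
    (trans (s b) r)
    (λ k p q → trans (trans (cong h (omega 2 (λ k t → k ≐ k ⊖ t ⊕ t) k t)) (s (k ℤ.- t))) (run (k ℤ.- t)
      (omega 3 (λ a k t → a ⊕ t ≼ k ⇛ a ≼ k ⊖ t) a k t p)
      (omega 3 (λ b k t → k ⊕ # 1 ≼ b ⊕ t ⇛ k ⊖ t ⊕ # 1 ≼ b) b k t q)))

  module _ {i₀ j₀ : ℤ} (i₀≢j₀ : ¬ (h i₀ ≡ h j₀)) where

    other : ∀ v → Σ ℤ λ k → h k ≡ not v
    other v with h i₀ Bool.≟ v
    ... | no p = i₀ , Boolₚ.¬-not p
    ... | yes p = j₀ , Boolₚ.¬-not (λ q → i₀≢j₀ (trans p (sym q)))

    -- As h takes both values and is periodic, it takes the value opposite to h i somewhere to the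
    -- right of i.
    up : ∀ i → Σ ℤ λ b → i ℤ.+ + 1 ℤ.≤ b × h b ≡ not (h i) × (∀ k → i ℤ.≤ k → k ℤ.+ + 1 ℤ.≤ b → h k ≡ h i)
    up i with other (h i)
    ... | k , hk = first h (h i) i (proj₁ t) (i ℤ.+ + 1) ℤₚ.≤-refl
        (λ k p q → cong h (omega 2 (λ i k → i ≼ k ⇛ k ⊕ # 1 ≼ i ⊕ # 1 ⇛ k ≐ i) i k p q))
        (trans (cong h (proj₂ t)) (trans (shiftX-multiple T k) hk))
      where
      z : ℤ
      z = i ℤ.- k
      -- This many periods move k beyond i, because |i - k| + 1 exceeds i - k and the period is at
      -- least 1.
      T : ℕ
      T = suc ℤ.∣ z ∣
      z≤∣z∣ : ∀ z → z ℤ.≤ + ℤ.∣ z ∣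
      z≤∣z∣ (+ _) = ℤₚ.≤-refl
      z≤∣z∣ -[1+ _ ] = ℤ.-≤+
      t : Σ ℕ λ t → i ℤ.+ + 1 ℤ.+ + t ≡ k ℤ.+ (m ℤ.+ + 1) ℤ.* + T
      t = offset _ (omega 4 (λ i k m z → i ⊖ k ≼ z ⇛ scaled z (# 1 ≼ m) ⇛ # 0 ≼ z ⇛ # 1 ≼ m ⇛ # 0 ≼ k ⊕ (m ⊕ # 1) ⊗ (# 1 ⊕ z) ⊖ (i ⊕ # 1))
          i k m (+ ℤ.∣ z ∣) (z≤∣z∣ z) (scaled-ok {[]} (cst (+ ℤ.∣ z ∣)) (ℤ.+≤+ ℕ.z≤n) (# 1 ≼ cst m) m≥1) (ℤ.+≤+ ℕ.z≤n) m≥1)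
        where
        offset : ∀ w → + 0 ℤ.≤ w ℤ.- (i ℤ.+ + 1) → Σ ℕ λ t → i ℤ.+ + 1 ℤ.+ + t ≡ w
        offset w p with w ℤ.- (i ℤ.+ + 1) in eq
        offset w p | + t = t , omega 3 (λ w i t → w ⊖ (i ⊕ # 1) ≐ t ⇛ i ⊕ # 1 ⊕ t ≐ w) w i (+ t) eq
        offset w () | -[1+ _ ]

    -- Searching upwards is enough: the reflection i ↦ - e - i turns the upper end of the gap of - e
    -- - i into the lower end of the gap of i.
    findGap : ∀ i → Σ ℤ λ a → Σ ℤ λ b → a ℤ.≤ i × i ℤ.+ + 1 ℤ.≤ b × Gap h a b (h i)
    findGap i with up i | up (ℤ.- e ℤ.- i)
    ... | b , i<b , hb , run | b′ , i′<b′ , hb′ , run′ = + 1 ℤ.- e ℤ.- b′ , b , a≤i , i<b , gap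
      (omega 3 (λ a i b → a ≼ i ⇛ i ⊕ # 1 ≼ b ⇛ a ⊕ # 1 ≼ b) (+ 1 ℤ.- e ℤ.- b′) i b a≤i i<b)
      (trans (trans (cong h (omega 2 (λ b e → # 1 ⊖ e ⊖ b ⊖ # 1 ≐ ⊝ e ⊖ b) b′ e)) (reflect b′)) (trans hb′ (cong not (reflect i))))
      hb all
      where
      a≤i : + 1 ℤ.- e ℤ.- b′ ℤ.≤ i
      a≤i = omega 3 (λ i b e → ⊝ e ⊖ i ⊕ # 1 ≼ b ⇛ # 1 ⊖ e ⊖ b ≼ i) i b′ e i′<b′
      all : ∀ k → + 1 ℤ.- e ℤ.- b′ ℤ.≤ k → k ℤ.+ + 1 ℤ.≤ b → h k ≡ h i
      all k p q with i ℤ.≤? k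
      ... | yes i≤k = run k i≤k q
      ... | no i≰k = trans (sym (reflect k)) (trans (run′ (ℤ.- e ℤ.- k)
        (omega 3 (λ i k e → (i ≼ k ⇛ ⊥′) ⇛ ⊝ e ⊖ i ≼ ⊝ e ⊖ k) i k e i≰k)
        (omega 3 (λ b k e → # 1 ⊖ e ⊖ b ≼ k ⇛ ⊝ e ⊖ k ⊕ # 1 ≼ b) b′ k e p)) (reflect i))

-- Overlapping gaps share a point and hence their value. Then the ends agree, since otherwise one
-- gap would contain a place just outside the other, where h has the opposite value.
gap-compare : ∀ {h a b v a′ b′ v′} → Gap h a b v → Gap h a′ b′ v′ →
  (a ≡ a′ × b ≡ b′ × v ≡ v′) ⊎ b ℤ.≤ a′ ⊎ b′ ℤ.≤ a
gap-compare {h} {a} {b} {v} {a′} {b′} {v′} G G′ with b ℤ.≤? a′ | b′ ℤ.≤? a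
... | yes p | _ = inj₂ (inj₁ p)
... | no _ | yes q = inj₂ (inj₂ q)
... | no p | no q = inj₁ (a≡a′ , b≡b′ , v≡v′)
  where
  open Gap
  inside : Gap h a b v → Gap h a′ b′ v′ → ¬ (b ℤ.≤ a′) → ¬ (b′ ℤ.≤ a) → v ≡ v′
  inside G G′ p q with a ℤ.≤? a′
  ... | yes a≤a′ = trans (sym (between G a′ a≤a′ (omega 2 (λ a b → (b ≼ a ⇛ ⊥′) ⇛ a ⊕ # 1 ≼ b) a′ b p))) (between G′ a′ ℤₚ.≤-refl (nonempty G′))
  ... | no a≰a′ = trans (sym (between G a ℤₚ.≤-refl (nonempty G))) (between G′ a (omega 2 (λ a b → (a ≼ b ⇛ ⊥′) ⇛ b ≼ a) a a′ a≰a′) (omega 2 (λ a b → (b ≼ a ⇛ ⊥′) ⇛ a ⊕ # 1 ≼ b) a b′ q))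
  v≡v′ : v ≡ v′
  v≡v′ = inside G G′ p q
  left : ∀ {a b v a′ b′} → Gap h a b v → Gap h a′ b′ v → ¬ (b ℤ.≤ a′) → a ℤ.+ + 1 ℤ.≤ a′ → ⊥
  left {a} {b} {v} {a′} G G′ p a<a′ = clash v (between G (a′ ℤ.- + 1)
    (omega 2 (λ a a′ → a ⊕ # 1 ≼ a′ ⇛ a ≼ a′ ⊖ # 1) a a′ a<a′)
    (omega 2 (λ a b → (b ≼ a ⇛ ⊥′) ⇛ a ⊖ # 1 ⊕ # 1 ≼ b) a′ b p)) (before G′)
  right : ∀ {a b v a′ b′} → Gap h a b v → Gap h a′ b′ v → ¬ (b′ ℤ.≤ a) → b′ ℤ.+ + 1 ℤ.≤ b → ⊥
  right {a} {b} {v} {a′} {b′} G G′ q b′<b = clash v (between G b′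
    (omega 2 (λ a b → (b ≼ a ⇛ ⊥′) ⇛ a ≼ b) a b′ q) b′<b) (after G′)
  recolor : ∀ {v v′} → v ≡ v′ → Gap h a′ b′ v′ → Gap h a′ b′ v
  recolor refl G = G
  G″ : Gap h a′ b′ v
  G″ = recolor v≡v′ G′
  a≡a′ : a ≡ a′
  a≡a′ = omega 2 (λ a a′ → (a ⊕ # 1 ≼ a′ ⇛ ⊥′) ⇛ (a′ ⊕ # 1 ≼ a ⇛ ⊥′) ⇛ a ≐ a′) a a′ (left G G″ p) (left G″ G q)
  b≡b′ : b ≡ b′
  b≡b′ = omega 2 (λ a a′ → (a ⊕ # 1 ≼ a′ ⇛ ⊥′) ⇛ (a′ ⊕ # 1 ≼ a ⇛ ⊥′) ⇛ a ≐ a′) b b′ (right G″ G p) (right G G″ q)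

-- Neighbouring gaps have different colours.
gap-apart : ∀ {h a b v a′ b′} → Gap h a b v → Gap h a′ b′ v → b ℤ.≤ a′ → b ℤ.+ + 1 ℤ.≤ a′
gap-apart {h} {a} {b} {v} {a′} G G′ b≤a′ with b ℤ.≟ a′
... | yes refl = ⊥-elim (clash v (Gap.between G′ b ℤₚ.≤-refl (Gap.nonempty G′)) (Gap.after G))
... | no b≢a′ = omega 2 (λ b a → b ≼ a ⇛ (b ≐ a ⇛ ⊥′) ⇛ b ⊕ # 1 ≼ a) b a′ b≤a′ b≢a′

gap-extend : ∀ {h a b v} i → Gap h a b v → a ℤ.≤ i → h (i ℤ.- + 1) ≡ v → a ℤ.≤ i ℤ.- + 1
gap-extend {h} {a} {v = v} i G a≤i hi with a ℤ.≟ i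
... | yes refl = ⊥-elim (clash v hi (Gap.before G))
... | no a≢i = omega 2 (λ a i → a ≼ i ⇛ (a ≐ i ⇛ ⊥′) ⇛ a ≼ i ⊖ # 1) a i a≤i a≢i

≢-trans : ∀ {x y z : Bool} → ¬ (x ≡ y) → ¬ (y ≡ z) → x ≡ z
≢-trans p q = trans (Boolₚ.¬-not p) (sym (Boolₚ.¬-not (λ r → q (sym r))))

module _ {e m n : ℤ} {h : ℤ → Bool} (m≥1 : + 1 ℤ.≤ m) (n≥1 : + 1 ℤ.≤ n) (W : IsWave e m n h) where

  module _ {i₀ j₀ : ℤ} (i₀≢j₀ : ¬ (h i₀ ≡ h j₀)) where

    -- The values at k - 1, k, l - 1, l give u at the four neighbours of the centre. If some
    -- neighbour has u = 0, `around` takes it as a core point, even if it lies outside R. If only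
    -- two opposite neighbours have u = 0, their octagons meet along a line through the centre, and
    -- p or q tells on which side the cell is.
    cover : ∀ z → CellR e m n z → Σ Piece λ P → Good e m n h P × CellIn P z
    cover z@(cell k l p q) r@(r₁ , bp , bq) = go (h (k ℤ.- + 1) Bool.≟ h k) (h (l ℤ.- + 1) Bool.≟ h l) (h k Bool.≟ h l)
      where
      Result : Set
      Result = Σ Piece λ P → Good e m n h P × CellIn P z
      around : ∀ i j → h i ≡ h j →
        (∀ a b c d → a ℤ.≤ i → i ℤ.+ + 1 ℤ.≤ b → c ℤ.≤ j → j ℤ.+ + 1 ℤ.≤ d →
          Gap h a b (h i) → Gap h c d (h j) → CellIn (oct a b c d) z) → Result
      around i j hij f with findGap m≥1 n≥1 W i₀≢j₀ i | findGap m≥1 n≥1 W i₀≢j₀ j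
      ... | a , b , a≤i , i<b , G | c , d , c≤j , j<d , G′ = oct a b c d ,
        (h i , G , subst (Gap h c d) (sym hij) G′ , z , r , inside) , inside
        where
        inside : CellIn (oct a b c d) z
        inside = f a b c d a≤i i<b c≤j j<d G G′
      go : Dec _ → Dec _ → Dec _ → Result
      go (yes s) (yes t) (yes u) = around k l u (λ a b c d a≤ <b c≤ <d G G′ →
        omega 8 (λ a b c d k l p q → bitF p ⇛ bitF q ⇛ a ≼ k ⊖ # 1 ⇛ k ⊕ # 1 ≼ b ⇛ c ≼ l ⊖ # 1 ⇛ l ⊕ # 1 ≼ d ⇛ cellOctF a b c d k l p q)
          a b c d k l p q bp bq (gap-extend k G a≤ s) <b (gap-extend l G′ c≤ t) <d)
      go (yes s) (yes t) (no u) = dia k l , (h k , (s , refl , trans t (hl u) , hl u) ,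
        omega 7 (λ k l p q e m n → cellRectF k l p q e m n ⇛ # 2 ≼ k ⊕ l ⊕ e & k ⊕ l ⊕ e ≼ m ⊕ # 1 & # 1 ≼ k ⊖ l & k ⊖ l ≼ n)
          k l p q e m n r) , (refl , refl)
        where
        hl : ¬ (h k ≡ h l) → h l ≡ not (h k)
        hl u = Boolₚ.¬-not (λ x → u (sym x))
      go (no s) (yes t) (yes u) = around k l u (λ a b c d a≤ <b c≤ <d G G′ →
        omega 8 (λ a b c d k l p q → bitF p ⇛ bitF q ⇛ a ≼ k ⇛ k ⊕ # 1 ≼ b ⇛ c ≼ l ⊖ # 1 ⇛ l ⊕ # 1 ≼ d ⇛ cellOctF a b c d k l p q)
          a b c d k l p q bp bq a≤ <b (gap-extend l G′ c≤ t) <d)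
      go (no s) (yes t) (no u) = around (k ℤ.- + 1) l (≢-trans s u) (λ a b c d a≤ <b c≤ <d G G′ →
        omega 8 (λ a b c d k l p q → bitF p ⇛ bitF q ⇛ a ≼ k ⊖ # 1 ⇛ k ⊖ # 1 ⊕ # 1 ≼ b ⇛ c ≼ l ⊖ # 1 ⇛ l ⊕ # 1 ≼ d ⇛ cellOctF a b c d k l p q)
          a b c d k l p q bp bq a≤ <b (gap-extend l G′ c≤ t) <d)
      go (yes s) (no t) (yes u) = around k l u (λ a b c d a≤ <b c≤ <d G G′ →
        omega 8 (λ a b c d k l p q → bitF p ⇛ bitF q ⇛ a ≼ k ⊖ # 1 ⇛ k ⊕ # 1 ≼ b ⇛ c ≼ l ⇛ l ⊕ # 1 ≼ d ⇛ cellOctF a b c d k l p q)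
          a b c d k l p q bp bq (gap-extend k G a≤ s) <b c≤ <d)
      go (yes s) (no t) (no u) = around k (l ℤ.- + 1) (≢-trans u (λ x → t (sym x))) (λ a b c d a≤ <b c≤ <d G G′ →
        omega 8 (λ a b c d k l p q → bitF p ⇛ bitF q ⇛ a ≼ k ⊖ # 1 ⇛ k ⊕ # 1 ≼ b ⇛ c ≼ l ⊖ # 1 ⇛ l ⊖ # 1 ⊕ # 1 ≼ d ⇛ cellOctF a b c d k l p q)
          a b c d k l p q bp bq (gap-extend k G a≤ s) <b c≤ <d)
      go (no s) (no t) (yes u) = east bp
        where
        east : _ → Result
        east (inj₂ p≡1) = around k l u (λ a b c d a≤ <b c≤ <d G G′ →
          omega 8 (λ a b c d k l p q → p ≐ # 1 ⇛ bitF q ⇛ a ≼ k ⇛ k ⊕ # 1 ≼ b ⇛ c ≼ l ⇛ l ⊕ # 1 ≼ d ⇛ cellOctF a b c d k l p q)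
            a b c d k l p q p≡1 bq a≤ <b c≤ <d)
        east (inj₁ p≡0) = around (k ℤ.- + 1) (l ℤ.- + 1) (trans (Boolₚ.¬-not s) (trans (cong not u) (sym (Boolₚ.¬-not t)))) (λ a b c d a≤ <b c≤ <d G G′ →
          omega 8 (λ a b c d k l p q → p ≐ # 0 ⇛ bitF q ⇛ a ≼ k ⊖ # 1 ⇛ k ⊖ # 1 ⊕ # 1 ≼ b ⇛ c ≼ l ⊖ # 1 ⇛ l ⊖ # 1 ⊕ # 1 ≼ d ⇛ cellOctF a b c d k l p q)
            a b c d k l p q p≡0 bq a≤ <b c≤ <d)
      go (no s) (no t) (no u) = north bq
        where
        north : _ → Result
        north (inj₂ q≡1) = around k (l ℤ.- + 1) (≢-trans u (λ x → t (sym x))) (λ a b c d a≤ <b c≤ <d G G′ →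
          omega 8 (λ a b c d k l p q → bitF p ⇛ q ≐ # 1 ⇛ a ≼ k ⇛ k ⊕ # 1 ≼ b ⇛ c ≼ l ⊖ # 1 ⇛ l ⊖ # 1 ⊕ # 1 ≼ d ⇛ cellOctF a b c d k l p q)
            a b c d k l p q bp q≡1 a≤ <b c≤ <d)
        north (inj₁ q≡0) = around (k ℤ.- + 1) l (≢-trans s u) (λ a b c d a≤ <b c≤ <d G G′ →
          omega 8 (λ a b c d k l p q → bitF p ⇛ q ≐ # 0 ⇛ a ≼ k ⊖ # 1 ⇛ k ⊖ # 1 ⊕ # 1 ≼ b ⇛ c ≼ l ⇛ l ⊕ # 1 ≼ d ⇛ cellOctF a b c d k l p q)
            a b c d k l p q bp q≡0 a≤ <b c≤ <d)

  -- For each of the four lines the first gap is compared with the mirror image of the second one.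
  -- If they coincide, the octagon is symmetric about the line. If they are disjoint, the cell in R
  -- fixes their order, and the distance that separates gaps of the same value keeps the octagon
  -- clear of the line.
  valid : ∀ P → Good e m n h P → Valid e m n P
  valid (oct a b c d) (v , G , G′ , cell k l p q , r , inside) =
    Gap.nonempty G , Gap.nonempty G′ ,
    left (gap-compare G (gap-reflect m≥1 n≥1 W G′)) , right (gap-compare G (gap-shift m≥1 n≥1 W (m ℤ.+ + 1) (IsWave.shiftX W) (gap-reflect m≥1 n≥1 W G′))) ,
    bottom (gap-compare G G′) , top (gap-compare G (gap-shift m≥1 n≥1 W (n ℤ.+ + 1) (IsWave.shiftY W) G′))
    where
    left : _ ⊎ _ ⊎ _ → _
    -- The case b = a + 1 is excluded by the cell: the octagon would be the square of side 2 centred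
    -- on X = 0, which has no interior point in R.
    left (inj₁ (x , y , _)) = inj₁ (omega 11 (λ a b c d k l p q e m n → cellRectF k l p q e m n ⇛ cellOctF a b c d k l p q ⇛
      a ≐ # 1 ⊖ e ⊖ d ⇛ b ≐ # 1 ⊖ e ⊖ c ⇛ symL a b c d e m n) a b c d k l p q e m n r inside x y)
    left (inj₂ (inj₁ x)) = ⊥-elim (omega 11 (λ a b c d k l p q e m n → cellRectF k l p q e m n ⇛ cellOctF a b c d k l p q ⇛
      b ≼ # 1 ⊖ e ⊖ d ⇛ ⊥′) a b c d k l p q e m n r inside x)
    left (inj₂ (inj₂ x)) = inj₂ (omega 3 (λ a c e → # 1 ⊖ e ⊖ c ⊕ # 1 ≼ a ⇛ # 2 ≼ a ⊕ c ⊕ e) a c e (gap-apart (gap-reflect m≥1 n≥1 W G′) G x))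
    right : _ ⊎ _ ⊎ _ → _
    right (inj₁ (x , y , _)) = inj₁ (omega 11 (λ a b c d k l p q e m n → cellRectF k l p q e m n ⇛ cellOctF a b c d k l p q ⇛
      a ≐ # 1 ⊖ e ⊖ d ⊕ (m ⊕ # 1) ⇛ b ≐ # 1 ⊖ e ⊖ c ⊕ (m ⊕ # 1) ⇛ symR a b c d e m n) a b c d k l p q e m n r inside x y)
    right (inj₂ (inj₁ x)) = inj₂ (omega 4 (λ b d e m → b ⊕ # 1 ≼ # 1 ⊖ e ⊖ d ⊕ (m ⊕ # 1) ⇛ b ⊕ d ⊕ e ≼ m ⊕ # 1) b d e m
      (gap-apart G (gap-shift m≥1 n≥1 W (m ℤ.+ + 1) (IsWave.shiftX W) (gap-reflect m≥1 n≥1 W G′)) x))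
    right (inj₂ (inj₂ x)) = ⊥-elim (omega 11 (λ a b c d k l p q e m n → cellRectF k l p q e m n ⇛ cellOctF a b c d k l p q ⇛
      # 1 ⊖ e ⊖ c ⊕ (m ⊕ # 1) ≼ a ⇛ ⊥′) a b c d k l p q e m n r inside x)
    bottom : _ ⊎ _ ⊎ _ → _
    bottom (inj₁ (x , y , _)) = inj₁ (omega 11 (λ a b c d k l p q e m n → cellRectF k l p q e m n ⇛ cellOctF a b c d k l p q ⇛
      a ≐ c ⇛ b ≐ d ⇛ symB a b c d e m n) a b c d k l p q e m n r inside x y)
    bottom (inj₂ (inj₁ x)) = ⊥-elim (omega 11 (λ a b c d k l p q e m n → cellRectF k l p q e m n ⇛ cellOctF a b c d k l p q ⇛
      b ≼ c ⇛ ⊥′) a b c d k l p q e m n r inside x)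
    bottom (inj₂ (inj₂ x)) = inj₂ (omega 2 (λ a d → d ⊕ # 1 ≼ a ⇛ # 1 ≼ a ⊖ d) a d (gap-apart G′ G x))
    top : _ ⊎ _ ⊎ _ → _
    top (inj₁ (x , y , _)) = inj₁ (omega 11 (λ a b c d k l p q e m n → cellRectF k l p q e m n ⇛ cellOctF a b c d k l p q ⇛
      a ≐ c ⊕ (n ⊕ # 1) ⇛ b ≐ d ⊕ (n ⊕ # 1) ⇛ symT a b c d e m n) a b c d k l p q e m n r inside x y)
    top (inj₂ (inj₁ x)) = inj₂ (omega 3 (λ b c n → b ⊕ # 1 ≼ c ⊕ (n ⊕ # 1) ⇛ b ⊖ c ≼ n) b c n
      (gap-apart G (gap-shift m≥1 n≥1 W (n ℤ.+ + 1) (IsWave.shiftY W) G′) x))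
    top (inj₂ (inj₂ x)) = ⊥-elim (omega 11 (λ a b c d k l p q e m n → cellRectF k l p q e m n ⇛ cellOctF a b c d k l p q ⇛
      d ⊕ (n ⊕ # 1) ≼ a ⇛ ⊥′) a b c d k l p q e m n r inside x)
  valid (dia k l) (v , (k₁ , k₂ , l₁ , l₂) , r) = omega 5 (λ k l e m n →
    (# 2 ≼ k ⊕ l ⊕ e & k ⊕ l ⊕ e ≼ m ⊕ # 1 & # 1 ≼ k ⊖ l & k ⊖ l ≼ n) ⇛
    (k ⊕ l ⊕ e ≐ # 2 ⇛ ⊥′) ⇛ (k ⊕ l ⊕ e ≐ m ⊕ # 1 ⇛ ⊥′) ⇛ (k ⊖ l ≐ # 1 ⇛ ⊥′) ⇛ (k ⊖ l ≐ n ⇛ ⊥′) ⇛ validDiaF k l e m n)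
    k l e m n r
    -- A centre on a side of R would have a neighbour on the adjacent line of reflection, where the
    -- symmetry of h forces u = 0.
    (λ x → clash v k₁ (trans (sym (reflect (k ℤ.- + 1)))
      (trans (cong h (omega 3 (λ k l e → k ⊕ l ⊕ e ≐ # 2 ⇛ ⊝ e ⊖ (k ⊖ # 1) ≐ l ⊖ # 1) k l e x)) l₁)))
    (λ x → clash v k₂ (trans (sym (reflectX m≥1 n≥1 W k))
      (trans (cong h (omega 4 (λ k l e m → k ⊕ l ⊕ e ≐ m ⊕ # 1 ⇛ m ⊕ # 1 ⊖ e ⊖ k ≐ l) k l e m x)) l₂)))
    (λ x → clash v k₁ (trans (cong h (omega 2 (λ k l → k ⊖ l ≐ # 1 ⇛ k ⊖ # 1 ≐ l) k l x)) l₂))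
    (λ x → clash v k₂ (trans (trans (cong h (omega 3 (λ k l n → k ⊖ l ≐ n ⇛ k ≐ l ⊖ # 1 ⊕ (n ⊕ # 1)) k l n x)) (shiftY (l ℤ.- + 1))) l₁))
    where
    open IsWave W

InF : (e m n : ℤ) → Piece → (X Y Q : ℤ) → Set
InF e m n P X Y Q = InPiece e m n P X Y Q (+ 1)

module _ {e m n : ℤ} {h : ℤ → Bool} where

  private
    scale-≤ : ∀ Q x y → + 0 ℤ.≤ Q → x ℤ.≤ y → x ℤ.* Q ℤ.≤ y ℤ.* Q
    scale-≤ Q x y Q≥0 x≤y = ℤₚ.*-monoʳ-≤-nonNeg Q {{ℤ.nonNegative Q≥0}} x≤y

  -- For a ≤ k ≤ b at least one of k - 1 and k is in the gap, and they carry the same value.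
  dia-inside-gap : ∀ {a b v w} k → Gap h a b v → h (k ℤ.- + 1) ≡ w → h k ≡ w → a ℤ.≤ k → k ℤ.≤ b → w ≡ v
  dia-inside-gap {a} {b} {v} {w} k G p q a≤k k≤b with a ℤ.≟ k | k ℤ.≟ b
  ... | yes refl | _ = trans (sym q) (Gap.between G k a≤k (Gap.nonempty G))
  ... | no _ | yes refl = trans (sym p) (Gap.between G (k ℤ.- + 1)
    (omega 2 (λ a b → a ⊕ # 1 ≼ b ⇛ a ≼ b ⊖ # 1) a b (Gap.nonempty G)) (omega 1 (λ k → k ⊖ # 1 ⊕ # 1 ≼ k) k))
  ... | no _ | no k≢b = trans (sym q) (Gap.between G k a≤k (omega 2 (λ k b → k ≼ b ⇛ (k ≐ b ⇛ ⊥′) ⇛ k ⊕ # 1 ≼ b) k b k≤b k≢b))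

  -- 2a - 2 < 2k as soon as some point has 2a - 2 < s / Q < 2k
  unscale : ∀ Q a b s → + 0 ℤ.< Q → (+ 2 ℤ.* a ℤ.- + 2 ℤ.+ e) ℤ.* Q ℤ.+ + 1 ℤ.≤ s → s ℤ.+ + 1 ℤ.≤ (+ 2 ℤ.* b ℤ.+ e) ℤ.* Q → a ℤ.≤ b
  unscale Q a b s Q>0 p q with a ℤ.≤? b
  ... | yes a≤b = a≤b
  ... | no a≰b = ⊥-elim (omega 5 (λ Q a b s e → (# 2 ⊗ a ⊖ # 2 ⊕ e) ⊗ Q ⊕ # 1 ≼ s ⇛ s ⊕ # 1 ≼ (# 2 ⊗ b ⊕ e) ⊗ Q ⇛ (b ⊕ # 1) ⊗ Q ≼ a ⊗ Q ⇛ ⊥′)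
    Q a b s e p q (scale-≤ Q (b ℤ.+ + 1) a (ℤₚ.<⇒≤ Q>0) (omega 2 (λ a b → (a ≼ b ⇛ ⊥′) ⇛ b ⊕ # 1 ≼ a) a b a≰b)))

  -- A common interior point puts k in the reach of the first gap and l in that of the second, so
  -- the two gaps would have the opposite values w and `not w`.
  disjoint-dia : ∀ a b c d k l X Y Q → + 0 ℤ.< Q → Good e m n h (oct a b c d) → Good e m n h (dia k l) →
    InF e m n (oct a b c d) X Y Q → InF e m n (dia k l) X Y Q → ⊥
  disjoint-dia a b c d k l X Y Q Q>0 (v , G , G′ , _) (w , (k₁ , k₂ , l₁ , l₂) , _) ((s₁ , s₂ , t₁ , t₂ , _) , _) (s₃ , s₄ , t₃ , t₄) =
    not-fixed (trans w≡v (sym w′≡v))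
    where
    w≡v : w ≡ v
    w≡v = dia-inside-gap k G k₁ k₂ (unscale Q a k (X ℤ.+ Y) Q>0 s₁ s₄) (unscale Q k b (X ℤ.+ Y) Q>0 s₃ s₂)
    w′≡v : not w ≡ v
    w′≡v = dia-inside-gap l G′ l₁ l₂ (unscale Q c l (X ℤ.- Y) Q>0 t₁ t₄) (unscale Q l d (X ℤ.- Y) Q>0 t₃ t₂)
    not-fixed : ∀ {w} → w ≡ not w → ⊥
    not-fixed {true} ()
    not-fixed {false} ()

  -- If two octagons agree in one gap, all four gaps have the same value, so the other two are at
  -- least 1 apart and a diagonal line separates the octagons. If they differ in both gaps, the
  -- values may be different and the gaps adjacent, but then an axis-parallel line separates the
  -- octagons.
  disjoint : ∀ P P′ X Y Q → + 0 ℤ.< Q → Good e m n h P → Good e m n h P′ → InF e m n P X Y Q → InF e m n P′ X Y Q → P ≡ P′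
  disjoint (dia k l) (dia k′ l′) X Y Q Q>0 _ _ (s₁ , s₂ , t₁ , t₂) (s₃ , s₄ , t₃ , t₄) = cong₂ dia
    (ℤₚ.≤-antisym (unscale Q k k′ (X ℤ.+ Y) Q>0 s₁ s₄) (unscale Q k′ k (X ℤ.+ Y) Q>0 s₃ s₂))
    (ℤₚ.≤-antisym (unscale Q l l′ (X ℤ.- Y) Q>0 t₁ t₄) (unscale Q l′ l (X ℤ.- Y) Q>0 t₃ t₂))
  disjoint (dia k l) (oct a b c d) X Y Q Q>0 g g′ i i′ = ⊥-elim (disjoint-dia a b c d k l X Y Q Q>0 g′ g i′ i)
  disjoint (oct a b c d) (dia k l) X Y Q Q>0 g g′ i i′ = ⊥-elim (disjoint-dia a b c d k l X Y Q Q>0 g g′ i i′)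
  disjoint (oct a b c d) (oct a′ b′ c′ d′) X Y Q Q>0 (v , A , C , _) (v′ , A′ , C′ , _) i i′ =
    go (gap-compare A A′) (gap-compare C C′)
    where
    Q≥0 : + 0 ℤ.≤ Q
    Q≥0 = ℤₚ.<⇒≤ Q>0
    far : ∀ {x y z w u u′} → Gap h x y u → Gap h z w u′ → u ≡ u′ → y ℤ.≤ z → (y ℤ.+ + 1) ℤ.* Q ℤ.≤ z ℤ.* Q
    far {y = y} {z = z} G G′ refl p = scale-≤ Q (y ℤ.+ + 1) z Q≥0 (gap-apart G G′ p)
    go : (a ≡ a′ × b ≡ b′ × v ≡ v′) ⊎ b ℤ.≤ a′ ⊎ b′ ℤ.≤ a → (c ≡ c′ × d ≡ d′ × v ≡ v′) ⊎ d ℤ.≤ c′ ⊎ d′ ℤ.≤ c → oct a b c d ≡ oct a′ b′ c′ d′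
    go (inj₁ (refl , refl , _)) (inj₁ (refl , refl , _)) = refl
    go (inj₁ (_ , _ , e₁)) (inj₂ (inj₁ p)) = ⊥-elim (omega 12 (λ a b c d a′ b′ c′ d′ e X Y Q →
      octF a b c d e X Y Q (# 1) ⇛ octF a′ b′ c′ d′ e X Y Q (# 1) ⇛ (d ⊕ # 1) ⊗ Q ≼ c′ ⊗ Q ⇛ ⊥′) a b c d a′ b′ c′ d′ e X Y Q (proj₁ i) (proj₁ i′) (far C C′ e₁ p))
    go (inj₁ (_ , _ , e₁)) (inj₂ (inj₂ p)) = ⊥-elim (omega 12 (λ a b c d a′ b′ c′ d′ e X Y Q →
      octF a b c d e X Y Q (# 1) ⇛ octF a′ b′ c′ d′ e X Y Q (# 1) ⇛ (d′ ⊕ # 1) ⊗ Q ≼ c ⊗ Q ⇛ ⊥′) a b c d a′ b′ c′ d′ e X Y Q (proj₁ i) (proj₁ i′) (far C′ C (sym e₁) p))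
    go (inj₂ (inj₁ p)) (inj₁ (_ , _ , e₁)) = ⊥-elim (omega 12 (λ a b c d a′ b′ c′ d′ e X Y Q →
      octF a b c d e X Y Q (# 1) ⇛ octF a′ b′ c′ d′ e X Y Q (# 1) ⇛ (b ⊕ # 1) ⊗ Q ≼ a′ ⊗ Q ⇛ ⊥′) a b c d a′ b′ c′ d′ e X Y Q (proj₁ i) (proj₁ i′) (far A A′ e₁ p))
    go (inj₂ (inj₂ p)) (inj₁ (_ , _ , e₁)) = ⊥-elim (omega 12 (λ a b c d a′ b′ c′ d′ e X Y Q →
      octF a b c d e X Y Q (# 1) ⇛ octF a′ b′ c′ d′ e X Y Q (# 1) ⇛ (b′ ⊕ # 1) ⊗ Q ≼ a ⊗ Q ⇛ ⊥′) a b c d a′ b′ c′ d′ e X Y Q (proj₁ i) (proj₁ i′) (far A′ A (sym e₁) p))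
    go (inj₂ (inj₁ p)) (inj₂ (inj₁ q)) = ⊥-elim (omega 12 (λ a b c d a′ b′ c′ d′ e X Y Q →
      octF a b c d e X Y Q (# 1) ⇛ octF a′ b′ c′ d′ e X Y Q (# 1) ⇛ b ⊗ Q ≼ a′ ⊗ Q ⇛ d ⊗ Q ≼ c′ ⊗ Q ⇛ ⊥′) a b c d a′ b′ c′ d′ e X Y Q (proj₁ i) (proj₁ i′) (scale-≤ Q _ _ Q≥0 p) (scale-≤ Q _ _ Q≥0 q))
    go (inj₂ (inj₁ p)) (inj₂ (inj₂ q)) = ⊥-elim (omega 12 (λ a b c d a′ b′ c′ d′ e X Y Q →
      octF a b c d e X Y Q (# 1) ⇛ octF a′ b′ c′ d′ e X Y Q (# 1) ⇛ b ⊗ Q ≼ a′ ⊗ Q ⇛ d′ ⊗ Q ≼ c ⊗ Q ⇛ ⊥′) a b c d a′ b′ c′ d′ e X Y Q (proj₁ i) (proj₁ i′) (scale-≤ Q _ _ Q≥0 p) (scale-≤ Q _ _ Q≥0 q))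
    go (inj₂ (inj₂ p)) (inj₂ (inj₁ q)) = ⊥-elim (omega 12 (λ a b c d a′ b′ c′ d′ e X Y Q →
      octF a b c d e X Y Q (# 1) ⇛ octF a′ b′ c′ d′ e X Y Q (# 1) ⇛ b′ ⊗ Q ≼ a ⊗ Q ⇛ d ⊗ Q ≼ c′ ⊗ Q ⇛ ⊥′) a b c d a′ b′ c′ d′ e X Y Q (proj₁ i) (proj₁ i′) (scale-≤ Q _ _ Q≥0 p) (scale-≤ Q _ _ Q≥0 q))
    go (inj₂ (inj₂ p)) (inj₂ (inj₂ q)) = ⊥-elim (omega 12 (λ a b c d a′ b′ c′ d′ e X Y Q →
      octF a b c d e X Y Q (# 1) ⇛ octF a′ b′ c′ d′ e X Y Q (# 1) ⇛ b′ ⊗ Q ≼ a ⊗ Q ⇛ d′ ⊗ Q ≼ c ⊗ Q ⇛ ⊥′) a b c d a′ b′ c′ d′ e X Y Q (proj₁ i) (proj₁ i′) (scale-≤ Q _ _ Q≥0 p) (scale-≤ Q _ _ Q≥0 q))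

-- The kernel

module _ {c : Color} {m n : ℕ} (u : V c m n) where

  OnPoint : ℤ → ℤ → Set
  OnPoint x y = Σ (Fin m) λ i → Σ (Fin n) λ j → Σ (colorG (i , j) ≡ c) λ e →
    x ≡ + toℕ i × y ≡ + toℕ j × val u x y ≡ u ((i , j) , e)

  val-view : ∀ x y → val u x y ≡ false ⊎ OnPoint x y
  val-view -[1+ _ ] _ = inj₁ refl
  val-view (+ _) -[1+ _ ] = inj₁ refl
  val-view (+ i) (+ j) with i ℕ.<? m | j ℕ.<? n
  ... | no _ | _ = inj₁ refl
  ... | yes _ | no _ = inj₁ refl
  ... | yes i<m | yes j<n with decColor (colorG {m} {n} (fromℕ< i<m , fromℕ< j<n)) c
  ...   | same e = inj₂ (fromℕ< i<m , fromℕ< j<n , e , cong +_ (sym (Finₚ.toℕ-fromℕ< i<m)) , cong +_ (sym (Finₚ.toℕ-fromℕ< j<n)) , refl)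
  ...   | diff _ = inj₁ refl

  val-at : ∀ i j (e : colorG (i , j) ≡ c) → val u (+ toℕ i) (+ toℕ j) ≡ u ((i , j) , e)
  val-at i j e with toℕ i ℕ.<? m | toℕ j ℕ.<? n
  ... | no i≮m | _ = ⊥-elim (i≮m (Finₚ.toℕ<n i))
  ... | yes _ | no j≮n = ⊥-elim (j≮n (Finₚ.toℕ<n j))
  ... | yes i<m | yes j<n with decColor (colorG {m} {n} (fromℕ< i<m , fromℕ< j<n)) c
  ...   | same e′ = transport (Finₚ.fromℕ<-toℕ i i<m) (Finₚ.fromℕ<-toℕ j j<n) e′
    where
    transport : ∀ {i′ j′} → i′ ≡ i → j′ ≡ j → ∀ e′ → u ((i′ , j′) , e′) ≡ u ((i , j) , e)
    transport refl refl e′ = cong (λ e → u ((i , j) , e)) (uip e′ e)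
  ...   | diff ne = ⊥-elim (ne (trans (cong₂ (λ i j → colorG (i , j)) (Finₚ.fromℕ<-toℕ i i<m) (Finₚ.fromℕ<-toℕ j j<n)) e))

  val-outside : ∀ x y → (⟦ # 0 ≼ cst x & cst x ⊕ # 1 ≼ # m & # 0 ≼ cst y & cst y ⊕ # 1 ≼ # n ⟧ [] → ⊥) → val u x y ≡ false
  val-outside x y out with val-view x y
  ... | inj₁ e = e
  ... | inj₂ (i , j , _ , refl , refl , _) = ⊥-elim (out (ℤ.+≤+ ℕ.z≤n , below (Finₚ.toℕ<n i) , ℤ.+≤+ ℕ.z≤n , below (Finₚ.toℕ<n j)))
    where
    below : ∀ {i m} → i ℕ.< m → + i ℤ.+ + 1 ℤ.≤ + m
    below {i} {m} i<m = ℤ.+≤+ (subst (ℕ._≤ m) (ℕₚ.+-comm 1 i) i<m)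

  val-parity : ∀ x y k → x ℤ.+ y ≡ + 2 ℤ.* k ℤ.+ eps c ℤ.+ + 1 → val u x y ≡ false
  val-parity x y k h with val-view x y
  ... | inj₁ e = e
  ... | inj₂ (i , j , e , refl , refl , _) with color-index (+ toℕ i ℤ.+ + toℕ j) c e
  ...   | k′ , h′ = ⊥-elim (omega 3 (λ k k′ e → # 2 ⊗ k′ ⊕ e ≐ # 2 ⊗ k ⊕ e ⊕ # 1 ⇛ ⊥′) k k′ (eps c) (trans (sym h′) h))

opp-eps : ∀ z c k → z ≡ + 2 ℤ.* k ℤ.+ eps (opp c) → Σ ℤ λ k → z ≡ + 2 ℤ.* k ℤ.+ eps c ℤ.+ + 1
opp-eps z black k h = k , trans h (omega 1 (λ k → # 2 ⊗ k ⊕ # 1 ≐ # 2 ⊗ k ⊕ # 0 ⊕ # 1) k)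
opp-eps z white k h = k ℤ.- + 1 , trans h (omega 1 (λ k → # 2 ⊗ k ⊕ # 0 ≐ # 2 ⊗ (k ⊖ # 1) ⊕ # 1 ⊕ # 1) k)

-- The kernel equation holds at all points: where it is not required, all
-- terms vanish.
module _ {c : Color} {m n : ℕ} (u : V c m n) (ker : ∀ w → adj u w ≡ false) where

  Balanced : ℤ → ℤ → Set
  Balanced x y = val u (x ℤ.- + 1) y xor val u (x ℤ.+ + 1) y xor val u x (y ℤ.- + 1) xor val u x (y ℤ.+ + 1) ≡ false

  kernel-at : ∀ (i : Fin m) (j : Fin n) → Balanced (+ toℕ i) (+ toℕ j)
  kernel-at i j with decColor (colorG (i , j)) (opp c)
  ... | same e = ker ((i , j) , e)
  ... | diff ne with color-index (+ toℕ i ℤ.+ + toℕ j) c (not-opp c _ ne)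
    where
    not-opp : ∀ c d → ¬ (d ≡ opp c) → d ≡ c
    not-opp black black _ = refl
    not-opp black white p = ⊥-elim (p refl)
    not-opp white black p = ⊥-elim (p refl)
    not-opp white white _ = refl
  ...   | k , h rewrite val-parity u (+ toℕ i ℤ.- + 1) (+ toℕ j) (k ℤ.- + 1) (omega 4 (λ x y k e → x ⊕ y ≐ # 2 ⊗ k ⊕ e ⇛ x ⊖ # 1 ⊕ y ≐ # 2 ⊗ (k ⊖ # 1) ⊕ e ⊕ # 1) (+ toℕ i) (+ toℕ j) k (eps c) h)
                      | val-parity u (+ toℕ i ℤ.+ + 1) (+ toℕ j) k (omega 4 (λ x y k e → x ⊕ y ≐ # 2 ⊗ k ⊕ e ⇛ x ⊕ # 1 ⊕ y ≐ # 2 ⊗ k ⊕ e ⊕ # 1) (+ toℕ i) (+ toℕ j) k (eps c) h)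
                      | val-parity u (+ toℕ i) (+ toℕ j ℤ.- + 1) (k ℤ.- + 1) (omega 4 (λ x y k e → x ⊕ y ≐ # 2 ⊗ k ⊕ e ⇛ x ⊕ (y ⊖ # 1) ≐ # 2 ⊗ (k ⊖ # 1) ⊕ e ⊕ # 1) (+ toℕ i) (+ toℕ j) k (eps c) h)
                      | val-parity u (+ toℕ i) (+ toℕ j ℤ.+ + 1) k (omega 4 (λ x y k e → x ⊕ y ≐ # 2 ⊗ k ⊕ e ⇛ x ⊕ (y ⊕ # 1) ≐ # 2 ⊗ k ⊕ e ⊕ # 1) (+ toℕ i) (+ toℕ j) k (eps c) h) = refl

  kernel : ∀ x y → ⟦ # 0 ≼ cst x & cst x ⊕ # 1 ≼ # m & # 0 ≼ cst y & cst y ⊕ # 1 ≼ # n ⟧ [] → Balanced x y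
  kernel (+ x) (+ y) (_ , x<m , _ , y<n) = subst₂ Balanced
    (cong +_ (Finₚ.toℕ-fromℕ< (above x<m))) (cong +_ (Finₚ.toℕ-fromℕ< (above y<n)))
    (kernel-at (fromℕ< (above x<m)) (fromℕ< (above y<n)))
    where
    above : ∀ {i m} → + i ℤ.+ + 1 ℤ.≤ + m → i ℕ.< m
    above {i} {m} (ℤ.+≤+ h) = subst (ℕ._≤ m) (ℕₚ.+-comm i 1) h

-- Functions on ℤ that are even and have period 2M are given by their values
-- on [0 , M].
module Fold (m : ℕ) where

  private
    M : ℕ
    M = suc m
    M≥1 : 1 ℕ.≤ M
    M≥1 = ℕ.s≤s ℕ.z≤n

  Class : ℕ → ℤ → Set
  Class t z = Σ ℤ λ q → z ≡ + t ℤ.+ q ℤ.* (+ 2 ℤ.* + M) ⊎ z ≡ ℤ.- + t ℤ.+ q ℤ.* (+ 2 ℤ.* + M)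

  representative : ∀ z → Σ ℕ λ t → t ℕ.≤ M × Class t z
  representative z = go (r ℕ.≤? M)
    where
    L r : ℕ
    L = 2 ℕ.* M
    r = z %ℕ L
    q = z /ℕ L
    e : z ≡ + r ℤ.+ q ℤ.* (+ 2 ℤ.* + M)
    e = trans (a≡a%ℕn+[a/ℕn]*n z L) (cong (λ l → + r ℤ.+ q ℤ.* l) (ℤₚ.pos-* 2 M))
    go : Dec (r ℕ.≤ M) → Σ ℕ λ t → t ℕ.≤ M × Σ ℤ λ q → z ≡ + t ℤ.+ q ℤ.* (+ 2 ℤ.* + M) ⊎ z ≡ ℤ.- + t ℤ.+ q ℤ.* (+ 2 ℤ.* + M)
    go (yes p) = r , p , q , inj₁ e
    go (no p) = L ℕ.∸ r , bound , q ℤ.+ + 1 , inj₂ (trans e (trans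
      (omega 3 (λ r q M → r ⊕ q ⊗ (# 2 ⊗ M) ≐ ⊝ (# 2 ⊗ M ⊖ r) ⊕ (q ⊕ # 1) ⊗ (# 2 ⊗ M)) (+ r) q (+ M))
      (cong (λ t → ℤ.- t ℤ.+ (q ℤ.+ + 1) ℤ.* (+ 2 ℤ.* + M)) (sym difference))))
      where
      r<L : r ℕ.< L
      r<L = n%ℕd<d z L
      difference : + (L ℕ.∸ r) ≡ + 2 ℤ.* + M ℤ.- + r
      difference = trans (sym (ℤₚ.⊖-≥ (ℕₚ.<⇒≤ r<L))) (trans (sym (ℤₚ.m-n≡m⊖n L r)) (cong (λ l → l ℤ.- + r) (ℤₚ.pos-* 2 M)))
      bound : L ℕ.∸ r ℕ.≤ M
      bound = ℤₚ.drop‿+≤+ (subst (ℤ._≤ + M) (sym difference)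
        (omega 2 (λ M r → M ≼ r ⇛ # 2 ⊗ M ⊖ r ≼ M) (+ M) (+ r) (ℤ.+≤+ (ℕₚ.<⇒≤ (ℕₚ.≰⇒> p)))))

  -- The interval [0 , M] is a fundamental domain for the reflections in 0 and M. The product q M is
  -- not linear, so its bounds are supplied separately for q ≤ -1, q ≥ 1 and q = 0.
  unique : ∀ s t → s ℕ.≤ M → t ℕ.≤ M → Class t (+ s) → s ≡ t
  unique s t s≤M t≤M (q , h) = ℤₚ.+-injective (go (q ℤ.≤? -[1+ 0 ]) (+ 1 ℤ.≤? q))
    where
    uniqueF : (s t q M : Expr) → Form
    uniqueF s t q M = # 0 ≼ s ⇛ # 0 ≼ t ⇛ s ≼ M ⇛ t ≼ M ⇛ (s ≐ t ⊕ q ⊗ (# 2 ⊗ M) ∥ s ≐ ⊝ t ⊕ q ⊗ (# 2 ⊗ M)) ⇛ s ≐ t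
    nat : ∀ {k} → + 0 ℤ.≤ + k
    nat = ℤ.+≤+ ℕ.z≤n
    1≤M : + 1 ℤ.≤ + M
    1≤M = ℤ.+≤+ M≥1
    go : Dec (q ℤ.≤ -[1+ 0 ]) → Dec (+ 1 ℤ.≤ q) → + s ≡ + t
    go (yes p) _ = omega 4 (λ s t q M → # 1 ≼ M ⇛ q ⊗ M ≼ ⊝ # 1 ⊗ M ⇛ uniqueF s t q M) (+ s) (+ t) q (+ M) 1≤M (ℤₚ.*-monoʳ-≤-nonNeg (+ M) p) nat nat (ℤ.+≤+ s≤M) (ℤ.+≤+ t≤M) h
    go (no _) (yes p) = omega 4 (λ s t q M → # 1 ≼ M ⇛ # 1 ⊗ M ≼ q ⊗ M ⇛ uniqueF s t q M) (+ s) (+ t) q (+ M) 1≤M (ℤₚ.*-monoʳ-≤-nonNeg (+ M) p) nat nat (ℤ.+≤+ s≤M) (ℤ.+≤+ t≤M) h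
    go (no p₁) (no p₂) = omega 4 (λ s t q M → q ⊗ M ≐ # 0 ⊗ M ⇛ uniqueF s t q M) (+ s) (+ t) q (+ M)
      (cong (ℤ._* + M) (omega 1 (λ q → (q ≼ ⊝ # 1 ⇛ ⊥′) ⇛ (# 1 ≼ q ⇛ ⊥′) ⇛ q ≐ # 0) q p₁ p₂)) nat nat (ℤ.+≤+ s≤M) (ℤ.+≤+ t≤M) h

  module Values (g : ℕ → Bool) where

    H : ℤ → Bool
    H z = g (proj₁ (representative z))

    class-H : ∀ t z → t ℕ.≤ M → Class t z → H z ≡ g t
    class-H t z t≤M (q , h) with representative z
    ... | s , s≤M , q′ , h′ = cong g (unique s t s≤M t≤M (combine h h′))
      where
      combine : z ≡ + t ℤ.+ q ℤ.* (+ 2 ℤ.* + M) ⊎ z ≡ ℤ.- + t ℤ.+ q ℤ.* (+ 2 ℤ.* + M) →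
                z ≡ + s ℤ.+ q′ ℤ.* (+ 2 ℤ.* + M) ⊎ z ≡ ℤ.- + s ℤ.+ q′ ℤ.* (+ 2 ℤ.* + M) → Class t (+ s)
      combine (inj₁ h) (inj₁ h′) = q ℤ.- q′ , inj₁ (omega 6 (λ z s t q q′ M → z ≐ t ⊕ q ⊗ (# 2 ⊗ M) ⇛ z ≐ s ⊕ q′ ⊗ (# 2 ⊗ M) ⇛ s ≐ t ⊕ (q ⊖ q′) ⊗ (# 2 ⊗ M)) z (+ s) (+ t) q q′ (+ M) h h′)
      combine (inj₁ h) (inj₂ h′) = q′ ℤ.- q , inj₂ (omega 6 (λ z s t q q′ M → z ≐ t ⊕ q ⊗ (# 2 ⊗ M) ⇛ z ≐ ⊝ s ⊕ q′ ⊗ (# 2 ⊗ M) ⇛ s ≐ ⊝ t ⊕ (q′ ⊖ q) ⊗ (# 2 ⊗ M)) z (+ s) (+ t) q q′ (+ M) h h′)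
      combine (inj₂ h) (inj₁ h′) = q ℤ.- q′ , inj₂ (omega 6 (λ z s t q q′ M → z ≐ ⊝ t ⊕ q ⊗ (# 2 ⊗ M) ⇛ z ≐ s ⊕ q′ ⊗ (# 2 ⊗ M) ⇛ s ≐ ⊝ t ⊕ (q ⊖ q′) ⊗ (# 2 ⊗ M)) z (+ s) (+ t) q q′ (+ M) h h′)
      combine (inj₂ h) (inj₂ h′) = q′ ℤ.- q , inj₁ (omega 6 (λ z s t q q′ M → z ≐ ⊝ t ⊕ q ⊗ (# 2 ⊗ M) ⇛ z ≐ ⊝ s ⊕ q′ ⊗ (# 2 ⊗ M) ⇛ s ≐ t ⊕ (q′ ⊖ q) ⊗ (# 2 ⊗ M)) z (+ s) (+ t) q q′ (+ M) h h′)

    H-small : ∀ t → t ℕ.≤ M → H (+ t) ≡ g t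
    H-small t t≤M = class-H t (+ t) t≤M (+ 0 , inj₁ (omega 2 (λ t M → t ≐ t ⊕ # 0 ⊗ (# 2 ⊗ M)) (+ t) (+ M)))

    H-period : ∀ z k → H (z ℤ.+ k ℤ.* (+ 2 ℤ.* + M)) ≡ H z
    H-period z k with representative z
    ... | t , t≤M , q , inj₁ h = class-H t (z ℤ.+ k ℤ.* (+ 2 ℤ.* + M)) t≤M (q ℤ.+ k , inj₁ (omega 5 (λ z t q k M → z ≐ t ⊕ q ⊗ (# 2 ⊗ M) ⇛ z ⊕ k ⊗ (# 2 ⊗ M) ≐ t ⊕ (q ⊕ k) ⊗ (# 2 ⊗ M)) z (+ t) q k (+ M) h))
    ... | t , t≤M , q , inj₂ h = class-H t (z ℤ.+ k ℤ.* (+ 2 ℤ.* + M)) t≤M (q ℤ.+ k , inj₂ (omega 5 (λ z t q k M → z ≐ ⊝ t ⊕ q ⊗ (# 2 ⊗ M) ⇛ z ⊕ k ⊗ (# 2 ⊗ M) ≐ ⊝ t ⊕ (q ⊕ k) ⊗ (# 2 ⊗ M)) z (+ t) q k (+ M) h))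

    H-even : ∀ z → H (ℤ.- z) ≡ H z
    H-even z with representative z
    ... | t , t≤M , q , inj₁ h = class-H t (ℤ.- z) t≤M (ℤ.- q , inj₂ (omega 4 (λ z t q M → z ≐ t ⊕ q ⊗ (# 2 ⊗ M) ⇛ ⊝ z ≐ ⊝ t ⊕ (⊝ q) ⊗ (# 2 ⊗ M)) z (+ t) q (+ M) h))
    ... | t , t≤M , q , inj₂ h = class-H t (ℤ.- z) t≤M (ℤ.- q , inj₁ (omega 4 (λ z t q M → z ≐ ⊝ t ⊕ q ⊗ (# 2 ⊗ M) ⇛ ⊝ z ≐ t ⊕ (⊝ q) ⊗ (# 2 ⊗ M)) z (+ t) q (+ M) h))

xor-cancel : ∀ p q → (p xor q) xor p ≡ q
xor-cancel false false = refl
xor-cancel false true  = refl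
xor-cancel true  false = refl
xor-cancel true  true  = refl

-- The terms p and s occur twice in the sum and cancel.
xor-step : ∀ p q r s {a b c d} → a ≡ p xor q → b ≡ r xor s → c ≡ p xor s → a xor b xor c xor d ≡ false → d ≡ r xor q
xor-step false false false false {d = false} refl refl refl _ = refl
xor-step false false false true  {d = false} refl refl refl _ = refl
xor-step false false true  false {d = true}  refl refl refl _ = refl
xor-step false false true  true  {d = true}  refl refl refl _ = refl
xor-step false true  false false {d = true}  refl refl refl _ = refl
xor-step false true  false true  {d = true}  refl refl refl _ = refl
xor-step false true  true  false {d = false} refl refl refl _ = refl
xor-step false true  true  true  {d = false} refl refl refl _ = refl
xor-step true  false false false {d = false} refl refl refl _ = refl
xor-step true  false false true  {d = false} refl refl refl _ = refl
xor-step true  false true  false {d = true}  refl refl refl _ = refl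
xor-step true  false true  true  {d = true}  refl refl refl _ = refl
xor-step true  true  false false {d = true}  refl refl refl _ = refl
xor-step true  true  false true  {d = true}  refl refl refl _ = refl
xor-step true  true  true  false {d = false} refl refl refl _ = refl
xor-step true  true  true  true  {d = false} refl refl refl _ = refl

xor-≡ : ∀ {p q} → p xor q ≡ false → p ≡ q
xor-≡ {false} {false} _ = refl
xor-≡ {true}  {true}  _ = refl

-- H on [0 , M]. The first row of R requires u = H (X + 1) xor H (X - 1), a recursion with step 2.
-- The initial values H 0 and H 1 are free, since a constant added to H on one parity class cancels
-- in d'Alembert's formula.
rowSum : ∀ {c m n} → V c m n → ℕ → Bool
rowSum u zero = false
rowSum u (suc zero) = false
rowSum u (suc (suc k)) = rowSum u k xor val u (+ k) (+ 0)

profile : ∀ {c m n} → V c m n → ℤ → Bool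
profile {m = m} u = Fold.Values.H m (rowSum u)

wave : ∀ {c m n} → V c m n → ℤ → Bool
wave {c} u i = profile u (+ 2 ℤ.* i ℤ.+ eps c)

module _ {c : Color} {m n : ℕ} (n≥1 : 1 ℕ.≤ n) (u : V c m n) (ker : ∀ w → adj u w ≡ false) where
  private
    module F = Fold.Values m (rowSum u)
    H : ℤ → Bool
    H = profile u
    U : ℤ → ℤ → Bool
    U X Y = val u (X ℤ.- + 1) (Y ℤ.- + 1)
    e M N : ℤ
    e = eps c
    M = + m ℤ.+ + 1
    N = + n ℤ.+ + 1
    M≡ : + suc m ≡ M
    M≡ = ℤₚ.+-comm (+ 1) (+ m)

  H-mirror : ∀ z → H (M ℤ.+ z) ≡ H (M ℤ.- z)
  H-mirror z = trans (cong H (omega 2 (λ M z → M ⊕ z ≐ ⊝ (M ⊖ z) ⊕ # 1 ⊗ (# 2 ⊗ M)) M z))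
    (trans (subst (λ M′ → H (ℤ.- (M ℤ.- z) ℤ.+ + 1 ℤ.* (+ 2 ℤ.* M′)) ≡ H (ℤ.- (M ℤ.- z))) M≡ (F.H-period (ℤ.- (M ℤ.- z)) (+ 1))) (F.H-even (M ℤ.- z)))

  -- d'Alembert's formula on one line. The columns X = 0 and X = M just outside R are included so
  -- that all neighbours are available in the induction over Y.
  Row : ℤ → Set
  Row Y = ∀ X → + 0 ℤ.≤ X → X ℤ.≤ M → U X Y ≡ H (X ℤ.+ Y) xor H (X ℤ.- Y)

  same-xor : ∀ {p q} → p ≡ q → p xor q ≡ false
  same-xor {p} refl = Boolₚ.xor-same p

  at-left : ∀ Y → U (+ 0) Y ≡ H (+ 0 ℤ.+ Y) xor H (+ 0 ℤ.- Y)
  at-left Y = trans (val-outside u (+ 0 ℤ.- + 1) (Y ℤ.- + 1) (omega 3 (λ Y m n → (# 0 ≼ # 0 ⊖ # 1 & # 0 ⊖ # 1 ⊕ # 1 ≼ m & # 0 ≼ Y ⊖ # 1 & Y ⊖ # 1 ⊕ # 1 ≼ n) ⇛ ⊥′) Y (+ m) (+ n)))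
    (sym (same-xor (trans (cong H (omega 1 (λ Y → # 0 ⊕ Y ≐ ⊝ (# 0 ⊖ Y)) Y)) (F.H-even (+ 0 ℤ.- Y)))))

  at-right : ∀ Y → U M Y ≡ H (M ℤ.+ Y) xor H (M ℤ.- Y)
  at-right Y = trans (val-outside u (M ℤ.- + 1) (Y ℤ.- + 1) (omega 3 (λ Y m n → (# 0 ≼ m ⊕ # 1 ⊖ # 1 & m ⊕ # 1 ⊖ # 1 ⊕ # 1 ≼ m & # 0 ≼ Y ⊖ # 1 & Y ⊖ # 1 ⊕ # 1 ≼ n) ⇛ ⊥′) Y (+ m) (+ n)))
    (sym (same-xor (H-mirror Y)))

  by-column : ∀ Y → (∀ X → + 1 ℤ.≤ X → X ℤ.≤ + m → U X Y ≡ H (X ℤ.+ Y) xor H (X ℤ.- Y)) → Row Y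
  by-column Y f X X≥0 X≤M with X ℤ.≟ + 0 | X ℤ.≟ M
  ... | yes refl | _ = at-left Y
  ... | no _ | yes refl = at-right Y
  ... | no X≢0 | no X≢M = f X
    (omega 1 (λ X → # 0 ≼ X ⇛ (X ≐ # 0 ⇛ ⊥′) ⇛ # 1 ≼ X) X X≥0 X≢0)
    (omega 2 (λ X m → X ≼ m ⊕ # 1 ⇛ (X ≐ m ⊕ # 1 ⇛ ⊥′) ⇛ X ≼ m) X (+ m) X≤M X≢M)

  row₀ : Row (+ 0)
  row₀ X _ _ = trans (val-outside u (X ℤ.- + 1) (+ 0 ℤ.- + 1) (omega 3 (λ X m n → (# 0 ≼ X ⊖ # 1 & X ⊖ # 1 ⊕ # 1 ≼ m & # 0 ≼ # 0 ⊖ # 1 & # 0 ⊖ # 1 ⊕ # 1 ≼ n) ⇛ ⊥′) X (+ m) (+ n)))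
    (sym (same-xor (cong H (omega 1 (λ X → X ⊕ # 0 ≐ X ⊖ # 0) X))))

  row₁ : Row (+ 1)
  row₁ = by-column (+ 1) column
    where
    column : ∀ X → + 1 ℤ.≤ X → X ℤ.≤ + m → U X (+ 1) ≡ H (X ℤ.+ + 1) xor H (X ℤ.- + 1)
    column (+ zero) (ℤ.+≤+ ()) _
    column (+ suc k) _ (ℤ.+≤+ k<m) = sym (trans (cong₂ _xor_
      (trans (cong H (cong +_ (ℕₚ.+-comm (suc k) 1))) (F.H-small (suc (suc k)) (ℕ.s≤s k<m)))
      (F.H-small k (ℕₚ.m≤n⇒m≤1+n (ℕₚ.<⇒≤ k<m)))) (xor-cancel (rowSum u k) _))

  row-step : ∀ Y → + 1 ℤ.≤ Y → Y ℤ.≤ + n → Row (Y ℤ.- + 1) → Row Y → Row (Y ℤ.+ + 1)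
  row-step Y Y≥1 Y≤n below current = by-column (Y ℤ.+ + 1) column
    where
    column : ∀ X → + 1 ℤ.≤ X → X ℤ.≤ + m → U X (Y ℤ.+ + 1) ≡ H (X ℤ.+ (Y ℤ.+ + 1)) xor H (X ℤ.- (Y ℤ.+ + 1))
    column X X≥1 X≤m = trans
      (xor-step (H (X ℤ.+ Y ℤ.- + 1)) (H (X ℤ.- Y ℤ.- + 1)) (H (X ℤ.+ Y ℤ.+ + 1)) (H (X ℤ.- Y ℤ.+ + 1))
        {a = val u (X ℤ.- + 1 ℤ.- + 1) (Y ℤ.- + 1)} {b = val u (X ℤ.- + 1 ℤ.+ + 1) (Y ℤ.- + 1)}
        {c = val u (X ℤ.- + 1) (Y ℤ.- + 1 ℤ.- + 1)} {d = U X (Y ℤ.+ + 1)}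
        (trans (current (X ℤ.- + 1) (omega 1 (λ X → # 1 ≼ X ⇛ # 0 ≼ X ⊖ # 1) X X≥1) (omega 2 (λ X m → X ≼ m ⇛ X ⊖ # 1 ≼ m ⊕ # 1) X (+ m) X≤m))
          (cong₂ _xor_ (cong H (omega 2 (λ X Y → X ⊖ # 1 ⊕ Y ≐ X ⊕ Y ⊖ # 1) X Y)) (cong H (omega 2 (λ X Y → X ⊖ # 1 ⊖ Y ≐ X ⊖ Y ⊖ # 1) X Y))))
        (trans (cong (λ x → val u x (Y ℤ.- + 1)) (omega 1 (λ X → X ⊖ # 1 ⊕ # 1 ≐ X ⊕ # 1 ⊖ # 1) X))
          (trans (current (X ℤ.+ + 1) (omega 1 (λ X → # 1 ≼ X ⇛ # 0 ≼ X ⊕ # 1) X X≥1) (omega 2 (λ X m → X ≼ m ⇛ X ⊕ # 1 ≼ m ⊕ # 1) X (+ m) X≤m))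
            (cong₂ _xor_ (cong H (omega 2 (λ X Y → X ⊕ # 1 ⊕ Y ≐ X ⊕ Y ⊕ # 1) X Y)) (cong H (omega 2 (λ X Y → X ⊕ # 1 ⊖ Y ≐ X ⊖ Y ⊕ # 1) X Y)))))
        (trans (below X (omega 1 (λ X → # 1 ≼ X ⇛ # 0 ≼ X) X X≥1) (omega 2 (λ X m → X ≼ m ⇛ X ≼ m ⊕ # 1) X (+ m) X≤m))
          (cong₂ _xor_ (cong H (omega 2 (λ X Y → X ⊕ (Y ⊖ # 1) ≐ X ⊕ Y ⊖ # 1) X Y)) (cong H (omega 2 (λ X Y → X ⊖ (Y ⊖ # 1) ≐ X ⊖ Y ⊕ # 1) X Y))))
        (subst (λ y → val u (X ℤ.- + 1 ℤ.- + 1) (Y ℤ.- + 1) xor val u (X ℤ.- + 1 ℤ.+ + 1) (Y ℤ.- + 1) xor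
                      val u (X ℤ.- + 1) (Y ℤ.- + 1 ℤ.- + 1) xor val u (X ℤ.- + 1) y ≡ false)
          (omega 1 (λ Y → Y ⊖ # 1 ⊕ # 1 ≐ Y ⊕ # 1 ⊖ # 1) Y)
          (kernel u ker (X ℤ.- + 1) (Y ℤ.- + 1) (omega 4 (λ X Y m n → # 1 ≼ X ⇛ X ≼ m ⇛ # 1 ≼ Y ⇛ Y ≼ n ⇛
            # 0 ≼ X ⊖ # 1 & X ⊖ # 1 ⊕ # 1 ≼ m & # 0 ≼ Y ⊖ # 1 & Y ⊖ # 1 ⊕ # 1 ≼ n) X Y (+ m) (+ n) X≥1 X≤m Y≥1 Y≤n))))
      (cong₂ _xor_ (cong H (omega 2 (λ X Y → X ⊕ Y ⊕ # 1 ≐ X ⊕ (Y ⊕ # 1)) X Y)) (cong H (omega 2 (λ X Y → X ⊖ Y ⊖ # 1 ≐ X ⊖ (Y ⊕ # 1)) X Y)))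

  rows : ∀ k → k ℕ.≤ n → Row (+ k) × Row (+ k ℤ.+ + 1)
  rows zero _ = row₀ , row₁
  rows (suc k) k<n with rows k (ℕₚ.<⇒≤ k<n)
  ... | below , current = current′ , row-step (+ suc k) (ℤ.+≤+ (ℕ.s≤s ℕ.z≤n)) (ℤ.+≤+ k<n) below current′
    where
    current′ : Row (+ suc k)
    current′ = subst Row (ℤₚ.+-comm (+ k) (+ 1)) current

  row : ∀ Y → + 0 ℤ.≤ Y → Y ℤ.≤ N → Row Y
  row (+ zero) _ _ = row₀
  row (+ suc k) _ h = subst Row (ℤₚ.+-comm (+ k) (+ 1)) (proj₂ (rows k (ℤₚ.drop‿+≤+ (omega 2 (λ k n → # 1 ⊕ k ≼ n ⊕ # 1 ⇛ k ≼ n) (+ k) (+ n) h))))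

  -- The line Y = N is outside R, so both sides of d'Alembert's formula vanish there; with H even,
  -- this is a symmetry of H about N, for the time being on a limited range.
  top-mirror : ∀ t → + 0 ℤ.≤ t → t ℤ.≤ M → H (t ℤ.+ N) ≡ H (t ℤ.- N)
  top-mirror t t≥0 t≤M = xor-≡ (trans (sym (row N (omega 1 (λ n → # 0 ≼ n ⇛ # 0 ≼ n ⊕ # 1) (+ n) (ℤ.+≤+ ℕ.z≤n)) ℤₚ.≤-refl t t≥0 t≤M))
    (val-outside u (t ℤ.- + 1) (N ℤ.- + 1) (omega 3 (λ t m n → (# 0 ≼ t ⊖ # 1 & t ⊖ # 1 ⊕ # 1 ≼ m & # 0 ≼ n ⊕ # 1 ⊖ # 1 & n ⊕ # 1 ⊖ # 1 ⊕ # 1 ≼ n) ⇛ ⊥′) t (+ m) (+ n))))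

  -- The symmetries of H that are built in reduce z + N to [0 , M], where `top-mirror` applies.
  H-periodY : ∀ z → H (z ℤ.+ + 2 ℤ.* N) ≡ H z
  H-periodY z with Fold.representative m (z ℤ.+ N)
  ... | t , t≤M , q , inj₁ h = trans (trans (cong H (omega 5 (λ z t q M N → z ⊕ N ≐ t ⊕ q ⊗ (# 2 ⊗ M) ⇛ z ⊕ # 2 ⊗ N ≐ (t ⊕ N) ⊕ q ⊗ (# 2 ⊗ M)) z (+ t) q (+ suc m) N h)) (F.H-period (+ t ℤ.+ N) q))
    (trans (top-mirror (+ t) (ℤ.+≤+ ℕ.z≤n) (subst (+ t ℤ.≤_) M≡ (ℤ.+≤+ t≤M)))
      (sym (trans (cong H (omega 5 (λ z t q M N → z ⊕ N ≐ t ⊕ q ⊗ (# 2 ⊗ M) ⇛ z ≐ (t ⊖ N) ⊕ q ⊗ (# 2 ⊗ M)) z (+ t) q (+ suc m) N h)) (F.H-period (+ t ℤ.- N) q))))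
  ... | t , t≤M , q , inj₂ h = trans (trans (cong H (omega 5 (λ z t q M N → z ⊕ N ≐ ⊝ t ⊕ q ⊗ (# 2 ⊗ M) ⇛ z ⊕ # 2 ⊗ N ≐ ⊝ (t ⊖ N) ⊕ q ⊗ (# 2 ⊗ M)) z (+ t) q (+ suc m) N h)) (trans (F.H-period (ℤ.- (+ t ℤ.- N)) q) (F.H-even (+ t ℤ.- N))))
    (trans (sym (top-mirror (+ t) (ℤ.+≤+ ℕ.z≤n) (subst (+ t ℤ.≤_) M≡ (ℤ.+≤+ t≤M))))
      (sym (trans (cong H (omega 5 (λ z t q M N → z ⊕ N ≐ ⊝ t ⊕ q ⊗ (# 2 ⊗ M) ⇛ z ≐ ⊝ (t ⊕ N) ⊕ q ⊗ (# 2 ⊗ M)) z (+ t) q (+ suc m) N h)) (trans (F.H-period (ℤ.- (+ t ℤ.+ N)) q) (F.H-even (+ t ℤ.+ N))))))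

  wave-isWave : IsWave e (+ m) (+ n) (wave u)
  wave-isWave = record
    { reflect = λ i → trans (cong H (omega 2 (λ i e → # 2 ⊗ (⊝ e ⊖ i) ⊕ e ≐ ⊝ (# 2 ⊗ i ⊕ e)) i e)) (F.H-even (+ 2 ℤ.* i ℤ.+ e))
    ; shiftX  = λ i → trans (cong H (omega 3 (λ i m e → # 2 ⊗ (i ⊕ (m ⊕ # 1)) ⊕ e ≐ # 2 ⊗ i ⊕ e ⊕ # 1 ⊗ (# 2 ⊗ (m ⊕ # 1))) i (+ m) e))
        (subst (λ M′ → H (+ 2 ℤ.* i ℤ.+ e ℤ.+ + 1 ℤ.* (+ 2 ℤ.* M′)) ≡ wave u i) M≡ (F.H-period (+ 2 ℤ.* i ℤ.+ e) (+ 1)))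
    ; shiftY  = λ i → trans (cong H (omega 3 (λ i n e → # 2 ⊗ (i ⊕ (n ⊕ # 1)) ⊕ e ≐ # 2 ⊗ i ⊕ e ⊕ # 2 ⊗ (n ⊕ # 1)) i (+ n) e)) (H-periodY (+ 2 ℤ.* i ℤ.+ e))
    }

  wave-represents : ∀ i j → + 0 ℤ.≤ i ℤ.+ j ℤ.+ e → i ℤ.+ j ℤ.+ e ℤ.≤ M → + 0 ℤ.≤ i ℤ.- j → i ℤ.- j ℤ.≤ N →
    val u (i ℤ.+ j ℤ.+ e ℤ.- + 1) (i ℤ.- j ℤ.- + 1) ≡ wave u i xor wave u j
  wave-represents i j X≥0 X≤M Y≥0 Y≤N = trans (row (i ℤ.- j) Y≥0 Y≤N (i ℤ.+ j ℤ.+ e) X≥0 X≤M)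
    (cong₂ _xor_ (cong H (omega 3 (λ i j e → i ⊕ j ⊕ e ⊕ (i ⊖ j) ≐ # 2 ⊗ i ⊕ e) i j e)) (cong H (omega 3 (λ i j e → i ⊕ j ⊕ e ⊖ (i ⊖ j) ≐ # 2 ⊗ j ⊕ e) i j e)))

-- From tilings to the kernel

coreF : (a b c d i j : Expr) → Form
coreF a b c d i j = a ≼ i & i ≺ b & c ≼ j & j ≺ d

Core : Piece → ℤ → ℤ → Set
Core (oct a b c d) i j = ⟦ coreF (cst a) (cst b) (cst c) (cst d) (cst i) (cst j) ⟧ []
Core (dia _ _) i j = ⊥

core? : ∀ i j P → Dec (Core P i j)
core? i j (oct a b c d) = dec (coreF (cst a) (cst b) (cst c) (cst d) (cst i) (cst j)) []
core? i j (dia _ _) = no λ ()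

-- The two vertices of a cell that have the colour c.
vertexF : (i j k l p q : Expr) → Form
vertexF i j k l p q =
  (p ≐ # 1 & i ≐ k & j ≐ l) ∥ (p ≐ # 0 & i ⊕ # 1 ≐ k & j ⊕ # 1 ≐ l) ∥
  (q ≐ # 1 & i ≐ k & j ⊕ # 1 ≐ l) ∥ (q ≐ # 0 & i ⊕ # 1 ≐ k & j ≐ l)

Vertex : ℤ → ℤ → Cell → Set
Vertex i j (cell k l p q) = ⟦ vertexF (cst i) (cst j) (cst k) (cst l) (cst p) (cst q) ⟧ []

east : ∀ k l q → Vertex k l (cell k l (+ 1) q)
east k l q = inj₁ (refl , refl , refl)

private
  pred-suc : ∀ k → k ℤ.- + 1 ℤ.+ + 1 ≡ k
  pred-suc = omega 1 (λ k → k ⊖ # 1 ⊕ # 1 ≐ k)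

west : ∀ k l q → Vertex (k ℤ.- + 1) (l ℤ.- + 1) (cell k l (+ 0) q)
west k l q = inj₂ (inj₁ (refl , pred-suc k , pred-suc l))

north : ∀ k l p → Vertex k (l ℤ.- + 1) (cell k l p (+ 1))
north k l p = inj₂ (inj₂ (inj₁ (refl , refl , pred-suc l)))

south : ∀ k l p → Vertex (k ℤ.- + 1) l (cell k l p (+ 0))
south k l p = inj₂ (inj₂ (inj₂ (refl , pred-suc k , refl)))

core-cell : ∀ e m n P i j z → CellR e m n z → Core P i j → Vertex i j z → CellIn P z
core-cell e m n (oct a b c d) i j (cell k l p q) (_ , bp , bq) co v =
  omega 10 (λ a b c d i j k l p q → bitF p ⇛ bitF q ⇛ coreF a b c d i j ⇛ vertexF i j k l p q ⇛ cellOctF a b c d k l p q)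
    a b c d i j k l p q bp bq co v

-- An octagon that contains the north-western cell but not the north-eastern one ends at the
-- vertical line through the centre. This forces k = b and l = d, so the western neighbour is in its
-- core. The other three directions are analogous.
across-west : ∀ {e m n} k l P → Valid e m n P → CellIn P (cell k l (+ 0) (+ 1)) → ¬ Core P (k ℤ.- + 1) (l ℤ.- + 1) → CellIn P (cell k l (+ 1) (+ 1))
across-west k l (oct a b c d) (a<b , c<d , _) = omega 6 (λ a b c d k l → a ≺ b ⇛ c ≺ d ⇛ cellOctF a b c d k l (# 0) (# 1) ⇛ (coreF a b c d (k ⊖ # 1) (l ⊖ # 1) ⇛ ⊥′) ⇛ cellOctF a b c d k l (# 1) (# 1)) a b c d k l a<b c<d
across-west k l (dia _ _) _ z _ = z

across-east : ∀ {e m n} k l P → Valid e m n P → CellIn P (cell k l (+ 1) (+ 1)) → ¬ Core P k l → CellIn P (cell k l (+ 0) (+ 1))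
across-east k l (oct a b c d) (a<b , c<d , _) = omega 6 (λ a b c d k l → a ≺ b ⇛ c ≺ d ⇛ cellOctF a b c d k l (# 1) (# 1) ⇛ (coreF a b c d k l ⇛ ⊥′) ⇛ cellOctF a b c d k l (# 0) (# 1)) a b c d k l a<b c<d
across-east k l (dia _ _) _ z _ = z

across-south : ∀ {e m n} k l P → Valid e m n P → CellIn P (cell k l (+ 1) (+ 0)) → ¬ Core P (k ℤ.- + 1) l → CellIn P (cell k l (+ 1) (+ 1))
across-south k l (oct a b c d) (a<b , c<d , _) = omega 6 (λ a b c d k l → a ≺ b ⇛ c ≺ d ⇛ cellOctF a b c d k l (# 1) (# 0) ⇛ (coreF a b c d (k ⊖ # 1) l ⇛ ⊥′) ⇛ cellOctF a b c d k l (# 1) (# 1)) a b c d k l a<b c<d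
across-south k l (dia _ _) _ z _ = z

across-north : ∀ {e m n} k l P → Valid e m n P → CellIn P (cell k l (+ 1) (+ 1)) → ¬ Core P k (l ℤ.- + 1) → CellIn P (cell k l (+ 1) (+ 0))
across-north k l (oct a b c d) (a<b , c<d , _) = omega 6 (λ a b c d k l → a ≺ b ⇛ c ≺ d ⇛ cellOctF a b c d k l (# 1) (# 1) ⇛ (coreF a b c d k (l ⊖ # 1) ⇛ ⊥′) ⇛ cellOctF a b c d k l (# 1) (# 0)) a b c d k l a<b c<d
across-north k l (dia _ _) _ z _ = z

rangeF : (i j e m n : Expr) → Form
rangeF i j e m n = # 1 ≼ i ⊕ j ⊕ e & i ⊕ j ⊕ e ≼ m & # 1 ≼ i ⊖ j & i ⊖ j ≼ n

Range : (e m n i j : ℤ) → Set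
Range e m n i j = ⟦ rangeF (cst i) (cst j) (cst e) (cst m) (cst n) ⟧ []

value : ∀ {c m n} → V c m n → ℤ → ℤ → Bool
value {c} u i j = val u (i ℤ.+ j ℤ.+ eps c ℤ.- + 1) (i ℤ.- j ℤ.- + 1)

-- All that the recovery of u uses of a tiling; `unique` is what remains of the disjointness of
-- interiors.
record IsFamily (e m n : ℤ) (Ps : List Piece) : Set where
  field
    valids : ∀ {P} → P ∈ Ps → Valid e m n P
    covers : ∀ z → CellR e m n z → Σ Piece λ P → P ∈ Ps × CellIn P z
    unique : ∀ {P P′} z → P ∈ Ps → P′ ∈ Ps → CellR e m n z → CellIn P z → CellIn P′ z → P ≡ P′

module _ (c : Color) (m n : ℕ) (Ps : List Piece) where

  Zero : ℤ → ℤ → Set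
  Zero i j = Any (λ P → Core P i j) Ps

  zero? : ∀ i j → Dec (Zero i j)
  zero? i j = any? (core? i j) Ps

  -- For x + y = 2 k + e these are the right indices because X + Y = x + y + 2 and X - Y = x - y.
  pointIndex : (p : GPt m n) → colorG p ≡ c → ℤ × ℤ
  pointIndex (x , y) e = let k = proj₁ (color-index (+ toℕ x ℤ.+ + toℕ y) c e) in k ℤ.+ + 1 , k ℤ.- + toℕ y

  solution : V c m n
  solution (p , e) = not ⌊ zero? (proj₁ (pointIndex p e)) (proj₂ (pointIndex p e)) ⌋

  value-solution : ∀ i j → Range (eps c) (+ m) (+ n) i j → value solution i j ≡ not ⌊ zero? i j ⌋
  value-solution i j r with i ℤ.+ j ℤ.+ eps c ℤ.- + 1 in ex | i ℤ.- j ℤ.- + 1 in ey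
  ... | x | y = go x y ex ey
    (omega 7 (λ i j e m n x y → rangeF i j e m n ⇛ i ⊕ j ⊕ e ⊖ # 1 ≐ x ⇛ i ⊖ j ⊖ # 1 ≐ y ⇛ # 0 ≼ x & x ⊕ # 1 ≼ m & # 0 ≼ y & y ⊕ # 1 ≼ n)
      i j (eps c) (+ m) (+ n) x y r ex ey)
    where
    above : ∀ {i m} → + i ℤ.+ + 1 ℤ.≤ + m → i ℕ.< m
    above {i} {m} (ℤ.+≤+ h) = subst (ℕ._≤ m) (ℕₚ.+-comm i 1) h
    at : ∀ (x : Fin m) (y : Fin n) → i ℤ.+ j ℤ.+ eps c ℤ.- + 1 ≡ + toℕ x → i ℤ.- j ℤ.- + 1 ≡ + toℕ y →
      val solution (+ toℕ x) (+ toℕ y) ≡ not ⌊ zero? i j ⌋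
    at x y ex ey = trans (val-at solution x y col)
      (cong₂ (λ i j → not ⌊ zero? i j ⌋)
        (omega 6 (λ i j e k x y → x ⊕ y ≐ # 2 ⊗ k ⊕ e ⇛ i ⊕ j ⊕ e ⊖ # 1 ≐ x ⇛ i ⊖ j ⊖ # 1 ≐ y ⇛ k ⊕ # 1 ≐ i) i j (eps c) k (+ toℕ x) (+ toℕ y) hk ex ey)
        (omega 6 (λ i j e k x y → x ⊕ y ≐ # 2 ⊗ k ⊕ e ⇛ i ⊕ j ⊕ e ⊖ # 1 ≐ x ⇛ i ⊖ j ⊖ # 1 ≐ y ⇛ k ⊖ y ≐ j) i j (eps c) k (+ toℕ x) (+ toℕ y) hk ex ey))
      where
      col : colorG (x , y) ≡ c
      col = index-color (+ toℕ x ℤ.+ + toℕ y) c (i ℤ.- + 1)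
        (omega 5 (λ i j e x y → i ⊕ j ⊕ e ⊖ # 1 ≐ x ⇛ i ⊖ j ⊖ # 1 ≐ y ⇛ x ⊕ y ≐ # 2 ⊗ (i ⊖ # 1) ⊕ e) i j (eps c) (+ toℕ x) (+ toℕ y) ex ey)
      k : ℤ
      k = proj₁ (color-index (+ toℕ x ℤ.+ + toℕ y) c col)
      hk : + toℕ x ℤ.+ + toℕ y ≡ + 2 ℤ.* k ℤ.+ eps c
      hk = proj₂ (color-index (+ toℕ x ℤ.+ + toℕ y) c col)
    go : ∀ x y → i ℤ.+ j ℤ.+ eps c ℤ.- + 1 ≡ x → i ℤ.- j ℤ.- + 1 ≡ y →
      ⟦ # 0 ≼ cst x & cst x ⊕ # 1 ≼ # m & # 0 ≼ cst y & cst y ⊕ # 1 ≼ # n ⟧ [] → val solution x y ≡ not ⌊ zero? i j ⌋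
    go (+ x) (+ y) ex ey (_ , x<m , _ , y<n) = subst₂ (λ x y → val solution x y ≡ not ⌊ zero? i j ⌋)
      (cong +_ (Finₚ.toℕ-fromℕ< (above x<m))) (cong +_ (Finₚ.toℕ-fromℕ< (above y<n)))
      (at (fromℕ< (above x<m)) (fromℕ< (above y<n)) (trans ex (cong +_ (sym (Finₚ.toℕ-fromℕ< (above x<m))))) (trans ey (cong +_ (sym (Finₚ.toℕ-fromℕ< (above y<n))))))

  value-outside : ∀ (u : V c m n) i j → ¬ Range (eps c) (+ m) (+ n) i j → value u i j ≡ false
  value-outside u i j out = val-outside u _ _ (λ h → out (omega 5 (λ i j e m n →
    (# 0 ≼ i ⊕ j ⊕ e ⊖ # 1 & i ⊕ j ⊕ e ⊖ # 1 ⊕ # 1 ≼ m & # 0 ≼ i ⊖ j ⊖ # 1 & i ⊖ j ⊖ # 1 ⊕ # 1 ≼ n) ⇛ rangeF i j e m n)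
    i j (eps c) (+ m) (+ n) h))

  value-zero : ∀ i j → Zero i j → value solution i j ≡ false
  value-zero i j z with dec (rangeF (cst i) (cst j) (cst (eps c)) (# m) (# n)) []
  ... | no out = value-outside solution i j out
  ... | yes r = trans (value-solution i j r) (is-no (zero? i j))
    where
    is-no : (d : Dec (Zero i j)) → not ⌊ d ⌋ ≡ false
    is-no (yes _) = refl
    is-no (no ¬z) = ⊥-elim (¬z z)

  value-one : ∀ i j → Range (eps c) (+ m) (+ n) i j → ¬ Zero i j → value solution i j ≡ true
  value-one i j r ¬z = trans (value-solution i j r) (is-yes (zero? i j))
    where
    is-yes : (d : Dec (Zero i j)) → not ⌊ d ⌋ ≡ true
    is-yes (yes z) = ⊥-elim (¬z z)
    is-yes (no _) = refl

module Recover (c : Color) (m n : ℕ) (m≥2 : + 2 ℤ.≤ + m) (n≥2 : + 2 ℤ.≤ + n) (Ps : List Piece) (F : IsFamily (eps c) (+ m) (+ n) Ps) where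
  open IsFamily F

  private
    e M N : ℤ
    e = eps c
    M = + m
    N = + n

  u : V c m n
  u = solution c m n Ps

  core-false : ∀ {P} i j → P ∈ Ps → Core P i j → value u i j ≡ false
  core-false i j P∈ co = value-zero c m n Ps i j (lose P∈ co)

  -- Inside the rectangle, u vanishes at a vertex of a cell precisely if the
  -- vertex is in the core of the piece of that cell.
  vertex-true : ∀ {P} i j z → P ∈ Ps → CellR e M N z → CellIn P z → Vertex i j z → ¬ Core P i j → Range e M N i j → value u i j ≡ true
  vertex-true {P} i j z P∈ zR zP v ¬co r = value-one c m n Ps i j r λ zero → let (P′ , P′∈ , co) = find zero in
    ¬co (subst (λ P → Core P i j) (sym (unique z P∈ P′∈ zR zP (core-cell e M N P′ i j z zR co v))) co)

  -- At the midpoint of a side of length 2, the fourth neighbour lies in the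
  -- core of the piece on the other side.
  beyond : ∀ {P} i j z z′ → P ∈ Ps → CellR e M N z → CellIn P z → ¬ CellIn P z′ →
    (Range e M N i j → CellR e M N z′) → (∀ P′ → Valid e M N P′ → CellIn P′ z′ → ¬ Core P′ i j → CellIn P′ z) → value u i j ≡ false
  beyond {P} i j z z′ P∈ zR zP ¬z′P z′R across with dec (rangeF (cst i) (cst j) (cst e) (cst M) (cst N)) []
  ... | no out = value-outside c m n Ps u i j out
  ... | yes r with covers z′ (z′R r)
  ...   | P′ , P′∈ , z′P′ with core? i j P′
  ...     | yes co = core-false i j P′∈ co
  ...     | no ¬co = ⊥-elim (¬z′P (subst (λ P → CellIn P z′) (sym (unique z P∈ P′∈ zR zP (across P′ (valids P′∈) z′P′ ¬co))) z′P′))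

  Balance : ℤ → ℤ → Set
  Balance k l = value u (k ℤ.- + 1) (l ℤ.- + 1) xor value u k l xor value u (k ℤ.- + 1) l xor value u k (l ℤ.- + 1) ≡ false

  balance : ∀ k l w x y z → value u (k ℤ.- + 1) (l ℤ.- + 1) ≡ w → value u k l ≡ x → value u (k ℤ.- + 1) l ≡ y → value u k (l ℤ.- + 1) ≡ z →
    w xor x xor y xor z ≡ false → Balance k l
  balance k l w x y z p q r s h = trans (cong₂ _xor_ p (cong₂ _xor_ q (cong₂ _xor_ r s))) h

  centerF : (k l e m n : Expr) → Form
  centerF k l e m n = # 1 ≼ k ⊕ l ⊖ # 1 ⊕ e & k ⊕ l ⊖ # 1 ⊕ e ≼ m & # 1 ≼ k ⊖ l & k ⊖ l ≼ n

  Center : ℤ → ℤ → Set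
  Center k l = ⟦ centerF (cst k) (cst l) (cst e) (cst M) (cst N) ⟧ []

  Bit : ℤ → Set
  Bit p = ⟦ bitF (cst p) ⟧ []

  bit₀ : Bit (+ 0)
  bit₀ = inj₁ refl

  bit₁ : Bit (+ 1)
  bit₁ = inj₂ refl

  outerF : (a b c d i j k l p q e m n : Expr) → Form
  outerF a b c d i j k l p q e m n = boxF k l p q e m n & cellOctF a b c d k l p q &
    (coreF a b c d i j ⇛ ⊥′) & rangeF i j e m n

  outer : ∀ {a b c d} i j k l p q → oct a b c d ∈ Ps → Vertex i j (cell k l p q) → Bit p → Bit q →
    ⟦ outerF (cst a) (cst b) (cst c) (cst d) (cst i) (cst j) (cst k) (cst l) (cst p) (cst q) (cst e) (cst M) (cst N) ⟧ [] → value u i j ≡ true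
  outer i j k l p q P∈ v bp bq (zR , zP , ¬co , r) = vertex-true i j (cell k l p q) P∈ (zR , bp , bq) zP v ¬co r

  dia-true : ∀ k l → dia k l ∈ Ps → value u (k ℤ.- + 1) (l ℤ.- + 1) ≡ true × value u k l ≡ true × value u (k ℤ.- + 1) l ≡ true × value u k (l ℤ.- + 1) ≡ true
  dia-true k l P∈ =
    let (r₁ , s₁) , (r₂ , s₂) , (r₃ , s₃) , (r₄ , s₄) = omega 5 (λ k l e m n → validDiaF k l e m n ⇛
          (boxF k l (# 0) (# 0) e m n & rangeF (k ⊖ # 1) (l ⊖ # 1) e m n) &
          (boxF k l (# 1) (# 1) e m n & rangeF k l e m n) &
          (boxF k l (# 0) (# 0) e m n & rangeF (k ⊖ # 1) l e m n) &
          (boxF k l (# 1) (# 1) e m n & rangeF k (l ⊖ # 1) e m n))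
          k l e M N (valids P∈)
    in vertex-true (k ℤ.- + 1) (l ℤ.- + 1) (cell k l (+ 0) (+ 0)) P∈ (r₁ , bit₀ , bit₀) (refl , refl) (west k l (+ 0)) (λ ()) s₁ , vertex-true k l (cell k l (+ 1) (+ 1)) P∈ (r₂ , bit₁ , bit₁) (refl , refl) (east k l (+ 1)) (λ ()) s₂ ,
       vertex-true (k ℤ.- + 1) l (cell k l (+ 0) (+ 0)) P∈ (r₃ , bit₀ , bit₀) (refl , refl) (south k l (+ 0)) (λ ()) s₃ , vertex-true k (l ℤ.- + 1) (cell k l (+ 1) (+ 1)) P∈ (r₄ , bit₁ , bit₁) (refl , refl) (north k l (+ 1)) (λ ()) s₄

  -- The centre is compared with the ends of the core. Away from them all four neighbours are core
  -- points. At one end, two neighbours are core points and two are on a diagonal side. At two ends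
  -- the centre is the midpoint of an axis-parallel side: one neighbour is a core point, two are the
  -- ends of this side, and the fourth is treated by `beyond`.
  balance-in : ∀ {P} k l p q → Center k l → P ∈ Ps → CellR e M N (cell k l p q) → CellIn P (cell k l p q) → Balance k l
  balance-in {dia _ _} k l p q w P∈ _ (refl , refl) = let (h₁ , h₂ , h₃ , h₄) = dia-true k l P∈ in balance k l true true true true h₁ h₂ h₃ h₄ refl
  balance-in {oct a b c′ d} k l p q w P∈ zR zP = go (k ℤ.≟ a) (k ℤ.≟ b) (l ℤ.≟ c′) (l ℤ.≟ d)
    where
    ok : Valid e M N (oct a b c′ d)
    ok = valids P∈
    co : ∀ i j → ⟦ coreF (cst a) (cst b) (cst c′) (cst d) (cst i) (cst j) ⟧ [] → value u i j ≡ false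
    co i j h = core-false i j P∈ h
    hypF : (F : (a b c d k l p q e m n : Expr) → Form) → (a b c d k l p q e m n : Expr) → Form
    hypF F a b c d k l p q e m n = validOctF a b c d e m n ⇛ centerF k l e m n ⇛ cellRectF k l p q e m n ⇛ cellOctF a b c d k l p q ⇛ F a b c d k l p q e m n
    go : Dec (k ≡ a) → Dec (k ≡ b) → Dec (l ≡ c′) → Dec (l ≡ d) → Balance k l
    go (yes x) (yes y) _ _ = ⊥-elim (omega 11 (hypF (λ a b c d k l p q e m n → k ≐ a ⇛ k ≐ b ⇛ ⊥′)) a b c′ d k l p q e M N ok w zR zP x y)
    go _ _ (yes x) (yes y) = ⊥-elim (omega 11 (hypF (λ a b c d k l p q e m n → l ≐ c ⇛ l ≐ d ⇛ ⊥′)) a b c′ d k l p q e M N ok w zR zP x y)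
    go (no x₁) (no x₂) (no y₁) (no y₂) =
      let (h₁ , h₂ , h₃ , h₄) = omega 11 (λ a b c d k l p q e m n → cellOctF a b c d k l p q ⇛ (k ≐ a ⇛ ⊥′) ⇛ (k ≐ b ⇛ ⊥′) ⇛ (l ≐ c ⇛ ⊥′) ⇛ (l ≐ d ⇛ ⊥′) ⇛
             coreF a b c d (k ⊖ # 1) (l ⊖ # 1) & coreF a b c d k l & coreF a b c d (k ⊖ # 1) l & coreF a b c d k (l ⊖ # 1))
             a b c′ d k l p q e M N zP x₁ x₂ y₁ y₂
      in balance k l false false false false (co (k ℤ.- + 1) (l ℤ.- + 1) h₁) (co k l h₂) (co (k ℤ.- + 1) l h₃) (co k (l ℤ.- + 1) h₄) refl
    go (yes refl) (no _) (no y₁) (no y₂) =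
      let (h₁ , h₂ , h₃ , h₄) = omega 10 (λ a b c d l p q e m n → validOctF a b c d e m n ⇛ centerF a l e m n ⇛ cellOctF a b c d a l p q ⇛ (l ≐ c ⇛ ⊥′) ⇛ (l ≐ d ⇛ ⊥′) ⇛
             outerF a b c d (a ⊖ # 1) (l ⊖ # 1) a l (# 0) (# 0) e m n & coreF a b c d a l &
             outerF a b c d (a ⊖ # 1) l a l (# 0) (# 0) e m n & coreF a b c d a (l ⊖ # 1))
             a b c′ d l p q e M N ok w zP y₁ y₂
      in balance a l true false true false (outer (a ℤ.- + 1) (l ℤ.- + 1) a l (+ 0) (+ 0) P∈ (west a l (+ 0)) bit₀ bit₀ h₁) (co a l h₂) (outer (a ℤ.- + 1) l a l (+ 0) (+ 0) P∈ (south a l (+ 0)) bit₀ bit₀ h₃) (co a (l ℤ.- + 1) h₄) refl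
    go (no _) (yes refl) (no y₁) (no y₂) =
      let (h₁ , h₂ , h₃ , h₄) = omega 10 (λ a b c d l p q e m n → validOctF a b c d e m n ⇛ centerF b l e m n ⇛ cellOctF a b c d b l p q ⇛ (l ≐ c ⇛ ⊥′) ⇛ (l ≐ d ⇛ ⊥′) ⇛
             coreF a b c d (b ⊖ # 1) (l ⊖ # 1) & outerF a b c d b l b l (# 1) (# 1) e m n &
             coreF a b c d (b ⊖ # 1) l & outerF a b c d b (l ⊖ # 1) b l (# 1) (# 1) e m n)
             a b c′ d l p q e M N ok w zP y₁ y₂
      in balance b l false true false true (co (b ℤ.- + 1) (l ℤ.- + 1) h₁) (outer b l b l (+ 1) (+ 1) P∈ (east b l (+ 1)) bit₁ bit₁ h₂) (co (b ℤ.- + 1) l h₃) (outer b (l ℤ.- + 1) b l (+ 1) (+ 1) P∈ (north b l (+ 1)) bit₁ bit₁ h₄) refl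
    go (no x₁) (no x₂) (yes refl) (no _) =
      let (h₁ , h₂ , h₃ , h₄) = omega 10 (λ a b c d k p q e m n → validOctF a b c d e m n ⇛ centerF k c e m n ⇛ cellOctF a b c d k c p q ⇛ (k ≐ a ⇛ ⊥′) ⇛ (k ≐ b ⇛ ⊥′) ⇛
             outerF a b c d (k ⊖ # 1) (c ⊖ # 1) k c (# 0) (# 1) e m n & coreF a b c d k c &
             coreF a b c d (k ⊖ # 1) c & outerF a b c d k (c ⊖ # 1) k c (# 0) (# 1) e m n)
             a b c′ d k p q e M N ok w zP x₁ x₂
      in balance k c′ true false false true (outer (k ℤ.- + 1) (c′ ℤ.- + 1) k c′ (+ 0) (+ 1) P∈ (west k c′ (+ 1)) bit₀ bit₁ h₁) (co k c′ h₂) (co (k ℤ.- + 1) c′ h₃) (outer k (c′ ℤ.- + 1) k c′ (+ 0) (+ 1) P∈ (north k c′ (+ 0)) bit₀ bit₁ h₄) refl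
    go (no x₁) (no x₂) (no _) (yes refl) =
      let (h₁ , h₂ , h₃ , h₄) = omega 10 (λ a b c d k p q e m n → validOctF a b c d e m n ⇛ centerF k d e m n ⇛ cellOctF a b c d k d p q ⇛ (k ≐ a ⇛ ⊥′) ⇛ (k ≐ b ⇛ ⊥′) ⇛
             coreF a b c d (k ⊖ # 1) (d ⊖ # 1) & outerF a b c d k d k d (# 1) (# 0) e m n &
             outerF a b c d (k ⊖ # 1) d k d (# 1) (# 0) e m n & coreF a b c d k (d ⊖ # 1))
             a b c′ d k p q e M N ok w zP x₁ x₂
      in balance k d false true true false (co (k ℤ.- + 1) (d ℤ.- + 1) h₁) (outer k d k d (+ 1) (+ 0) P∈ (east k d (+ 0)) bit₁ bit₀ h₂) (outer (k ℤ.- + 1) d k d (+ 1) (+ 0) P∈ (south k d (+ 1)) bit₁ bit₀ h₃) (co k (d ℤ.- + 1) h₄) refl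
    -- The midpoint of the left side; the next three cases are the right, the bottom and the top
    -- side.
    go (yes refl) (no _) (yes refl) (no _) =
      let (h₂ , h₃ , h₄ , h₅ , h₆) = omega 9 (λ a b c d p q e m n → validOctF a b c d e m n ⇛ centerF a c e m n ⇛ boxF a c p q e m n ⇛ cellOctF a b c d a c p q ⇛
             coreF a b c d a c & outerF a b c d (a ⊖ # 1) c a c (# 1) (# 0) e m n & outerF a b c d a (c ⊖ # 1) a c (# 1) (# 1) e m n &
             (rangeF (a ⊖ # 1) (c ⊖ # 1) e m n ⇛ boxF a c (# 0) (# 1) e m n) & (cellOctF a b c d a c (# 0) (# 1) ⇛ ⊥′))
             a b c′ d p q e M N ok w (proj₁ zR) zP
      in balance a c′ false false true true
           (beyond (a ℤ.- + 1) (c′ ℤ.- + 1) (cell a c′ (+ 1) (+ 1)) (cell a c′ (+ 0) (+ 1)) P∈ (proj₁ h₄ , bit₁ , bit₁) (proj₁ (proj₂ h₄)) h₆ (λ r → h₅ r , bit₀ , bit₁) (across-west a c′))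
           (co a c′ h₂) (outer (a ℤ.- + 1) c′ a c′ (+ 1) (+ 0) P∈ (south a c′ (+ 1)) bit₁ bit₀ h₃) (outer a (c′ ℤ.- + 1) a c′ (+ 1) (+ 1) P∈ (north a c′ (+ 1)) bit₁ bit₁ h₄) refl
    go (no _) (yes refl) (no _) (yes refl) =
      let (h₁ , h₃ , h₄ , h₅ , h₆) = omega 9 (λ a b c d p q e m n → validOctF a b c d e m n ⇛ centerF b d e m n ⇛ boxF b d p q e m n ⇛ cellOctF a b c d b d p q ⇛
             coreF a b c d (b ⊖ # 1) (d ⊖ # 1) & outerF a b c d (b ⊖ # 1) d b d (# 0) (# 0) e m n & outerF a b c d b (d ⊖ # 1) b d (# 0) (# 1) e m n &
             (rangeF b d e m n ⇛ boxF b d (# 1) (# 1) e m n) & (cellOctF a b c d b d (# 1) (# 1) ⇛ ⊥′))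
             a b c′ d p q e M N ok w (proj₁ zR) zP
      in balance b d false false true true (co (b ℤ.- + 1) (d ℤ.- + 1) h₁)
           (beyond b d (cell b d (+ 0) (+ 1)) (cell b d (+ 1) (+ 1)) P∈ (proj₁ h₄ , bit₀ , bit₁) (proj₁ (proj₂ h₄)) h₆ (λ r → h₅ r , bit₁ , bit₁) (across-east b d))
           (outer (b ℤ.- + 1) d b d (+ 0) (+ 0) P∈ (south b d (+ 0)) bit₀ bit₀ h₃) (outer b (d ℤ.- + 1) b d (+ 0) (+ 1) P∈ (north b d (+ 0)) bit₀ bit₁ h₄) refl
    go (yes refl) (no _) (no _) (yes refl) =
      let (h₁ , h₂ , h₄ , h₅ , h₆) = omega 9 (λ a b c d p q e m n → validOctF a b c d e m n ⇛ centerF a d e m n ⇛ boxF a d p q e m n ⇛ cellOctF a b c d a d p q ⇛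
             outerF a b c d (a ⊖ # 1) (d ⊖ # 1) a d (# 0) (# 1) e m n & outerF a b c d a d a d (# 1) (# 1) e m n & coreF a b c d a (d ⊖ # 1) &
             (rangeF (a ⊖ # 1) d e m n ⇛ boxF a d (# 1) (# 0) e m n) & (cellOctF a b c d a d (# 1) (# 0) ⇛ ⊥′))
             a b c′ d p q e M N ok w (proj₁ zR) zP
      in balance a d true true false false (outer (a ℤ.- + 1) (d ℤ.- + 1) a d (+ 0) (+ 1) P∈ (west a d (+ 1)) bit₀ bit₁ h₁) (outer a d a d (+ 1) (+ 1) P∈ (east a d (+ 1)) bit₁ bit₁ h₂)
           (beyond (a ℤ.- + 1) d (cell a d (+ 1) (+ 1)) (cell a d (+ 1) (+ 0)) P∈ (proj₁ h₂ , bit₁ , bit₁) (proj₁ (proj₂ h₂)) h₆ (λ r → h₅ r , bit₁ , bit₀) (across-south a d))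
           (co a (d ℤ.- + 1) h₄) refl
    go (no _) (yes refl) (yes refl) (no _) =
      let (h₁ , h₂ , h₃ , h₅ , h₆) = omega 9 (λ a b c d p q e m n → validOctF a b c d e m n ⇛ centerF b c e m n ⇛ boxF b c p q e m n ⇛ cellOctF a b c d b c p q ⇛
             outerF a b c d (b ⊖ # 1) (c ⊖ # 1) b c (# 0) (# 0) e m n & outerF a b c d b c b c (# 1) (# 0) e m n & coreF a b c d (b ⊖ # 1) c &
             (rangeF b (c ⊖ # 1) e m n ⇛ boxF b c (# 1) (# 1) e m n) & (cellOctF a b c d b c (# 1) (# 1) ⇛ ⊥′))
             a b c′ d p q e M N ok w (proj₁ zR) zP
      in balance b c′ true true false false (outer (b ℤ.- + 1) (c′ ℤ.- + 1) b c′ (+ 0) (+ 0) P∈ (west b c′ (+ 0)) bit₀ bit₀ h₁) (outer b c′ b c′ (+ 1) (+ 0) P∈ (east b c′ (+ 0)) bit₁ bit₀ h₂) (co (b ℤ.- + 1) c′ h₃)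
           (beyond b (c′ ℤ.- + 1) (cell b c′ (+ 1) (+ 0)) (cell b c′ (+ 1) (+ 1)) P∈ (proj₁ h₂ , bit₁ , bit₀) (proj₁ (proj₂ h₂)) h₆ (λ r → h₅ r , bit₁ , bit₁) (across-north b c′))
           refl

  -- As m, n ≥ 2, at least one quadrant of every centre is in R.
  balance-at : ∀ k l → Center k l → Balance k l
  balance-at k l w = go (dec (k′ ⊕ l′ ⊕ e′ ≼ # m) []) (dec (k′ ⊖ l′ ⊕ # 1 ≼ # n) [])
    where
    k′ = cst k
    l′ = cst l
    e′ = cst e
    at : ∀ p q → CellR e M N (cell k l p q) → Balance k l
    at p q zR = let (P , P∈ , zP) = covers (cell k l p q) zR in balance-in {P} k l p q w P∈ zR zP
    boxAt : (p q : Expr) (A B : Form) → (k l e m n : Expr) → Form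
    boxAt p q A B k l e m n = # 2 ≼ m ⇛ # 2 ≼ n ⇛ centerF k l e m n ⇛ A ⇛ B ⇛ boxF k l p q e m n
    go : Dec (k ℤ.+ l ℤ.+ e ℤ.≤ M) → Dec (k ℤ.- l ℤ.+ + 1 ℤ.≤ N) → Balance k l
    go (yes r) (yes t) = at (+ 1) (+ 1) (omega 5 (λ k l e m n → boxAt (# 1) (# 1) (k ⊕ l ⊕ e ≼ m) (k ⊖ l ⊕ # 1 ≼ n) k l e m n) k l e M N m≥2 n≥2 w r t , bit₁ , bit₁)
    go (yes r) (no t) = at (+ 1) (+ 0) (omega 5 (λ k l e m n → boxAt (# 1) (# 0) (k ⊕ l ⊕ e ≼ m) (k ⊖ l ⊕ # 1 ≼ n ⇛ ⊥′) k l e m n) k l e M N m≥2 n≥2 w r t , bit₁ , bit₀)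
    go (no r) (yes t) = at (+ 0) (+ 1) (omega 5 (λ k l e m n → boxAt (# 0) (# 1) (k ⊕ l ⊕ e ≼ m ⇛ ⊥′) (k ⊖ l ⊕ # 1 ≼ n) k l e m n) k l e M N m≥2 n≥2 w r t , bit₀ , bit₁)
    go (no r) (no t) = at (+ 0) (+ 0) (omega 5 (λ k l e m n → boxAt (# 0) (# 0) (k ⊕ l ⊕ e ≼ m ⇛ ⊥′) (k ⊖ l ⊕ # 1 ≼ n ⇛ ⊥′) k l e m n) k l e M N m≥2 n≥2 w r t , bit₀ , bit₀)

  solution-kernel : ∀ w → adj u w ≡ false
  solution-kernel ((x , y) , col) with color-index (+ toℕ x ℤ.+ + toℕ y) (opp c) col
  ... | k₀ , h₀ with opp-eps (+ toℕ x ℤ.+ + toℕ y) c k₀ h₀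
  ...   | k₁ , h = trans (sym (cong₂ _xor_ (term (X ℤ.- + 1) Y (k ℤ.- + 1) (l ℤ.- + 1)
      (omega 5 (λ X Y k e k₁ → X ⊕ Y ≐ # 2 ⊗ k₁ ⊕ e ⊕ # 1 ⇛ (k₁ ⊕ # 2 ⊖ # 1) ⊕ (k₁ ⊕ # 1 ⊖ Y ⊖ # 1) ⊕ e ⊖ # 1 ≐ X ⊖ # 1 & (k₁ ⊕ # 2 ⊖ # 1) ⊖ (k₁ ⊕ # 1 ⊖ Y ⊖ # 1) ⊖ # 1 ≐ Y) X Y k e k₁ h))
    (cong₂ _xor_ (term (X ℤ.+ + 1) Y k l
      (omega 5 (λ X Y k e k₁ → X ⊕ Y ≐ # 2 ⊗ k₁ ⊕ e ⊕ # 1 ⇛ (k₁ ⊕ # 2) ⊕ (k₁ ⊕ # 1 ⊖ Y) ⊕ e ⊖ # 1 ≐ X ⊕ # 1 & (k₁ ⊕ # 2) ⊖ (k₁ ⊕ # 1 ⊖ Y) ⊖ # 1 ≐ Y) X Y k e k₁ h))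
    (cong₂ _xor_ (term X (Y ℤ.- + 1) (k ℤ.- + 1) l
      (omega 5 (λ X Y k e k₁ → X ⊕ Y ≐ # 2 ⊗ k₁ ⊕ e ⊕ # 1 ⇛ (k₁ ⊕ # 2 ⊖ # 1) ⊕ (k₁ ⊕ # 1 ⊖ Y) ⊕ e ⊖ # 1 ≐ X & (k₁ ⊕ # 2 ⊖ # 1) ⊖ (k₁ ⊕ # 1 ⊖ Y) ⊖ # 1 ≐ Y ⊖ # 1) X Y k e k₁ h))
    (term X (Y ℤ.+ + 1) k (l ℤ.- + 1)
      (omega 5 (λ X Y k e k₁ → X ⊕ Y ≐ # 2 ⊗ k₁ ⊕ e ⊕ # 1 ⇛ (k₁ ⊕ # 2) ⊕ (k₁ ⊕ # 1 ⊖ Y ⊖ # 1) ⊕ e ⊖ # 1 ≐ X & (k₁ ⊕ # 2) ⊖ (k₁ ⊕ # 1 ⊖ Y ⊖ # 1) ⊖ # 1 ≐ Y ⊕ # 1) X Y k e k₁ h)))))) (balance-at k l center)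
    where
    X Y k l : ℤ
    X = + toℕ x
    Y = + toℕ y
    -- The solution of k + l - 1 + e = x + 1 and k - l = y + 1, where x + y = 2 k₁ + e + 1.
    k = k₁ ℤ.+ + 2
    l = k₁ ℤ.+ + 1 ℤ.- Y
    term : ∀ x y i j → i ℤ.+ j ℤ.+ e ℤ.- + 1 ≡ x × i ℤ.- j ℤ.- + 1 ≡ y → value u i j ≡ val u x y
    term x y i j (p , q) = cong₂ (val u) p q
    below : ∀ {i m} → i ℕ.< m → + i ℤ.+ + 1 ℤ.≤ + m
    below {i} {m} i<m = ℤ.+≤+ (subst (ℕ._≤ m) (ℕₚ.+-comm 1 i) i<m)
    center : Center k l
    center = omega 6 (λ X Y e k₁ m n → X ⊕ Y ≐ # 2 ⊗ k₁ ⊕ e ⊕ # 1 ⇛ # 0 ≼ X ⇛ X ⊕ # 1 ≼ m ⇛ # 0 ≼ Y ⇛ Y ⊕ # 1 ≼ n ⇛ centerF (k₁ ⊕ # 2) (k₁ ⊕ # 1 ⊖ Y) e m n)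
      X Y e k₁ M N h (ℤ.+≤+ ℕ.z≤n) (below (Finₚ.toℕ<n x)) (ℤ.+≤+ ℕ.z≤n) (below (Finₚ.toℕ<n y))

  -- For an octagon, the seeds used are the ends of its horizontal sides: there one index is in a
  -- gap and the other just outside the other gap, so u = 1 gives the value of h beyond an end.
  record Seed (P : Piece) (i j : ℤ) : Set where
    constructor seed
    field
      z       : Cell
      zR      : CellR e M N z
      zP      : CellIn P z
      range   : Range e M N i j
      isTrue  : value u i j ≡ true

  private
    seedAt : ∀ {a b c d} i j k l p q → oct a b c d ∈ Ps → Vertex i j (cell k l p q) → Bit p → Bit q →
      ⟦ outerF (cst a) (cst b) (cst c) (cst d) (cst i) (cst j) (cst k) (cst l) (cst p) (cst q) (cst e) (cst M) (cst N) ⟧ [] → Seed (oct a b c d) i j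
    seedAt i j k l p q P∈ v bp bq h@(zR , zP , ¬co , r) = seed (cell k l p q) (zR , bp , bq) zP r (outer i j k l p q P∈ v bp bq h)

  module Corners (a b c′ d : ℤ) (P∈ : oct a b c′ d ∈ Ps) where
    private
      P : Piece
      P = oct a b c′ d
      At : (f : (a b c d e m n : Expr) → Form) → Set
      At f = ⟦ f (cst a) (cst b) (cst c′) (cst d) (cst e) (cst M) (cst N) ⟧ []
      ok : Valid e M N P
      ok = valids P∈

    -- The eastern end of the top side. If the octagon is symmetric about X = 0, the midpoint of
    -- this side is on that line, so the cells around it are not in R and a cell below the end is
    -- taken instead.
    seedNE : At clrR → At clrT → Seed P b c′
    seedNE r t with proj₁ (proj₂ (proj₂ ok))
    ... | inj₂ l = seedAt b c′ b c′ (+ 1) (+ 0) P∈ (east b c′ (+ 0)) bit₁ bit₀ (omega 7 (λ a b c d e m n → validOctF a b c d e m n ⇛ clrL a b c d e m n ⇛ clrR a b c d e m n ⇛ clrT a b c d e m n ⇛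
      outerF a b c d b c b c (# 1) (# 0) e m n) a b c′ d e M N ok l r t)
    ... | inj₁ l = seedAt b c′ b (c′ ℤ.+ + 1) (+ 1) (+ 1) P∈ (inj₂ (inj₂ (inj₁ (refl , refl , refl)))) bit₁ bit₁ (omega 7 (λ a b c d e m n → # 2 ≼ m ⇛ validOctF a b c d e m n ⇛ symL a b c d e m n ⇛ clrR a b c d e m n ⇛ clrT a b c d e m n ⇛
      outerF a b c d b c b (c ⊕ # 1) (# 1) (# 1) e m n) a b c′ d e M N m≥2 ok l r t)

    seedNW : At clrL → At clrT → Seed P (b ℤ.- + 1) (c′ ℤ.- + 1)
    seedNW l t with proj₁ (proj₂ (proj₂ (proj₂ ok)))
    ... | inj₂ r = seedAt (b ℤ.- + 1) (c′ ℤ.- + 1) b c′ (+ 0) (+ 0) P∈ (west b c′ (+ 0)) bit₀ bit₀ (omega 7 (λ a b c d e m n → validOctF a b c d e m n ⇛ clrL a b c d e m n ⇛ clrR a b c d e m n ⇛ clrT a b c d e m n ⇛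
      outerF a b c d (b ⊖ # 1) (c ⊖ # 1) b c (# 0) (# 0) e m n) a b c′ d e M N ok l r t)
    ... | inj₁ r = seedAt (b ℤ.- + 1) (c′ ℤ.- + 1) (b ℤ.- + 1) c′ (+ 0) (+ 1) P∈ (north (b ℤ.- + 1) c′ (+ 0)) bit₀ bit₁ (omega 7 (λ a b c d e m n → # 2 ≼ m ⇛ validOctF a b c d e m n ⇛ clrL a b c d e m n ⇛ symR a b c d e m n ⇛ clrT a b c d e m n ⇛
      outerF a b c d (b ⊖ # 1) (c ⊖ # 1) (b ⊖ # 1) c (# 0) (# 1) e m n) a b c′ d e M N m≥2 ok l r t)

    seedSW : At clrL → At clrB → Seed P (a ℤ.- + 1) (d ℤ.- + 1)
    seedSW l t with proj₁ (proj₂ (proj₂ (proj₂ ok)))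
    ... | inj₂ r = seedAt (a ℤ.- + 1) (d ℤ.- + 1) a d (+ 0) (+ 1) P∈ (west a d (+ 1)) bit₀ bit₁ (omega 7 (λ a b c d e m n → validOctF a b c d e m n ⇛ clrL a b c d e m n ⇛ clrR a b c d e m n ⇛ clrB a b c d e m n ⇛
      outerF a b c d (a ⊖ # 1) (d ⊖ # 1) a d (# 0) (# 1) e m n) a b c′ d e M N ok l r t)
    ... | inj₁ r = seedAt (a ℤ.- + 1) (d ℤ.- + 1) a (d ℤ.- + 1) (+ 0) (+ 0) P∈ (south a (d ℤ.- + 1) (+ 0)) bit₀ bit₀ (omega 7 (λ a b c d e m n → # 2 ≼ m ⇛ validOctF a b c d e m n ⇛ clrL a b c d e m n ⇛ symR a b c d e m n ⇛ clrB a b c d e m n ⇛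
      outerF a b c d (a ⊖ # 1) (d ⊖ # 1) a (d ⊖ # 1) (# 0) (# 0) e m n) a b c′ d e M N m≥2 ok l r t)

    seedSE : At clrR → At clrB → Seed P a d
    seedSE r t with proj₁ (proj₂ (proj₂ ok))
    ... | inj₂ l = seedAt a d a d (+ 1) (+ 1) P∈ (east a d (+ 1)) bit₁ bit₁ (omega 7 (λ a b c d e m n → validOctF a b c d e m n ⇛ clrL a b c d e m n ⇛ clrR a b c d e m n ⇛ clrB a b c d e m n ⇛
      outerF a b c d a d a d (# 1) (# 1) e m n) a b c′ d e M N ok l r t)
    ... | inj₁ l = seedAt a d (a ℤ.+ + 1) d (+ 1) (+ 0) P∈ (inj₂ (inj₂ (inj₂ (refl , refl , refl)))) bit₁ bit₀ (omega 7 (λ a b c d e m n → # 2 ≼ m ⇛ validOctF a b c d e m n ⇛ symL a b c d e m n ⇛ clrR a b c d e m n ⇛ clrB a b c d e m n ⇛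
      outerF a b c d a d (a ⊕ # 1) d (# 1) (# 0) e m n) a b c′ d e M N m≥2 ok l r t)

    exclusiveX : At symL → At symR → ⊥
    exclusiveX l r = omega 7 (λ a b c d e m n → # 2 ≼ m ⇛ symL a b c d e m n ⇛ symR a b c d e m n ⇛ ⊥′) a b c′ d e M N m≥2 l r

    exclusiveY : At symB → At symT → ⊥
    exclusiveY l r = omega 7 (λ a b c d e m n → # 2 ≼ n ⇛ symB a b c d e m n ⇛ symT a b c d e m n ⇛ ⊥′) a b c′ d e M N n≥2 l r

    -- The corners of the rectangle of points at which u = 1, up to the
    -- reflections that preserve it.
    someSeed : Σ ℤ λ i → Σ ℤ λ j → Seed P i j
    someSeed with ok
    ... | _ , _ , _ , inj₂ r , _ , inj₂ t = _ , _ , seedNE r t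
    ... | _ , _ , _ , inj₂ r , inj₂ bt , inj₁ t = _ , _ , seedSE r bt
    ... | _ , _ , _ , inj₂ r , inj₁ bt , inj₁ t = ⊥-elim (exclusiveY bt t)
    ... | _ , _ , inj₁ l , inj₁ r , _ , _ = ⊥-elim (exclusiveX l r)
    ... | _ , _ , inj₂ l , inj₁ r , _ , inj₂ t = _ , _ , seedNW l t
    ... | _ , _ , inj₂ l , inj₁ r , inj₂ bt , inj₁ t = _ , _ , seedSW l bt
    ... | _ , _ , inj₂ l , inj₁ r , inj₁ bt , inj₁ t = ⊥-elim (exclusiveY bt t)

  some-true : ∀ P → P ∈ Ps → Σ ℤ λ i → Σ ℤ λ j → Range e M N i j × value u i j ≡ true
  some-true (oct a b c′ d) P∈ = let (i , j , s) = Corners.someSeed a b c′ d P∈ in i , j , Seed.range s , Seed.isTrue s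
  some-true (dia k l) P∈ = k , l , omega 5 (λ k l e m n → validDiaF k l e m n ⇛ rangeF k l e m n) k l e M N (valids P∈) , proj₁ (proj₂ (dia-true k l P∈))

  module _ {h : ℤ → Bool} (W : IsWave e M N h)
    (rep : ∀ i j → + 0 ℤ.≤ i ℤ.+ j ℤ.+ e → i ℤ.+ j ℤ.+ e ℤ.≤ M ℤ.+ + 1 → + 0 ℤ.≤ i ℤ.- j → i ℤ.- j ℤ.≤ N ℤ.+ + 1 → value u i j ≡ h i xor h j) where
    open IsWave W

    private
      m≥1 : + 1 ℤ.≤ M
      m≥1 = ℤₚ.≤-trans (ℤ.+≤+ (ℕ.s≤s ℕ.z≤n)) m≥2
      n≥1 : + 1 ℤ.≤ N
      n≥1 = ℤₚ.≤-trans (ℤ.+≤+ (ℕ.s≤s ℕ.z≤n)) n≥2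

    rep-range : ∀ i j → Range e M N i j → value u i j ≡ h i xor h j
    rep-range i j r = let (p₁ , p₂ , p₃ , p₄) = omega 5 (λ i j e m n → rangeF i j e m n ⇛ # 0 ≼ i ⊕ j ⊕ e & i ⊕ j ⊕ e ≼ m ⊕ # 1 & # 0 ≼ i ⊖ j & i ⊖ j ≼ n ⊕ # 1) i j e M N r
      in rep i j p₁ p₂ p₃ p₄

    xor-true : ∀ {p q} → p xor q ≡ true → p ≡ not q
    xor-true {false} {true} _ = refl
    xor-true {true} {false} _ = refl

    module _ (a b c′ d : ℤ) (P∈ : oct a b c′ d ∈ Ps) where
      open Corners a b c′ d P∈
      private
        ok : Valid e M N (oct a b c′ d)
        ok = valids P∈
        C : ℤ → ℤ → Set
        C i j = Core (oct a b c′ d) i j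

      columnF : (i j e m : Expr) → Form
      columnF i j e m = # 0 ≼ i ⊕ j ⊕ e & i ⊕ j ⊕ e ≼ m ⊕ # 1

      -- A core point with Y < 0 or Y > n + 1 exists only if the octagon is symmetric about Y = 0 or
      -- Y = n + 1. Its mirror image is then a core point in the strip, and h does not distinguish
      -- the two.
      core-equal-column : ∀ i j → C i j → ⟦ columnF (cst i) (cst j) (cst e) (cst M) ⟧ [] → h i ≡ h j
      core-equal-column i j co (x₁ , x₂) = go ((+ 0) ℤ.≤? (i ℤ.- j)) ((i ℤ.- j) ℤ.≤? (N ℤ.+ + 1))
        where
        inFrame : ∀ i j → C i j → ⟦ columnF (cst i) (cst j) (cst e) (cst M) ⟧ [] → + 0 ℤ.≤ i ℤ.- j → i ℤ.- j ℤ.≤ N ℤ.+ + 1 → h i ≡ h j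
        inFrame i j co (x₁ , x₂) y₁ y₂ = xor-≡ (trans (sym (rep i j x₁ x₂ y₁ y₂)) (core-false i j P∈ co))
        go : Dec _ → Dec _ → h i ≡ h j
        go (yes y₁) (yes y₂) = inFrame i j co (x₁ , x₂) y₁ y₂
        go (no y₁) _ = let (co′ , x′ , y₃ , y₄) = omega 9 (λ a b c d i j e m n → validOctF a b c d e m n ⇛ coreF a b c d i j ⇛ columnF i j e m ⇛ # 2 ≼ n ⇛ (# 0 ≼ i ⊖ j ⇛ ⊥′) ⇛
                                        coreF a b c d j i & columnF j i e m & # 0 ≼ j ⊖ i & j ⊖ i ≼ n ⊕ # 1) a b c′ d i j e M N ok co (x₁ , x₂) n≥2 y₁
          in sym (inFrame j i co′ x′ y₃ y₄)
        go (yes _) (no y₂) = let (co′ , x′ , y₃ , y₄) = omega 9 (λ a b c d i j e m n → validOctF a b c d e m n ⇛ coreF a b c d i j ⇛ columnF i j e m ⇛ # 2 ≼ n ⇛ (i ⊖ j ≼ n ⊕ # 1 ⇛ ⊥′) ⇛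
                                        coreF a b c d (j ⊕ (n ⊕ # 1)) (i ⊖ (n ⊕ # 1)) & columnF (j ⊕ (n ⊕ # 1)) (i ⊖ (n ⊕ # 1)) e m &
                                        # 0 ≼ j ⊕ (n ⊕ # 1) ⊖ (i ⊖ (n ⊕ # 1)) & j ⊕ (n ⊕ # 1) ⊖ (i ⊖ (n ⊕ # 1)) ≼ n ⊕ # 1) a b c′ d i j e M N ok co (x₁ , x₂) n≥2 y₂
          in trans (trans (trans (cong h (omega 2 (λ i n → i ≐ i ⊖ (n ⊕ # 1) ⊕ (n ⊕ # 1)) i N)) (shiftY (i ℤ.- (N ℤ.+ + 1))))
               (sym (inFrame (j ℤ.+ (N ℤ.+ + 1)) (i ℤ.- (N ℤ.+ + 1)) co′ x′ y₃ y₄))) (shiftY j)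

      -- The same reflection argument for X reduces to `core-equal-column`. Core points outside R
      -- matter because the gaps of a symmetric octagon extend beyond R.
      core-equal : ∀ i j → C i j → h i ≡ h j
      core-equal i j co = go ((+ 0) ℤ.≤? (i ℤ.+ j ℤ.+ e)) ((i ℤ.+ j ℤ.+ e) ℤ.≤? (M ℤ.+ + 1))
        where
        go : Dec _ → Dec _ → h i ≡ h j
        go (yes x₁) (yes x₂) = core-equal-column i j co (x₁ , x₂)
        go (no x₁) _ = let (co′ , x′) = omega 9 (λ a b c d i j e m n → validOctF a b c d e m n ⇛ coreF a b c d i j ⇛ # 2 ≼ m ⇛ (# 0 ≼ i ⊕ j ⊕ e ⇛ ⊥′) ⇛
                                        coreF a b c d (⊝ e ⊖ j) (⊝ e ⊖ i) & columnF (⊝ e ⊖ j) (⊝ e ⊖ i) e m) a b c′ d i j e M N ok co m≥2 x₁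
          in trans (sym (reflect i)) (trans (sym (core-equal-column (ℤ.- e ℤ.- j) (ℤ.- e ℤ.- i) co′ x′)) (reflect j))
        go (yes _) (no x₂) = let (co′ , x′) = omega 9 (λ a b c d i j e m n → validOctF a b c d e m n ⇛ coreF a b c d i j ⇛ # 2 ≼ m ⇛ (i ⊕ j ⊕ e ≼ m ⊕ # 1 ⇛ ⊥′) ⇛
                                        coreF a b c d (m ⊕ # 1 ⊖ e ⊖ j) (m ⊕ # 1 ⊖ e ⊖ i) & columnF (m ⊕ # 1 ⊖ e ⊖ j) (m ⊕ # 1 ⊖ e ⊖ i) e m) a b c′ d i j e M N ok co m≥2 x₂
          in trans (sym (reflectX m≥1 n≥1 W i)) (trans (sym (core-equal-column (M ℤ.+ + 1 ℤ.- e ℤ.- j) (M ℤ.+ + 1 ℤ.- e ℤ.- i) co′ x′)) (reflectX m≥1 n≥1 W j))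

      private
        v : Bool
        v = h c′
        a<b = proj₁ ok
        c<d = proj₁ (proj₂ ok)

      run₁ : ∀ k → a ℤ.≤ k → k ℤ.+ + 1 ℤ.≤ b → h k ≡ v
      run₁ k p q = core-equal k c′ (p , q , ℤₚ.≤-refl , c<d)

      run₂ : ∀ k → c′ ℤ.≤ k → k ℤ.+ + 1 ℤ.≤ d → h k ≡ v
      run₂ k p q = trans (sym (core-equal a k (ℤₚ.≤-refl , a<b , p , q))) (run₁ a ℤₚ.≤-refl a<b)

      Outer : Set
      Outer = h b ≡ not v × h (c′ ℤ.- + 1) ≡ not v × h (a ℤ.- + 1) ≡ not v × h d ≡ not v

      private
        At : (f : (a b c d e m n : Expr) → Form) → Set
        At f = ⟦ f (cst a) (cst b) (cst c′) (cst d) (cst e) (cst M) (cst N) ⟧ []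

        pred< : ∀ {x y} → x ℤ.+ + 1 ℤ.≤ y → x ℤ.≤ y ℤ.- + 1
        pred< {x} {y} = omega 2 (λ x y → x ⊕ # 1 ≼ y ⇛ x ≼ y ⊖ # 1) x y
        pred≤ : ∀ y → y ℤ.- + 1 ℤ.+ + 1 ℤ.≤ y
        pred≤ = omega 1 (λ y → y ⊖ # 1 ⊕ # 1 ≼ y)
        flip : ∀ {p q} → p ≡ not q → q ≡ not p
        flip {p} {q} refl = sym (Boolₚ.not-involutive q)

        ne : At clrR → At clrT → h b ≡ not v
        ne r t = let s = seedNE r t in xor-true (trans (sym (rep-range b c′ (Seed.range s))) (Seed.isTrue s))
        nw : At clrL → At clrT → h (c′ ℤ.- + 1) ≡ not v
        nw l t = let s = seedNW l t in trans (flip (xor-true (trans (sym (rep-range (b ℤ.- + 1) (c′ ℤ.- + 1) (Seed.range s))) (Seed.isTrue s)))) (cong not (run₁ (b ℤ.- + 1) (pred< a<b) (pred≤ b)))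
        sw : At clrL → At clrB → h (a ℤ.- + 1) ≡ not v
        sw l t = let s = seedSW l t in trans (xor-true (trans (sym (rep-range (a ℤ.- + 1) (d ℤ.- + 1) (Seed.range s))) (Seed.isTrue s))) (cong not (run₂ (d ℤ.- + 1) (pred< c<d) (pred≤ d)))
        se : At clrR → At clrB → h d ≡ not v
        se r t = let s = seedSE r t in trans (flip (xor-true (trans (sym (rep-range a d (Seed.range s))) (Seed.isTrue s)))) (cong not (run₁ a ℤₚ.≤-refl a<b))

        xsym : At symL ⊎ At symR → h (c′ ℤ.- + 1) ≡ h b × h (a ℤ.- + 1) ≡ h d
        xsym (inj₁ l) = let (p , q) = omega 7 (λ a b c d e m n → symL a b c d e m n ⇛ c ⊖ # 1 ≐ ⊝ e ⊖ b & a ⊖ # 1 ≐ ⊝ e ⊖ d) a b c′ d e M N l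
          in trans (cong h p) (reflect b) , trans (cong h q) (reflect d)
        xsym (inj₂ r) = let (p , q) = omega 7 (λ a b c d e m n → symR a b c d e m n ⇛ c ⊖ # 1 ≐ m ⊕ # 1 ⊖ e ⊖ b & a ⊖ # 1 ≐ m ⊕ # 1 ⊖ e ⊖ d) a b c′ d e M N r
          in trans (cong h p) (reflectX m≥1 n≥1 W b) , trans (cong h q) (reflectX m≥1 n≥1 W d)

        ysym : At symB ⊎ At symT → h (a ℤ.- + 1) ≡ h (c′ ℤ.- + 1) × h b ≡ h d
        ysym (inj₁ (_ , refl , refl)) = refl , refl
        ysym (inj₂ t) = let (p , q) = omega 7 (λ a b c d e m n → symT a b c d e m n ⇛ a ⊖ # 1 ≐ c ⊖ # 1 ⊕ (n ⊕ # 1) & b ≐ d ⊕ (n ⊕ # 1)) a b c′ d e M N t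
          in trans (cong h p) (shiftY (c′ ℤ.- + 1)) , trans (cong h q) (shiftY d)

      -- An end of a horizontal side that is in R provides a seed. The values of h belonging to the
      -- ends outside R follow from the symmetries of the octagon and of h.
      outers : Outer
      outers with ok
      ... | _ , _ , inj₂ l , inj₂ r , inj₂ bt , inj₂ t = ne r t , nw l t , sw l bt , se r bt
      ... | _ , _ , inj₁ l , inj₂ r , inj₂ bt , inj₂ t = let (p , q) = xsym (inj₁ l) in ne r t , trans p (ne r t) , trans q (se r bt) , se r bt
      ... | _ , _ , inj₂ l , inj₁ r , inj₂ bt , inj₂ t = let (p , q) = xsym (inj₂ r) in trans (sym p) (nw l t) , nw l t , sw l bt , trans (sym q) (sw l bt)
      ... | _ , _ , inj₂ l , inj₂ r , inj₁ bt , inj₂ t = let (p , q) = ysym (inj₁ bt) in ne r t , nw l t , trans p (nw l t) , trans (sym q) (ne r t)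
      ... | _ , _ , inj₂ l , inj₂ r , inj₂ bt , inj₁ t = let (p , q) = ysym (inj₂ t) in trans q (se r bt) , trans (sym p) (sw l bt) , sw l bt , se r bt
      ... | _ , _ , inj₁ l , inj₂ r , inj₁ bt , inj₂ t = let (p , q) = xsym (inj₁ l) ; (p′ , q′) = ysym (inj₁ bt) in
            ne r t , trans p (ne r t) , trans p′ (trans p (ne r t)) , trans (sym q′) (ne r t)
      ... | _ , _ , inj₁ l , inj₂ r , inj₂ bt , inj₁ t = let (p , q) = xsym (inj₁ l) ; (p′ , q′) = ysym (inj₂ t) in
            trans q′ (se r bt) , trans p (trans q′ (se r bt)) , trans q (se r bt) , se r bt
      ... | _ , _ , inj₂ l , inj₁ r , inj₁ bt , inj₂ t = let (p , q) = xsym (inj₂ r) ; (p′ , q′) = ysym (inj₁ bt) in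
            trans (sym p) (nw l t) , nw l t , trans p′ (nw l t) , trans (sym q′) (trans (sym p) (nw l t))
      ... | _ , _ , inj₂ l , inj₁ r , inj₂ bt , inj₁ t = let (p , q) = xsym (inj₂ r) ; (p′ , q′) = ysym (inj₂ t) in
            trans (sym p) (trans (sym p′) (sw l bt)) , trans (sym p′) (sw l bt) , sw l bt , trans (sym q) (sw l bt)
      ... | _ , _ , inj₁ l , inj₁ r , _ , _ = ⊥-elim (exclusiveX l r)
      ... | _ , _ , _ , _ , inj₁ bt , inj₁ t = ⊥-elim (exclusiveY bt t)

      oct-good : Good e M N h (oct a b c′ d)
      oct-good = let (i , j , s) = someSeed ; (hb , hc , ha , hd) = outers in
        v , gap a<b ha hb run₁ , gap c<d hc hd run₂ , Seed.z s , Seed.zR s , Seed.zP s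

    family-good : ∀ P → P ∈ Ps → Good e M N h P
    family-good (oct a b c′ d) P∈ = oct-good a b c′ d P∈
    family-good (dia k l) P∈ =
      let (_ , t₂ , t₃ , t₄) = dia-true k l P∈
          (r₂ , r₃ , r₄ , r) = omega 5 (λ k l e m n → validDiaF k l e m n ⇛ rangeF k l e m n & rangeF (k ⊖ # 1) l e m n & rangeF k (l ⊖ # 1) e m n &
            (# 2 ≼ k ⊕ l ⊕ e & k ⊕ l ⊕ e ≼ m ⊕ # 1 & # 1 ≼ k ⊖ l & k ⊖ l ≼ n)) k l e M N (valids P∈)
          x₂ = xor-true (trans (sym (rep-range k l r₂)) t₂)
          x₃ = xor-true (trans (sym (rep-range (k ℤ.- + 1) l r₃)) t₃)
          x₄ = xor-true (trans (sym (rep-range k (l ℤ.- + 1) r₄)) t₄)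
      in h k , (trans x₃ (sym x₂) , refl , inverse x₄ , inverse x₂) , r
      where
      inverse : ∀ {p q} → p ≡ not q → q ≡ not p
      inverse {p} {q} refl = sym (Boolₚ.not-involutive q)

-- The core points in R are determined by the cells of a piece

withinF : (a b c d k l : Expr) → Form
withinF a b c d k l = a ≼ k & k ≼ b & c ≼ l & l ≼ d

module _ {e m n : ℤ} (m≥2 : + 2 ℤ.≤ m) (n≥2 : + 2 ℤ.≤ n) where

  module _ (a b c d : ℤ) (V : Valid e m n (oct a b c d)) (i j : ℤ) (co : Core (oct a b c d) i j) (r : Range e m n i j)
    (P′ : Piece) (V′ : Valid e m n P′)
    (to : ∀ z → CellR e m n z → CellIn (oct a b c d) z → CellIn P′ z)
    (from : ∀ z → CellR e m n z → CellIn P′ z → CellIn (oct a b c d) z) where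

    private
      East West North South : Set
      East = i ℤ.+ j ℤ.+ e ℤ.+ + 1 ℤ.≤ m
      West = + 2 ℤ.≤ i ℤ.+ j ℤ.+ e
      North = i ℤ.- j ℤ.+ + 1 ℤ.≤ n
      South = + 2 ℤ.≤ i ℤ.- j
      bit₀ : ⟦ bitF (# 0) ⟧ []
      bit₀ = inj₁ refl
      bit₁ : ⟦ bitF (# 1) ⟧ []
      bit₁ = inj₂ refl
      near : ∀ z → CellR e m n z → Vertex i j z → CellIn P′ z
      near z zR v = to z zR (core-cell e m n (oct a b c d) i j z zR co v)

    vertical : North ⊎ South
    vertical with i ℤ.- j ℤ.+ + 1 ℤ.≤? n
    ... | yes p = inj₁ p
    ... | no p = inj₂ (omega 3 (λ i j n → # 2 ≼ n ⇛ (i ⊖ j ⊕ # 1 ≼ n ⇛ ⊥′) ⇛ # 2 ≼ i ⊖ j) i j n n≥2 p)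

    horizontal : East ⊎ West
    horizontal with i ℤ.+ j ℤ.+ e ℤ.+ + 1 ℤ.≤? m
    ... | yes p = inj₁ p
    ... | no p = inj₂ (omega 4 (λ i j e m → # 2 ≼ m ⇛ (i ⊕ j ⊕ e ⊕ # 1 ≼ m ⇛ ⊥′) ⇛ # 2 ≼ i ⊕ j ⊕ e) i j e m m≥2 p)

    eastCell : East → Σ ℤ λ q → CellIn P′ (cell (i ℤ.+ + 1) (j ℤ.+ + 1) (+ 0) q)
    eastCell x with vertical
    ... | inj₁ y = + 1 , near _ (omega 5 (λ i j e m n → rangeF i j e m n ⇛ i ⊕ j ⊕ e ⊕ # 1 ≼ m ⇛ i ⊖ j ⊕ # 1 ≼ n ⇛ boxF (i ⊕ # 1) (j ⊕ # 1) (# 0) (# 1) e m n) i j e m n r x y , bit₀ , bit₁) (inj₂ (inj₁ (refl , refl , refl)))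
    ... | inj₂ y = + 0 , near _ (omega 5 (λ i j e m n → rangeF i j e m n ⇛ i ⊕ j ⊕ e ⊕ # 1 ≼ m ⇛ # 2 ≼ i ⊖ j ⇛ boxF (i ⊕ # 1) (j ⊕ # 1) (# 0) (# 0) e m n) i j e m n r x y , bit₀ , bit₀) (inj₂ (inj₁ (refl , refl , refl)))

    westCell : West → Σ ℤ λ q → CellIn P′ (cell i j (+ 1) q)
    westCell x with vertical
    ... | inj₁ y = + 1 , near _ (omega 5 (λ i j e m n → rangeF i j e m n ⇛ # 2 ≼ i ⊕ j ⊕ e ⇛ i ⊖ j ⊕ # 1 ≼ n ⇛ boxF i j (# 1) (# 1) e m n) i j e m n r x y , bit₁ , bit₁) (inj₁ (refl , refl , refl))
    ... | inj₂ y = + 0 , near _ (omega 5 (λ i j e m n → rangeF i j e m n ⇛ # 2 ≼ i ⊕ j ⊕ e ⇛ # 2 ≼ i ⊖ j ⇛ boxF i j (# 1) (# 0) e m n) i j e m n r x y , bit₁ , bit₀) (inj₁ (refl , refl , refl))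

    northCell : North → Σ ℤ λ p → CellIn P′ (cell (i ℤ.+ + 1) j p (+ 0))
    northCell y with horizontal
    ... | inj₁ x = + 1 , near _ (omega 5 (λ i j e m n → rangeF i j e m n ⇛ i ⊕ j ⊕ e ⊕ # 1 ≼ m ⇛ i ⊖ j ⊕ # 1 ≼ n ⇛ boxF (i ⊕ # 1) j (# 1) (# 0) e m n) i j e m n r x y , bit₁ , bit₀) (inj₂ (inj₂ (inj₂ (refl , refl , refl))))
    ... | inj₂ x = + 0 , near _ (omega 5 (λ i j e m n → rangeF i j e m n ⇛ # 2 ≼ i ⊕ j ⊕ e ⇛ i ⊖ j ⊕ # 1 ≼ n ⇛ boxF (i ⊕ # 1) j (# 0) (# 0) e m n) i j e m n r x y , bit₀ , bit₀) (inj₂ (inj₂ (inj₂ (refl , refl , refl))))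

    southCell : South → Σ ℤ λ p → CellIn P′ (cell i (j ℤ.+ + 1) p (+ 1))
    southCell y with horizontal
    ... | inj₁ x = + 1 , near _ (omega 5 (λ i j e m n → rangeF i j e m n ⇛ i ⊕ j ⊕ e ⊕ # 1 ≼ m ⇛ # 2 ≼ i ⊖ j ⇛ boxF i (j ⊕ # 1) (# 1) (# 1) e m n) i j e m n r x y , bit₁ , bit₁) (inj₂ (inj₂ (inj₁ (refl , refl , refl))))
    ... | inj₂ x = + 0 , near _ (omega 5 (λ i j e m n → rangeF i j e m n ⇛ # 2 ≼ i ⊕ j ⊕ e ⇛ # 2 ≼ i ⊖ j ⇛ boxF i (j ⊕ # 1) (# 0) (# 1) e m n) i j e m n r x y , bit₀ , bit₁) (inj₂ (inj₂ (inj₁ (refl , refl , refl))))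

    -- The cells around (i , j) belong to different diamonds.
    not-dia : ∀ k l → P′ ≡ dia k l → ⊥
    not-dia k l refl with horizontal | vertical
    ... | inj₁ x | inj₁ y = omega 4 (λ i j k l → i ⊕ # 1 ≐ k ⇛ j ⊕ # 1 ≐ l ⇛ i ⊕ # 1 ≐ k ⇛ j ≐ l ⇛ ⊥′) i j k l
      (proj₁ (proj₂ (eastCell x))) (proj₂ (proj₂ (eastCell x))) (proj₁ (proj₂ (northCell y))) (proj₂ (proj₂ (northCell y)))
    ... | inj₁ x | inj₂ y = omega 4 (λ i j k l → i ⊕ # 1 ≐ k ⇛ j ⊕ # 1 ≐ l ⇛ i ≐ k ⇛ j ⊕ # 1 ≐ l ⇛ ⊥′) i j k l
      (proj₁ (proj₂ (eastCell x))) (proj₂ (proj₂ (eastCell x))) (proj₁ (proj₂ (southCell y))) (proj₂ (proj₂ (southCell y)))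
    ... | inj₂ x | inj₁ y = omega 4 (λ i j k l → i ≐ k ⇛ j ≐ l ⇛ i ⊕ # 1 ≐ k ⇛ j ≐ l ⇛ ⊥′) i j k l
      (proj₁ (proj₂ (westCell x))) (proj₂ (proj₂ (westCell x))) (proj₁ (proj₂ (northCell y))) (proj₂ (proj₂ (northCell y)))
    ... | inj₂ x | inj₂ y = omega 4 (λ i j k l → i ≐ k ⇛ j ≐ l ⇛ i ≐ k ⇛ j ⊕ # 1 ≐ l ⇛ ⊥′) i j k l
      (proj₁ (proj₂ (westCell x))) (proj₂ (proj₂ (westCell x))) (proj₁ (proj₂ (southCell y))) (proj₂ (proj₂ (southCell y)))

    module _ (a′ b′ c′ d′ : ℤ) (eq : P′ ≡ oct a′ b′ c′ d′) where
      private
        inOct : ∀ {z} → CellIn P′ z → CellIn (oct a′ b′ c′ d′) z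
        inOct {z} = subst (λ P → CellIn P z) eq
        V″ : Valid e m n (oct a′ b′ c′ d′)
        V″ = subst (Valid e m n) eq V′
        to′ : ∀ z → CellR e m n z → CellIn (oct a b c d) z → CellIn (oct a′ b′ c′ d′) z
        to′ z zR zP = inOct {z} (to z zR zP)
        from′ : ∀ z → CellR e m n z → CellIn (oct a′ b′ c′ d′) z → CellIn (oct a b c d) z
        from′ z zR zP = from z zR (subst (λ P → CellIn P z) (sym eq) zP)
        -- A cell with western vertex (i , j) has k = i + 1 and l = j + 1, so k ≤ b′ and l ≤ d′ are
        -- the upper bounds for a core point. The western cell gives the lower bounds, and each of
        -- the other two gives one of either kind.
        eastE : East → ⟦ withinF (cst a′) (cst b′) (cst c′) (cst d′) (cst i ⊕ # 1) (cst j ⊕ # 1) ⟧ []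
        eastE x = let (p , q , p′ , q′ , _) = inOct (proj₂ (eastCell x)) in p , q , p′ , q′
        westE : West → ⟦ withinF (cst a′) (cst b′) (cst c′) (cst d′) (cst i) (cst j) ⟧ []
        westE x = let (p , q , p′ , q′ , _) = inOct (proj₂ (westCell x)) in p , q , p′ , q′
        northE : North → ⟦ withinF (cst a′) (cst b′) (cst c′) (cst d′) (cst i ⊕ # 1) (cst j) ⟧ []
        northE x = let (p , q , p′ , q′ , _) = inOct (proj₂ (northCell x)) in p , q , p′ , q′
        southE : South → ⟦ withinF (cst a′) (cst b′) (cst c′) (cst d′) (cst i) (cst j ⊕ # 1) ⟧ []
        southE x = let (p , q , p′ , q′ , _) = inOct (proj₂ (southCell x)) in p , q , p′ , q′

      -- If (i , j) is a corner of the rectangle, the two cells around it may lie in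
      -- two octagons of which only one has (i , j) in its core; these differ in
      -- another cell.
      corner-north-east : i ℤ.+ j ℤ.+ e ≡ m → i ℤ.- j ≡ n → i ℤ.+ + 1 ℤ.≤ b′
      corner-north-east x y = ok (i ℤ.+ + 1 ℤ.≤? b′) (a ℤ.+ + 1 ℤ.≤? i)
        where
        symmetric = omega 9 (λ a b c d i j e m n → validOctF a b c d e m n ⇛ coreF a b c d i j ⇛ i ⊕ j ⊕ e ≐ m ⇛ i ⊖ j ≐ n ⇛ # 2 ≼ m ⇛ # 2 ≼ n ⇛
          symR a b c d e m n & symT a b c d e m n & clrL a b c d e m n & clrB a b c d e m n) a b c d i j e m n V co x y m≥2 n≥2
        w = westE (omega 4 (λ i j e m → i ⊕ j ⊕ e ≐ m ⇛ # 2 ≼ m ⇛ # 2 ≼ i ⊕ j ⊕ e) i j e m x m≥2)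
        s = southE (omega 3 (λ i j n → i ⊖ j ≐ n ⇛ # 2 ≼ n ⇛ # 2 ≼ i ⊖ j) i j n y n≥2)
        -- For i ≥ b′ only a square or hexagon pushed into the corner is left, while the first
        -- octagon shows a triangle.
        extreme = λ p → omega 9 (λ a b c d i j e m n → validOctF a b c d e m n ⇛ i ⊕ j ⊕ e ≐ m ⇛ i ⊖ j ≐ n ⇛ # 2 ≼ m ⇛ # 2 ≼ n ⇛
          withinF a b c d i j ⇛ withinF a b c d i (j ⊕ # 1) ⇛ (i ⊕ # 1 ≼ b ⇛ ⊥′) ⇛
          b ≐ i & d ≐ j ⊕ # 1 & c ≐ j & clrL a b c d e m n & clrB a b c d e m n) a′ b′ c′ d′ i j e m n V″ x y m≥2 n≥2 w s p
        ok : Dec (i ℤ.+ + 1 ℤ.≤ b′) → Dec (a ℤ.+ + 1 ℤ.≤ i) → i ℤ.+ + 1 ℤ.≤ b′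
        ok (yes p) _ = p
        -- For a < i the triangle reaches further down the side X = m than the two units that the
        -- hexagon or square occupies there.
        ok (no p) (yes q) = ⊥-elim (
          let (zR , zP , no′) = omega 13 (λ a b c d a′ b′ c′ d′ i j e m n → (symR a b c d e m n & symT a b c d e m n & clrL a b c d e m n & clrB a b c d e m n) ⇛ (b′ ≐ i & d′ ≐ j ⊕ # 1 & c′ ≐ j & clrL a′ b′ c′ d′ e m n & clrB a′ b′ c′ d′ e m n) ⇛
                i ⊕ j ⊕ e ≐ m ⇛ i ⊖ j ≐ n ⇛ a ⊕ # 1 ≼ i ⇛
                boxF (i ⊖ # 1) (j ⊕ # 2) (# 0) (# 1) e m n & cellOctF a b c d (i ⊖ # 1) (j ⊕ # 2) (# 0) (# 1) & (j ⊕ # 2 ≼ d′ ⇛ ⊥′))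
                a b c d a′ b′ c′ d′ i j e m n symmetric (extreme p) x y q
          in no′ ((proj₁ ∘ proj₂ ∘ proj₂ ∘ proj₂) (to′ (cell (i ℤ.- + 1) (j ℤ.+ + 2) (+ 0) (+ 1)) (zR , bit₀ , bit₁) zP)))
        -- For a = i the triangle has legs of length 2, and the other piece extends beyond its
        -- hypotenuse.
        ok (no p) (no q) = ⊥-elim (
          let (zR , zP , no′) = omega 13 (λ a b c d a′ b′ c′ d′ i j e m n → a′ ≺ b′ ⇛ c′ ≺ d′ ⇛ (b′ ≐ i & d′ ≐ j ⊕ # 1 & c′ ≐ j & clrL a′ b′ c′ d′ e m n & clrB a′ b′ c′ d′ e m n) ⇛
                i ⊕ j ⊕ e ≐ m ⇛ i ⊖ j ≐ n ⇛ # 2 ≼ m ⇛ # 2 ≼ n ⇛ (a ⊕ # 1 ≼ i ⇛ ⊥′) ⇛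
                boxF (i ⊖ # 1) j (# 1) (# 0) e m n & cellOctF a′ b′ c′ d′ (i ⊖ # 1) j (# 1) (# 0) & (a ≼ i ⊖ # 1 ⇛ ⊥′))
                a b c d a′ b′ c′ d′ i j e m n (proj₁ V″) (proj₁ (proj₂ V″)) (extreme p) x y m≥2 n≥2 q
          in no′ (proj₁ (from′ (cell (i ℤ.- + 1) j (+ 1) (+ 0)) (zR , bit₁ , bit₀) zP)))

      corner-south-east : i ℤ.+ j ℤ.+ e ≡ m → i ℤ.- j ≡ + 1 → j ℤ.+ + 1 ℤ.≤ d′
      corner-south-east x y = ok (j ℤ.+ + 1 ℤ.≤? d′) (c ℤ.+ + 1 ℤ.≤? j)
        where
        symmetric = omega 9 (λ a b c d i j e m n → validOctF a b c d e m n ⇛ coreF a b c d i j ⇛ i ⊕ j ⊕ e ≐ m ⇛ i ⊖ j ≐ # 1 ⇛ # 2 ≼ m ⇛ # 2 ≼ n ⇛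
          symR a b c d e m n & symB a b c d e m n & clrL a b c d e m n & clrT a b c d e m n) a b c d i j e m n V co x y m≥2 n≥2
        w = westE (omega 4 (λ i j e m → i ⊕ j ⊕ e ≐ m ⇛ # 2 ≼ m ⇛ # 2 ≼ i ⊕ j ⊕ e) i j e m x m≥2)
        s = northE (omega 3 (λ i j n → i ⊖ j ≐ # 1 ⇛ # 2 ≼ n ⇛ i ⊖ j ⊕ # 1 ≼ n) i j n y n≥2)
        extreme = λ p → omega 9 (λ a b c d i j e m n → validOctF a b c d e m n ⇛ i ⊕ j ⊕ e ≐ m ⇛ i ⊖ j ≐ # 1 ⇛ # 2 ≼ m ⇛ # 2 ≼ n ⇛
          withinF a b c d i j ⇛ withinF a b c d (i ⊕ # 1) j ⇛ (j ⊕ # 1 ≼ d ⇛ ⊥′) ⇛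
          d ≐ j & b ≐ i ⊕ # 1 & a ≐ i & clrL a b c d e m n & clrT a b c d e m n) a′ b′ c′ d′ i j e m n V″ x y m≥2 n≥2 w s p
        ok : Dec (j ℤ.+ + 1 ℤ.≤ d′) → Dec (c ℤ.+ + 1 ℤ.≤ j) → j ℤ.+ + 1 ℤ.≤ d′
        ok (yes p) _ = p
        ok (no p) (yes q) = ⊥-elim (
          let (zR , zP , no′) = omega 13 (λ a b c d a′ b′ c′ d′ i j e m n → (symR a b c d e m n & symB a b c d e m n & clrL a b c d e m n & clrT a b c d e m n) ⇛ (d′ ≐ j & b′ ≐ i ⊕ # 1 & a′ ≐ i & clrL a′ b′ c′ d′ e m n & clrT a′ b′ c′ d′ e m n) ⇛
                i ⊕ j ⊕ e ≐ m ⇛ i ⊖ j ≐ # 1 ⇛ c ⊕ # 1 ≼ j ⇛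
                boxF (i ⊕ # 2) (j ⊖ # 1) (# 0) (# 0) e m n & cellOctF a b c d (i ⊕ # 2) (j ⊖ # 1) (# 0) (# 0) & (i ⊕ # 2 ≼ b′ ⇛ ⊥′))
                a b c d a′ b′ c′ d′ i j e m n symmetric (extreme p) x y q
          in no′ ((proj₁ ∘ proj₂) (to′ (cell (i ℤ.+ + 2) (j ℤ.- + 1) (+ 0) (+ 0)) (zR , bit₀ , bit₀) zP)))
        ok (no p) (no q) = ⊥-elim (
          let (zR , zP , no′) = omega 13 (λ a b c d a′ b′ c′ d′ i j e m n → a′ ≺ b′ ⇛ c′ ≺ d′ ⇛ (d′ ≐ j & b′ ≐ i ⊕ # 1 & a′ ≐ i & clrL a′ b′ c′ d′ e m n & clrT a′ b′ c′ d′ e m n) ⇛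
                i ⊕ j ⊕ e ≐ m ⇛ i ⊖ j ≐ # 1 ⇛ # 2 ≼ m ⇛ # 2 ≼ n ⇛ (c ⊕ # 1 ≼ j ⇛ ⊥′) ⇛
                boxF i (j ⊖ # 1) (# 1) (# 1) e m n & cellOctF a′ b′ c′ d′ i (j ⊖ # 1) (# 1) (# 1) & (c ≼ j ⊖ # 1 ⇛ ⊥′))
                a b c d a′ b′ c′ d′ i j e m n (proj₁ V″) (proj₁ (proj₂ V″)) (extreme p) x y m≥2 n≥2 q
          in no′ ((proj₁ ∘ proj₂ ∘ proj₂) (from′ (cell i (j ℤ.- + 1) (+ 1) (+ 1)) (zR , bit₁ , bit₁) zP)))

      corner-north-west : i ℤ.+ j ℤ.+ e ≡ + 1 → i ℤ.- j ≡ n → c′ ℤ.≤ j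
      corner-north-west x y = ok (c′ ℤ.≤? j) (j ℤ.+ + 2 ℤ.≤? d)
        where
        symmetric = omega 9 (λ a b c d i j e m n → validOctF a b c d e m n ⇛ coreF a b c d i j ⇛ i ⊕ j ⊕ e ≐ # 1 ⇛ i ⊖ j ≐ n ⇛ # 2 ≼ m ⇛ # 2 ≼ n ⇛
          symL a b c d e m n & symT a b c d e m n & clrR a b c d e m n & clrB a b c d e m n) a b c d i j e m n V co x y m≥2 n≥2
        w = eastE (omega 4 (λ i j e m → i ⊕ j ⊕ e ≐ # 1 ⇛ # 2 ≼ m ⇛ i ⊕ j ⊕ e ⊕ # 1 ≼ m) i j e m x m≥2)
        s = southE (omega 3 (λ i j n → i ⊖ j ≐ n ⇛ # 2 ≼ n ⇛ # 2 ≼ i ⊖ j) i j n y n≥2)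
        extreme = λ p → omega 9 (λ a b c d i j e m n → validOctF a b c d e m n ⇛ i ⊕ j ⊕ e ≐ # 1 ⇛ i ⊖ j ≐ n ⇛ # 2 ≼ m ⇛ # 2 ≼ n ⇛
          withinF a b c d (i ⊕ # 1) (j ⊕ # 1) ⇛ withinF a b c d i (j ⊕ # 1) ⇛ (c ≼ j ⇛ ⊥′) ⇛
          c ≐ j ⊕ # 1 & a ≐ i & b ≐ i ⊕ # 1 & clrR a b c d e m n & clrB a b c d e m n) a′ b′ c′ d′ i j e m n V″ x y m≥2 n≥2 w s p
        ok : Dec (c′ ℤ.≤ j) → Dec (j ℤ.+ + 2 ℤ.≤ d) → c′ ℤ.≤ j
        ok (yes p) _ = p
        ok (no p) (yes q) = ⊥-elim (
          let (zR , zP , no′) = omega 13 (λ a b c d a′ b′ c′ d′ i j e m n → (symL a b c d e m n & symT a b c d e m n & clrR a b c d e m n & clrB a b c d e m n) ⇛ (c′ ≐ j ⊕ # 1 & a′ ≐ i & b′ ≐ i ⊕ # 1 & clrR a′ b′ c′ d′ e m n & clrB a′ b′ c′ d′ e m n) ⇛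
                i ⊕ j ⊕ e ≐ # 1 ⇛ i ⊖ j ≐ n ⇛ j ⊕ # 2 ≼ d ⇛
                boxF (i ⊖ # 1) (j ⊕ # 2) (# 1) (# 1) e m n & cellOctF a b c d (i ⊖ # 1) (j ⊕ # 2) (# 1) (# 1) & (a′ ≼ i ⊖ # 1 ⇛ ⊥′))
                a b c d a′ b′ c′ d′ i j e m n symmetric (extreme p) x y q
          in no′ (proj₁ (to′ (cell (i ℤ.- + 1) (j ℤ.+ + 2) (+ 1) (+ 1)) (zR , bit₁ , bit₁) zP)))
        ok (no p) (no q) = ⊥-elim (
          let (zR , zP , no′) = omega 13 (λ a b c d a′ b′ c′ d′ i j e m n → a′ ≺ b′ ⇛ c′ ≺ d′ ⇛ (c′ ≐ j ⊕ # 1 & a′ ≐ i & b′ ≐ i ⊕ # 1 & clrR a′ b′ c′ d′ e m n & clrB a′ b′ c′ d′ e m n) ⇛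
                i ⊕ j ⊕ e ≐ # 1 ⇛ i ⊖ j ≐ n ⇛ # 2 ≼ m ⇛ # 2 ≼ n ⇛ (j ⊕ # 2 ≼ d ⇛ ⊥′) ⇛
                boxF (i ⊕ # 1) (j ⊕ # 2) (# 0) (# 0) e m n & cellOctF a′ b′ c′ d′ (i ⊕ # 1) (j ⊕ # 2) (# 0) (# 0) & (j ⊕ # 2 ≼ d ⇛ ⊥′))
                a b c d a′ b′ c′ d′ i j e m n (proj₁ V″) (proj₁ (proj₂ V″)) (extreme p) x y m≥2 n≥2 q
          in no′ ((proj₁ ∘ proj₂ ∘ proj₂ ∘ proj₂) (from′ (cell (i ℤ.+ + 1) (j ℤ.+ + 2) (+ 0) (+ 0)) (zR , bit₀ , bit₀) zP)))

      corner-south-west : i ℤ.+ j ℤ.+ e ≡ + 1 → i ℤ.- j ≡ + 1 → a′ ℤ.≤ i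
      corner-south-west x y = ok (a′ ℤ.≤? i) (i ℤ.+ + 2 ℤ.≤? b)
        where
        symmetric = omega 9 (λ a b c d i j e m n → validOctF a b c d e m n ⇛ coreF a b c d i j ⇛ i ⊕ j ⊕ e ≐ # 1 ⇛ i ⊖ j ≐ # 1 ⇛ # 2 ≼ m ⇛ # 2 ≼ n ⇛
          symL a b c d e m n & symB a b c d e m n & clrR a b c d e m n & clrT a b c d e m n) a b c d i j e m n V co x y m≥2 n≥2
        w = eastE (omega 4 (λ i j e m → i ⊕ j ⊕ e ≐ # 1 ⇛ # 2 ≼ m ⇛ i ⊕ j ⊕ e ⊕ # 1 ≼ m) i j e m x m≥2)
        s = northE (omega 3 (λ i j n → i ⊖ j ≐ # 1 ⇛ # 2 ≼ n ⇛ i ⊖ j ⊕ # 1 ≼ n) i j n y n≥2)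
        extreme = λ p → omega 9 (λ a b c d i j e m n → validOctF a b c d e m n ⇛ i ⊕ j ⊕ e ≐ # 1 ⇛ i ⊖ j ≐ # 1 ⇛ # 2 ≼ m ⇛ # 2 ≼ n ⇛
          withinF a b c d (i ⊕ # 1) (j ⊕ # 1) ⇛ withinF a b c d (i ⊕ # 1) j ⇛ (a ≼ i ⇛ ⊥′) ⇛
          a ≐ i ⊕ # 1 & c ≐ j & d ≐ j ⊕ # 1 & clrR a b c d e m n & clrT a b c d e m n) a′ b′ c′ d′ i j e m n V″ x y m≥2 n≥2 w s p
        ok : Dec (a′ ℤ.≤ i) → Dec (i ℤ.+ + 2 ℤ.≤ b) → a′ ℤ.≤ i
        ok (yes p) _ = p
        ok (no p) (yes q) = ⊥-elim (
          let (zR , zP , no′) = omega 13 (λ a b c d a′ b′ c′ d′ i j e m n → (symL a b c d e m n & symB a b c d e m n & clrR a b c d e m n & clrT a b c d e m n) ⇛ (a′ ≐ i ⊕ # 1 & c′ ≐ j & d′ ≐ j ⊕ # 1 & clrR a′ b′ c′ d′ e m n & clrT a′ b′ c′ d′ e m n) ⇛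
                i ⊕ j ⊕ e ≐ # 1 ⇛ i ⊖ j ≐ # 1 ⇛ i ⊕ # 2 ≼ b ⇛
                boxF (i ⊕ # 2) (j ⊖ # 1) (# 1) (# 0) e m n & cellOctF a b c d (i ⊕ # 2) (j ⊖ # 1) (# 1) (# 0) & (c′ ≼ j ⊖ # 1 ⇛ ⊥′))
                a b c d a′ b′ c′ d′ i j e m n symmetric (extreme p) x y q
          in no′ ((proj₁ ∘ proj₂ ∘ proj₂) (to′ (cell (i ℤ.+ + 2) (j ℤ.- + 1) (+ 1) (+ 0)) (zR , bit₁ , bit₀) zP)))
        ok (no p) (no q) = ⊥-elim (
          let (zR , zP , no′) = omega 13 (λ a b c d a′ b′ c′ d′ i j e m n → a′ ≺ b′ ⇛ c′ ≺ d′ ⇛ (a′ ≐ i ⊕ # 1 & c′ ≐ j & d′ ≐ j ⊕ # 1 & clrR a′ b′ c′ d′ e m n & clrT a′ b′ c′ d′ e m n) ⇛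
                i ⊕ j ⊕ e ≐ # 1 ⇛ i ⊖ j ≐ # 1 ⇛ # 2 ≼ m ⇛ # 2 ≼ n ⇛ (i ⊕ # 2 ≼ b ⇛ ⊥′) ⇛
                boxF (i ⊕ # 2) (j ⊕ # 1) (# 0) (# 1) e m n & cellOctF a′ b′ c′ d′ (i ⊕ # 2) (j ⊕ # 1) (# 0) (# 1) & (i ⊕ # 2 ≼ b ⇛ ⊥′))
                a b c d a′ b′ c′ d′ i j e m n (proj₁ V″) (proj₁ (proj₂ V″)) (extreme p) x y m≥2 n≥2 q
          in no′ ((proj₁ ∘ proj₂) (from′ (cell (i ℤ.+ + 2) (j ℤ.+ + 1) (+ 0) (+ 1)) (zR , bit₀ , bit₁) zP)))

      -- Each of the four bounds follows from a cell in one of two adjacent directions; both are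
      -- missing only if (i , j) is the corresponding corner of R.
      core-oct : Core (oct a′ b′ c′ d′) i j
      core-oct = below-a , below-b , below-c , below-d
        where
        east? : Dec East
        east? = i ℤ.+ j ℤ.+ e ℤ.+ + 1 ℤ.≤? m
        west? : Dec West
        west? = + 2 ℤ.≤? i ℤ.+ j ℤ.+ e
        north? : Dec North
        north? = i ℤ.- j ℤ.+ + 1 ℤ.≤? n
        south? : Dec South
        south? = + 2 ℤ.≤? i ℤ.- j
        atEast : ¬ East → i ℤ.+ j ℤ.+ e ≡ m
        atEast = omega 5 (λ i j e m n → rangeF i j e m n ⇛ (i ⊕ j ⊕ e ⊕ # 1 ≼ m ⇛ ⊥′) ⇛ i ⊕ j ⊕ e ≐ m) i j e m n r
        atWest : ¬ West → i ℤ.+ j ℤ.+ e ≡ + 1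
        atWest = omega 5 (λ i j e m n → rangeF i j e m n ⇛ (# 2 ≼ i ⊕ j ⊕ e ⇛ ⊥′) ⇛ i ⊕ j ⊕ e ≐ # 1) i j e m n r
        atNorth : ¬ North → i ℤ.- j ≡ n
        atNorth = omega 5 (λ i j e m n → rangeF i j e m n ⇛ (i ⊖ j ⊕ # 1 ≼ n ⇛ ⊥′) ⇛ i ⊖ j ≐ n) i j e m n r
        atSouth : ¬ South → i ℤ.- j ≡ + 1
        atSouth = omega 5 (λ i j e m n → rangeF i j e m n ⇛ (# 2 ≼ i ⊖ j ⇛ ⊥′) ⇛ i ⊖ j ≐ # 1) i j e m n r
        below-a : a′ ℤ.≤ i
        below-a with west? | south?
        ... | yes x | _ = proj₁ (westE x)
        ... | no _ | yes y = proj₁ (southE y)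
        ... | no x | no y = corner-south-west (atWest x) (atSouth y)
        below-b : i ℤ.+ + 1 ℤ.≤ b′
        below-b with east? | north?
        ... | yes x | _ = proj₁ (proj₂ (eastE x))
        ... | no _ | yes y = proj₁ (proj₂ (northE y))
        ... | no x | no y = corner-north-east (atEast x) (atNorth y)
        below-c : c′ ℤ.≤ j
        below-c with west? | north?
        ... | yes x | _ = proj₁ (proj₂ (proj₂ (westE x)))
        ... | no _ | yes y = proj₁ (proj₂ (proj₂ (northE y)))
        ... | no x | no y = corner-north-west (atWest x) (atNorth y)
        below-d : j ℤ.+ + 1 ℤ.≤ d′
        below-d with east? | south?
        ... | yes x | _ = proj₂ (proj₂ (proj₂ (eastE x)))
        ... | no _ | yes y = proj₂ (proj₂ (proj₂ (southE y)))
        ... | no x | no y = corner-south-east (atEast x) (atSouth y)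

  core-transfer : ∀ P P′ i j → Valid e m n P → Valid e m n P′ → Core P i j → Range e m n i j →
    (∀ z → CellR e m n z → CellIn P z → CellIn P′ z) → (∀ z → CellR e m n z → CellIn P′ z → CellIn P z) → Core P′ i j
  core-transfer (oct a b c d) P′@(oct a′ b′ c′ d′) i j V V′ co r to from = core-oct a b c d V i j co r P′ V′ to from a′ b′ c′ d′ refl
  core-transfer (oct a b c d) P′@(dia k l) i j V V′ co r to from = ⊥-elim (not-dia a b c d V i j co r P′ V′ to from k l refl)

-- The bijection

_≟ᴾ_ : (P P′ : Piece) → Dec (P ≡ P′)
oct a b c d ≟ᴾ oct a′ b′ c′ d′ with a ℤ.≟ a′ | b ℤ.≟ b′ | c ℤ.≟ c′ | d ℤ.≟ d′
... | yes refl | yes refl | yes refl | yes refl = yes refl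
... | no ne | _ | _ | _ = no λ { refl → ne refl }
... | yes _ | no ne | _ | _ = no λ { refl → ne refl }
... | yes _ | yes _ | no ne | _ = no λ { refl → ne refl }
... | yes _ | yes _ | yes _ | no ne = no λ { refl → ne refl }
dia k l ≟ᴾ dia k′ l′ with k ℤ.≟ k′ | l ℤ.≟ l′
... | yes refl | yes refl = yes refl
... | no ne | _ = no λ { refl → ne refl }
... | yes _ | no ne = no λ { refl → ne refl }
oct _ _ _ _ ≟ᴾ dia _ _ = no λ ()
dia _ _ ≟ᴾ oct _ _ _ _ = no λ ()

lookup-injective : ∀ {A : Set} {xs : List A} → Unique xs → ∀ i j → lookup xs i ≡ lookup xs j → i ≡ j
lookup-injective (_ ∷ _) zero zero _ = refl
lookup-injective (p ∷ _) zero (suc j) e = ⊥-elim (All.lookup p (∈-lookup j) e)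
lookup-injective (p ∷ _) (suc i) zero e = ⊥-elim (All.lookup p (∈-lookup i) (sym e))
lookup-injective (_ ∷ u) (suc i) (suc j) e = cong suc (lookup-injective u i j e)

allPairs-lookup : ∀ {A : Set} {R : A → A → Set} → (∀ {x y} → R x y → R y x) → ∀ {xs} → AllPairs R xs →
  ∀ i j → ¬ (i ≡ j) → R (lookup xs i) (lookup xs j)
allPairs-lookup s (_ ∷ _) zero zero ne = ⊥-elim (ne refl)
allPairs-lookup s (p ∷ _) zero (suc j) ne = All.lookup p (∈-lookup j)
allPairs-lookup s (p ∷ _) (suc i) zero ne = s (All.lookup p (∈-lookup i))
allPairs-lookup s (_ ∷ ps) (suc i) (suc j) ne = allPairs-lookup s ps i j (ne ∘ cong suc)

lookup-index : ∀ {A : Set} {x : A} {xs} (p : x ∈ xs) → x ≡ lookup xs (Any.index p)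
lookup-index (here refl) = refl
lookup-index (there p) = lookup-index p

cell? : ∀ e m n z → Dec (CellR e m n z)
cell? e m n (cell k l p q) = dec (cellRectF (cst k) (cst l) (cst p) (cst q) (cst e) (cst m) (cst n)) []

module Finite (e : ℤ) (m n : ℕ) (e≥0 : + 0 ℤ.≤ e) (e≤1 : e ℤ.≤ + 1) where

  -- A cell in R has 1 ≤ k + l ≤ m + 1 and 1 ≤ k - l ≤ n, so this safely bounds |k| and |l|.
  bound : ℕ
  bound = m ℕ.+ n ℕ.+ 2

  integers : List ℤ
  integers = map (λ i → + i ℤ.- + bound) (upTo (suc (bound ℕ.+ bound)))

  bits : List ℤ
  bits = + 0 ∷ + 1 ∷ []

  cells : List Cell
  cells = cartesianProductWith (λ (k , l) (p , q) → cell k l p q)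
    (cartesianProductWith _,_ integers integers) (cartesianProductWith _,_ bits bits)

  integers-complete : ∀ z → ℤ.- + bound ℤ.≤ z → z ℤ.≤ + bound → z ∈ integers
  integers-complete z lo hi with z ℤ.+ + bound in eq
  ... | + i = subst (_∈ integers) (omega 3 (λ z i b → z ⊕ b ≐ i ⇛ i ⊖ b ≐ z) z (+ i) (+ bound) eq)
    (∈-map⁺ (λ i → + i ℤ.- + bound) (∈-upTo⁺ (ℕ.s≤s (ℤₚ.drop‿+≤+ (omega 3 (λ z i b → z ⊕ b ≐ i ⇛ z ≼ b ⇛ i ≼ b ⊕ b) z (+ i) (+ bound) eq hi)))))
  ... | -[1+ i ] = ⊥-elim (omega 3 (λ z i b → z ⊕ b ≐ i ⇛ i ⊕ # 1 ≼ # 0 ⇛ ⊝ b ≼ z ⇛ ⊥′) z -[1+ i ] (+ bound) eq (negative i) lo)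
    where
    negative : ∀ i → -[1+ i ] ℤ.+ + 1 ℤ.≤ + 0
    negative zero = ℤₚ.≤-refl
    negative (suc _) = ℤ.-≤+

  cells-complete : ∀ z → CellR e (+ m) (+ n) z → z ∈ cells
  cells-complete (cell k l p q) (r , bp , bq) =
    let (k₁ , k₂ , l₁ , l₂) = omega 7 (λ k l p q e m n → boxF k l p q e m n ⇛ bitF p ⇛ bitF q ⇛ # 0 ≼ m ⇛ # 0 ≼ n ⇛ # 0 ≼ e ⇛ e ≼ # 1 ⇛
          ⊝ (m ⊕ n ⊕ # 2) ≼ k & k ≼ m ⊕ n ⊕ # 2 & ⊝ (m ⊕ n ⊕ # 2) ≼ l & l ≼ m ⊕ n ⊕ # 2)
          k l p q e (+ m) (+ n) r bp bq (ℤ.+≤+ ℕ.z≤n) (ℤ.+≤+ ℕ.z≤n) e≥0 e≤1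
    in ∈-cartesianProductWith⁺ _ (∈-cartesianProductWith⁺ _,_ (integers-complete k k₁ k₂) (integers-complete l l₁ l₂))
         (∈-cartesianProductWith⁺ _,_ (bit bp) (bit bq))
    where
    bit : ∀ {p} → p ≡ + 0 ⊎ p ≡ + 1 → p ∈ bits
    bit (inj₁ refl) = here refl
    bit (inj₂ refl) = there (here refl)

record Match (c : Color) (m n : ℕ) (t : Tile) (P : Piece) : Set where
  constructor match
  field
    placed : Placed (eps c) (+ m) (+ n) (Tile.shape t) (Tile.rot t) (proj₁ (Tile.shift t)) (proj₂ (Tile.shift t)) P
    color  : tileColor t ≡ c

module _ {c : Color} {m n : ℕ} {t : Tile} {P : Piece} (M : Match c m n t P) {r X Y Q} (R : Rep r X Y Q) where
  private
    described : ∀ b → Iff (In b t r) (InPiece (eps c) (+ m) (+ n) P X Y Q (slack b))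
    described = describe (eps c) (+ m) (+ n) (Tile.shape t) (Tile.rot t) (proj₁ (Tile.shift t)) (proj₂ (Tile.shift t)) P (Match.placed M) R
  closed⇒ : r ∈T t → InPiece (eps c) (+ m) (+ n) P X Y Q (+ 0)
  closed⇒ = proj₁ (described false)
  closed⇐ : InPiece (eps c) (+ m) (+ n) P X Y Q (+ 0) → r ∈T t
  closed⇐ = proj₂ (described false)
  open⇒ : r ∈T° t → InPiece (eps c) (+ m) (+ n) P X Y Q (+ 1)
  open⇒ = proj₁ (described true)
  open⇐ : InPiece (eps c) (+ m) (+ n) P X Y Q (+ 1) → r ∈T° t
  open⇐ = proj₂ (described true)

same-piece : ∀ {c m n t t′ P} → Match c m n t P → Match c m n t′ P → SameTile t t′
same-piece M M′ r = let (_ , _ , _ , R) = represent r in closed⇐ M′ R ∘ closed⇒ M R , closed⇐ M R ∘ closed⇒ M′ R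

piece-rect : ∀ e m n P X Y Q → + 0 ℤ.≤ Q → Valid e m n P → InPiece e m n P X Y Q (+ 0) → InRect m n X Y Q (+ 0)
piece-rect e m n (oct _ _ _ _) X Y Q _ _ h = proj₂ h
piece-rect e m n (dia k l) X Y Q Q≥0 V h = omega 8 (λ k l e m n X Y Q → scaled Q (validDiaF k l e m n) ⇛ diaF k l e X Y Q (# 0) ⇛ rectF m n X Y Q (# 0))
  k l e m n X Y Q (scaled-ok {[]} (cst Q) Q≥0 (validDiaF (cst k) (cst l) (cst e) (cst m) (cst n)) V) h

samplePoint : ∀ (e : ℤ) z → Σ QPt λ r → Rep r (sampleX e z) (sampleY e z) (+ 4)
samplePoint e z = point (sampleX e z) (sampleY e z) 3

module Theory (c : Color) (m n : ℕ) (m≥2 : 2 ℕ.≤ m) (n≥2 : 2 ℕ.≤ n) where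
  private
    e M N : ℤ
    e = eps c
    M = + m
    N = + n
    M≥2 : + 2 ℤ.≤ M
    M≥2 = ℤ.+≤+ m≥2
    N≥2 : + 2 ℤ.≤ N
    N≥2 = ℤ.+≤+ n≥2
    M≥1 : + 1 ℤ.≤ M
    M≥1 = ℤₚ.≤-trans (ℤ.+≤+ (ℕ.s≤s ℕ.z≤n)) M≥2
    N≥1 : + 1 ℤ.≤ N
    N≥1 = ℤₚ.≤-trans (ℤ.+≤+ (ℕ.s≤s ℕ.z≤n)) N≥2
    e≥0 : ∀ c → + 0 ℤ.≤ eps c
    e≥0 black = ℤ.+≤+ ℕ.z≤n
    e≥0 white = ℤ.+≤+ ℕ.z≤n
    e≤1 : ∀ c → eps c ℤ.≤ + 1
    e≤1 black = ℤ.+≤+ ℕ.z≤n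
    e≤1 white = ℤₚ.≤-refl

  open Finite e m n (e≥0 c) (e≤1 c)

  module Sampled {t : Tile} {P : Piece} (Mt : Match c m n t P) (z : Cell) (zR : CellR e M N z) where
    private
      r = proj₁ (samplePoint e z)
      R = proj₂ (samplePoint e z)
    sampled⇒ : r ∈T t → CellIn P z
    sampled⇒ h = sample-out e M N P z zR (closed⇒ Mt R h)
    sampled⇐ : CellIn P z → r ∈T° t
    sampled⇐ h = open⇐ Mt R (sample-in e M N P z zR h)
    sampled-closed : CellIn P z → r ∈T t
    sampled-closed h = closed⇐ Mt R (weaken P (sample-in e M N P z zR h))
      where
      X = sampleX e z
      Y = sampleY e z
      weaken : ∀ P → InPiece e M N P X Y (+ 4) (+ 1) → InPiece e M N P X Y (+ 4) (+ 0)
      weaken (oct a b c d) = omega 9 (λ a b c d e m n X Y → octRF a b c d e m n X Y (# 4) (# 1) ⇛ octRF a b c d e m n X Y (# 4) (# 0)) a b c d e M N X Y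
      weaken (dia k l) = omega 5 (λ k l e X Y → diaF k l e X Y (# 4) (# 1) ⇛ diaF k l e X Y (# 4) (# 0)) k l e X Y

  covering-tile : ∀ {ts} → IsTiling m n ts → ∀ z → CellR e M N z → Σ Tile λ t → t ∈ ts × proj₁ (samplePoint e z) ∈T t
  covering-tile T z zR = find (IsTiling.covers T (proj₁ (samplePoint e z)) (InR⇐ {m} {n} (proj₂ (samplePoint e z)) (sample-rect e M N z zR)))

  good-cell : ∀ {h} P → Good e M N h P → Valid e M N P → Σ Cell λ z → CellR e M N z × CellIn P z
  good-cell (oct _ _ _ _) (_ , _ , _ , z) _ = z
  good-cell (dia k l) _ V = cell k l (+ 1) (+ 1) ,
    (omega 5 (λ k l e m n → validDiaF k l e m n ⇛ boxF k l (# 1) (# 1) e m n) k l e M N V , inj₂ refl , inj₂ refl) , (refl , refl)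

  good-unique : ∀ {h} P P′ z → CellR e M N z → Good e M N h P → Good e M N h P′ → CellIn P z → CellIn P′ z → P ≡ P′
  good-unique P P′ z zR g g′ zP zP′ = disjoint P P′ (sampleX e z) (sampleY e z) (+ 4) (ℤ.+<+ (ℕ.s≤s ℕ.z≤n)) g g′
    (sample-in e M N P z zR zP) (sample-in e M N P′ z zR zP′)

  Fits : (ℤ → Bool) → List Tile → Set
  Fits h ts = ∀ t → t ∈ ts → Σ Piece λ P → Match c m n t P × Good e M N h P

  -- A piece of the first list contains a cell in R. The tile of the second list that covers the
  -- sample point of this cell has a piece with the same cell, hence the same piece. That a tiling
  -- is determined by a wave it fits yields both congruence and surjectivity of `Φ`.
  fits-sub : ∀ {h ts ts′} → IsWave e M N h → Fits h ts → Fits h ts′ → IsTiling m n ts′ → Sub ts ts′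
  fits-sub W f f′ T′ = All.tabulate λ {t} t∈ →
    let (P , Mt , g) = f t t∈
        (z , zR , zP) = good-cell P g (valid M≥1 N≥1 W P g)
        (t′ , t′∈ , r∈) = covering-tile T′ z zR
        (P′ , Mt′ , g′) = f′ t′ t′∈
        zP′ = Sampled.sampled⇒ Mt′ z zR r∈
    in lose t′∈ (same-piece Mt (subst (Match c m n t′) (sym (good-unique P P′ z zR g g′ zP zP′)) Mt′))

  true-value : ∀ (u : V c m n) → ¬ (∀ p → u p ≡ false) → Σ (Fin m) λ x → Σ (Fin n) λ y → val u (+ toℕ x) (+ toℕ y) ≡ true
  true-value u u≢0 with Finₚ.any? (λ x → Finₚ.any? (λ y → val u (+ toℕ x) (+ toℕ y) Bool.≟ true))
  ... | yes p = p
  ... | no none = ⊥-elim (u≢0 λ { ((x , y) , col) → trans (sym (val-at u x y col)) (Boolₚ.¬-not (λ h → none (x , y , h))) })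

  abstract
    index : (x : Fin m) (y : Fin n) → colorG (x , y) ≡ c → Σ ℤ λ i → Σ ℤ λ j →
      (i ℤ.+ j ℤ.+ e ℤ.- + 1 ≡ + toℕ x × i ℤ.- j ℤ.- + 1 ≡ + toℕ y) × Range e M N i j
    index x y col = let (k , h) = color-index (+ toℕ x ℤ.+ + toℕ y) c col in k ℤ.+ + 1 , k ℤ.- + toℕ y ,
      omega 6 (λ x y k e m n → x ⊕ y ≐ # 2 ⊗ k ⊕ e ⇛ # 0 ≼ x ⇛ x ⊕ # 1 ≼ m ⇛ # 0 ≼ y ⇛ y ⊕ # 1 ≼ n ⇛
        ((k ⊕ # 1) ⊕ (k ⊖ y) ⊕ e ⊖ # 1 ≐ x & (k ⊕ # 1) ⊖ (k ⊖ y) ⊖ # 1 ≐ y) & rangeF (k ⊕ # 1) (k ⊖ y) e m n)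
        (+ toℕ x) (+ toℕ y) k e M N h (ℤ.+≤+ ℕ.z≤n) (below (Finₚ.toℕ<n x)) (ℤ.+≤+ ℕ.z≤n) (below (Finₚ.toℕ<n y))
      where
      below : ∀ {i m} → i ℕ.< m → + i ℤ.+ + 1 ℤ.≤ + m
      below {i} {m} i<m = ℤ.+≤+ (subst (ℕ._≤ m) (ℕₚ.+-comm 1 i) i<m)

  module Solution (u : V c m n) (ker : ∀ w → adj u w ≡ false) where
    h : ℤ → Bool
    h = wave u

    W : IsWave e M N h
    W = wave-isWave {c} {m} {n} (ℕₚ.≤-trans (ℕ.s≤s ℕ.z≤n) n≥2) u ker

    represents : ∀ i j → + 0 ℤ.≤ i ℤ.+ j ℤ.+ e → i ℤ.+ j ℤ.+ e ℤ.≤ M ℤ.+ + 1 → + 0 ℤ.≤ i ℤ.- j → i ℤ.- j ℤ.≤ N ℤ.+ + 1 → value u i j ≡ h i xor h j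
    represents = wave-represents {c} {m} {n} (ℕₚ.≤-trans (ℕ.s≤s ℕ.z≤n) n≥2) u ker

    value-wave : ∀ x y col → let (i , j , _) = index x y col in u ((x , y) , col) ≡ h i xor h j
    value-wave x y col = let (i , j , (ex , ey) , r) = index x y col
                             (p₁ , p₂ , p₃ , p₄) = omega 5 (λ i j e m n → rangeF i j e m n ⇛ # 0 ≼ i ⊕ j ⊕ e & i ⊕ j ⊕ e ≼ m ⊕ # 1 & # 0 ≼ i ⊖ j & i ⊖ j ≼ n ⊕ # 1) i j e M N r
      in trans (sym (val-at u x y col)) (trans (sym (cong₂ (val u) ex ey)) (represents i j p₁ p₂ p₃ p₄))

  module Nonzero (u : V c m n) (ker : ∀ w → adj u w ≡ false) (u≢0 : ¬ (∀ p → u p ≡ false)) where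
    open Solution u ker public

    -- At a point with u = 1 the wave has different values at the two indices.
    distinct : Σ ℤ λ i → Σ ℤ λ j → ¬ (h i ≡ h j)
    distinct with true-value u u≢0
    ... | x , y , hv with val-view u (+ toℕ x) (+ toℕ y)
    ...   | inj₁ f = ⊥-elim (clash true hv f)
    ...   | inj₂ (x′ , y′ , col , _ , _ , eq) = let (i , j , _) = index x′ y′ col in i , j , λ hij →
      clash true (trans (sym eq) hv) (trans (value-wave x′ y′ col) (trans (cong (_xor h j) hij) (Boolₚ.xor-same (h j))))

    coverᵘ : ∀ z → CellR e M N z → Σ Piece λ P → Good e M N h P × CellIn P z
    coverᵘ = cover M≥1 N≥1 W {proj₁ distinct} {proj₁ (proj₂ distinct)} (proj₂ (proj₂ distinct))

    abstract
      gapAt : ∀ i → Σ ℤ λ a → Σ ℤ λ b → a ℤ.≤ i × i ℤ.+ + 1 ℤ.≤ b × Gap h a b (h i)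
      gapAt = findGap M≥1 N≥1 W {proj₁ distinct} {proj₁ (proj₂ distinct)} (proj₂ (proj₂ distinct))

    pieceAt : (z : Cell) → Dec (CellR e M N z) → List Piece
    pieceAt z (yes zR) = proj₁ (coverᵘ z zR) ∷ []
    pieceAt z (no _) = []

    abstract
      candidates : List Piece
      candidates = concatMap (λ z → pieceAt z (cell? e M N z)) cells

      -- A piece is found once for each cell that selects it; repetitions have to go, since equal
      -- tiles in different positions would violate disjointness.
      pieces : List Piece
      pieces = deduplicate _≟ᴾ_ candidates

      pieces-unique : Unique pieces
      pieces-unique = deduplicate-! _≟ᴾ_ candidates

      pieces-good : ∀ {P} → P ∈ pieces → Good e M N h P
      pieces-good {P} P∈ = let (z , _ , p) = find (∈-concatMap⁻ (λ z → pieceAt z (cell? e M N z)) {xs = cells} (∈-deduplicate⁻ _≟ᴾ_ candidates P∈)) in from z (cell? e M N z) p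
        where
        from : ∀ z d → P ∈ pieceAt z d → Good e M N h P
        from z (yes zR) (here refl) = proj₁ (proj₂ (coverᵘ z zR))

      pieces-cover : ∀ z → CellR e M N z → Σ Piece λ P → P ∈ pieces × CellIn P z
      pieces-cover z zR = let (P , p , zP) = at (cell? e M N z) in
        P , ∈-deduplicate⁺ _≟ᴾ_ (∈-concatMap⁺ (λ z → pieceAt z (cell? e M N z)) {xs = cells} (lose (cells-complete z zR) p)) , zP
        where
        at : ∀ d → Σ Piece λ P → P ∈ pieceAt z d × CellIn P z
        at (yes zR) = proj₁ (coverᵘ z zR) , here refl , proj₂ (proj₂ (coverᵘ z zR))
        at (no ¬zR) = ⊥-elim (¬zR zR)

    piece : Fin (length pieces) → Piece
    piece = lookup pieces

    piece-valid : ∀ i → Valid e M N (piece i)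
    piece-valid i = valid M≥1 N≥1 W (piece i) (pieces-good (∈-lookup i))

    tileAt : ∀ {P} → Realization c M N P → Tile
    tileAt R = tile (Realization.shape R) (Realization.rot R) (Realization.dx R , Realization.dy R)

    abstract
      realization : ∀ i → Realization c M N (piece i)
      realization i = build c M N M≥1 N≥1 (piece i) (piece-valid i)

    tiles : List Tile
    tiles = tabulate (λ i → tileAt (realization i))

    tile-match : ∀ {P} (R : Realization c M N P) → Match c m n (tileAt R) P
    tile-match R = match (Realization.placed R) (trans (tileColor-sum (Realization.shape R) (Realization.rot R) (Realization.dx R) (Realization.dy R))
      (index-color (colorSum (Realization.shape R) (Realization.rot R) (Realization.dx R) (Realization.dy R)) c (proj₁ (Realization.index R)) (proj₂ (Realization.index R))))

    tiles-match : ∀ i → Match c m n (tileAt (realization i)) (piece i)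
    tiles-match i = tile-match (realization i)

    tiles-fit : Fits h tiles
    tiles-fit t t∈ with ∈-tabulate⁻ t∈
    ... | i , refl = piece i , tiles-match i , pieces-good (∈-lookup i)

    tiles-inside : ∀ t → t ∈ tiles → ∀ r → r ∈T t → InR m n r
    tiles-inside t t∈ r r∈ = let (P , Mt , g) = tiles-fit t t∈ ; (X , Y , Q , R) = represent r in
      InR⇐ {m} {n} R (piece-rect e M N P X Y Q (ℤₚ.<⇒≤ (Rep.pos R)) (valid M≥1 N≥1 W P g) (closed⇒ Mt R r∈))

    covered-by : ∀ {r X Y Q P} → Rep r X Y Q → P ∈ pieces → InPiece e M N P X Y Q (+ 0) → Any (λ t → r ∈T t) tiles
    covered-by {r} {X} {Y} {Q} R P∈ h = lose {P = λ t → r ∈T t} (∈-tabulate⁺ {f = λ i → tileAt (realization i)} (Any.index P∈))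
      (closed⇐ (tiles-match (Any.index P∈)) R (subst (λ P → InPiece e M N P X Y Q (+ 0)) (lookup-index P∈) h))

    tiles-cover : ∀ r → InR m n r → Any (λ t → r ∈T t) tiles
    tiles-cover r r∈ = at (represent r)
      where
      in-cell : ∀ {X Y Q} → Rep r X Y Q → (Σ Cell λ z → CellR e M N z × Triangle e z X Y Q) → Any (λ t → r ∈T t) tiles
      in-cell {X} {Y} {Q} R (z , zR , tri) = by (pieces-cover z zR)
        where
        by : (Σ Piece λ P → P ∈ pieces × CellIn P z) → Any (λ t → r ∈T t) tiles
        by (P , P∈ , zP) = covered-by R P∈ (triangle-in e M N P z X Y Q (ℤₚ.<⇒≤ (Rep.pos R)) zR zP tri)
      at : (Σ ℤ λ X → Σ ℤ λ Y → Σ ℤ λ Q → Rep r X Y Q) → Any (λ t → r ∈T t) tiles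
      at (X , Y , Q , R) = in-cell R (locate e M N X Y Q M≥2 N≥2 (Rep.pos R) (InR⇒ {m} {n} R r∈))

    Disjoint : Tile → Tile → Set
    Disjoint t t′ = ∀ r → r ∈T° t → r ∈T° t′ → ⊥

    tile-disjoint : ∀ {i j} → ¬ (i ≡ j) → Disjoint (tileAt (realization i)) (tileAt (realization j))
    tile-disjoint {i} {j} i≢j r x y = at (represent r)
      where
      at : (Σ ℤ λ X → Σ ℤ λ Y → Σ ℤ λ Q → Rep r X Y Q) → ⊥
      at (X , Y , Q , R) = i≢j (lookup-injective pieces-unique i j
        (disjoint (piece i) (piece j) X Y Q (Rep.pos R) (pieces-good (∈-lookup i)) (pieces-good (∈-lookup j))
          (open⇒ (tiles-match i) R x) (open⇒ (tiles-match j) R y)))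

    tiles-tiling : IsTiling m n tiles
    tiles-tiling = record
      { inside   = tiles-inside
      ; covers   = tiles-cover
      ; disjoint = allPairs-lookup {R = Disjoint} (λ d r x y → d r y x) (AllPairsₚ.tabulate⁺ tile-disjoint)
      ; dashed   = λ t t∈ → let (P , Mt , _) = tiles-fit t t∈ in
          placed-dashed e m n (Tile.shape t) (Tile.rot t) (proj₁ (Tile.shift t)) (proj₂ (Tile.shift t)) P (Match.placed Mt)
      }

    tiling : Tilings c m n
    tiling = tiles , tiles-tiling , All.tabulate (λ {t} t∈ → Match.color (proj₁ (proj₂ (tiles-fit t t∈))))

  Φ : KerNZ c m n → Tilings c m n
  Φ (u , ker , u≢0) = Nonzero.tiling u ker u≢0

  good-cong : ∀ {h h′ : ℤ → Bool} → (∀ i → h i ≡ h′ i) → ∀ P → Good e M N h P → Good e M N h′ P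
  good-cong eq (oct a b c d) (v , G , G′ , z) = v , gap-cong G , gap-cong G′ , z
    where
    gap-cong : ∀ {a b v} → Gap _ a b v → Gap _ a b v
    gap-cong (gap a<b l r run) = gap a<b (trans (sym (eq _)) l) (trans (sym (eq _)) r) (λ k p q → trans (sym (eq k)) (run k p q))
  good-cong eq (dia k l) (v , (p₁ , p₂ , p₃ , p₄) , r) = v , (trans (sym (eq _)) p₁ , trans (sym (eq _)) p₂ , trans (sym (eq _)) p₃ , trans (sym (eq _)) p₄) , r

  fits-cong : ∀ {h h′ ts} → (∀ i → h i ≡ h′ i) → Fits h ts → Fits h′ ts
  fits-cong eq f t t∈ = let (P , Mt , g) = f t t∈ in P , Mt , good-cong eq P g

  val-cong : ∀ (u v : V c m n) → (∀ p → u p ≡ v p) → ∀ x y → val u x y ≡ val v x y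
  val-cong u v eq -[1+ _ ] _ = refl
  val-cong u v eq (+ _) -[1+ _ ] = refl
  val-cong u v eq (+ i) (+ j) with i ℕ.<? m | j ℕ.<? n
  ... | no _ | _ = refl
  ... | yes _ | no _ = refl
  ... | yes i<m | yes j<n with decColor (colorG {m} {n} (Fin.fromℕ< i<m , Fin.fromℕ< j<n)) c
  ...   | same e = eq _
  ...   | diff _ = refl

  wave-cong : ∀ (u v : V c m n) → (∀ p → u p ≡ v p) → ∀ i → wave u i ≡ wave v i
  wave-cong u v eq i = rowSum-cong (proj₁ (Fold.representative m (+ 2 ℤ.* i ℤ.+ e)))
    where
    rowSum-cong : ∀ k → rowSum u k ≡ rowSum v k
    rowSum-cong zero = refl
    rowSum-cong (suc zero) = refl
    rowSum-cong (suc (suc k)) = cong₂ _xor_ (rowSum-cong k) (val-cong u v eq (+ k) (+ 0))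

  Φ-cong : ∀ (x y : KerNZ c m n) → (∀ p → proj₁ x p ≡ proj₁ y p) → Sub (proj₁ (Φ x)) (proj₁ (Φ y)) × Sub (proj₁ (Φ y)) (proj₁ (Φ x))
  Φ-cong (u , ker , nz) (v , ker′ , nz′) eq =
    fits-sub (Nonzero.W v ker′ nz′) fu fv (Nonzero.tiles-tiling v ker′ nz′) , fits-sub (Nonzero.W v ker′ nz′) fv fu (Nonzero.tiles-tiling u ker nz)
    where
    fu : Fits (wave v) (Nonzero.tiles u ker nz)
    fu = fits-cong (wave-cong u v eq) (Nonzero.tiles-fit u ker nz)
    fv : Fits (wave v) (Nonzero.tiles v ker′ nz′)
    fv = Nonzero.tiles-fit v ker′ nz′

  abstract
    -- As m, n ≥ 2, every point of R is a vertex of a cell in R.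
    neighbourCell : ∀ i j → Range e M N i j → Σ Cell λ z → CellR e M N z × Vertex i j z
    neighbourCell i j r = go (i ℤ.+ j ℤ.+ e ℤ.+ + 1 ℤ.≤? M) (i ℤ.- j ℤ.+ + 1 ℤ.≤? N)
      where
      go : Dec (i ℤ.+ j ℤ.+ e ℤ.+ + 1 ℤ.≤ M) → Dec (i ℤ.- j ℤ.+ + 1 ℤ.≤ N) → Σ Cell λ z → CellR e M N z × Vertex i j z
      go (yes x) (yes y) = cell (i ℤ.+ + 1) (j ℤ.+ + 1) (+ 0) (+ 1) , (omega 5 (λ i j e m n → rangeF i j e m n ⇛ i ⊕ j ⊕ e ⊕ # 1 ≼ m ⇛ i ⊖ j ⊕ # 1 ≼ n ⇛ boxF (i ⊕ # 1) (j ⊕ # 1) (# 0) (# 1) e m n) i j e M N r x y , inj₁ refl , inj₂ refl) , inj₂ (inj₁ (refl , refl , refl))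
      go (yes x) (no y) = cell (i ℤ.+ + 1) (j ℤ.+ + 1) (+ 0) (+ 0) , (omega 5 (λ i j e m n → # 2 ≼ n ⇛ rangeF i j e m n ⇛ i ⊕ j ⊕ e ⊕ # 1 ≼ m ⇛ (i ⊖ j ⊕ # 1 ≼ n ⇛ ⊥′) ⇛ boxF (i ⊕ # 1) (j ⊕ # 1) (# 0) (# 0) e m n) i j e M N N≥2 r x y , inj₁ refl , inj₁ refl) , inj₂ (inj₁ (refl , refl , refl))
      go (no x) (yes y) = cell i j (+ 1) (+ 1) , (omega 5 (λ i j e m n → # 2 ≼ m ⇛ rangeF i j e m n ⇛ (i ⊕ j ⊕ e ⊕ # 1 ≼ m ⇛ ⊥′) ⇛ i ⊖ j ⊕ # 1 ≼ n ⇛ boxF i j (# 1) (# 1) e m n) i j e M N M≥2 r x y , inj₂ refl , inj₂ refl) , inj₁ (refl , refl , refl)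
      go (no x) (no y) = cell i j (+ 1) (+ 0) , (omega 5 (λ i j e m n → # 2 ≼ m ⇛ # 2 ≼ n ⇛ rangeF i j e m n ⇛ (i ⊕ j ⊕ e ⊕ # 1 ≼ m ⇛ ⊥′) ⇛ (i ⊖ j ⊕ # 1 ≼ n ⇛ ⊥′) ⇛ boxF i j (# 1) (# 0) e m n) i j e M N M≥2 N≥2 r x y , inj₂ refl , inj₁ refl) , inj₁ (refl , refl , refl)

  good-core : ∀ {h} P i j → Good e M N h P → Core P i j → h i ≡ h j
  good-core (oct a b c d) i j (v , G , G′ , _) (p , q , p′ , q′) = trans (Gap.between G i p q) (sym (Gap.between G′ j p′ q′))

  -- A zero of u is in the core of a tile of Φ u, hence in the core of the same
  -- tile of Φ v.
  zero-transfer : ∀ (x y : KerNZ c m n) → Sub (proj₁ (Φ x)) (proj₁ (Φ y)) → ∀ p → proj₁ x p ≡ false → proj₁ y p ≡ false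
  zero-transfer (u , ker , nz) (v , ker′ , nz′) sub ((px , py) , col) up≡0 =
    trans (B.value-wave px py col) (trans (cong (_xor B.h j) hij′) (Boolₚ.xor-same (B.h j)))
    where
    module A = Nonzero u ker nz
    module B = Nonzero v ker′ nz′
    i j : ℤ
    i = proj₁ (index px py col)
    j = proj₁ (proj₂ (index px py col))
    r : Range e M N i j
    r = proj₂ (proj₂ (proj₂ (index px py col)))
    hij : A.h i ≡ A.h j
    hij = xor-≡ (trans (sym (A.value-wave px py col)) up≡0)
    Near : Cell → Set
    Near z = CellR e M N z × Vertex i j z
    GapAt : ℤ → Set
    GapAt i = Σ ℤ λ a → Σ ℤ λ b → a ℤ.≤ i × i ℤ.+ + 1 ℤ.≤ b × Gap A.h a b (A.h i)
    matched : ∀ P → Good e M N A.h P → Core P i j → ∀ t t′ → SameTile t t′ → Match c m n t P →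
      (Σ Piece λ P′ → Match c m n t′ P′ × Good e M N B.h P′) → B.h i ≡ B.h j
    matched P g core t t′ same′ Mt (P′ , Mt′ , g′) = good-core P′ i j g′
      (core-transfer M≥2 N≥2 P P′ i j (valid M≥1 N≥1 A.W P g) (valid M≥1 N≥1 B.W P′ g′) core r
        (λ z zR zP → Sampled.sampled⇒ Mt′ z zR (proj₁ (same′ (proj₁ (samplePoint e z))) (Sampled.sampled-closed Mt z zR zP)))
        (λ z zR zP → Sampled.sampled⇒ Mt z zR (proj₂ (same′ (proj₁ (samplePoint e z))) (Sampled.sampled-closed Mt′ z zR zP))))
    located : ∀ P → Good e M N A.h P → Core P i j → ∀ z → CellR e M N z → CellIn P z →
      (Σ Tile λ t → t ∈ A.tiles × proj₁ (samplePoint e z) ∈T t) → B.h i ≡ B.h j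
    located P g core z zR zP (t , t∈ , z∈t) = at (A.tiles-fit t t∈) (find (All.lookup sub t∈))
      where
      at : (Σ Piece λ P₁ → Match c m n t P₁ × Good e M N A.h P₁) → (Σ Tile λ t′ → t′ ∈ B.tiles × SameTile t t′) → B.h i ≡ B.h j
      at (P₁ , Mt₁ , g₁) (t′ , t′∈ , same′) = matched P g core t t′ same′
        (subst (Match c m n t) (sym (good-unique P P₁ z zR g g₁ zP (Sampled.sampled⇒ Mt₁ z zR z∈t))) Mt₁) (B.tiles-fit t′ t′∈)
    around : (Σ Cell Near) → GapAt i → GapAt j → B.h i ≡ B.h j
    around (z , zR , vertex) (a , b , p , q , G) (a′ , b′ , p′ , q′ , G′) =
      located (oct a b a′ b′) (A.h i , G , subst (Gap A.h a′ b′) (sym hij) G′ , z , zR , zP) core z zR zP (covering-tile A.tiles-tiling z zR)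
      where
      core : Core (oct a b a′ b′) i j
      core = p , q , p′ , q′
      zP : CellIn (oct a b a′ b′) z
      zP = core-cell e M N (oct a b a′ b′) i j z zR core vertex
    hij′ : B.h i ≡ B.h j
    hij′ = around (neighbourCell i j r) (A.gapAt i) (A.gapAt j)

  Φ-injective : ∀ (x y : KerNZ c m n) → Sub (proj₁ (Φ x)) (proj₁ (Φ y)) × Sub (proj₁ (Φ y)) (proj₁ (Φ x)) → ∀ p → proj₁ x p ≡ proj₁ y p
  Φ-injective x y (s , s′) p with proj₁ x p in ex | proj₁ y p in ey
  ... | false | false = refl
  ... | true | true = refl
  ... | false | true = ⊥-elim (clash true ey (zero-transfer x y s p ex))
  ... | true | false = ⊥-elim (clash true ex (zero-transfer y x s′ p ey))

  module Inverse (T : Tilings c m n) where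
    private
      ts = proj₁ T
      tl = proj₁ (proj₂ T)
      col = proj₂ (proj₂ T)
    abstract
      analysis : ∀ t → t ∈ ts → Σ Piece λ P → Match c m n t P × Valid e M N P
      analysis t t∈ = let (P , pl , V) = analyze c m n (Tile.shape t) (Tile.rot t) (proj₁ (Tile.shift t)) (proj₂ (Tile.shift t)) (All.lookup col t∈) (IsTiling.inside tl t t∈) (IsTiling.dashed tl t t∈) in
        P , match pl (All.lookup col t∈) , V
      at : ∀ i → Σ Piece λ P → Match c m n (lookup ts i) P × Valid e M N P
      at i = analysis (lookup ts i) (∈-lookup i)

    -- Indexed by positions in the list of tiles, because the disjointness of a tiling is stated for
    -- positions.
    Ps : List Piece
    Ps = tabulate (λ i → proj₁ (at i))

    family : IsFamily e M N Ps
    family = record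
      { valids = λ P∈ → valids (∈-tabulate⁻ P∈)
      ; covers = λ z zR → let (t , t∈ , r∈) = covering-tile tl z zR in cover′ z zR t t∈ r∈
      ; unique = λ z P∈ P′∈ zR zP zP′ → unique z zR (∈-tabulate⁻ P∈) (∈-tabulate⁻ P′∈) zP zP′
      }
      where
      valids : ∀ {P} → (Σ (Fin (length ts)) λ i → P ≡ proj₁ (at i)) → Valid e M N P
      valids (i , refl) = proj₂ (proj₂ (at i))
      cover′ : ∀ z → CellR e M N z → ∀ t → t ∈ ts → proj₁ (samplePoint e z) ∈T t → Σ Piece λ P → P ∈ Ps × CellIn P z
      cover′ z zR t t∈ r∈ = let i = Any.index t∈ in proj₁ (at i) , ∈-tabulate⁺ i ,
        Sampled.sampled⇒ (proj₁ (proj₂ (at i))) z zR (subst (proj₁ (samplePoint e z) ∈T_) (lookup-index t∈) r∈)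
      unique : ∀ {P P′} z → CellR e M N z → (Σ (Fin (length ts)) λ i → P ≡ proj₁ (at i)) → (Σ (Fin (length ts)) λ i → P′ ≡ proj₁ (at i)) →
        CellIn P z → CellIn P′ z → P ≡ P′
      unique z zR (i , refl) (j , refl) zP zP′ with i Fin.≟ j
      ... | yes refl = refl
      ... | no i≢j = ⊥-elim (IsTiling.disjoint tl i j i≢j (proj₁ (samplePoint e z)) (Sampled.sampled⇐ (proj₁ (proj₂ (at i))) z zR zP) (Sampled.sampled⇐ (proj₁ (proj₂ (at j))) z zR zP′))

    private
      module F = Recover c m n M≥2 N≥2 Ps family

    abstract
      u : V c m n
      u = F.u

      u-kernel : ∀ w → adj u w ≡ false
      u-kernel = F.solution-kernel

      u-true : ∀ P → P ∈ Ps → Σ ℤ λ i → Σ ℤ λ j → value u i j ≡ true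
      u-true P P∈ = let (i , j , _ , eq) = F.some-true P P∈ in i , j , eq

      u-good : IsWave e M N (wave u) → (∀ i j → + 0 ℤ.≤ i ℤ.+ j ℤ.+ e → i ℤ.+ j ℤ.+ e ℤ.≤ M ℤ.+ + 1 → + 0 ℤ.≤ i ℤ.- j → i ℤ.- j ℤ.≤ N ℤ.+ + 1 →
        value u i j ≡ wave u i xor wave u j) → ∀ P → P ∈ Ps → Good e M N (wave u) P
      u-good = F.family-good

      somePiece : Σ Piece λ P → P ∈ Ps
      somePiece = let (z , zR , _) = locate e M N (+ 1) (+ 1) (+ 1) M≥2 N≥2 (ℤ.+<+ (ℕ.s≤s ℕ.z≤n))
                                       (omega 2 (λ m n → # 2 ≼ m ⇛ # 2 ≼ n ⇛ rectF m n (# 1) (# 1) (# 1) (# 0)) M N M≥2 N≥2)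
                      (P , P∈ , _) = IsFamily.covers family z zR
                  in P , P∈

    -- A tiling has at least one tile, since R is not empty, and every piece has a point with u = 1
    -- on its boundary.
    nonzero : ¬ (∀ p → u p ≡ false)
    nonzero u≡0 = at-point (u-true (proj₁ somePiece) (proj₂ somePiece))
      where
      at-view : ∀ {x y} → val u x y ≡ true → val u x y ≡ false ⊎ OnPoint u x y → ⊥
      at-view ut (inj₁ f) = clash true ut f
      at-view ut (inj₂ (x , y , pc , _ , _ , eq)) = clash true ut (trans eq (u≡0 ((x , y) , pc)))
      at-point : (Σ ℤ λ i → Σ ℤ λ j → value u i j ≡ true) → ⊥
      at-point (i , j , ut) = at-view ut (val-view u (i ℤ.+ j ℤ.+ e ℤ.- + 1) (i ℤ.- j ℤ.- + 1))

    preimage : KerNZ c m n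
    preimage = u , u-kernel , nonzero

    fits : Fits (wave u) ts
    fits t t∈ = let i = Any.index t∈ in proj₁ (at i) , subst (λ t → Match c m n t (proj₁ (at i))) (sym (lookup-index t∈)) (proj₁ (proj₂ (at i))) ,
      u-good (Solution.W u u-kernel) (Solution.represents u u-kernel) (proj₁ (at i)) (∈-tabulate⁺ i)

    section : Sub (proj₁ (Φ preimage)) ts × Sub ts (proj₁ (Φ preimage))
    section = fits-sub (Solution.W u u-kernel) (Nonzero.tiles-fit u u-kernel nonzero) fits tl ,
              fits-sub (Solution.W u u-kernel) fits (Nonzero.tiles-fit u u-kernel nonzero) (Nonzero.tiles-tiling u u-kernel nonzero)

  bijection : Bijection (KerSetoid c m n) (TilingSetoid c m n)
  bijection = record
    { to = Φ
    ; cong = λ {x} {y} → Φ-cong x y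
    ; bijective = (λ {x} {y} → Φ-injective x y) , λ T → Inverse.preimage T , λ {x} eq →
        Setoid.trans (TilingSetoid c m n) {Φ x} {Φ (Inverse.preimage T)} {T} (Φ-cong x (Inverse.preimage T) eq) (Inverse.section T)
    }

theorem2 : (m n : ℕ) → 2 ≤ m → 2 ≤ n →
    Bijection (KerSetoid black m n) (TilingSetoid black m n) ×
    Bijection (KerSetoid white m n) (TilingSetoid white m n)
theorem2 m n m≥2 n≥2 = Theory.bijection black m n m≥2 n≥2 , Theory.bijection white m n m≥2 n≥2
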